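{- There is a randomized algorithm which, given as a black box a polynomial $f\in\mathbb{R}_{\ge 0}[x_1,\ldots,x_n]_d$ and given any $0<\varepsilon<1$, computes a number $z$ such that with probability at least $2/3$, $$(1-\varepsilon)\cdot e_{n,d}(\partial\mathbf{x})f \le z \le (1+\varepsilon)\cdot e_{n,d}(\partial\mathbf{x})f.$$ The algorithm runs in time $4.075^d\cdot\varepsilon^{ -2}\log(\varepsilon^{ -1})\cdot\mathrm{poly}(n,s_f)$ and uses $\mathrm{poly}(n,s_f,\log(\varepsilon^{ -1}))$ space, where $s_f$ is the maximum bit complexity of $f$ on the domain $\{\pm1\}^n$.
   Context: $\mathbb{R}_{\ge0}[x_1,\ldots,x_n]_d$ is the set of homogeneous degree-$d$ polynomials in $x_1,\dots,x_n$ with nonnegative real coefficients. $e_{n,d}=\sum_{1\le i_1<\cdots<i_d\le n}x_{i_1}\cdots x_{i_d}$ is the elementary symmetric polynomial, and $e_{n,d}(\partial\mathbf{x})$ is the differential operator $e_{n,d}(\partial/\partial x_1,\ldots,\partial/\partial x_n)$; thus $e_{n,d}(\partial\mathbf{x})f$ is the sum of the coefficients of the multilinear monomials of $f$. Black-box access means the algorithm may query the value of $f$ at points of its choice, each query being charged unit cost. The bit complexity of $f$ on $\{\pm1\}^n$ is the maximum number of bits needed to write down $f(v)$ for $v\in\{\pm1\}^n$. The factor $\log(\varepsilon^{ -1})$ in the running time is understood as $\max(1,\log(\varepsilon^{ -1}))$. -}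

module Defs where

open import Algebra.Bundles using (module CommutativeMonoid)
open import Algebra.Properties.CommutativeSemigroup using (interchange)
open import Data.Bool.Base using (Bool; true; false; if_then_else_)
open import Data.Fin.Base using (Fin; toℕ)
open import Data.Integer.Base as ℤ using (ℤ; +_; +[1+_]; -[1+_]; 0ℤ; 1ℤ)
import Data.Integer.DivMod as ℤ using (_/_)
import Data.Integer.Properties as ℤ using (_≟_; _≤?_; _<?_)
open import Data.List.Base as List using (List; []; _∷_; allFin; concatMap; foldr; upTo)
open import Data.Maybe.Base using (Maybe; just; nothing)
open import Data.Nat.Base as ℕ using (ℕ; zero; suc; _⊔_; _∸_)
import Data.Nat.Properties as ℕ
open import Data.Nat.ListAction using (sum)
open import Data.Nat.Logarithm using (⌊log₂_⌋)
open import Data.Product.Base using (∃; _×_; _,_; proj₁)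
open import Data.Rational.Base as ℚ using (ℚ; 0ℚ; 1ℚ; ½; ∣_∣)
import Data.Rational.Properties as ℚ
open import Data.Sign.Base as Sign using (Sign)
open import Data.Vec.Base as Vec using (Vec; []; _∷_)
open import Function.Bundles using (_⇔_)
open import Relation.Binary.PropositionalEquality using (_≡_; _≢_; refl; sym; trans; cong; cong₂; module ≡-Reasoning)
open import Relation.Nullary.Decidable using (⌊_⌋)

Eventually : (ℕ → Set) → Set
Eventually P = ∃ λ N → ∀ n → N ℕ.≤ n → P n

Cauchy : (ℕ → ℚ) → Set
Cauchy x = ∀ δ → 0ℚ ℚ.< δ → ∃ λ N → ∀ m n → N ℕ.≤ m → N ℕ.≤ n → ∣ x m ℚ.- x n ∣ ℚ.≤ δ

record ℝ : Set where
  no-eta-equality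
  constructor mkℝ
  field
    seq    : ℕ → ℚ
    cauchy : Cauchy seq

open ℝ public

infix  4 _≤ᵣ_ _<ᵣ_ _≈ᵣ_
infixl 6 _+ᵣ_ _-ᵣ_
infixl 7 _*ᵣ_

record _≤ᵣ_ (x y : ℝ) : Set where
  constructor mk≤
  field
    eventually-≤ : ∀ δ → 0ℚ ℚ.< δ → Eventually λ n → seq x n ℚ.≤ seq y n ℚ.+ δ

record _<ᵣ_ (x y : ℝ) : Set where
  constructor mk<
  field
    gap          : ℚ
    gap-positive : 0ℚ ℚ.< gap
    eventually-< : Eventually λ n → seq x n ℚ.+ gap ℚ.≤ seq y n

_≈ᵣ_ : ℝ → ℝ → Set
x ≈ᵣ y = x ≤ᵣ y × y ≤ᵣ x

fromℚ : ℚ → ℝ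
fromℚ q = mkℝ (λ _ → q) λ δ 0<δ → 0 , λ _ _ _ _ →
  ℚ.≤-trans (ℚ.≤-reflexive (cong ∣_∣ (ℚ.+-inverseʳ q))) (ℚ.<⇒≤ 0<δ)

fromℤ : ℤ → ℝ
fromℤ z = fromℚ (z ℚ./ 1)

fromℕ : ℕ → ℝ
fromℕ k = fromℤ (+ k)

0ᵣ 1ᵣ : ℝ
0ᵣ = fromℚ 0ℚ
1ᵣ = fromℚ 1ℚ

abstract
  private
    0<½* : ∀ δ → 0ℚ ℚ.< δ → 0ℚ ℚ.< ½ ℚ.* δ
    0<½* δ 0<δ = ℚ.positive⁻¹ (½ ℚ.* δ) {{ℚ.pos*pos⇒pos ½ δ {{ℚ.positive 0<δ}}}}

    ½+½ : ∀ δ → ½ ℚ.* δ ℚ.+ ½ ℚ.* δ ≡ δ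
    ½+½ δ = trans (sym (ℚ.*-distribʳ-+ δ ½ ½)) (ℚ.*-identityˡ δ)

    cancel-shift : ∀ a b → (a ℚ.- b) ℚ.+ b ≡ a
    cancel-shift a b = trans (ℚ.+-assoc a (ℚ.- b) b)
                      (trans (cong (a ℚ.+_) (ℚ.+-inverseˡ b)) (ℚ.+-identityʳ a))

    +-regroup : ∀ a b c d → (a ℚ.+ b) ℚ.- (c ℚ.+ d) ≡ (a ℚ.- c) ℚ.+ (b ℚ.- d)
    +-regroup a b c d = trans (cong ((a ℚ.+ b) ℚ.+_) (ℚ.neg-distrib-+ c d))
                              (interchange (CommutativeMonoid.commutativeSemigroup ℚ.+-0-commutativeMonoid)
                                a b (ℚ.- c) (ℚ.- d))

    *-regroup : ∀ a b c d → a ℚ.* b ℚ.- c ℚ.* d ≡ a ℚ.* (b ℚ.- d) ℚ.+ d ℚ.* (a ℚ.- c)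
    *-regroup a b c d = sym (begin
      a ℚ.* (b ℚ.- d) ℚ.+ d ℚ.* (a ℚ.- c)
        ≡⟨ cong₂ ℚ._+_ (ℚ.*-distribˡ-+ a b (ℚ.- d)) (ℚ.*-distribˡ-+ d a (ℚ.- c)) ⟩
      (a ℚ.* b ℚ.+ a ℚ.* ℚ.- d) ℚ.+ (d ℚ.* a ℚ.+ d ℚ.* ℚ.- c)
        ≡⟨ cong₂ (λ u v → (a ℚ.* b ℚ.+ u) ℚ.+ v) (sym (ℚ.neg-distribʳ-* a d))
             (cong₂ ℚ._+_ (ℚ.*-comm d a) (trans (sym (ℚ.neg-distribʳ-* d c)) (cong ℚ.-_ (ℚ.*-comm d c)))) ⟩
      (a ℚ.* b ℚ.- a ℚ.* d) ℚ.+ (a ℚ.* d ℚ.- c ℚ.* d)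
        ≡⟨ ℚ.+-assoc (a ℚ.* b ℚ.- a ℚ.* d) (a ℚ.* d) (ℚ.- (c ℚ.* d)) ⟨
      ((a ℚ.* b ℚ.- a ℚ.* d) ℚ.+ a ℚ.* d) ℚ.- c ℚ.* d
        ≡⟨ cong (ℚ._- c ℚ.* d) (cancel-shift (a ℚ.* b) (a ℚ.* d)) ⟩
      a ℚ.* b ℚ.- c ℚ.* d ∎)
      where open ≡-Reasoning

    bounded : ∀ x → ∃ λ B → 0ℚ ℚ.< B × Eventually λ n → ∣ seq x n ∣ ℚ.≤ B
    bounded x with cauchy x 1ℚ (ℚ.positive⁻¹ 1ℚ)
    ... | N , close = 1ℚ ℚ.+ ∣ seq x N ∣ , 0<B , N , bound
      where
      0<B : 0ℚ ℚ.< 1ℚ ℚ.+ ∣ seq x N ∣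
      0<B = ℚ.+-mono-<-≤ (ℚ.positive⁻¹ 1ℚ) (ℚ.0≤∣p∣ (seq x N))

      bound : ∀ n → N ℕ.≤ n → ∣ seq x n ∣ ℚ.≤ 1ℚ ℚ.+ ∣ seq x N ∣
      bound n N≤n = begin
        ∣ seq x n ∣                               ≡⟨ cong ∣_∣ (cancel-shift (seq x n) (seq x N)) ⟨
        ∣ (seq x n ℚ.- seq x N) ℚ.+ seq x N ∣     ≤⟨ ℚ.∣p+q∣≤∣p∣+∣q∣ (seq x n ℚ.- seq x N) (seq x N) ⟩
        ∣ seq x n ℚ.- seq x N ∣ ℚ.+ ∣ seq x N ∣   ≤⟨ ℚ.+-monoˡ-≤ ∣ seq x N ∣ (close n N N≤n ℕ.≤-refl) ⟩
        1ℚ ℚ.+ ∣ seq x N ∣                        ∎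
        where open ℚ.≤-Reasoning

    ∣*∣≤ : ∀ p q {a b} → 0ℚ ℚ.< a → ∣ p ∣ ℚ.≤ a → ∣ q ∣ ℚ.≤ b → ∣ p ℚ.* q ∣ ℚ.≤ a ℚ.* b
    ∣*∣≤ p q {a} {b} 0<a p≤a q≤b = begin
      ∣ p ℚ.* q ∣      ≡⟨ ℚ.∣p*q∣≡∣p∣*∣q∣ p q ⟩
      ∣ p ∣ ℚ.* ∣ q ∣  ≤⟨ ℚ.*-monoʳ-≤-nonNeg ∣ q ∣ {{ℚ.nonNegative (ℚ.0≤∣p∣ q)}} p≤a ⟩
      a ℚ.* ∣ q ∣      ≤⟨ ℚ.*-monoˡ-≤-nonNeg a {{ℚ.nonNegative (ℚ.<⇒≤ 0<a)}} q≤b ⟩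
      a ℚ.* b          ∎
      where open ℚ.≤-Reasoning

    ∣*-*∣≤ : ∀ a b c d {A B η} → 0ℚ ℚ.< A → 0ℚ ℚ.< B → ∣ a ∣ ℚ.≤ A → ∣ d ∣ ℚ.≤ B →
             ∣ a ℚ.- c ∣ ℚ.≤ η → ∣ b ℚ.- d ∣ ℚ.≤ η →
             ∣ a ℚ.* b ℚ.- c ℚ.* d ∣ ℚ.≤ A ℚ.* η ℚ.+ B ℚ.* η
    ∣*-*∣≤ a b c d {A} {B} {η} 0<A 0<B a≤A d≤B a~c b~d = begin
      ∣ a ℚ.* b ℚ.- c ℚ.* d ∣                          ≡⟨ cong ∣_∣ (*-regroup a b c d) ⟩
      ∣ a ℚ.* (b ℚ.- d) ℚ.+ d ℚ.* (a ℚ.- c) ∣          ≤⟨ ℚ.∣p+q∣≤∣p∣+∣q∣ (a ℚ.* (b ℚ.- d)) (d ℚ.* (a ℚ.- c)) ⟩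
      ∣ a ℚ.* (b ℚ.- d) ∣ ℚ.+ ∣ d ℚ.* (a ℚ.- c) ∣      ≤⟨ ℚ.+-mono-≤ (∣*∣≤ a (b ℚ.- d) 0<A a≤A b~d)
                                                                      (∣*∣≤ d (a ℚ.- c) 0<B d≤B a~c) ⟩
      A ℚ.* η ℚ.+ B ℚ.* η                              ∎
      where open ℚ.≤-Reasoning

    split : ∀ A B δ → 0ℚ ℚ.< A → 0ℚ ℚ.< B → 0ℚ ℚ.< δ →
            ∃ λ η → 0ℚ ℚ.< η × A ℚ.* η ℚ.+ B ℚ.* η ≡ δ
    split A B δ 0<A 0<B 0<δ = η , 0<η , eq
      where
      instance
        posC : ℚ.Positive (A ℚ.+ B)
        posC = ℚ.positive (ℚ.+-mono-< 0<A 0<B)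
        nzC : ℚ.NonZero (A ℚ.+ B)
        nzC = ℚ.pos⇒nonZero (A ℚ.+ B)
        posδ : ℚ.Positive δ
        posδ = ℚ.positive 0<δ

      η : ℚ
      η = ℚ.1/ (A ℚ.+ B) ℚ.* δ

      0<η : 0ℚ ℚ.< η
      0<η = ℚ.positive⁻¹ η {{ℚ.pos*pos⇒pos (ℚ.1/ (A ℚ.+ B)) {{ℚ.1/pos⇒pos (A ℚ.+ B)}} δ}}

      eq : A ℚ.* η ℚ.+ B ℚ.* η ≡ δ
      eq = trans (sym (ℚ.*-distribʳ-+ η A B))
          (trans (sym (ℚ.*-assoc (A ℚ.+ B) (ℚ.1/ (A ℚ.+ B)) δ))
          (trans (cong (ℚ._* δ) (ℚ.*-inverseʳ (A ℚ.+ B))) (ℚ.*-identityˡ δ)))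

_+ᵣ_ : ℝ → ℝ → ℝ
x +ᵣ y = mkℝ (λ n → seq x n ℚ.+ seq y n) go
  where
  open ℚ.≤-Reasoning
  go : Cauchy (λ n → seq x n ℚ.+ seq y n)
  go δ 0<δ with cauchy x (½ ℚ.* δ) (0<½* δ 0<δ) | cauchy y (½ ℚ.* δ) (0<½* δ 0<δ)
  ... | M , closeˣ | N , closeʸ = M ⊔ N , λ m n p q → begin
    ∣ (seq x m ℚ.+ seq y m) ℚ.- (seq x n ℚ.+ seq y n) ∣
      ≡⟨ cong ∣_∣ (+-regroup (seq x m) (seq y m) (seq x n) (seq y n)) ⟩
    ∣ (seq x m ℚ.- seq x n) ℚ.+ (seq y m ℚ.- seq y n) ∣
      ≤⟨ ℚ.∣p+q∣≤∣p∣+∣q∣ (seq x m ℚ.- seq x n) (seq y m ℚ.- seq y n) ⟩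
    ∣ seq x m ℚ.- seq x n ∣ ℚ.+ ∣ seq y m ℚ.- seq y n ∣
      ≤⟨ ℚ.+-mono-≤ (closeˣ m n (ℕ.m⊔n≤o⇒m≤o M N p) (ℕ.m⊔n≤o⇒m≤o M N q))
                    (closeʸ m n (ℕ.m⊔n≤o⇒n≤o M N p) (ℕ.m⊔n≤o⇒n≤o M N q)) ⟩
    ½ ℚ.* δ ℚ.+ ½ ℚ.* δ
      ≡⟨ ½+½ δ ⟩
    δ ∎

_-ᵣ_ : ℝ → ℝ → ℝ
x -ᵣ y = x +ᵣ mkℝ (λ n → ℚ.- seq y n) λ δ 0<δ → let N , close = cauchy y δ 0<δ in
  N , λ m n p q → ℚ.≤-trans
    (ℚ.≤-reflexive (trans (cong ∣_∣ (sym (ℚ.neg-distrib-+ (seq y m) (ℚ.- seq y n))))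
                          (ℚ.∣-p∣≡∣p∣ (seq y m ℚ.- seq y n))))
    (close m n p q)

_*ᵣ_ : ℝ → ℝ → ℝ
x *ᵣ y = mkℝ (λ n → seq x n ℚ.* seq y n) (*-cauchy (bounded x) (bounded y))
  where
  Bounded : ℝ → Set
  Bounded z = ∃ λ B → 0ℚ ℚ.< B × Eventually λ n → ∣ seq z n ∣ ℚ.≤ B

  close : ∀ {δ A B η} → 0ℚ ℚ.< A → 0ℚ ℚ.< B → A ℚ.* η ℚ.+ B ℚ.* η ≡ δ →
          Eventually (λ n → ∣ seq x n ∣ ℚ.≤ A) → Eventually (λ n → ∣ seq y n ∣ ℚ.≤ B) →
          (∃ λ M → ∀ m n → M ℕ.≤ m → M ℕ.≤ n → ∣ seq x m ℚ.- seq x n ∣ ℚ.≤ η) →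
          (∃ λ N → ∀ m n → N ℕ.≤ m → N ℕ.≤ n → ∣ seq y m ℚ.- seq y n ∣ ℚ.≤ η) →
          ∃ λ J → ∀ m n → J ℕ.≤ m → J ℕ.≤ n →
            ∣ seq x m ℚ.* seq y m ℚ.- seq x n ℚ.* seq y n ∣ ℚ.≤ δ
  close 0<A 0<B eq (K , x≤A) (L , y≤B) (M , closeˣ) (N , closeʸ) = (K ⊔ L) ⊔ (M ⊔ N) , λ m n p q →
    let KL≤m = ℕ.m⊔n≤o⇒m≤o (K ⊔ L) (M ⊔ N) p
        KL≤n = ℕ.m⊔n≤o⇒m≤o (K ⊔ L) (M ⊔ N) q
        MN≤m = ℕ.m⊔n≤o⇒n≤o (K ⊔ L) (M ⊔ N) p
        MN≤n = ℕ.m⊔n≤o⇒n≤o (K ⊔ L) (M ⊔ N) q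
    in ℚ.≤-trans
      (∣*-*∣≤ (seq x m) (seq y m) (seq x n) (seq y n) 0<A 0<B
        (x≤A m (ℕ.m⊔n≤o⇒m≤o K L KL≤m)) (y≤B n (ℕ.m⊔n≤o⇒n≤o K L KL≤n))
        (closeˣ m n (ℕ.m⊔n≤o⇒m≤o M N MN≤m) (ℕ.m⊔n≤o⇒m≤o M N MN≤n))
        (closeʸ m n (ℕ.m⊔n≤o⇒n≤o M N MN≤m) (ℕ.m⊔n≤o⇒n≤o M N MN≤n)))
      (ℚ.≤-reflexive eq)

  *-cauchy : Bounded x → Bounded y → Cauchy (λ n → seq x n ℚ.* seq y n)
  *-cauchy (A , 0<A , x≤A) (B , 0<B , y≤B) δ 0<δ =
    let η , 0<η , eq = split A B δ 0<A 0<B 0<δ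
    in close 0<A 0<B eq x≤A y≤B (cauchy x η 0<η) (cauchy y η 0<η)

sumᵣ : List ℝ → ℝ
sumᵣ = foldr _+ᵣ_ 0ᵣ

-- A polynomial or power series in n variables, as the family of its
-- coefficients indexed by exponent vectors.
Coefficients : ℕ → Set
Coefficients n = Vec ℕ n → ℝ

record NonNegForm (n d : ℕ) : Set where
  field
    coeff       : Coefficients n
    nonNegative : ∀ α → 0ᵣ ≤ᵣ coeff α
    homogeneous : ∀ α → Vec.sum α ≢ d → coeff α ≈ᵣ 0ᵣ

open NonNegForm public

-- All exponent vectors of total degree d, each once.
exponents : (n d : ℕ) → List (Vec ℕ n)
exponents zero    zero    = [] ∷ []
exponents zero    (suc d) = []
exponents (suc n) d       = concatMap (λ a → List.map (a ∷_) (exponents n (d ∸ a))) (upTo (suc d))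

monomial : ∀ {n} → Vec ℕ n → Vec ℤ n → ℤ
monomial α v = Vec.foldr′ ℤ._*_ 1ℤ (Vec.zipWith ℤ._^_ v α)

eval : ∀ {n d} → NonNegForm n d → Vec ℤ n → ℝ
eval {n} {d} f v = sumᵣ (List.map (λ α → coeff f α *ᵣ fromℤ (monomial α v)) (exponents n d))

∂ : ∀ {n} → Fin n → Coefficients n → Coefficients n
∂ i g α = fromℕ (suc (Vec.lookup α i)) *ᵣ g (α Vec.[ i ]%= suc)

-- The length-d sublists of a list; for allFin n these are the index
-- sequences i₁ < ⋯ < i_d.
sublists : ∀ {A : Set} → ℕ → List A → List (List A)
sublists zero    xs       = [] ∷ []
sublists (suc d) []       = []
sublists (suc d) (x ∷ xs) = List.map (x ∷_) (sublists d xs) List.++ sublists (suc d) xs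

elementary∂ : ∀ n → ℕ → Coefficients n → Coefficients n
elementary∂ n d g α = sumᵣ (List.map (λ I → foldr ∂ g I α) (sublists d (allFin n)))

-- e_{n,d}(∂x) f has degree 0, so as a number it is its constant coefficient.
e∂ : ∀ {n d} → NonNegForm n d → ℝ
e∂ {n} {d} f = elementary∂ n d (coeff f) (Vec.replicate n 0)

-- ⌊log₂ |z|⌋ + 1, and 1 for z = 0.
len : ℤ → ℕ
len z = suc ⌊log₂ ℤ.∣ z ∣ ⌋

-- A number that can be written down in bits, i.e. with a finite binary
-- expansion; ℚ is in lowest terms, so `places` is the number of binary
-- digits after the point.
record Binary : Set where
  field
    value    : ℚ
    places   : ℕ
    isBinary : ℚ.↧ₙ value ≡ 2 ℕ.^ places

open Binary public

-- A sign bit followed by the digits: `value` is the integer ↥ value with the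
-- binary point moved `places` digits to the left.
bits : Binary → ℕ
bits b = suc (len (ℚ.↥ value b) ⊔ places b)

cubePoint : ∀ {n} → Vec Sign n → Vec ℤ n
cubePoint = Vec.map (λ s → s ℤ.◃ 1)

CubeValues : ∀ {n d} → NonNegForm n d → Set
CubeValues {n} f = (σ : Vec Sign n) → ∃ λ b → fromℚ (value b) ≈ᵣ eval f (cubePoint σ)

maxSigns : ∀ n → (Vec Sign n → ℕ) → ℕ
maxSigns zero    g = g []
maxSigns (suc n) g = maxSigns n (λ σ → g (Sign.+ ∷ σ)) ⊔ maxSigns n (λ σ → g (Sign.- ∷ σ))

bitComplexity : ∀ {n d} (f : NonNegForm n d) → CubeValues f → ℕ
bitComplexity {n} f values = maxSigns n (λ σ → bits (proj₁ (values σ)))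

-- The box may be queried at every integer point (by homogeneity this covers
-- the rational points). It returns the exact value if that is a rational
-- number, and `nothing` if the value is irrational.
IsBlackBox : ∀ {n d} → (Vec ℤ n → Maybe ℚ) → NonNegForm n d → Set
IsBlackBox F f = ∀ v q → F v ≡ just q ⇔ fromℚ q ≈ᵣ eval f v

-- A real number is handed to the algorithm through approximations
-- |x − a k / 2ᵏ| ≤ 1 / 2ᵏ for k chosen by the algorithm.
_Approximates_ : (ℕ → ℤ) → ℝ → Set
a Approximates x = ∀ k → fromℤ (a k) -ᵣ 1ᵣ ≤ᵣ fromℕ (2 ℕ.^ k) *ᵣ x
                       × fromℕ (2 ℕ.^ k) *ᵣ x ≤ᵣ fromℤ (a k) +ᵣ 1ᵣ

-- Randomized random-access machines with logarithmic costs (Aho, Hopcroft,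
-- Ullman, "The Design and Analysis of Computer Algorithms", Section 1.3), with
-- structured control flow, integer registers, and coin-flip and query
-- instructions.

data Address : Set where
  at  : ℕ → Address     -- register k
  via : ℕ → Address     -- the register whose index is stored in register k

data Operand : Set where
  lit           : ℤ → Operand
  reg           : Address → Operand
  inputN inputD : Operand

data ArithOp : Set where
  add sub mul div : ArithOp

data Comparison : Set where
  lt le eq : Comparison

infixr 5 _⨾_

data Program : Set where
  skip    : Program
  compute : Address → ArithOp → Operand → Operand → Program
  -- flip x writes a fair random bit to x
  flip    : Address → Program
  -- query x y b queries f at the n consecutive registers from index b on, and
  -- writes numerator and denominator of the answer (0 and 0 if there is none)
  -- to x and y
  query   : Address → Address → Operand → Program
  -- approxε x k writes the k-th approximation of ε to x
  approxε : Address → Operand → Program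
  _⨾_     : Program → Program → Program
  ifte    : Operand → Comparison → Operand → Program → Program → Program
  while   : Operand → Comparison → Operand → Program → Program

quotient : ℤ → ℤ → ℤ
quotient a (+ zero)   = 0ℤ
quotient a b@(+[1+ _ ]) = a ℤ./ b
quotient a b@(-[1+ _ ]) = a ℤ./ b

arith : ArithOp → ℤ → ℤ → ℤ
arith add = ℤ._+_
arith sub = ℤ._-_
arith mul = ℤ._*_
arith div = quotient

compare : Comparison → ℤ → ℤ → Bool
compare lt a b = ⌊ a ℤ.<? b ⌋
compare le a b = ⌊ a ℤ.≤? b ⌋
compare eq a b = ⌊ a ℤ.≟ b ⌋

-- The registers up to the last one written; all others hold 0.
Memory : Set
Memory = List ℤ

load : Memory → ℕ → ℤ
load []      _       = 0ℤ
load (z ∷ m) zero    = z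
load (z ∷ m) (suc k) = load m k

store : Memory → ℕ → ℤ → Memory
store []      zero    z = z ∷ []
store (_ ∷ m) zero    z = z ∷ m
store []      (suc k) z = 0ℤ ∷ store [] k z
store (y ∷ m) (suc k) z = y ∷ store m k z

size : Memory → ℕ
size m = sum (List.map len m)

-- Negative register indices are replaced by their absolute values.
resolve : Memory → Address → ℕ
resolve m (at k)  = k
resolve m (via k) = ℤ.∣ load m k ∣

addressCost : Memory → Address → ℕ
addressCost m (at k)  = len (+ k)
addressCost m (via k) = len (+ k) ℕ.+ len (load m k)

bit : Bool → ℤ
bit b = if b then 1ℤ else 0ℤ

numerator denominator : Maybe ℚ → ℤ
numerator   (just q) = ℚ.↥ q
numerator   nothing  = 0ℤ
denominator (just q) = ℚ.↧ q
denominator nothing  = 0ℤ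

module Semantics (n d : ℕ) (box : Vec ℤ n → Maybe ℚ) (ε̂ : ℕ → ℤ) where

  -- The inputs n and d are read-only; they cost time but no working space.
  read : Memory → Operand → ℤ
  read m (lit z) = z
  read m (reg a) = load m (resolve m a)
  read m inputN  = + n
  read m inputD  = + d

  operandCost : Memory → Operand → ℕ
  operandCost m (lit z) = len z
  operandCost m (reg a) = addressCost m a ℕ.+ len (load m (resolve m a))
  operandCost m inputN  = len (+ n)
  operandCost m inputD  = len (+ d)

  testCost : Memory → Operand → Operand → ℕ
  testCost m a b = operandCost m a ℕ.+ operandCost m b

  point : Memory → ℕ → Vec ℤ n
  point m base = Vec.tabulate λ i → load m (base ℕ.+ toℕ i)

  answerAt : Memory → Operand → Maybe ℚ
  answerAt m b = box (point m ℤ.∣ read m b ∣)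

  assign : Memory → Address → ℤ → Memory
  assign m x z = store m (resolve m x) z

  assignAnswer : Memory → Address → Address → Maybe ℚ → Memory
  assignAnswer m x y r = store (store m (resolve m x) (numerator r)) (resolve m y) (denominator r)

  -- Run P m ω m′ ω′ t s: started with memory m and random bits ω, P halts
  -- with memory m′ and unused random bits ω′, after time t and with peak
  -- memory size s.
  data Run : Program → Memory → List Bool → Memory → List Bool → ℕ → ℕ → Set where
    run-skip : ∀ {m ω} → Run skip m ω m ω 1 (size m)
    run-compute : ∀ {x o a b m ω} → let m′ = assign m x (arith o (read m a) (read m b)) in
      Run (compute x o a b) m ω m′ ω
          (addressCost m x ℕ.+ operandCost m a ℕ.+ operandCost m b) (size m ⊔ size m′)
    run-flip : ∀ {x m c ω} → let m′ = assign m x (bit c) in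
      Run (flip x) m (c ∷ ω) m′ ω (addressCost m x) (size m ⊔ size m′)
    run-query : ∀ {x y b m ω} → let m′ = assignAnswer m x y (answerAt m b) in
      Run (query x y b) m ω m′ ω 1 (size m ⊔ size m′)
    run-approxε : ∀ {x k m ω} → let p = ℤ.∣ read m k ∣; m′ = assign m x (ε̂ p) in
      Run (approxε x k) m ω m′ ω (addressCost m x ℕ.+ operandCost m k ℕ.+ p) (size m ⊔ size m′)
    run-⨾ : ∀ {P Q m ω m′ ω′ m″ ω″ t t′ s s′} →
      Run P m ω m′ ω′ t s → Run Q m′ ω′ m″ ω″ t′ s′ →
      Run (P ⨾ Q) m ω m″ ω″ (t ℕ.+ t′) (s ⊔ s′)
    run-then : ∀ {a c b P Q m ω m′ ω′ t s} →
      compare c (read m a) (read m b) ≡ true → Run P m ω m′ ω′ t s →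
      Run (ifte a c b P Q) m ω m′ ω′ (testCost m a b ℕ.+ t) s
    run-else : ∀ {a c b P Q m ω m′ ω′ t s} →
      compare c (read m a) (read m b) ≡ false → Run Q m ω m′ ω′ t s →
      Run (ifte a c b P Q) m ω m′ ω′ (testCost m a b ℕ.+ t) s
    run-done : ∀ {a c b P m ω} →
      compare c (read m a) (read m b) ≡ false →
      Run (while a c b P) m ω m ω (testCost m a b) (size m)
    run-loop : ∀ {a c b P m ω m′ ω′ m″ ω″ t t′ s s′} →
      compare c (read m a) (read m b) ≡ true →
      Run P m ω m′ ω′ t s → Run (while a c b P) m′ ω′ m″ ω″ t′ s′ →
      Run (while a c b P) m ω m″ ω″ (testCost m a b ℕ.+ t ℕ.+ t′) (s ⊔ s′)

-- A halting computation from empty memory.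
record Execution (P : Program) (n d : ℕ) (F : Vec ℤ n → Maybe ℚ) (ε̂ : ℕ → ℤ)
                 (ω : List Bool) : Set where
  open Semantics n d F ε̂
  field
    final      : Memory
    unused     : List Bool
    time space : ℕ
    run        : Run P [] ω final unused time space

open Execution public

-- Register 0 divided by register 1.
result : Memory → ℚ
result m with load m 1
... | +[1+ k ]  = load m 0 ℚ./ suc k
... | + zero    = 0ℚ
... | -[1+ k ]  = ℚ.- (load m 0 ℚ./ suc k)

count : ∀ {R} → (Vec Bool R → Bool) → ℕ
count {zero}  p = if p [] then 1 else 0
count {suc R} p = count (λ ω → p (true ∷ ω)) ℕ.+ count (λ ω → p (false ∷ ω))

-- With probability at least a / b over R fair coin flips, E holds. The event E
-- need not be decidable (it may compare real numbers), so the bound is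
-- witnessed by a decidable event contained in E.
Probability≥ : ∀ {R} (a b : ℕ) → (Vec Bool R → Set) → Set
Probability≥ {R} a b E = ∃ λ (p : Vec Bool R → Bool) →
  (∀ ω → p ω ≡ true → E ω) × a ℕ.* 2 ℕ.^ R ℕ.≤ b ℕ.* count p

infixr 8 _^ᵣ_
_^ᵣ_ : ℝ → ℕ → ℝ
x ^ᵣ zero  = 1ᵣ
x ^ᵣ suc k = x *ᵣ x ^ᵣ k

-- ℓ ≥ max(1, log₂(ε⁻¹)). Bounds that hold for all such integers ℓ hold for
-- ⌈max(1, log₂(ε⁻¹))⌉, which is at most twice max(1, log₂(ε⁻¹)).
_≥log1/_ : ℕ → ℝ → Set
ℓ ≥log1/ ε = 1 ℕ.≤ ℓ × 1ᵣ ≤ᵣ fromℕ (2 ℕ.^ ℓ) *ᵣ ε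

-- T ≤ (163/40)ᵈ · ε⁻² · ℓ · p, multiplied by ε²; 163/40 = 4.075.
TimeBound : (T d : ℕ) (ε : ℝ) (ℓ p : ℕ) → Set
TimeBound T d ε ℓ p =
  fromℕ T *ᵣ ε ^ᵣ 2 ≤ᵣ fromℚ (+ 163 ℚ./ 40) ^ᵣ d *ᵣ fromℕ ℓ *ᵣ fromℕ p

-- Polarise with random colours: a signed sum of the values of f over the sign
-- vectors read off from the subsets of at most m of K colours is zero unless all
-- variables of a monomial have distinct colours (a Lee-style identity for
-- e_{K,2m+1}, weighted by a power series so that short sums suffice). Padding
-- with dummy variables makes the degree odd, 2m + 1 = 20M + 1, with K = 31M
-- colours. Each sample is then nonnegative and bounded by a multiple of the mean, so
-- Chebyshev's inequality applies, and the growth rate of (number of samples) ×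
-- (number of subsets) is at most 4.075ᵈ.
module Submission where

open import Data.Bool.Base as Bool using (Bool; true; false; if_then_else_; T; _∧_; not)
open import Data.Empty using (⊥; ⊥-elim)
open import Data.Fin.Base as Fin using (Fin; toℕ; zero; suc)
import Data.Fin.Properties as Fin
open import Data.Integer.Base as ℤ using (ℤ; +_; +[1+_]; -[1+_]; 0ℤ; 1ℤ; -1ℤ)
import Data.Integer.DivMod as ℤ
import Data.Integer.Properties as ℤ
import Data.Integer.Tactic.RingSolver as ℤRing
open import Data.List.Base as List using (List; []; _∷_; _++_; length; allFin; concatMap; foldr; upTo)
import Data.List.Properties as List
open import Data.List.Relation.Unary.All as All using (All; []; _∷_)
import Data.List.Relation.Unary.All.Properties as All
open import Data.Maybe.Base using (Maybe; just; nothing)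
open import Data.Nat.Base as ℕ using (ℕ; zero; suc; _+_; _*_; _^_; _∸_; _≤_; _<_; _⊔_; z≤n; s≤s; z<s; s<s; NonZero; _<ᵇ_; _≡ᵇ_; _/_; _%_)
import Data.Nat.DivMod as ℕ
open import Data.Nat.ListAction using (sum)
open import Data.Nat.Logarithm using (⌊log₂_⌋; ⌊log₂⌋-mono-≤; ⌊log₂[2^n]⌋≡n)
import Data.Nat.Properties as ℕ
import Data.Nat.Tactic.RingSolver as ℕRing
open import Data.Product.Base using (∃; ∃₂; _×_; _,_; proj₁; proj₂)
open import Data.Rational.Base as ℚ using (ℚ; 0ℚ; 1ℚ; ½)
import Data.Rational.Properties as ℚ
open import Data.Rational.Solver using (module +-*-Solver)
import Data.Rational.Unnormalised.Base as ℚᵘ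
import Data.Rational.Unnormalised.Properties as ℚᵘ
open import Data.Sign.Base as Sign using (Sign)
import Data.Sign.Properties as Sign
open import Data.Sum.Base using (_⊎_; inj₁; inj₂; [_,_]′)
open import Data.Unit.Base using (⊤; tt)
open import Data.Vec.Base as Vec using (Vec; []; _∷_; toList)
import Data.Vec.Properties as Vec
open import Function.Base using (_∘_; case_of_; _$_)
open import Function.Bundles using (Equivalence)
open import Relation.Binary.PropositionalEquality
  using (_≡_; _≢_; _≗_; refl; sym; trans; cong; cong₂; subst; subst₂; module ≡-Reasoning)
open import Relation.Nullary.Decidable using (yes; no; Dec; ⌊_⌋; isYes≗does)
open import Relation.Nullary.Negation.Core using (¬_; contradiction)
open import Defs
open +-*-Solver using (_:+_; _:*_; _:-_; :-_; _:=_; con) renaming (solve to ℚ-solve)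

∑ : ℕ → (ℕ → ℤ) → ℤ
∑ zero    f = 0ℤ
∑ (suc n) f = ∑ n f ℤ.+ f n

∏ : ℕ → (ℕ → ℤ) → ℤ
∏ zero    f = 1ℤ
∏ (suc n) f = ∏ n f ℤ.* f n

binom : ℕ → ℕ → ℕ
binom n       zero    = 1
binom zero    (suc k) = 0
binom (suc n) (suc k) = binom n k + binom n (suc k)

binom-absorb : ∀ n k → suc k * binom (suc n) (suc k) ≡ suc n * binom n k
binom-absorb zero    zero    = refl
binom-absorb zero    (suc k) = ℕ.*-zeroʳ k
binom-absorb (suc n) zero    = trans (ℕ.*-identityˡ _) (cong suc (trans (sym (ℕ.*-identityˡ _)) (binom-absorb n 0)))
binom-absorb (suc n) (suc k) = begin
  suc (suc k) * (binom (suc n) (suc k) + binom (suc n) (suc (suc k)))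
    ≡⟨ expand k (binom (suc n) (suc k)) (binom (suc n) (suc (suc k))) ⟩
  suc k * binom (suc n) (suc k) + suc (suc k) * binom (suc n) (suc (suc k)) + binom (suc n) (suc k)
    ≡⟨ cong₂ (λ x y → x + y + binom (suc n) (suc k)) (binom-absorb n k) (binom-absorb n (suc k)) ⟩
  suc n * binom n k + suc n * binom n (suc k) + binom (suc n) (suc k)
    ≡⟨ collect n (binom n k) (binom n (suc k)) ⟩
  suc (suc n) * binom (suc n) (suc k) ∎
  where
  open ≡-Reasoning
  expand : ∀ k x y → suc (suc k) * (x + y) ≡ suc k * x + suc (suc k) * y + x
  expand = ℕRing.solve-∀
  collect : ∀ n x y → suc n * x + suc n * y + (x + y) ≡ suc (suc n) * (x + y)
  collect = ℕRing.solve-∀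

binom-lower : ∀ n r {z} → r + z ≡ suc n → z * binom (suc n) r ≡ suc n * binom n r
binom-lower n zero    refl = refl
binom-lower n (suc r) {z} r+z≡ = ℕ.+-cancelˡ-≡ (suc r * binom (suc n) (suc r)) _ _ (begin
  suc r * binom (suc n) (suc r) + z * binom (suc n) (suc r)  ≡⟨ ℕ.*-distribʳ-+ (binom (suc n) (suc r)) (suc r) z ⟨
  (suc r + z) * binom (suc n) (suc r)                        ≡⟨ cong (_* binom (suc n) (suc r)) r+z≡ ⟩
  suc n * binom (suc n) (suc r)                              ≡⟨ ℕ.*-distribˡ-+ (suc n) (binom n r) (binom n (suc r)) ⟩
  suc n * binom n r + suc n * binom n (suc r)                ≡⟨ cong (_+ suc n * binom n (suc r)) (binom-absorb n r) ⟨
  suc r * binom (suc n) (suc r) + suc n * binom n (suc r)    ∎)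
  where open ≡-Reasoning

binom-next : ∀ n k {z} → k + z ≡ n → suc k * binom n (suc k) ≡ z * binom n k
binom-next zero    zero    {zero}  refl = refl
binom-next (suc n) k       {z}     k+z≡ = trans (binom-absorb n k) (sym (binom-lower n k k+z≡))

binom-zero : ∀ n k → n < k → binom n k ≡ 0
binom-zero zero    (suc k) _         = refl
binom-zero (suc n) (suc k) (s≤s n<k) = cong₂ _+_ (binom-zero n k n<k) (binom-zero n (suc k) (ℕ.m≤n⇒m≤1+n n<k))

binom-≤ : ∀ n k → binom n k ≤ 2 ^ n
binom-≤ n       zero    = ℕ.m^n>0 2 n
binom-≤ zero    (suc k) = z≤n
binom-≤ (suc n) (suc k) = ℕ.≤-trans (ℕ.+-mono-≤ (binom-≤ n k) (binom-≤ n (suc k)))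
                            (ℕ.≤-reflexive (cong (_+_ (2 ^ n)) (sym (ℕ.+-identityʳ (2 ^ n)))))

binom-support : ∀ n k {i} → i < binom n k → k ≤ n
binom-support n k i< with k ℕ.≤? n
... | yes k≤n = k≤n
... | no  k≰n = contradiction (subst (_ <_) (binom-zero n k (ℕ.≰⇒> k≰n)) i<) λ ()

-- The sign of c₀ in the sign vector of the idx-th j-element subset of
-- {0, …, c - 1}, with the subsets avoiding c - 1 listed first.
signAt : (c j idx c₀ : ℕ) → Sign
signAt zero    j idx c₀ = Sign.+
signAt (suc c) j idx c₀ = if idx <ᵇ binom c j then signAt c j idx c₀
  else (if c ≡ᵇ c₀ then Sign.- else Sign.+) Sign.* signAt c (j ∸ 1) (idx ∸ binom c j) c₀

module _ (R : ℕ) .{{_ : NonZero R}} where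

  shift : ℕ → ℕ → ℕ
  shift X zero    = X
  shift X (suc i) = shift X i / R

  module _ (u : ℕ) .{{_ : NonZero u}} where

    colour : ℕ → ℕ → ℕ
    colour X i = (shift X i % R) / u

sub-pos : ∀ {a b} → b ≤ a → + a ℤ.- + b ≡ + (a ∸ b)
sub-pos {a} {b} b≤a = trans (ℤ.m-n≡m⊖n a b) (ℤ.⊖-≥ b≤a)

sub-pos-+ : ∀ a b {c} → a + b ≡ c → + c ℤ.- + a ≡ + b
sub-pos-+ a b refl = trans (sub-pos (ℕ.m≤m+n a b)) (cong +_ (ℕ.m+n∸m≡n a b))

mul-pos : ∀ a b → + a ℤ.* + b ≡ + (a * b)
mul-pos a b = sym (ℤ.pos-* a b)

quotient-pos : ∀ a b .{{_ : NonZero b}} → quotient (+ a) (+ b) ≡ + (a / b)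
quotient-pos a (suc b) = ℤ.div-pos-is-/ℕ (+ a) (suc b)

quotient-exact : ∀ a b q .{{_ : NonZero b}} → q * b ≡ a → quotient (+ a) (+ b) ≡ + q
quotient-exact a b q refl = trans (quotient-pos a b) (cong +_ (ℕ.m*n/n≡m q b))

T→≡ : ∀ {b} → T b → b ≡ true
T→≡ {true} _ = refl

≡→T : ∀ {b} → b ≡ true → T b
≡→T refl = tt

compare-lt : ∀ a b → compare lt (+ a) (+ b) ≡ (a <ᵇ b)
compare-lt a b = isYes≗does (+ a ℤ.<? + b)

compare-lt-true : ∀ {a b} → a < b → compare lt (+ a) (+ b) ≡ true
compare-lt-true {a} {b} a<b = trans (compare-lt a b) (T→≡ (ℕ.<⇒<ᵇ a<b))

<ᵇ-false : ∀ {a b} → b ≤ a → (a <ᵇ b) ≡ false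
<ᵇ-false {a} {b} b≤a with a <ᵇ b in e
... | false = refl
... | true  = contradiction (ℕ.<ᵇ⇒< a b (≡→T e)) (ℕ.≤⇒≯ b≤a)

compare-lt-false : ∀ {a b} → b ≤ a → compare lt (+ a) (+ b) ≡ false
compare-lt-false {a} {b} b≤a = trans (compare-lt a b) (<ᵇ-false b≤a)

<ᵇ-false⁻¹ : ∀ {a b} → (a <ᵇ b) ≡ false → b ≤ a
<ᵇ-false⁻¹ {a} {b} e = ℕ.≮⇒≥ λ a<b → contradiction (trans (sym e) (T→≡ (ℕ.<⇒<ᵇ a<b))) λ ()

<ᵇ-true⁻¹ : ∀ {a b} → (a <ᵇ b) ≡ true → a < b
<ᵇ-true⁻¹ {a} {b} e = ℕ.<ᵇ⇒< a b (≡→T e)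

compare-le : ∀ a b → compare le (+ a) (+ b) ≡ (a <ᵇ suc b)
compare-le zero    b = isYes≗does (+ 0 ℤ.≤? + b)
compare-le (suc a) b = isYes≗does (+ suc a ℤ.≤? + b)

compare-eq : ∀ a b → compare eq (+ a) (+ b) ≡ (a ≡ᵇ b)
compare-eq a b = isYes≗does (+ a ℤ.≟ + b)

n<2^n : ∀ n → n < 2 ^ n
n<2^n zero    = s≤s z≤n
n<2^n (suc n) = ℕ.≤-trans (ℕ.+-mono-≤ (ℕ.m^n>0 2 n) (n<2^n n)) (ℕ.≤-reflexive (cong (_+_ (2 ^ n)) (sym (ℕ.+-identityʳ (2 ^ n)))))

value± : Sign → ℤ
value± s = s ℤ.◃ 1

alternate : ℕ → Sign
alternate zero    = Sign.+
alternate (suc j) = Sign.- Sign.* alternate j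

falling : ℕ → ℕ → ℕ
falling K zero    = 1
falling K (suc i) = falling K i * (K ∸ i)

falling-≤ : ∀ K i → falling K i ≤ K ^ i
falling-≤ K zero    = ℕ.≤-refl
falling-≤ K (suc i) = ℕ.≤-trans (ℕ.*-mono-≤ (falling-≤ K i) (ℕ.m∸n≤m K i)) (ℕ.≤-reflexive (ℕ.*-comm (K ^ i) K))

digit : Bool → ℕ
digit b = if b then 1 else 0

fromBits : ℕ → List Bool → ℕ
fromBits x []       = x
fromBits x (b ∷ bs) = fromBits (x + x + digit b) bs

^-cancel-< : ∀ {a l} → 2 ^ a < 2 ^ l → a < l
^-cancel-< {a} {l} p = ℕ.≰⇒> λ l≤a → contradiction (ℕ.<-≤-trans p (ℕ.^-monoʳ-≤ 2 l≤a)) (ℕ.<-irrefl refl)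

^-cancel-≤ : ∀ {a l} → 2 ^ l ≤ 2 ^ a → l ≤ a
^-cancel-≤ {a} {l} p = ℕ.≮⇒≥ λ a<l → contradiction (ℕ.<-≤-trans (ℕ.^-monoʳ-< 2 (s≤s (s≤s z≤n)) a<l) p) (ℕ.<-irrefl refl)

∣value±∣ : ∀ s → ℤ.∣ value± s ∣ ≡ 1
∣value±∣ Sign.+ = refl
∣value±∣ Sign.- = refl

module Weights (n K R u : ℕ) .{{_ : NonZero R}} .{{_ : NonZero u}} (X j idx w : ℕ) (σ : Sign) where

  signOf : ℕ → Sign
  signOf i = signAt K j idx (colour R u X i)

  factor : ℕ → ℤ
  factor i = (if colour R u X i <ᵇ K then 1ℤ else 0ℤ) ℤ.* (if i <ᵇ n then 1ℤ else value± (signOf i))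

  weight : ℕ → ℤ
  weight i = (+ w ℤ.* value± σ) ℤ.* ∏ i factor

  ∣factor∣≤1 : ∀ i → ℤ.∣ factor i ∣ ≤ 1
  ∣factor∣≤1 i with colour R u X i <ᵇ K | i <ᵇ n
  ... | true  | true  = s≤s z≤n
  ... | true  | false = ℕ.≤-reflexive (trans (cong ℤ.∣_∣ (ℤ.*-identityˡ (value± (signOf i)))) (∣value±∣ (signOf i)))
  ... | false | true  = z≤n
  ... | false | false = z≤n

  ∣weight∣≤ : ∀ i → ℤ.∣ weight i ∣ ≤ w
  ∣weight∣≤ zero = ℕ.≤-reflexive (trans (ℤ.abs-* (+ w ℤ.* value± σ) 1ℤ) (trans (ℕ.*-identityʳ _)
    (trans (ℤ.abs-* (+ w) (value± σ)) (trans (cong (w *_) (∣value±∣ σ)) (ℕ.*-identityʳ w)))))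
  ∣weight∣≤ (suc i) = begin
    ℤ.∣ (+ w ℤ.* value± σ) ℤ.* (∏ i factor ℤ.* factor i) ∣  ≡⟨ cong ℤ.∣_∣ (sym (ℤ.*-assoc (+ w ℤ.* value± σ) (∏ i factor) (factor i))) ⟩
    ℤ.∣ weight i ℤ.* factor i ∣                              ≡⟨ ℤ.abs-* (weight i) (factor i) ⟩
    ℤ.∣ weight i ∣ * ℤ.∣ factor i ∣                          ≤⟨ ℕ.*-mono-≤ (∣weight∣≤ i) (∣factor∣≤1 i) ⟩
    w * 1                                                    ≡⟨ ℕ.*-identityʳ w ⟩
    w                                                        ∎
    where open ℕ.≤-Reasoning

module _ (m e₀ w₀ : ℕ) where

  sizeWeight : ℕ → ℕ
  sizeWeight zero    = w₀
  sizeWeight (suc j) = sizeWeight j * (m ∸ j) / (suc e₀ + (m ∸ j))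

  sizeWeight-≤ : ∀ j → sizeWeight j ≤ w₀
  sizeWeight-≤ zero    = ℕ.≤-refl
  sizeWeight-≤ (suc j) = ℕ.≤-trans (ℕ./-monoˡ-≤ (suc e₀ + (m ∸ j)) (ℕ.*-monoʳ-≤ (sizeWeight j) (ℕ.m≤n+m (m ∸ j) (suc e₀))))
    (ℕ.≤-trans (ℕ.≤-reflexive (ℕ.m*n/n≡m (sizeWeight j) (suc e₀ + (m ∸ j)))) (sizeWeight-≤ j))

module Estimator (n K m n′ R u : ℕ) .{{_ : NonZero R}} .{{_ : NonZero u}} (e₀ w₀ : ℕ) (fz : Vec Sign n → ℤ) where

  point± : ℕ → ℕ → ℕ → Vec Sign n
  point± X j idx = Vec.tabulate (λ i → signAt K j idx (colour R u X (toℕ i)))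

  wt : ℕ → ℕ → ℕ → ℤ
  wt X j idx = Weights.weight n K R u X j idx (sizeWeight m e₀ w₀ j) (alternate j) n′

  term : ℕ → ℕ → ℕ → ℤ
  term X j idx = wt X j idx ℤ.* fz (point± X j idx)

  layer : ℕ → ℕ → ℤ
  layer X j = ∑ (binom K j) (term X j)

  sampleValue : ℕ → ℤ
  sampleValue X = ∑ (suc m) (layer X)

module Machine (n d : ℕ) (F : Vec ℤ n → Maybe ℚ) (ε̂ : ℕ → ℤ)
               (B G : ℕ) (6≤B : 6 ≤ B) (48≤G : 48 ≤ G) (n≤2^B : n ≤ 2 ^ B) (d≤2^B : d ≤ 2 ^ B) where
  open Semantics n d F ε̂ public

  Small : ℤ → Set
  Small z = ℤ.∣ z ∣ ≤ 2 ^ B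

  Fits : Memory → Set
  Fits m = All Small m × length m ≤ G

  unit : ℕ
  unit = 6 * suc B

  len-small : ∀ z → Small z → len z ≤ suc B
  len-small z small = s≤s (ℕ.≤-trans (⌊log₂⌋-mono-≤ small) (ℕ.≤-reflexive (⌊log₂[2^n]⌋≡n B)))

  64≤2^B : 64 ≤ 2 ^ B
  64≤2^B = ℕ.^-monoʳ-≤ 2 6≤B

  small-<64 : ∀ z → T (ℤ.∣ z ∣ <ᵇ 64) → Small z
  small-<64 z z<64 = ℕ.≤-trans (ℕ.<⇒≤ (ℕ.<ᵇ⇒< ℤ.∣ z ∣ 64 z<64)) 64≤2^B

  small-load : ∀ {m} → All Small m → ∀ k → Small (load m k)
  small-load []          k       = z≤n
  small-load (small ∷ _) zero    = small
  small-load (_ ∷ fits)  (suc k) = small-load fits k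

  small-store : ∀ {m z} → All Small m → Small z → ∀ k → All Small (store m k z)
  small-store []         sz zero    = sz ∷ []
  small-store []         sz (suc k) = z≤n ∷ small-store [] sz k
  small-store (_ ∷ fits) sz zero    = sz ∷ fits
  small-store (s ∷ fits) sz (suc k) = s ∷ small-store fits sz k

  length-store : ∀ m k z → length m ≤ G → k < G → length (store m k z) ≤ G
  length-store m k z m≤G k<G = ℕ.≤-trans (bound m k) (ℕ.⊔-lub m≤G k<G)
    where
    bound : ∀ m k → length (store m k z) ≤ length m ⊔ suc k
    bound []      zero    = s≤s z≤n
    bound (_ ∷ m) zero    = s≤s (ℕ.m≤m⊔n (length m) 0)
    bound []      (suc k) = s≤s (bound [] k)
    bound (_ ∷ m) (suc k) = s≤s (bound m k)

  fits-store : ∀ {m z} k → Fits m → Small z → k < G → Fits (store m k z)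
  fits-store {m} {z} k (fits , m≤G) sz k<G = small-store fits sz k , length-store m k z m≤G k<G

  size-fits : ∀ {m} → Fits m → size m ≤ G * suc B
  size-fits (fits , m≤G) = ℕ.≤-trans (go fits) (ℕ.*-monoˡ-≤ (suc B) m≤G)
    where
    go : ∀ {m} → All Small m → size m ≤ length m * suc B
    go []                 = z≤n
    go (_∷_ {x} s fits) = ℕ.+-mono-≤ (len-small x s) (go fits)

  operandOk : Operand → Bool
  operandOk (lit z)       = ℤ.∣ z ∣ <ᵇ 64
  operandOk (reg (at k))  = k <ᵇ 48
  operandOk (reg (via _)) = false
  operandOk inputN        = true
  operandOk inputD        = true

  small-at : ∀ k → T (k <ᵇ 48) → len (+ k) ≤ suc B
  small-at k k<48 = len-small (+ k) (small-<64 (+ k) (ℕ.<⇒<ᵇ (ℕ.<-≤-trans (ℕ.<ᵇ⇒< k 48 k<48) (ℕ.m≤m+n 48 16))))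

  cost-operand : ∀ {m} → Fits m → ∀ a → T (operandOk a) → operandCost m a ≤ 2 * suc B
  cost-operand fits (lit z)      ok = ℕ.≤-trans (len-small z (small-<64 z ok)) (ℕ.m≤m+n _ _)
  cost-operand {m} fits (reg (at k)) ok = ℕ.+-mono-≤ (small-at k ok)
    (ℕ.≤-trans (len-small (load m k) (small-load (proj₁ fits) k)) (ℕ.m≤m+n _ _))
  cost-operand fits inputN       ok = ℕ.≤-trans (len-small (+ n) n≤2^B) (ℕ.m≤m+n _ _)
  cost-operand fits inputD       ok = ℕ.≤-trans (len-small (+ d) d≤2^B) (ℕ.m≤m+n _ _)

  record Term (P : Program) (m : Memory) (ω : List Bool) (T : ℕ) (Post : Memory → List Bool → Set) : Set where
    constructor mkTerm
    field
      halts : Fits m → ∃ λ m′ → ∃ λ ω′ → ∃ λ t → ∃ λ s →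
        Run P m ω m′ ω′ t s × t ≤ T * unit × s ≤ G * suc B × Fits m′ × Post m′ ω′

  open Term public

  weaken : ∀ {P m ω T T′ Post} → T ≤ T′ → Term P m ω T Post → Term P m ω T′ Post
  weaken T≤T′ (mkTerm h) = mkTerm λ fits → let m′ , ω′ , t , s , run , t≤ , rest = h fits in
    m′ , ω′ , t , s , run , ℕ.≤-trans t≤ (ℕ.*-monoˡ-≤ unit T≤T′) , rest

  mapPost : ∀ {P m ω T Post Post′} → (∀ m′ ω′ → Post m′ ω′ → Post′ m′ ω′) → Term P m ω T Post → Term P m ω T Post′
  mapPost f (mkTerm h) = mkTerm λ fits → let m′ , ω′ , t , s , run , t≤ , s≤ , fits′ , post = h fits in
    m′ , ω′ , t , s , run , t≤ , s≤ , fits′ , f m′ ω′ post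

  infixr 5 _▸_
  _▸_ : ∀ {P Q m ω T T′ Mid Post} → Term P m ω T Mid → (∀ {m′ ω′} → Mid m′ ω′ → Term Q m′ ω′ T′ Post) →
        Term (P ⨾ Q) m ω (T + T′) Post
  _▸_ {T = T} {T′} (mkTerm h) k = mkTerm λ fits →
    let m₁ , ω₁ , t₁ , s₁ , run₁ , t₁≤ , s₁≤ , fits₁ , mid = h fits
        m₂ , ω₂ , t₂ , s₂ , run₂ , t₂≤ , s₂≤ , fits₂ , post = halts (k mid) fits₁
    in m₂ , ω₂ , _ , _ , run-⨾ run₁ run₂
       , ℕ.≤-trans (ℕ.+-mono-≤ t₁≤ t₂≤) (ℕ.≤-reflexive (sym (ℕ.*-distribʳ-+ unit T T′)))
       , ℕ.⊔-lub s₁≤ s₂≤ , fits₂ , post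

  finish : ∀ {m ω Post} → Post m ω → Term skip m ω 1 Post
  finish post = mkTerm λ fits → _ , _ , _ , _ , run-skip , s≤s z≤n , size-fits fits , fits , post

  private
    1≤suc-B : 1 ≤ suc B
    1≤suc-B = s≤s z≤n

    ≤1*unit : ∀ {t} k → k ≤ 6 → t ≤ k * suc B → t ≤ 1 * unit
    ≤1*unit k k≤6 t≤ = ℕ.≤-trans t≤ (ℕ.≤-trans (ℕ.*-monoˡ-≤ (suc B) k≤6) (ℕ.≤-reflexive (sym (ℕ.*-identityˡ unit))))

    sum₃ : ∀ {a b c} → a ≤ 2 * suc B → b ≤ 2 * suc B → c ≤ 2 * suc B → a + b + c ≤ 6 * suc B
    sum₃ p q r = ℕ.≤-trans (ℕ.+-mono-≤ (ℕ.+-mono-≤ p q) r) (ℕ.≤-reflexive (identity (suc B)))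
      where
      identity : ∀ x → 2 * x + 2 * x + 2 * x ≡ 6 * x
      identity = ℕRing.solve-∀

    cost-test : ∀ {m} → Fits m → ∀ a b → T (operandOk a ∧ operandOk b) → testCost m a b ≤ 1 * unit
    cost-test {m} fits a b ok with operandOk a in eqa | operandOk b in eqb
    ... | true | true = ≤1*unit 6 ℕ.≤-refl (ℕ.≤-trans (ℕ.m≤m+n _ 0) (sum₃ {c = 0} (cost-operand fits a (subst T (sym eqa) _))
                                                          (cost-operand fits b (subst T (sym eqb) _)) z≤n))

    ∧-split : ∀ {a b} → T (a ∧ b) → T a × T b
    ∧-split {true} {true} _ = _ , _

    at<G : ∀ k → T (k <ᵇ 48) → k < G
    at<G k ok = ℕ.<-≤-trans (ℕ.<ᵇ⇒< k 48 ok) 48≤G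

  compute! : ∀ {k o a b m ω} z → arith o (read m a) (read m b) ≡ z → Small z →
             {T ((k <ᵇ 48) ∧ (operandOk a ∧ operandOk b))} →
             Term (compute (at k) o a b) m ω 1 (λ m′ ω′ → m′ ≡ store m k z × ω′ ≡ ω)
  compute! {k} {o} {a} {b} {m} z refl small {ok} = mkTerm λ fits →
    let okk , okab = ∧-split {k <ᵇ 48} ok
        oka , okb = ∧-split {operandOk a} okab
        fits′ = fits-store k fits small (at<G k okk)
    in _ , _ , _ , _ , run-compute
     , ≤1*unit 6 ℕ.≤-refl (sum₃ (ℕ.≤-trans (small-at k okk) (ℕ.m≤m+n _ _)) (cost-operand fits a oka) (cost-operand fits b okb))
     , ℕ.⊔-lub (size-fits fits) (size-fits fits′) , fits′ , refl , refl

  compute-via! : ∀ {k o a b m ω} j z → ℤ.∣ load m k ∣ ≡ j → j < G →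
                 arith o (read m a) (read m b) ≡ z → Small z →
                 {T ((k <ᵇ 48) ∧ (operandOk a ∧ operandOk b))} →
                 Term (compute (via k) o a b) m ω 1 (λ m′ ω′ → m′ ≡ store m j z × ω′ ≡ ω)
  compute-via! {k} {o} {a} {b} {m} j z refl j<G refl small {ok} = mkTerm λ fits →
    let okk , okab = ∧-split {k <ᵇ 48} ok
        oka , okb = ∧-split {operandOk a} okab
        fits′ = fits-store ℤ.∣ load m k ∣ fits small j<G
    in _ , _ , _ , _ , run-compute
     , ≤1*unit 6 ℕ.≤-refl (sum₃ (ℕ.≤-trans (ℕ.+-mono-≤ (small-at k okk) (len-small (load m k) (small-load (proj₁ fits) k)))
                                  (ℕ.≤-reflexive (identity (suc B)))) (cost-operand fits a oka) (cost-operand fits b okb))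
     , ℕ.⊔-lub (size-fits fits) (size-fits fits′) , fits′ , refl , refl
    where
    identity : ∀ x → x + x ≡ 2 * x
    identity = ℕRing.solve-∀

  flip! : ∀ {k m c ω} → {T (k <ᵇ 48)} → Term (flip (at k)) m (c ∷ ω) 1 (λ m′ ω′ → m′ ≡ store m k (bit c) × ω′ ≡ ω)
  flip! {k} {m} {c} {ω} {ok} = mkTerm λ fits →
    let fits′ = fits-store k fits (small-bit c) (at<G k ok)
    in _ , _ , _ , _ , run-flip
     , ≤1*unit 6 ℕ.≤-refl (ℕ.≤-trans (small-at k ok) (ℕ.m≤m+n _ _))
     , ℕ.⊔-lub (size-fits fits) (size-fits fits′) , fits′ , refl , refl
    where
    small-bit : ∀ c → Small (bit c)
    small-bit true  = small-<64 1ℤ _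
    small-bit false = z≤n

  query! : ∀ {j k b m ω} r → answerAt m b ≡ r → Small (numerator r) → Small (denominator r) →
           {T ((j <ᵇ 48) ∧ (k <ᵇ 48))} →
           Term (query (at j) (at k) b) m ω 1
                (λ m′ ω′ → m′ ≡ store (store m j (numerator r)) k (denominator r) × ω′ ≡ ω)
  query! {j} {k} {b} {m} r refl sn sd {ok} = mkTerm λ fits →
    let okj , okk = ∧-split {j <ᵇ 48} ok
        fits′ = fits-store k (fits-store j fits sn (at<G j okj)) sd (at<G k okk)
    in _ , _ , _ , _ , run-query , s≤s z≤n
     , ℕ.⊔-lub (size-fits fits) (size-fits fits′) , fits′ , refl , refl

  approxε! : ∀ {j a m ω} p → ℤ.∣ read m a ∣ ≡ p → p ≤ B → Small (ε̂ p) →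
             {T ((j <ᵇ 48) ∧ operandOk a)} →
             Term (approxε (at j) a) m ω 1 (λ m′ ω′ → m′ ≡ store m j (ε̂ p) × ω′ ≡ ω)
  approxε! {j} {a} {m} p refl p≤B small {ok} = mkTerm λ fits →
    let okj , oka = ∧-split {j <ᵇ 48} ok
        fits′ = fits-store j fits small (at<G j okj)
    in _ , _ , _ , _ , run-approxε
     , ≤1*unit 6 ℕ.≤-refl (sum₃ (ℕ.≤-trans (small-at j okj) (ℕ.m≤m+n _ _)) (cost-operand fits a oka)
         (ℕ.≤-trans p≤B (ℕ.≤-trans (ℕ.n≤1+n B) (ℕ.m≤m+n _ _))))
     , ℕ.⊔-lub (size-fits fits) (size-fits fits′) , fits′ , refl , refl

  branch! : ∀ {a c b P Q m ω T Post} t → compare c (read m a) (read m b) ≡ t →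
            (t ≡ true → Term P m ω T Post) → (t ≡ false → Term Q m ω T Post) →
            {ok : Bool.T (operandOk a ∧ operandOk b)} → Term (ifte a c b P Q) m ω (suc T) Post
  branch! {a} {c} {b} {T = T} true holds onTrue _ {ok} = mkTerm λ fits →
    let m′ , ω′ , t , s , run , t≤ , rest = halts (onTrue refl) fits
    in m′ , ω′ , _ , s , run-then holds run
     , ℕ.≤-trans (ℕ.+-mono-≤ (cost-test fits a b ok) t≤) (ℕ.≤-reflexive (sym (ℕ.*-distribʳ-+ unit 1 T))) , rest
  branch! {a} {c} {b} {T = T} false holds _ onFalse {ok} = mkTerm λ fits →
    let m′ , ω′ , t , s , run , t≤ , rest = halts (onFalse refl) fits
    in m′ , ω′ , _ , s , run-else holds run
     , ℕ.≤-trans (ℕ.+-mono-≤ (cost-test fits a b ok) t≤) (ℕ.≤-reflexive (sym (ℕ.*-distribʳ-+ unit 1 T))) , rest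

  total : ℕ → (ℕ → ℕ) → ℕ
  total zero    T = 1
  total (suc N) T = suc (T 0) + total N (T ∘ suc)

  while! : ∀ {a c b P} (N : ℕ) (T : ℕ → ℕ) (I : ℕ → Memory → List Bool → Set) →
           (∀ i m ω → i < N → I i m ω →
              compare c (read m a) (read m b) ≡ true × Term P m ω (T i) (I (suc i))) →
           (∀ m ω → I N m ω → compare c (read m a) (read m b) ≡ false) →
           ∀ {m ω} → I 0 m ω → {ok : Bool.T (operandOk a ∧ operandOk b)} →
           Term (while a c b P) m ω (total N T) (I N)
  while! {a} {c} {b} zero T I body exit {m} {ω} inv {ok} = mkTerm λ fits →
    m , ω , _ , _ , run-done (exit m ω inv) , cost-test fits a b ok , size-fits fits , fits , inv
  while! {a} {c} {b} (suc N) T I body exit {m} {ω} inv {ok} = mkTerm λ fits →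
    let guard , term = body 0 m ω z<s inv
        m₁ , ω₁ , t₁ , s₁ , run₁ , t₁≤ , s₁≤ , fits₁ , inv₁ = halts term fits
        m₂ , ω₂ , t₂ , s₂ , run₂ , t₂≤ , s₂≤ , rest =
          halts (while! N (T ∘ suc) (I ∘ suc) (λ i m ω i<N → body (suc i) m ω (s<s i<N)) exit inv₁ {ok}) fits₁
    in m₂ , ω₂ , _ , _ , run-loop guard run₁ run₂
     , ℕ.≤-trans (ℕ.+-mono-≤ (ℕ.+-mono-≤ (cost-test fits a b ok) t₁≤) t₂≤)
         (ℕ.≤-reflexive (identity unit (T 0) (total N (T ∘ suc))))
     , ℕ.⊔-lub s₁≤ s₂≤ , rest
    where
    identity : ∀ u x y → 1 * u + x * u + y * u ≡ (suc x + y) * u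
    identity = ℕRing.solve-∀

  while-done : ∀ {a c b P m ω Post} → compare c (read m a) (read m b) ≡ false → Post m ω →
               {ok : Bool.T (operandOk a ∧ operandOk b)} → Term (while a c b P) m ω 1 Post
  while-done {a} {c} {b} {m = m} {ω} done post {ok} = mkTerm λ fits →
    m , ω , _ , _ , run-done done , cost-test fits a b ok , size-fits fits , fits , post

  while-step : ∀ {a c b P m ω T T′ Mid Post} → compare c (read m a) (read m b) ≡ true →
               Term P m ω T Mid → (∀ {m′ ω′} → Mid m′ ω′ → Term (while a c b P) m′ ω′ T′ Post) →
               {ok : Bool.T (operandOk a ∧ operandOk b)} → Term (while a c b P) m ω (suc T + T′) Post
  while-step {a} {c} {b} {T = T} {T′} guard body next {ok} = mkTerm λ fits →
    let m₁ , ω₁ , t₁ , s₁ , run₁ , t₁≤ , s₁≤ , fits₁ , mid = halts body fits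
        m₂ , ω₂ , t₂ , s₂ , run₂ , t₂≤ , s₂≤ , rest = halts (next mid) fits₁
    in m₂ , ω₂ , _ , _ , run-loop guard run₁ run₂
     , ℕ.≤-trans (ℕ.+-mono-≤ (ℕ.+-mono-≤ (cost-test fits a b ok) t₁≤) t₂≤)
         (ℕ.≤-reflexive (identity unit T T′))
     , ℕ.⊔-lub s₁≤ s₂≤ , rest
    where
    identity : ∀ u x y → 1 * u + x * u + y * u ≡ (suc x + y) * u
    identity = ℕRing.solve-∀

ρ : ℕ → Operand
ρ k = reg (at k)

-- Register usage: 0 scratch, 1 binom c r, 2 r, 3 remaining index, 4 c,
-- 5 the sign found so far, 6 the colour looked up.
unrank : Program
unrank = while (lit 0ℤ) lt (ρ 4)
  (compute (at 0) sub (ρ 4) (ρ 2) ⨾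
   compute (at 0) mul (ρ 0) (ρ 1) ⨾
   compute (at 0) div (ρ 0) (ρ 4) ⨾
   compute (at 4) sub (ρ 4) (lit 1ℤ) ⨾
   ifte (ρ 3) lt (ρ 0)
     (compute (at 1) add (ρ 0) (lit 0ℤ) ⨾ skip)
     (compute (at 3) sub (ρ 3) (ρ 0) ⨾
      compute (at 1) sub (ρ 1) (ρ 0) ⨾
      compute (at 2) sub (ρ 2) (lit 1ℤ) ⨾
      ifte (ρ 4) eq (ρ 6) (compute (at 5) sub (lit 0ℤ) (ρ 5) ⨾ skip) skip))

module UnrankRun (n d : ℕ) (F : Vec ℤ n → Maybe ℚ) (ε̂ : ℕ → ℤ)
               (B G : ℕ) (6≤B : 6 ≤ B) (48≤G : 48 ≤ G) (n≤2^B : n ≤ 2 ^ B) (d≤2^B : d ≤ 2 ^ B)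
               (K : ℕ) (K*2^K≤ : K * 2 ^ K ≤ 2 ^ B) where
  open Machine n d F ε̂ B G 6≤B 48≤G n≤2^B d≤2^B

  private
    inner : (t b r id c x c₀ : ℤ) → Memory → Memory
    inner t b r id c x c₀ rest = t ∷ b ∷ r ∷ id ∷ c ∷ x ∷ c₀ ∷ rest

  record Unranked (x c₀ : ℤ) (rest : Memory) (ω : List Bool) (m : Memory) (ω′ : List Bool) : Set where
    constructor unranked
    field
      {t b r index c′} : ℤ
      shape  : m ≡ inner t b r index c′ x c₀ rest
      unread : ω′ ≡ ω

  small-≤ : ∀ {c x} → c ≤ K → x ≤ c * 2 ^ c → Small (+ x)
  small-≤ c≤K x≤ = ℕ.≤-trans x≤ (ℕ.≤-trans (ℕ.*-mono-≤ c≤K (ℕ.^-monoʳ-≤ 2 c≤K)) K*2^K≤)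

  small-value± : ∀ s → Small (value± s)
  small-value± Sign.+ = small-<64 1ℤ _
  small-value± Sign.- = small-<64 -1ℤ _

  unrank-correct : ∀ c r idx c₀ s {t rest ω} → c ≤ K → idx < binom c r →
    Term unrank (inner t (+ binom c r) (+ r) (+ idx) (+ c) (value± s) (+ c₀) rest) ω (c * 12 + 1)
         (Unranked (value± (s Sign.* signAt c r idx c₀)) (+ c₀) rest ω)
  unrank-correct zero r idx c₀ s {t} _ _ =
    while-done refl (unranked (cong (λ x → inner t (+ binom 0 r) (+ r) (+ idx) (+ 0) (value± x) _ _) (sym (Sign.*-identityʳ s))) refl)
  unrank-correct (suc c) r idx c₀ s {rest = rest} {ω} c<K idx< =
    weaken (ℕ.≤-reflexive (cost c)) (while-step (compare-lt-true {0} {suc c} z<s) body next)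
    where
    open ℕ.≤-Reasoning
    cost : ∀ c → suc 11 + (c * 12 + 1) ≡ suc c * 12 + 1
    cost = ℕRing.solve-∀

    r≤ : r ≤ suc c
    r≤ = binom-support (suc c) r idx<

    lower : (suc c ∸ r) * binom (suc c) r ≡ suc c * binom c r
    lower = binom-lower c r (ℕ.m+[n∸m]≡n r≤)

    c≤K : c ≤ K
    c≤K = ℕ.≤-trans (ℕ.n≤1+n c) c<K

    binom-≤′ : ∀ k → binom c k ≤ suc c * 2 ^ suc c
    binom-≤′ k = ℕ.≤-trans (binom-≤ c k) (ℕ.≤-trans (ℕ.^-monoʳ-≤ 2 (ℕ.n≤1+n c)) (ℕ.m≤n*m _ (suc c)))

    small-id : Small (+ idx)
    small-id = small-≤ c<K (ℕ.≤-trans (ℕ.<⇒≤ idx<) (ℕ.≤-trans (binom-≤ (suc c) r) (ℕ.m≤n*m _ (suc c))))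

    Mid : Memory → List Bool → Set
    Mid m ω′ = ∃ λ r′ → ∃ λ idx′ → ∃ λ s′ → ∃ λ t′ → m ≡ inner t′ (+ binom c r′) (+ r′) (+ idx′) (+ c) (value± s′) (+ c₀) rest × ω′ ≡ ω
                 × idx′ < binom c r′ × s′ Sign.* signAt c r′ idx′ c₀ ≡ s Sign.* signAt (suc c) r idx c₀

    next : ∀ {m ω′} → Mid m ω′ → Term unrank m ω′ (c * 12 + 1) (Unranked (value± (s Sign.* signAt (suc c) r idx c₀)) (+ c₀) rest ω)
    next (r′ , idx′ , s′ , t′ , refl , refl , idx′< , same) =
      mapPost (λ { m ω (unranked shape unread) → unranked (trans shape (cong (λ x → inner _ _ _ _ _ (value± x) _ _) same)) unread })
        (unrank-correct c r′ idx′ c₀ s′ c≤K idx′<)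

    avoid : (idx <ᵇ binom c r) ≡ true → signAt (suc c) r idx c₀ ≡ signAt c r idx c₀
    avoid e rewrite e = refl

    take : (idx <ᵇ binom c r) ≡ false → signAt (suc c) r idx c₀ ≡
           (if c ≡ᵇ c₀ then Sign.- else Sign.+) Sign.* signAt c (r ∸ 1) (idx ∸ binom c r) c₀
    take e rewrite e = refl

    small-c∸r : Small (+ (suc c ∸ r))
    small-c∸r = small-≤ c<K (ℕ.≤-trans (ℕ.m∸n≤m (suc c) r) (ℕ.m≤m*n (suc c) (2 ^ suc c) {{ℕ.m^n≢0 2 (suc c)}}))

    small-c : Small (+ c)
    small-c = small-≤ c<K (ℕ.≤-trans (ℕ.n≤1+n c) (ℕ.m≤m*n (suc c) (2 ^ suc c) {{ℕ.m^n≢0 2 (suc c)}}))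

    body = compute! (+ (suc c ∸ r)) (sub-pos r≤) small-c∸r ▸ λ { (refl , refl) →
      compute! (+ (suc c * binom c r)) (trans (mul-pos (suc c ∸ r) (binom (suc c) r)) (cong +_ lower))
        (small-≤ c<K (ℕ.*-monoʳ-≤ (suc c) (ℕ.≤-trans (binom-≤ c r) (ℕ.^-monoʳ-≤ 2 (ℕ.n≤1+n c))))) ▸ λ { (refl , refl) →
      compute! (+ binom c r) (quotient-exact _ (suc c) (binom c r) (ℕ.*-comm (binom c r) (suc c))) (small-≤ c<K (binom-≤′ r)) ▸ λ { (refl , refl) →
      compute! (+ c) (sub-pos {suc c} {1} (s≤s z≤n)) small-c ▸ λ { (refl , refl) →
      branch! {Post = Mid} (idx <ᵇ binom c r) (compare-lt idx (binom c r))
        (λ below → weaken {T′ = 6} (s≤s (s≤s z≤n)) (compute! (+ binom c r) (cong +_ (ℕ.+-identityʳ _)) (small-≤ c<K (binom-≤′ r)) ▸ λ { (refl , refl) →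
           finish (r , idx , s , _ , refl , refl , <ᵇ-true⁻¹ below , cong (s Sign.*_) (sym (avoid below))) }))
        (λ above → taken r refl above (<ᵇ-false⁻¹ above)) } } } }
      where
      taken : ∀ r₀ → r ≡ r₀ → (idx <ᵇ binom c r) ≡ false → binom c r ≤ idx →
              Term _ (inner (+ binom c r) (+ binom (suc c) r) (+ r) (+ idx) (+ c) (value± s) (+ c₀) rest) ω 6 Mid
      taken zero     refl above above≤ = contradiction (ℕ.<-≤-trans idx< above≤) (ℕ.<-irrefl refl)
      taken (suc r′) refl above above≤ =
        compute! (+ idx′) (sub-pos above≤) (small-≤ c<K (ℕ.≤-trans (ℕ.<⇒≤ idx′<) (binom-≤′ r′))) ▸ λ { (refl , refl) →
        compute! (+ binom c r′) (sub-pos-+ (binom c (suc r′)) (binom c r′) (ℕ.+-comm (binom c (suc r′)) (binom c r′))) (small-≤ c<K (binom-≤′ r′)) ▸ λ { (refl , refl) →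
        compute! (+ r′) (sub-pos {suc r′} {1} (s≤s z≤n)) (small-≤ c<K (ℕ.≤-trans (ℕ.n≤1+n r′) (ℕ.≤-trans r≤ (ℕ.m≤m*n (suc c) (2 ^ suc c) {{ℕ.m^n≢0 2 (suc c)}})))) ▸ λ { (refl , refl) →
        branch! {Post = Mid} (c ≡ᵇ c₀) (compare-eq c c₀)
          (λ hit → compute! (value± (Sign.- Sign.* s)) (negate s) (small-value± (Sign.- Sign.* s)) ▸ λ { (refl , refl) →
             finish (r′ , idx′ , Sign.- Sign.* s , _ , refl , refl , idx′< , same Sign.- (cong (λ b → if b then Sign.- else Sign.+) hit)) })
          (λ miss → weaken (s≤s z≤n) (finish (r′ , idx′ , s , _ , refl , refl , idx′< , same Sign.+ (cong (λ b → if b then Sign.- else Sign.+) miss)))) } } }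
        where
        idx′ = idx ∸ binom c (suc r′)

        idx′< : idx′ < binom c r′
        idx′< = ℕ.+-cancelʳ-< (binom c (suc r′)) idx′ (binom c r′) (subst (_< binom c r′ + binom c (suc r′)) (sym (ℕ.m∸n+n≡m above≤)) idx<)

        negate : ∀ s → 0ℤ ℤ.- value± s ≡ value± (Sign.- Sign.* s)
        negate Sign.+ = refl
        negate Sign.- = refl

        same : ∀ σ → (if c ≡ᵇ c₀ then Sign.- else Sign.+) ≡ σ →
               (σ Sign.* s) Sign.* signAt c r′ idx′ c₀ ≡ s Sign.* signAt (suc c) (suc r′) idx c₀
        same σ refl = trans (cong (Sign._* signAt c r′ idx′ c₀) (Sign.*-comm σ s))
          (trans (Sign.*-assoc s σ (signAt c r′ idx′ c₀)) (cong (s Sign.*_) (sym (take above))))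

-- Further registers: 7 X / Rⁱ, 8 weight, 9 i, 10 address, 11/12 query answer,
-- 13 scratch, 14 index of the subset, 15 its size j, 16 binom K j, 17/18 weight
-- and sign for j, 19 X, 20 sample number, 21/22 accumulated sum, and from 23 on
-- the constants K, m, n′, R, u, e, number of coins, initial weight, N; the
-- query point starts at register 40.
placeSign : Program
placeSign =
  compute (at 12) div (ρ 7) (ρ 26) ⨾
  compute (at 6) mul (ρ 12) (ρ 26) ⨾
  compute (at 6) sub (ρ 7) (ρ 6) ⨾
  compute (at 6) div (ρ 6) (ρ 27) ⨾
  compute (at 7) add (lit 0ℤ) (ρ 12) ⨾
  compute (at 5) add (lit 0ℤ) (lit 1ℤ) ⨾
  compute (at 1) add (lit 0ℤ) (ρ 16) ⨾
  compute (at 2) add (lit 0ℤ) (ρ 15) ⨾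
  compute (at 3) add (lit 0ℤ) (ρ 14) ⨾
  compute (at 4) add (lit 0ℤ) (ρ 23) ⨾
  unrank ⨾
  ifte (ρ 6) lt (ρ 23) skip (compute (at 8) add (lit 0ℤ) (lit 0ℤ) ⨾ skip) ⨾
  compute (at 10) add (lit (+ 40)) (ρ 9) ⨾
  compute (via 10) add (lit 0ℤ) (ρ 5) ⨾
  ifte (ρ 9) lt inputN skip (compute (at 8) mul (ρ 8) (ρ 5) ⨾ skip) ⨾
  compute (at 9) add (lit 1ℤ) (ρ 9) ⨾ skip

accumulate : Program
accumulate =
  ifte (ρ 22) lt (ρ 12)
    (compute (at 13) div (ρ 12) (ρ 22) ⨾ compute (at 21) mul (ρ 21) (ρ 13) ⨾ compute (at 22) add (lit 0ℤ) (ρ 12) ⨾ skip)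
    skip ⨾
  compute (at 13) div (ρ 22) (ρ 12) ⨾
  compute (at 13) mul (ρ 13) (ρ 11) ⨾
  compute (at 13) mul (ρ 13) (ρ 8) ⨾
  compute (at 21) add (ρ 21) (ρ 13) ⨾ skip

evaluate : Program
evaluate =
  compute (at 7) add (lit 0ℤ) (ρ 19) ⨾
  compute (at 8) mul (ρ 17) (ρ 18) ⨾
  compute (at 9) add (lit 0ℤ) (lit 0ℤ) ⨾
  while (ρ 9) lt (ρ 25) placeSign ⨾
  query (at 11) (at 12) (lit (+ 40)) ⨾
  accumulate

load-store : ∀ m k z → load (store m k z) k ≡ z
load-store []      zero    z = refl
load-store []      (suc k) z = load-store [] k z
load-store (_ ∷ m) zero    z = refl
load-store (_ ∷ m) (suc k) z = load-store m k z

load-store-≢ : ∀ m k z {l} → l ≢ k → load (store m k z) l ≡ load m l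
load-store-≢ []      zero    z {zero}  l≢k = contradiction refl l≢k
load-store-≢ []      zero    z {suc l} l≢k = refl
load-store-≢ []      (suc k) z {zero}  l≢k = refl
load-store-≢ []      (suc k) z {suc l} l≢k = load-store-≢ [] k z (l≢k ∘ cong suc)
load-store-≢ (_ ∷ m) zero    z {zero}  l≢k = contradiction refl l≢k
load-store-≢ (_ ∷ m) zero    z {suc l} l≢k = refl
load-store-≢ (_ ∷ m) (suc k) z {zero}  l≢k = refl
load-store-≢ (_ ∷ m) (suc k) z {suc l} l≢k = load-store-≢ m k z (l≢k ∘ cong suc)

record Outer : Set where
  constructor outer
  field
    idx j C w sg X τ P Q : ℤ

module EvaluateRun (n d : ℕ) (F : Vec ℤ n → Maybe ℚ) (ε̂ : ℕ → ℤ)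
               (B G : ℕ) (6≤B : 6 ≤ B) (48≤G : 48 ≤ G) (n≤2^B : n ≤ 2 ^ B) (d≤2^B : d ≤ 2 ^ B)
               (K : ℕ) (K*2^K≤ : K * 2 ^ K ≤ 2 ^ B)
               (m n′ R u : ℕ) .{{_ : NonZero R}} .{{_ : NonZero u}} (c₂₈ c₂₉ c₃₀ c₃₁ : ℤ) (others : Vec ℤ 8)
               (40+n′≤G : 40 + n′ ≤ G) (n′≤2^B : 40 + n′ ≤ 2 ^ B) (n≤n′ : n ≤ n′) where
  open Machine n d F ε̂ B G 6≤B 48≤G n≤2^B d≤2^B
  open UnrankRun n d F ε̂ B G 6≤B 48≤G n≤2^B d≤2^B K K*2^K≤

  constants : Memory → Memory
  constants arr = + K ∷ + m ∷ + n′ ∷ + R ∷ + u ∷ c₂₈ ∷ c₂₉ ∷ c₃₀ ∷ c₃₁ ∷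
    v zero ∷ v (suc zero) ∷ v (suc (suc zero)) ∷ v (suc (suc (suc zero))) ∷ v (suc (suc (suc (suc zero)))) ∷
    v (suc (suc (suc (suc (suc zero))))) ∷ v (suc (suc (suc (suc (suc (suc zero)))))) ∷
    v (suc (suc (suc (suc (suc (suc (suc zero))))))) ∷ arr
    where v = Vec.lookup others

  outers : Outer → Memory → Memory
  outers (outer idx j C w sg X τ P Q) rest = idx ∷ j ∷ C ∷ w ∷ sg ∷ X ∷ τ ∷ P ∷ Q ∷ rest

  record Scratch : Set where
    constructor scratch
    field
      t b r index c x c₀ y wt i ad p q tmp : ℤ

  mem : Scratch → Outer → Memory → Memory
  mem (scratch t b r index c x c₀ y wt i ad p q tmp) o arr =
    t ∷ b ∷ r ∷ index ∷ c ∷ x ∷ c₀ ∷ y ∷ wt ∷ i ∷ ad ∷ p ∷ q ∷ tmp ∷ outers o (constants arr)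

  module _ (X j idx w : ℕ) (σ : Sign) (τ P Q : ℤ) where

    here : Outer
    here = outer (+ idx) (+ j) (+ binom K j) (+ w) (value± σ) (+ X) τ P Q

    open Weights n K R u X j idx w σ public

    record Placed (ω : List Bool) (i : ℕ) (m : Memory) (ω′ : List Bool) : Set where
      constructor placed
      field
        {t b r index c x c₀ ad p q tmp} : ℤ
        {arr}  : Memory
        shape  : m ≡ mem (scratch t b r index c x c₀ (+ shift R X i) (weight i) (+ i) ad p q tmp) here arr
        unread : ω′ ≡ ω
        signs  : ∀ k → k < i → load arr k ≡ value± (signOf k)

    module _ (smallX : Small (+ X)) (smallw : Small (+ w)) (idx< : idx < binom K j) (j≤K : j ≤ K) where

      shift-≤ : ∀ i → shift R X i ≤ X
      shift-≤ zero    = ℕ.≤-refl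
      shift-≤ (suc i) = ℕ.≤-trans (ℕ.m/n≤m (shift R X i) R) (shift-≤ i)

      small-≤K : ∀ {x} → x ≤ K → Small (+ x)
      small-≤K x≤K = small-≤ ℕ.≤-refl (ℕ.≤-trans x≤K (ℕ.m≤m*n K (2 ^ K) {{ℕ.m^n≢0 2 K}}))

      small-binom : Small (+ binom K j)
      small-binom = ℕ.≤-trans (binom-≤ K j) (bound K K*2^K≤)
        where
        bound : ∀ k → k * 2 ^ k ≤ 2 ^ B → 2 ^ k ≤ 2 ^ B
        bound zero    _ = ℕ.m^n>0 2 B
        bound (suc k) p = ℕ.≤-trans (ℕ.m≤n*m (2 ^ suc k) (suc k)) p

      small-weight : ∀ i → Small (weight i)
      small-weight i = ℕ.≤-trans (∣weight∣≤ i) smallw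

      placeSign-correct : ∀ ω i m ω′ → i < n′ → Placed ω i m ω′ → Term placeSign m ω′ (K * 12 + 21) (Placed ω (suc i))
      placeSign-correct ω i m ω′ i<n′ (placed {ad = ad} {p = p} {tmp = tmp} {arr = arr} refl refl signs) =
        weaken (ℕ.≤-reflexive (cost (K * 12))) (
        compute! (+ (Y / R)) (quotient-pos Y R) (small-Y (ℕ.m/n≤m Y R)) ▸ λ { (refl , refl) →
        compute! (+ (Y / R * R)) (mul-pos (Y / R) R) (small-Y (ℕ.m/n*n≤m Y R)) ▸ λ { (refl , refl) →
        compute! (+ (Y % R)) (trans (sub-pos (ℕ.m/n*n≤m Y R)) (cong +_ (sym (ℕ.m%n≡m∸m/n*n Y R)))) (small-Y (ℕ.m%n≤m Y R)) ▸ λ { (refl , refl) →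
        compute! (+ c₀) (quotient-pos (Y % R) u) (small-Y (ℕ.≤-trans (ℕ.m/n≤m (Y % R) u) (ℕ.m%n≤m Y R))) ▸ λ { (refl , refl) →
        compute! (+ (Y / R)) refl (small-Y (ℕ.m/n≤m Y R)) ▸ λ { (refl , refl) →
        compute! 1ℤ refl (small-<64 1ℤ _) ▸ λ { (refl , refl) →
        compute! (+ binom K j) refl small-binom ▸ λ { (refl , refl) →
        compute! (+ j) refl (small-≤K j≤K) ▸ λ { (refl , refl) →
        compute! (+ idx) refl (ℕ.≤-trans (ℕ.<⇒≤ idx<) small-binom) ▸ λ { (refl , refl) →
        compute! (+ K) refl (small-≤K ℕ.≤-refl) ▸ λ { (refl , refl) →
        unrank-correct K j idx c₀ Sign.+ ℕ.≤-refl idx< ▸ λ { (unranked refl refl) →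
        branch! {Post = After₁} (c₀ <ᵇ K) (compare-lt c₀ K)
          (λ accept → weaken (s≤s z≤n) (finish (after₁ (accepted accept))))
          (λ reject → compute! 0ℤ refl z≤n ▸ λ { (refl , refl) →
             finish (after₁ (rejected reject)) }) ▸ λ { (_ , _ , _ , _ , _ , refl , refl) →
        compute! (+ (40 + i)) refl (ℕ.≤-trans (ℕ.+-monoʳ-≤ 40 (ℕ.<⇒≤ i<n′)) n′≤2^B) ▸ λ { (refl , refl) →
        compute-via! (40 + i) (value± s) refl (ℕ.<-≤-trans (ℕ.+-monoʳ-< 40 i<n′) 40+n′≤G) (ℤ.+-identityˡ (value± s)) (small-value± s) ▸ λ { (refl , refl) →
        branch! {Post = After₂} (i <ᵇ n) (compare-lt i n)
          (λ real  → weaken (s≤s z≤n) (finish (after₂ (unweighted real))))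
          (λ dummy → compute! (weight i ℤ.* g ℤ.* value± s) refl (subst Small (sym (weighted dummy)) (small-weight (suc i))) ▸ λ { (refl , refl) →
             finish (after₂ (weighted dummy)) }) ▸ λ { (_ , _ , _ , _ , _ , refl , refl) →
        compute! (+ suc i) refl (ℕ.≤-trans i<n′ (ℕ.≤-trans (ℕ.m≤n+m n′ 40) n′≤2^B)) ▸ λ { (refl , refl) →
        finish (placed refl refl signs′) } } } } } } } } } } } } } } } })
        where
        Y = shift R X i
        c₀ = colour R u X i
        s = signOf i
        arr′ = store arr i (value± s)
        g = if c₀ <ᵇ K then 1ℤ else 0ℤ

        cost : ∀ x → 10 + (x + 1 + (suc 2 + (1 + (1 + (suc 2 + (1 + 1)))))) ≡ x + 21
        cost = ℕRing.solve-∀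

        small-Y : ∀ {x} → x ≤ Y → Small (+ x)
        small-Y x≤Y = ℕ.≤-trans x≤Y (ℕ.≤-trans (shift-≤ i) smallX)

        accepted : (c₀ <ᵇ K) ≡ true → weight i ≡ weight i ℤ.* g
        accepted e rewrite e = sym (ℤ.*-identityʳ (weight i))

        rejected : (c₀ <ᵇ K) ≡ false → 0ℤ ≡ weight i ℤ.* g
        rejected e rewrite e = sym (ℤ.*-zeroʳ (weight i))

        unfold : weight (suc i) ≡ weight i ℤ.* g ℤ.* (if i <ᵇ n then 1ℤ else value± s)
        unfold = trans (sym (ℤ.*-assoc (+ w ℤ.* value± σ) (∏ i factor) (factor i))) (sym (ℤ.*-assoc (weight i) g (if i <ᵇ n then 1ℤ else value± s)))

        unweighted : (i <ᵇ n) ≡ true → weight i ℤ.* g ≡ weight (suc i)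
        unweighted e = sym (trans unfold (trans (cong (λ b → weight i ℤ.* g ℤ.* (if b then 1ℤ else value± s)) e) (ℤ.*-identityʳ _)))

        weighted : (i <ᵇ n) ≡ false → weight i ℤ.* g ℤ.* value± s ≡ weight (suc i)
        weighted e = sym (trans unfold (cong (λ b → weight i ℤ.* g ℤ.* (if b then 1ℤ else value± s)) e))

        After₁ After₂ : Memory → List Bool → Set
        After₁ m ω′ = ∃ λ t → ∃ λ b → ∃ λ r → ∃₂ λ index c → m ≡ mem (scratch t b r index c (value± s) (+ c₀) (+ (Y / R)) (weight i ℤ.* g) (+ i) ad p (+ (Y / R)) tmp) here arr × ω′ ≡ ω
        After₂ m ω′ = ∃ λ t → ∃ λ b → ∃ λ r → ∃₂ λ index c → m ≡ mem (scratch t b r index c (value± s) (+ c₀) (+ (Y / R)) (weight (suc i)) (+ i) (+ (40 + i)) p (+ (Y / R)) tmp) here arr′ × ω′ ≡ ω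

        after₁ : ∀ {t b r index c z} → z ≡ weight i ℤ.* g →
          After₁ (mem (scratch t b r index c (value± s) (+ c₀) (+ (Y / R)) z (+ i) ad p (+ (Y / R)) tmp) here arr) ω
        after₁ refl = _ , _ , _ , _ , _ , refl , refl

        after₂ : ∀ {t b r index c z} → z ≡ weight (suc i) →
          After₂ (mem (scratch t b r index c (value± s) (+ c₀) (+ (Y / R)) z (+ i) (+ (40 + i)) p (+ (Y / R)) tmp) here arr′) ω
        after₂ refl = _ , _ , _ , _ , _ , refl , refl

        signs′ : ∀ k → k < suc i → load arr′ k ≡ value± (signOf k)
        signs′ k k≤i with k ℕ.≟ i
        ... | yes refl = load-store arr i (value± s)
        ... | no  k≢i  = trans (load-store-≢ arr i (value± s) k≢i) (signs k (ℕ.≤∧≢⇒< (ℕ.≤-pred k≤i) k≢i))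

perSize : Program
perSize =
  compute (at 14) add (lit 0ℤ) (lit 0ℤ) ⨾
  while (ρ 14) lt (ρ 16) (evaluate ⨾ compute (at 14) add (lit 1ℤ) (ρ 14) ⨾ skip) ⨾
  compute (at 13) sub (ρ 23) (ρ 15) ⨾
  compute (at 16) mul (ρ 13) (ρ 16) ⨾
  compute (at 13) sub (ρ 24) (ρ 15) ⨾
  compute (at 17) mul (ρ 17) (ρ 13) ⨾
  compute (at 13) add (ρ 28) (ρ 13) ⨾
  compute (at 17) div (ρ 17) (ρ 13) ⨾
  compute (at 18) sub (lit 0ℤ) (ρ 18) ⨾
  compute (at 15) add (lit 1ℤ) (ρ 15) ⨾
  compute (at 16) div (ρ 16) (ρ 15) ⨾ skip

toss : Program
toss = flip (at 13) ⨾ compute (at 19) add (ρ 19) (ρ 19) ⨾ compute (at 19) add (ρ 19) (ρ 13) ⨾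
       compute (at 9) add (lit 1ℤ) (ρ 9) ⨾ skip

sample : Program
sample =
  compute (at 19) add (lit 0ℤ) (lit 0ℤ) ⨾
  compute (at 9) add (lit 0ℤ) (lit 0ℤ) ⨾
  while (ρ 9) lt (ρ 29) toss ⨾
  compute (at 15) add (lit 0ℤ) (lit 0ℤ) ⨾
  compute (at 16) add (lit 0ℤ) (lit 1ℤ) ⨾
  compute (at 17) add (lit 0ℤ) (ρ 30) ⨾
  compute (at 18) add (lit 0ℤ) (lit 1ℤ) ⨾
  while (ρ 15) le (ρ 24) perSize ⨾
  compute (at 20) add (lit 1ℤ) (ρ 20) ⨾ skip

∣∑∣-≤ : ∀ n f b → (∀ i → i < n → ℤ.∣ f i ∣ ≤ b) → ℤ.∣ ∑ n f ∣ ≤ n * b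
∣∑∣-≤ zero    f b f≤ = z≤n
∣∑∣-≤ (suc n) f b f≤ = ℕ.≤-trans (ℤ.∣i+j∣≤∣i∣+∣j∣ (∑ n f) (f n))
  (ℕ.≤-trans (ℕ.+-mono-≤ (∣∑∣-≤ n f b (λ i i<n → f≤ i (ℕ.m≤n⇒m≤1+n i<n))) (f≤ n ℕ.≤-refl))
             (ℕ.≤-reflexive (ℕ.+-comm (n * b) b)))

2^-+ : ∀ a b {c} → a + b ≡ c → 2 ^ a * 2 ^ b ≡ 2 ^ c
2^-+ a b refl = sym (ℕ.^-distribˡ-+-* 2 a b)

module SampleRun (n d : ℕ) (F : Vec ℤ n → Maybe ℚ) (ε̂ : ℕ → ℤ)
               (B G : ℕ) (6≤B : 6 ≤ B) (48≤G : 48 ≤ G) (n≤2^B : n ≤ 2 ^ B) (d≤2^B : d ≤ 2 ^ B)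
               (K : ℕ) (K*2^K≤ : K * 2 ^ K ≤ 2 ^ B)
               (m n′ R u : ℕ) .{{_ : NonZero R}} .{{_ : NonZero u}} (e₀ rb w₀ N : ℕ) (others : Vec ℤ 8)
               (40+n′≤G : 40 + n′ ≤ G) (n′≤2^B : 40 + n′ ≤ 2 ^ B) (n≤n′ : n ≤ n′)
               (val : Vec Sign n → ℚ) (F-val : ∀ σ → F (cubePoint σ) ≡ just (val σ))
               (s : ℕ) (pl : Vec Sign n → ℕ) (pl≤s : ∀ σ → pl σ ≤ s)
               (den : ∀ σ → ℚ.↧ₙ (val σ) ≡ 2 ^ pl σ) (num : ∀ σ → ℤ.∣ ℚ.↥ (val σ) ∣ ≤ 2 ^ s)
               (m<K : m < K) (e₀+m≤ : suc e₀ + m ≤ 2 ^ B) (w₀*m≤ : w₀ * (suc m) ≤ 2 ^ B) (rb≤B : rb < B)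
               (N≤ : N ≤ 2 ^ B)
               (cap : suc N * (suc (suc m) * (2 ^ K * (w₀ * (2 ^ s * 2 ^ s)))) ≤ 2 ^ B) where
  open Machine n d F ε̂ B G 6≤B 48≤G n≤2^B d≤2^B public
  open UnrankRun n d F ε̂ B G 6≤B 48≤G n≤2^B d≤2^B K K*2^K≤ public
  open EvaluateRun n d F ε̂ B G 6≤B 48≤G n≤2^B d≤2^B K K*2^K≤ m n′ R u (+ suc e₀) (+ rb) (+ w₀) (+ N) others
         40+n′≤G n′≤2^B n≤n′ public

  fz : Vec Sign n → ℤ
  fz σ = ℚ.↥ (val σ) ℤ.* + 2 ^ (s ∸ pl σ)

  record Sums (S P Q : ℤ) : Set where
    constructor sums
    field
      a     : ℕ
      a≤s   : a ≤ s
      Q≡    : Q ≡ + 2 ^ a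
      P≡    : P ℤ.* + 2 ^ (s ∸ a) ≡ S

  small-P : ∀ P {S Q} → Sums S P Q → Small S → Small P
  small-P P (sums a _ _ refl) small = ℕ.≤-trans (ℕ.m≤m*n ℤ.∣ P ∣ (2 ^ (s ∸ a)) {{ℕ.m^n≢0 2 (s ∸ a)}})
    (ℕ.≤-trans (ℕ.≤-reflexive (sym (ℤ.abs-* P (+ 2 ^ (s ∸ a))))) small)

  open Estimator n K m n′ R u e₀ w₀ fz public

  unitBound layerBound valueBound : ℕ
  unitBound = w₀ * (2 ^ s * 2 ^ s)
  layerBound = 2 ^ K * unitBound
  valueBound = suc (suc m) * layerBound

  ∣term∣-≤ : ∀ X j idx → ℤ.∣ term X j idx ∣ ≤ unitBound
  ∣term∣-≤ X j idx = ℕ.≤-trans (ℕ.≤-reflexive (ℤ.abs-* (wt X j idx) (fz σ)))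
    (ℕ.*-mono-≤ (ℕ.≤-trans (∣weight∣≤ X j idx (sizeWeight m e₀ w₀ j) (alternate j) 0ℤ 0ℤ 0ℤ n′) (sizeWeight-≤ m e₀ w₀ j))
      (ℕ.≤-trans (ℕ.≤-reflexive (ℤ.abs-* (ℚ.↥ (val σ)) (+ 2 ^ (s ∸ pl σ))))
        (ℕ.*-mono-≤ (num σ) (ℕ.^-monoʳ-≤ 2 (ℕ.m∸n≤m s (pl σ))))))
    where σ = point± X j idx

  ∣layer∣-≤ : ∀ X j → ℤ.∣ layer X j ∣ ≤ layerBound
  ∣layer∣-≤ X j = ℕ.≤-trans (∣∑∣-≤ (binom K j) (term X j) unitBound (λ i _ → ∣term∣-≤ X j i)) (ℕ.*-monoˡ-≤ unitBound (binom-≤ K j))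

  ∣sampleValue∣-≤ : ∀ X → ℤ.∣ sampleValue X ∣ ≤ valueBound
  ∣sampleValue∣-≤ X = ℕ.≤-trans (∣∑∣-≤ (suc m) (layer X) layerBound (λ j _ → ∣layer∣-≤ X j)) (ℕ.*-monoˡ-≤ layerBound (ℕ.n≤1+n (suc m)))

  cap-≤ : ∀ {x} → x ≤ suc N * valueBound → x ≤ 2 ^ B
  cap-≤ x≤ = ℕ.≤-trans x≤ cap

  unitBound-≤ : unitBound ≤ 2 ^ B
  unitBound-≤ = cap-≤ (ℕ.≤-trans (ℕ.≤-trans (ℕ.m≤n*m unitBound (2 ^ K) {{ℕ.m^n≢0 2 K}}) (ℕ.m≤n*m layerBound (suc (suc m)))) (ℕ.m≤n*m valueBound (suc N)))

  module _ (X j idx : ℕ) (τ : ℤ) where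

    private
      w′ = sizeWeight m e₀ w₀ j
      σ = point± X j idx
      q = val σ

    state : Scratch → ℤ → ℤ → Memory → Memory
    state sc P Q arr = mem sc (here X j idx w′ (alternate j) τ P Q) arr

    record Evaluated (S : ℤ) (ω : List Bool) (m : Memory) (ω′ : List Bool) : Set where
      constructor evaluated
      field
        {P Q}    : ℤ
        {sc}     : Scratch
        {arr}    : Memory
        shape    : m ≡ state sc P Q arr
        unread   : ω′ ≡ ω
        total-is : Sums S P Q

    module _ (2^s≤ : 2 ^ s ≤ 2 ^ B) (2^s*2^s≤ : 2 ^ s * 2 ^ s ≤ 2 ^ B) where

     small-den : ∀ {x} → x ≤ s → Small (+ 2 ^ x)
     small-den x≤s = ℕ.≤-trans (ℕ.^-monoʳ-≤ 2 x≤s) 2^s≤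

     accumulate-correct : ∀ {t b r index c x c₀ y i ad tmp P Q arr ω S} →
      Sums S P Q → Small S → Small (S ℤ.+ term X j idx) →
      Term accumulate (state (scratch t b r index c x c₀ y (wt X j idx) i ad (ℚ.↥ q) (ℚ.↧ q) tmp) P Q arr) ω 10 (Evaluated (S ℤ.+ term X j idx) ω)
     accumulate-correct {t} {b} {r} {index} {c} {x} {c₀} {y} {i} {ad} {tmp} {P} {.(+ 2 ^ a)} {arr} {ω} {S} (sums a a≤s refl P≡) smallS small′ =
      branch! {Post = Mid} (2 ^ a <ᵇ 2 ^ l) (trans (cong (λ z → compare lt (+ 2 ^ a) (+ z)) (den σ)) (compare-lt (2 ^ a) (2 ^ l)))
        (λ below → let a<l = ^-cancel-< (<ᵇ-true⁻¹ below) ; a≤l = ℕ.<⇒≤ a<l in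
          let P′≡ = rescale a≤l in
          compute! (+ 2 ^ (l ∸ a)) (trans (cong (λ z → quotient (+ z) (+ 2 ^ a)) (den σ)) (quotient-exact (2 ^ l) (2 ^ a) (2 ^ (l ∸ a)) {{ℕ.m^n≢0 2 a}} (2^-+ (l ∸ a) a (ℕ.m∸n+n≡m a≤l))))
            (small-den (ℕ.≤-trans (ℕ.m∸n≤m l a) (pl≤s σ))) ▸ λ { (refl , refl) →
          compute! (P ℤ.* + 2 ^ (l ∸ a)) refl (small-P (P ℤ.* + 2 ^ (l ∸ a)) (sums l (pl≤s σ) refl P′≡) smallS) ▸ λ { (refl , refl) →
          compute! (+ 2 ^ l) (trans (ℤ.+-identityˡ _) (cong +_ (den σ))) (small-den (pl≤s σ)) ▸ λ { (refl , refl) →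
          finish (l , P ℤ.* + 2 ^ (l ∸ a) , _ , refl , refl , pl≤s σ , ℕ.≤-refl , P′≡) } } })
        (λ above → weaken (s≤s z≤n) (finish (a , P , _ , refl , refl , a≤s , ^-cancel-≤ (<ᵇ-false⁻¹ above) , P≡))) ▸
      λ { (a′ , P′ , tmp′ , refl , refl , a′≤s , l≤a′ , P′≡) →
        let final = combine a′ P′ a′≤s l≤a′ P′≡ in
        compute! (+ 2 ^ (a′ ∸ l)) (trans (cong (λ z → quotient (+ 2 ^ a′) (+ z)) (den σ)) (quotient-exact (2 ^ a′) (2 ^ l) (2 ^ (a′ ∸ l)) {{ℕ.m^n≢0 2 l}} (2^-+ (a′ ∸ l) l (ℕ.m∸n+n≡m l≤a′))))
          (small-den (ℕ.≤-trans (ℕ.m∸n≤m a′ l) a′≤s)) ▸ λ { (refl , refl) →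
        compute! (+ 2 ^ (a′ ∸ l) ℤ.* ℚ.↥ q) refl (ℕ.≤-trans (scaled-≤ a′ a′≤s) 2^s*2^s≤) ▸ λ { (refl , refl) →
        compute! (+ 2 ^ (a′ ∸ l) ℤ.* ℚ.↥ q ℤ.* wt X j idx) refl (product-≤ a′ a′≤s) ▸ λ { (refl , refl) →
        compute! (P′ ℤ.+ + 2 ^ (a′ ∸ l) ℤ.* ℚ.↥ q ℤ.* wt X j idx) refl (small-P (P′ ℤ.+ + 2 ^ (a′ ∸ l) ℤ.* ℚ.↥ q ℤ.* wt X j idx) final small′) ▸ λ { (refl , refl) →
        finish (evaluated refl refl final) } } } } }
      where
      l = pl σ

      Mid : Memory → List Bool → Set
      Mid m ω′ = ∃ λ a′ → ∃ λ P′ → ∃ λ tmp′ →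
        m ≡ state (scratch t b r index c x c₀ y (wt X j idx) i ad (ℚ.↥ q) (ℚ.↧ q) tmp′) P′ (+ 2 ^ a′) arr ×
        ω′ ≡ ω × a′ ≤ s × l ≤ a′ × P′ ℤ.* + 2 ^ (s ∸ a′) ≡ S

      pow-* : ∀ x y {z} → x + y ≡ z → + 2 ^ x ℤ.* + 2 ^ y ≡ + 2 ^ z
      pow-* x y x+y≡z = trans (mul-pos (2 ^ x) (2 ^ y)) (cong +_ (2^-+ x y x+y≡z))

      rescale : a ≤ l → P ℤ.* + 2 ^ (l ∸ a) ℤ.* + 2 ^ (s ∸ l) ≡ S
      rescale a≤l = trans (ℤ.*-assoc P (+ 2 ^ (l ∸ a)) (+ 2 ^ (s ∸ l))) (trans (cong (P ℤ.*_) (pow-* (l ∸ a) (s ∸ l) gap≡)) P≡)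
        where
        gap≡ : l ∸ a + (s ∸ l) ≡ s ∸ a
        gap≡ = trans (sym (ℕ.+-∸-comm (s ∸ l) a≤l)) (cong (_∸ a) (ℕ.m+[n∸m]≡n (pl≤s σ)))

      combine : ∀ a′ P′ → a′ ≤ s → l ≤ a′ → P′ ℤ.* + 2 ^ (s ∸ a′) ≡ S →
        Sums (S ℤ.+ term X j idx) (P′ ℤ.+ + 2 ^ (a′ ∸ l) ℤ.* ℚ.↥ q ℤ.* wt X j idx) (+ 2 ^ a′)
      combine a′ P′ a′≤s l≤a′ P′≡ = sums a′ a′≤s refl
        (trans (expand P′ (+ 2 ^ (a′ ∸ l)) (ℚ.↥ q) (wt X j idx) (+ 2 ^ (s ∸ a′)))
          (cong₂ ℤ._+_ P′≡ (cong (λ z → wt X j idx ℤ.* (ℚ.↥ q ℤ.* z)) (pow-* (a′ ∸ l) (s ∸ a′) gap≡))))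
        where
        expand : ∀ p x y w z → (p ℤ.+ x ℤ.* y ℤ.* w) ℤ.* z ≡ p ℤ.* z ℤ.+ w ℤ.* (y ℤ.* (x ℤ.* z))
        expand = ℤRing.solve-∀
        gap≡ : a′ ∸ l + (s ∸ a′) ≡ s ∸ l
        gap≡ = trans (sym (ℕ.+-∸-comm (s ∸ a′) l≤a′)) (cong (_∸ l) (ℕ.m+[n∸m]≡n a′≤s))

      scaled-≤ : ∀ a′ → a′ ≤ s → ℤ.∣ + 2 ^ (a′ ∸ l) ℤ.* ℚ.↥ q ∣ ≤ 2 ^ s * 2 ^ s
      scaled-≤ a′ a′≤s = ℕ.≤-trans (ℕ.≤-reflexive (ℤ.abs-* (+ 2 ^ (a′ ∸ l)) (ℚ.↥ q)))
        (ℕ.*-mono-≤ (ℕ.^-monoʳ-≤ 2 (ℕ.≤-trans (ℕ.m∸n≤m a′ l) a′≤s)) (num σ))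

      product-≤ : ∀ a′ → a′ ≤ s → Small (+ 2 ^ (a′ ∸ l) ℤ.* ℚ.↥ q ℤ.* wt X j idx)
      product-≤ a′ a′≤s = ℕ.≤-trans (ℕ.≤-reflexive (trans (ℤ.abs-* (+ 2 ^ (a′ ∸ l) ℤ.* ℚ.↥ q) (wt X j idx)) (ℕ.*-comm _ ℤ.∣ wt X j idx ∣)))
        (ℕ.≤-trans (ℕ.*-mono-≤ (ℕ.≤-trans (∣weight∣≤ X j idx w′ (alternate j) 0ℤ 0ℤ 0ℤ n′) (sizeWeight-≤ m e₀ w₀ j)) (scaled-≤ a′ a′≤s)) unitBound-≤)

     evaluateTime : ℕ
     evaluateTime = 3 + (n′ * (K * 12 + 22) + 1 + 11)

     total-const : ∀ N T → total N (λ _ → T) ≡ N * suc T + 1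
     total-const zero    T = refl
     total-const (suc N) T = trans (cong (_+_ (suc T)) (total-const N T)) (sym (ℕ.+-assoc (suc T) (N * suc T) 1))

     evaluate-correct : ∀ {sc P Q arr ω S} → Small (+ X) → idx < binom K j → j ≤ K →
       Sums S P Q → Small S → Small (S ℤ.+ term X j idx) →
       Term evaluate (state sc P Q arr) ω evaluateTime (Evaluated (S ℤ.+ term X j idx) ω)
     evaluate-correct {sc} {P} {Q} {arr} {ω} smallX idx< j≤K S-is smallS small′ =
       compute! (+ X) refl smallX ▸ λ { (refl , refl) →
       compute! (weightAt 0) (sym (ℤ.*-identityʳ (+ w′ ℤ.* value± (alternate j)))) (small-weight X j idx w′ (alternate j) τ P Q smallX smallw idx< j≤K 0) ▸ λ { (refl , refl) →
       compute! 0ℤ refl z≤n ▸ λ { (refl , refl) →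
       weaken (ℕ.≤-reflexive time-eq) (while! n′ (λ _ → K * 12 + 21) (Placed X j idx w′ (alternate j) τ P Q ω)
         (λ { i m ω′ i<n′ (placed refl unread signs) → compare-lt-true i<n′ , placeSign-correct X j idx w′ (alternate j) τ P Q smallX smallw idx< j≤K ω i m ω′ i<n′ (placed refl unread signs) })
         (λ { m ω′ (placed refl _ _) → compare-lt-false {n′} {n′} ℕ.≤-refl })
         (placed refl refl λ k ())) ▸ λ { (placed {arr = arr} refl refl signs) →
       query! (just q) (trans (cong F (queried arr signs)) (F-val σ)) (ℕ.≤-trans (num σ) 2^s≤) (subst (_≤ 2 ^ B) (sym (den σ)) (small-den (pl≤s σ))) ▸ λ { (refl , refl) →
       accumulate-correct S-is smallS small′ } } } } }
       where
       weightAt = weight X j idx w′ (alternate j) τ P Q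

       smallw : Small (+ w′)
       smallw = ℕ.≤-trans (sizeWeight-≤ m e₀ w₀ j) (ℕ.≤-trans (ℕ.m≤m*n w₀ (suc m)) w₀*m≤)

       time-eq : total n′ (λ _ → K * 12 + 21) ≡ n′ * (K * 12 + 22) + 1
       time-eq = trans (total-const n′ (K * 12 + 21)) (cong (λ x → n′ * x + 1) (sym (ℕ.+-suc (K * 12) 21)))

       queried : ∀ arr → (∀ k → k < n′ → load arr k ≡ value± (signAt K j idx (colour R u X k))) →
                 Vec.tabulate {n = n} (λ i → load arr (toℕ i)) ≡ cubePoint σ
       queried arr signs = trans (Vec.tabulate-cong λ i → signs (toℕ i) (ℕ.<-≤-trans (Fin.toℕ<n i) n≤n′))
         (Vec.tabulate-∘ value± (λ i → signAt K j idx (colour R u X (toℕ i))))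

  module _ (2^s≤ : 2 ^ s ≤ 2 ^ B) (2^s*2^s≤ : 2 ^ s * 2 ^ s ≤ 2 ^ B) (X : ℕ) (τ : ℤ) (smallX : Small (+ X)) where

    record Sized (S : ℤ) (ω : List Bool) (j : ℕ) (μ : Memory) (ω′ : List Bool) : Set where
      constructor sized
      field
        {P Q idx} : ℤ
        {sc}      : Scratch
        {arr}     : Memory
        shape     : μ ≡ mem sc (outer idx (+ j) (+ binom K j) (+ sizeWeight m e₀ w₀ j) (value± (alternate j)) (+ X) τ P Q) arr
        unread    : ω′ ≡ ω
        total-is  : Sums (S ℤ.+ ∑ j (layer X)) P Q

    small-+ : ∀ {S b} x → ℤ.∣ S ∣ + b ≤ 2 ^ B → ℤ.∣ x ∣ ≤ b → Small (S ℤ.+ x)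
    small-+ {S} x S+b≤ x≤b = ℕ.≤-trans (ℤ.∣i+j∣≤∣i∣+∣j∣ S x) (ℕ.≤-trans (ℕ.+-monoʳ-≤ ℤ.∣ S ∣ x≤b) S+b≤)

    sizeTime : ℕ → ℕ
    sizeTime j = 1 + (binom K j * suc (evaluateTime X j 0 τ 2^s≤ 2^s*2^s≤ + 2) + 1 + 10)

    private
      evalTime = evaluateTime X 0 0 τ 2^s≤ 2^s*2^s≤

    perSize-correct : ∀ {S ω} j μ ω′ → j < suc m → ℤ.∣ S ∣ + valueBound ≤ 2 ^ B → Sized S ω j μ ω′ → Term perSize μ ω′ (sizeTime j) (Sized S ω (suc j))
    perSize-correct {S} {ω} j μ ω′ (s≤s j≤m) S≤ (sized {P} {Q} {arr = arr} refl refl S-is) =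
      compute! 0ℤ refl z≤n ▸ λ { (refl , refl) →
      weaken (ℕ.≤-reflexive (total-const X j 0 τ 2^s≤ 2^s*2^s≤ (binom K j) (evalTime + 2)))
        (while! (binom K j) (λ _ → evalTime + 2) (λ i → Evaluated X j i τ (S′ ℤ.+ ∑ i (term X j)) ω)
          (λ { i μ ω′ i< (evaluated refl refl is) → compare-lt-true i< ,
               (evaluate-correct X j i τ 2^s≤ 2^s*2^s≤ smallX i< j≤K is (small-partial i (ℕ.<⇒≤ i<))
                  (subst Small (next-term i) (small-partial (suc i) i<)) ▸ λ { (evaluated refl refl is′) →
                compute! (+ suc i) refl (ℕ.≤-trans i< (ℕ.≤-trans (binom-≤ K j) 2^K≤)) ▸ λ { (refl , refl) →
                finish (evaluated refl refl (subst (λ z → Sums z _ _) (sym (next-term i)) is′)) } }) })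
          (λ { μ ω′ (evaluated refl _ _) → compare-lt-false {binom K j} {binom K j} ℕ.≤-refl })
          (evaluated refl refl (subst (λ z → Sums z P Q) (sym (ℤ.+-identityʳ S′)) S-is))) ▸ λ { (evaluated refl refl is) →
      compute! (+ (K ∸ j)) (sub-pos j≤K) (ℕ.≤-trans (ℕ.m∸n≤m K j) K≤) ▸ λ { (refl , refl) →
      compute! (+ ((K ∸ j) * binom K j)) (mul-pos (K ∸ j) (binom K j)) (ℕ.≤-trans (ℕ.*-mono-≤ (ℕ.m∸n≤m K j) (binom-≤ K j)) K*2^K≤) ▸ λ { (refl , refl) →
      compute! (+ (m ∸ j)) (sub-pos j≤m) (ℕ.≤-trans (ℕ.m∸n≤m m j) m≤) ▸ λ { (refl , refl) →
      compute! (+ (wj * (m ∸ j))) (mul-pos wj (m ∸ j)) (ℕ.≤-trans (ℕ.*-mono-≤ (sizeWeight-≤ m e₀ w₀ j) (ℕ.≤-trans (ℕ.m∸n≤m m j) (ℕ.n≤1+n m))) w₀*m≤) ▸ λ { (refl , refl) →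
      compute! (+ (suc e₀ + (m ∸ j))) refl (ℕ.≤-trans (ℕ.+-monoʳ-≤ (suc e₀) (ℕ.m∸n≤m m j)) e₀+m≤) ▸ λ { (refl , refl) →
      compute! (+ sizeWeight m e₀ w₀ (suc j)) (quotient-pos (wj * (m ∸ j)) (suc e₀ + (m ∸ j))) (ℕ.≤-trans (sizeWeight-≤ m e₀ w₀ (suc j)) (ℕ.≤-trans (ℕ.m≤m*n w₀ (suc m)) w₀*m≤)) ▸ λ { (refl , refl) →
      compute! (value± (alternate (suc j))) (negate (alternate j)) (small-value± (alternate (suc j))) ▸ λ { (refl , refl) →
      compute! (+ suc j) refl (ℕ.≤-trans (ℕ.≤-trans (s≤s j≤m) m<K) K≤) ▸ λ { (refl , refl) →
      compute! (+ binom K (suc j)) (quotient-exact ((K ∸ j) * binom K j) (suc j) (binom K (suc j)) (trans (ℕ.*-comm (binom K (suc j)) (suc j)) (binom-next K j (ℕ.m+[n∸m]≡n j≤K))))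
        (ℕ.≤-trans (binom-≤ K (suc j)) 2^K≤) ▸ λ { (refl , refl) →
      finish (sized refl refl (subst (λ z → Sums z _ _) (ℤ.+-assoc S (∑ j (layer X)) (layer X j)) is)) } } } } } } } } } } }
      where
      S′ = S ℤ.+ ∑ j (layer X)
      wj = sizeWeight m e₀ w₀ j

      j≤K : j ≤ K
      j≤K = ℕ.≤-trans j≤m (ℕ.<⇒≤ m<K)

      2^K≤ : 2 ^ K ≤ 2 ^ B
      2^K≤ = ℕ.≤-trans (ℕ.m≤n*m (2 ^ K) K {{ℕ.>-nonZero (ℕ.≤-<-trans z≤n m<K)}}) K*2^K≤

      K≤ : K ≤ 2 ^ B
      K≤ = ℕ.≤-trans (ℕ.m≤m*n K (2 ^ K) {{ℕ.m^n≢0 2 K}}) K*2^K≤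

      m≤ : m ≤ 2 ^ B
      m≤ = ℕ.≤-trans (ℕ.<⇒≤ m<K) K≤

      negate : ∀ σ → 0ℤ ℤ.- value± σ ≡ value± (Sign.- Sign.* σ)
      negate Sign.+ = refl
      negate Sign.- = refl

      next-term : ∀ i → S′ ℤ.+ ∑ (suc i) (term X j) ≡ S′ ℤ.+ ∑ i (term X j) ℤ.+ term X j i
      next-term i = sym (ℤ.+-assoc S′ (∑ i (term X j)) (term X j i))

      small-partial : ∀ i → i ≤ binom K j → Small (S′ ℤ.+ ∑ i (term X j))
      small-partial i i≤ = subst Small (sym (ℤ.+-assoc S (∑ j (layer X)) (∑ i (term X j))))
        (small-+ {S} (∑ j (layer X) ℤ.+ ∑ i (term X j)) S≤ (ℕ.≤-trans (ℤ.∣i+j∣≤∣i∣+∣j∣ (∑ j (layer X)) (∑ i (term X j)))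
          (ℕ.≤-trans (ℕ.+-mono-≤
              (ℕ.≤-trans (∣∑∣-≤ j (layer X) layerBound (λ k _ → ∣layer∣-≤ X k)) (ℕ.*-monoˡ-≤ layerBound (ℕ.≤-trans j≤m (ℕ.n≤1+n m))))
              (ℕ.≤-trans (∣∑∣-≤ i (term X j) unitBound (λ k _ → ∣term∣-≤ X j k)) (ℕ.*-monoˡ-≤ unitBound (ℕ.≤-trans i≤ (binom-≤ K j)))))
            (ℕ.≤-reflexive (ℕ.+-comm (suc m * layerBound) layerBound)))))

  fromBits-< : ∀ {i x} bs → x < 2 ^ i → fromBits x bs < 2 ^ (i + length bs)
  fromBits-< {i} []       x< = subst (λ k → _ < 2 ^ k) (sym (ℕ.+-identityʳ i)) x<
  fromBits-< {i} {x} (b ∷ bs) x< = subst (λ k → fromBits x (b ∷ bs) < 2 ^ k) (sym (ℕ.+-suc i (length bs))) (fromBits-< {suc i} bs (double b))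
    where
    double : ∀ b → x + x + digit b < 2 ^ suc i
    double b = ℕ.≤-trans (s≤s (ℕ.+-monoʳ-≤ (x + x) (digit≤1 b))) (ℕ.≤-trans (ℕ.≤-reflexive (two x)) (ℕ.*-monoʳ-≤ 2 x<))
      where
      digit≤1 : ∀ b → digit b ≤ 1
      digit≤1 true  = ℕ.≤-refl
      digit≤1 false = z≤n
      two : ∀ x → suc (x + x + 1) ≡ 2 * suc x
      two = ℕRing.solve-∀

  bit-digit : ∀ b → bit b ≡ + digit b
  bit-digit true  = refl
  bit-digit false = refl

  tosses-correct : ∀ bs i x {t b r index c x₀ c₀ y wt ad p q tmp idx j C w sg τ P Q arr ω} → i + length bs ≡ rb → x < 2 ^ i →
    Term (while (ρ 9) lt (ρ 29) toss)
         (mem (scratch t b r index c x₀ c₀ y wt (+ i) ad p q tmp) (outer idx j C w sg (+ x) τ P Q) arr) (bs ++ ω) (length bs * 6 + 1)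
         (λ μ ω′ → ∃ λ tmp′ → μ ≡ mem (scratch t b r index c x₀ c₀ y wt (+ rb) ad p q tmp′) (outer idx j C w sg (+ fromBits x bs) τ P Q) arr × ω′ ≡ ω)
  tosses-correct [] i x {tmp = tmp} i≡ x< with trans (sym (ℕ.+-identityʳ i)) i≡
  ... | refl = while-done (compare-lt-false {i} {i} ℕ.≤-refl) (tmp , refl , refl)
  tosses-correct (b ∷ bs) i x {t} {b₁} {r} {index} {c} {x₀} {c₀} {y} {wt} {ad} {p} {q} {tmp} {idx} {j} {C} {w} {sg} {τ} {P} {Q} {arr} {ω} i≡ x< =
    while-step {Mid = λ μ ω′ → μ ≡ mem (scratch t b₁ r index c x₀ c₀ y wt (+ suc i) ad p q (bit b)) (outer idx j C w sg (+ (x + x + digit b)) τ P Q) arr × ω′ ≡ bs ++ ω}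
      (compare-lt-true i<rb)
      (flip! ▸ λ { (refl , refl) →
       compute! (+ (x + x)) refl (ℕ.≤-trans (ℕ.m≤m+n (x + x) (digit b)) small-next) ▸ λ { (refl , refl) →
       compute! (+ (x + x + digit b)) (cong (ℤ._+_ (+ (x + x))) (bit-digit b)) small-next ▸ λ { (refl , refl) →
       compute! (+ suc i) refl (ℕ.≤-trans i<rb (ℕ.≤-trans (ℕ.<⇒≤ (n<2^n rb)) (ℕ.^-monoʳ-≤ 2 (ℕ.<⇒≤ rb≤B)))) ▸ λ { (refl , refl) →
       finish (refl , refl) } } } })
      λ { (refl , refl) → tosses-correct bs (suc i) (x + x + digit b) (trans (sym (ℕ.+-suc i (length bs))) i≡) next-< }
    where
    i<rb : i < rb
    i<rb = subst (i <_) i≡ (ℕ.m<m+n i z<s)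

    next-< : x + x + digit b < 2 ^ suc i
    next-< = subst (λ k → x + x + digit b < 2 ^ k) (ℕ.+-comm i 1) (fromBits-< {i} {x} (b ∷ []) x<)

    small-next : x + x + digit b ≤ 2 ^ B
    small-next = ℕ.≤-trans (ℕ.<⇒≤ next-<) (ℕ.^-monoʳ-≤ 2 (ℕ.≤-trans i<rb (ℕ.<⇒≤ rb≤B)))

  record Sampled (τ : ℕ) (S : ℤ) (ω : List Bool) (μ : Memory) (ω′ : List Bool) : Set where
    constructor sampled
    field
      {idx j C w sg X P Q} : ℤ
      {sc}      : Scratch
      {arr}     : Memory
      shape     : μ ≡ mem sc (outer idx j C w sg X (+ τ) P Q) arr
      unread    : ω′ ≡ ω
      total-is  : Sums S P Q

  module _ (2^s≤ : 2 ^ s ≤ 2 ^ B) (2^s*2^s≤ : 2 ^ s * 2 ^ s ≤ 2 ^ B) where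

    sampleTime : ℕ
    sampleTime = 2 + (rb * 6 + 1 + (4 + (total (suc m) (sizeTime 2^s≤ 2^s*2^s≤ 0 0ℤ z≤n) + 2)))

    sample-correct : ∀ bs {τ S ω μ} → length bs ≡ rb → ℤ.∣ S ∣ + valueBound ≤ 2 ^ B → τ < N →
      Sampled τ S (bs ++ ω) μ (bs ++ ω) → Term sample μ (bs ++ ω) sampleTime (Sampled (suc τ) (S ℤ.+ sampleValue (fromBits 0 bs)) ω)
    sample-correct bs {τ} {S} {ω} {μ} refl S≤ τ<N (sampled {P = P} {Q} refl _ S-is) =
      compute! 0ℤ refl z≤n ▸ λ { (refl , refl) →
      compute! 0ℤ refl z≤n ▸ λ { (refl , refl) →
      tosses-correct bs 0 0 refl (s≤s z≤n) ▸ λ { (_ , refl , refl) →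
      compute! 0ℤ refl z≤n ▸ λ { (refl , refl) →
      compute! 1ℤ refl (small-<64 1ℤ _) ▸ λ { (refl , refl) →
      compute! (+ w₀) refl (ℕ.≤-trans (ℕ.m≤m*n w₀ (suc m)) w₀*m≤) ▸ λ { (refl , refl) →
      compute! 1ℤ refl (small-<64 1ℤ _) ▸ λ { (refl , refl) →
      while! (suc m) (sizeTime 2^s≤ 2^s*2^s≤ X (+ τ) smallX) (Sized 2^s≤ 2^s*2^s≤ X (+ τ) smallX S ω)
        (λ { j μ ω′ j< inv@(sized refl _ _) → trans (compare-le j m) (T→≡ (ℕ.<⇒<ᵇ j<)) , perSize-correct 2^s≤ 2^s*2^s≤ X (+ τ) smallX j μ ω′ j< S≤ inv })
        (λ { μ ω′ (sized refl _ _) → trans (compare-le (suc m) m) (<ᵇ-false {suc m} {suc m} ℕ.≤-refl) })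
        (sized refl refl (subst (λ z → Sums z P Q) (sym (ℤ.+-identityʳ S)) S-is)) ▸ λ { (sized refl refl is) →
      compute! (+ suc τ) refl (ℕ.≤-trans τ<N N≤) ▸ λ { (refl , refl) →
      finish (sampled refl refl is) } } } } } } } } }
      where
      X = fromBits 0 bs

      smallX : Small (+ X)
      smallX = ℕ.<⇒≤ (ℕ.<-≤-trans (fromBits-< {0} {0} bs (s≤s z≤n)) (ℕ.^-monoʳ-≤ 2 (ℕ.<⇒≤ rb≤B)))

    samplesSum : ℤ → List (List Bool) → ℤ
    samplesSum S []         = S
    samplesSum S (bs ∷ bss) = samplesSum (S ℤ.+ sampleValue (fromBits 0 bs)) bss

    samples-correct : ∀ bss τ {S ω μ} → All (λ bs → length bs ≡ rb) bss → τ + length bss ≡ N → ℤ.∣ S ∣ ≤ τ * valueBound →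
      Sampled τ S (List.concat bss ++ ω) μ (List.concat bss ++ ω) →
      Term (while (ρ 20) lt (ρ 31) sample) μ (List.concat bss ++ ω) (length bss * suc sampleTime + 1) (Sampled N (samplesSum S bss) ω)
    samples-correct [] τ [] τ≡ S≤ (sampled refl refl is) with trans (sym (ℕ.+-identityʳ τ)) τ≡
    ... | refl = while-done (compare-lt-false {τ} {τ} ℕ.≤-refl) (sampled refl refl is)
    samples-correct (bs ∷ bss) τ {S} {ω} {μ} (len-bs ∷ lens) τ≡ S≤ (sampled refl _ is) rewrite List.++-assoc bs (List.concat bss) ω =
      weaken (ℕ.≤-reflexive (sym (ℕ.+-assoc (suc sampleTime) (length bss * suc sampleTime) 1)))
        (while-step (compare-lt-true τ<N)
          (sample-correct bs len-bs S+≤ τ<N (sampled refl refl is))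
          λ { (sampled refl refl is′) → samples-correct bss (suc τ) lens (trans (sym (ℕ.+-suc τ (length bss))) τ≡) S′≤ (sampled refl refl is′) })
      where
      τ<N : τ < N
      τ<N = subst (τ <_) τ≡ (ℕ.m<m+n τ z<s)

      S+≤ : ℤ.∣ S ∣ + valueBound ≤ 2 ^ B
      S+≤ = cap-≤ (ℕ.≤-trans (ℕ.+-monoˡ-≤ valueBound S≤) (ℕ.≤-trans (ℕ.≤-reflexive (ℕ.+-comm (τ * valueBound) valueBound))
              (ℕ.*-monoˡ-≤ valueBound (s≤s (ℕ.<⇒≤ τ<N)))))

      S′≤ : ℤ.∣ S ℤ.+ sampleValue (fromBits 0 bs) ∣ ≤ suc τ * valueBound
      S′≤ = ℕ.≤-trans (ℤ.∣i+j∣≤∣i∣+∣j∣ S (sampleValue (fromBits 0 bs)))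
        (ℕ.≤-trans (ℕ.+-mono-≤ S≤ (∣sampleValue∣-≤ (fromBits 0 bs))) (ℕ.≤-reflexive (ℕ.+-comm (τ * valueBound) valueBound)))

powerLoop power fallingLoop fallingProduct weightLoop initialWeight precisionLoop precision prologue epilogue program : Program
powerLoop =
  while (ρ 3) lt (ρ 2) (compute (at 0) mul (ρ 1) (ρ 0) ⨾ compute (at 3) add (lit 1ℤ) (ρ 3) ⨾ skip)

power =
  compute (at 0) add (lit 0ℤ) (lit 1ℤ) ⨾
  compute (at 3) add (lit 0ℤ) (lit 0ℤ) ⨾
  powerLoop

fallingLoop =
  while (ρ 3) lt (ρ 33)
    (compute (at 0) mul (ρ 0) (ρ 1) ⨾ compute (at 1) sub (ρ 1) (lit 1ℤ) ⨾ compute (at 3) add (lit 1ℤ) (ρ 3) ⨾ skip)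

fallingProduct =
  compute (at 0) add (lit 0ℤ) (lit 1ℤ) ⨾
  compute (at 1) add (lit 0ℤ) (ρ 23) ⨾
  compute (at 3) add (lit 0ℤ) (lit 0ℤ) ⨾
  fallingLoop

weightLoop =
  while (ρ 3) lt (ρ 24)
    (compute (at 3) add (lit 1ℤ) (ρ 3) ⨾ compute (at 1) add (ρ 28) (ρ 3) ⨾ compute (at 0) mul (ρ 1) (ρ 0) ⨾
     compute (at 0) div (ρ 0) (ρ 3) ⨾ skip)

initialWeight =
  compute (at 0) add (lit 0ℤ) (lit 1ℤ) ⨾
  compute (at 3) add (lit 0ℤ) (lit 0ℤ) ⨾
  weightLoop

precisionLoop =
  while (ρ 0) lt (lit (+ 5))
    (compute (at 2) add (lit 1ℤ) (ρ 2) ⨾ compute (at 1) mul (lit (+ 4)) (ρ 1) ⨾ approxε (at 0) (ρ 2) ⨾ skip)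

precision =
  compute (at 2) add (lit 0ℤ) (lit 0ℤ) ⨾
  compute (at 1) add (lit 0ℤ) (lit 1ℤ) ⨾
  approxε (at 0) (ρ 2) ⨾
  precisionLoop

prologue =
  compute (at 39) add (lit 0ℤ) (lit 0ℤ) ⨾
  compute (at 32) div inputD (lit (+ 20)) ⨾
  compute (at 32) add (lit 1ℤ) (ρ 32) ⨾
  compute (at 24) mul (lit (+ 10)) (ρ 32) ⨾
  compute (at 23) mul (lit (+ 31)) (ρ 32) ⨾
  compute (at 28) mul (lit (+ 11)) (ρ 32) ⨾
  compute (at 28) sub (ρ 28) (lit 1ℤ) ⨾
  compute (at 33) mul (lit (+ 2)) (ρ 24) ⨾
  compute (at 33) add (lit 1ℤ) (ρ 33) ⨾
  compute (at 25) sub (ρ 33) inputD ⨾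
  compute (at 25) add (ρ 25) inputN ⨾
  compute (at 34) add (ρ 25) (ρ 23) ⨾
  compute (at 29) mul (ρ 25) (ρ 34) ⨾
  compute (at 1) add (lit 0ℤ) (lit (+ 2)) ⨾ compute (at 2) add (lit 0ℤ) (ρ 34) ⨾ power ⨾ compute (at 26) add (lit 0ℤ) (ρ 0) ⨾
  compute (at 27) div (ρ 26) (ρ 23) ⨾
  compute (at 1) add (lit 0ℤ) (ρ 26) ⨾ compute (at 2) add (lit 0ℤ) (ρ 25) ⨾ power ⨾ compute (at 35) add (lit 0ℤ) (ρ 0) ⨾
  compute (at 1) add (lit 0ℤ) (lit (+ 4)) ⨾ compute (at 2) add (lit 0ℤ) (ρ 24) ⨾ power ⨾ compute (at 36) add (lit 0ℤ) (ρ 0) ⨾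
  compute (at 1) add (lit 0ℤ) (ρ 23) ⨾ compute (at 2) add (lit 0ℤ) (ρ 33) ⨾ power ⨾ compute (at 37) add (lit 0ℤ) (ρ 0) ⨾
  compute (at 1) mul (ρ 23) (ρ 27) ⨾ compute (at 2) add (lit 0ℤ) (ρ 25) ⨾ power ⨾ compute (at 38) add (lit 0ℤ) (ρ 0) ⨾
  fallingProduct ⨾ compute (at 39) add (lit 0ℤ) (ρ 0) ⨾
  initialWeight ⨾ compute (at 30) add (lit 0ℤ) (ρ 0) ⨾
  precision ⨾
  compute (at 31) div (ρ 37) (ρ 39) ⨾
  compute (at 31) add (lit 1ℤ) (ρ 31) ⨾
  compute (at 31) mul (ρ 31) (ρ 1) ⨾
  compute (at 22) add (lit 0ℤ) (lit 1ℤ) ⨾ skip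

epilogue =
  compute (at 0) mul (ρ 21) (ρ 37) ⨾
  compute (at 0) mul (ρ 0) (ρ 35) ⨾
  compute (at 1) mul (ρ 22) (ρ 31) ⨾
  compute (at 1) mul (ρ 1) (ρ 36) ⨾
  compute (at 1) mul (ρ 1) (ρ 39) ⨾
  compute (at 1) mul (ρ 1) (ρ 38) ⨾ skip

program = ifte inputN lt inputD skip (prologue ⨾ while (ρ 20) lt (ρ 31) sample ⨾ epilogue)

module PrologueRun (n d : ℕ) (F : Vec ℤ n → Maybe ℚ) (ε̂ : ℕ → ℤ)
               (B G : ℕ) (6≤B : 6 ≤ B) (48≤G : 48 ≤ G) (n≤2^B : n ≤ 2 ^ B) (d≤2^B : d ≤ 2 ^ B) where
  open Machine n d F ε̂ B G 6≤B 48≤G n≤2^B d≤2^B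

  Four : (a₀ a₁ a₂ : ℤ) → Memory → List Bool → Memory → List Bool → Set
  Four a₀ a₁ a₂ rest ω μ ω′ = ∃ λ a₃ → μ ≡ a₀ ∷ a₁ ∷ a₂ ∷ a₃ ∷ rest × ω′ ≡ ω

  power-correct : ∀ x k {a₀ a₃ rest ω} → 1 ≤ x → x ^ k ≤ 2 ^ B → k ≤ 2 ^ B →
    Term power (a₀ ∷ + x ∷ + k ∷ a₃ ∷ rest) ω (4 * k + 3) (Four (+ (x ^ k)) (+ x) (+ k) rest ω)
  power-correct x k {rest = rest} {ω} 1≤x small k≤ =
    weaken (ℕ.≤-reflexive (duration k)) (
    compute! 1ℤ refl (small-<64 1ℤ _) ▸ λ { (refl , refl) →
    compute! 0ℤ refl z≤n ▸ λ { (refl , refl) → loop k 0 (ℕ.+-identityʳ k) } })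
    where
    duration : ∀ k → 1 + (1 + (4 * k + 1)) ≡ 4 * k + 3
    duration = ℕRing.solve-∀

    step-duration : ∀ j → 3 + 1 + (4 * j + 1) ≡ 4 * suc j + 1
    step-duration = ℕRing.solve-∀

    loop : ∀ j i → j + i ≡ k → Term powerLoop (+ (x ^ i) ∷ + x ∷ + k ∷ + i ∷ rest) ω (4 * j + 1) (Four (+ (x ^ k)) (+ x) (+ k) rest ω)
    loop zero    i refl = while-done (compare-lt-false {i} {i} ℕ.≤-refl) (_ , refl , refl)
    loop (suc j) i j+i≡ = weaken (ℕ.≤-reflexive (step-duration j)) (while-step {Mid = λ μ ω′ → μ ≡ + (x ^ suc i) ∷ + x ∷ + k ∷ + suc i ∷ rest × ω′ ≡ ω} (compare-lt-true i<k)
      (compute! (+ (x ^ suc i)) (mul-pos x (x ^ i)) (ℕ.≤-trans (ℕ.^-monoʳ-≤ x {{ℕ.>-nonZero 1≤x}} i<k) small) ▸ λ { (refl , refl) →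
       compute! (+ suc i) refl (ℕ.≤-trans i<k k≤) ▸ λ { (refl , refl) → finish (refl , refl) } })
      λ { (refl , refl) → loop j (suc i) (trans (ℕ.+-suc j i) j+i≡) })
      where
      i<k : i < k
      i<k = subst (i <_) j+i≡ (s≤s (ℕ.m≤n+m i j))

  fallingProduct-correct : ∀ K D {a₀ a₁ a₂ a₃ rest ω} → D ≤ K → load rest 19 ≡ + K → load rest 29 ≡ + D → K ≤ 2 ^ B → K ^ D ≤ 2 ^ B →
    Term fallingProduct (a₀ ∷ a₁ ∷ a₂ ∷ a₃ ∷ rest) ω (5 * D + 4) (λ μ ω′ → ∃ λ a₁′ → Four (+ falling K D) a₁′ a₂ rest ω μ ω′)
  fallingProduct-correct K D {a₂ = a₂} {rest = rest} {ω} D≤K K≡ D≡ K≤ small =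
    weaken (ℕ.≤-reflexive (duration D)) (
    compute! 1ℤ refl (small-<64 1ℤ _) ▸ λ { (refl , refl) →
    compute! (+ K) (trans (ℤ.+-identityˡ _) K≡) K≤ ▸ λ { (refl , refl) →
    compute! 0ℤ refl z≤n ▸ λ { (refl , refl) → loop D 0 (ℕ.+-identityʳ D) } } })
    where
    duration : ∀ k → 1 + (1 + (1 + (5 * k + 1))) ≡ 5 * k + 4
    duration = ℕRing.solve-∀

    step-duration : ∀ j → 4 + 1 + (5 * j + 1) ≡ 5 * suc j + 1
    step-duration = ℕRing.solve-∀

    loop : ∀ j i → j + i ≡ D → Term fallingLoop (+ falling K i ∷ + (K ∸ i) ∷ a₂ ∷ + i ∷ rest) ω (5 * j + 1) (λ μ ω′ → ∃ λ a₁′ → Four (+ falling K D) a₁′ a₂ rest ω μ ω′)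
    loop zero    i refl = while-done (trans (cong (compare lt (+ i)) D≡) (compare-lt-false {i} {i} ℕ.≤-refl)) (_ , _ , refl , refl)
    loop (suc j) i j+i≡ = weaken (ℕ.≤-reflexive (step-duration j)) (while-step {Mid = λ μ ω′ → μ ≡ + falling K (suc i) ∷ + (K ∸ suc i) ∷ a₂ ∷ + suc i ∷ rest × ω′ ≡ ω}
      (trans (cong (compare lt (+ i)) D≡) (compare-lt-true i<D))
      (compute! (+ falling K (suc i)) (mul-pos (falling K i) (K ∸ i)) (ℕ.≤-trans (falling-≤ K (suc i)) (ℕ.≤-trans (ℕ.^-monoʳ-≤ K {{ℕ.>-nonZero (ℕ.≤-trans (s≤s z≤n) i<K)}} i<D) small)) ▸ λ { (refl , refl) →
       compute! (+ (K ∸ suc i)) (trans (sub-pos {K ∸ i} {1} (ℕ.m<n⇒0<n∸m i<K)) (cong +_ (trans (ℕ.∸-+-assoc K i 1) (cong (K ∸_) (ℕ.+-comm i 1))))) (ℕ.≤-trans (ℕ.m∸n≤m K (suc i)) K≤) ▸ λ { (refl , refl) →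
       compute! (+ suc i) refl (ℕ.≤-trans i<K K≤) ▸ λ { (refl , refl) → finish (refl , refl) } } })
      λ { (refl , refl) → loop j (suc i) (trans (ℕ.+-suc j i) j+i≡) })
      where
      i<D : i < D
      i<D = subst (i <_) j+i≡ (s≤s (ℕ.m≤n+m i j))

      i<K : i < K
      i<K = ℕ.≤-trans i<D D≤K

  initialWeight-correct : ∀ e m {a₀ a₁ a₂ a₃ rest ω} → load rest 20 ≡ + m → load rest 24 ≡ + e → e + m ≤ 2 ^ B →
    (∀ i → i < m → (e + suc i) * binom (e + i) i ≤ 2 ^ B) →
    Term initialWeight (a₀ ∷ a₁ ∷ a₂ ∷ a₃ ∷ rest) ω (6 * m + 3) (λ μ ω′ → ∃ λ a₁′ → Four (+ binom (e + m) m) a₁′ a₂ rest ω μ ω′)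
  initialWeight-correct e m {a₁ = a₁} {a₂ = a₂} {rest = rest} {ω} m≡ e≡ e+m≤ small =
    weaken (ℕ.≤-reflexive (duration m)) (
    compute! 1ℤ refl (small-<64 1ℤ _) ▸ λ { (refl , refl) →
    compute! 0ℤ refl z≤n ▸ λ { (refl , refl) → loop m 0 a₁ (ℕ.+-identityʳ m) } })
    where
    duration : ∀ k → 1 + (1 + (6 * k + 1)) ≡ 6 * k + 3
    duration = ℕRing.solve-∀

    step-duration : ∀ j → 5 + 1 + (6 * j + 1) ≡ 6 * suc j + 1
    step-duration = ℕRing.solve-∀

    loop : ∀ j i a₁ → j + i ≡ m → Term weightLoop (+ binom (e + i) i ∷ a₁ ∷ a₂ ∷ + i ∷ rest) ω (6 * j + 1) (λ μ ω′ → ∃ λ a₁′ → Four (+ binom (e + m) m) a₁′ a₂ rest ω μ ω′)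
    loop zero    i _ refl = while-done (trans (cong (compare lt (+ i)) m≡) (compare-lt-false {i} {i} ℕ.≤-refl)) (_ , _ , refl , refl)
    loop (suc j) i a₁ j+i≡ = weaken (ℕ.≤-reflexive (step-duration j)) (while-step {Mid = λ μ ω′ → μ ≡ + binom (e + suc i) (suc i) ∷ + (e + suc i) ∷ a₂ ∷ + suc i ∷ rest × ω′ ≡ ω}
      (trans (cong (compare lt (+ i)) m≡) (compare-lt-true i<m))
      (compute! (+ suc i) refl (ℕ.≤-trans i<m (ℕ.≤-trans (ℕ.m≤n+m m e) e+m≤)) ▸ λ { (refl , refl) →
       compute! (+ (e + suc i)) (cong (ℤ._+ + suc i) e≡) (ℕ.≤-trans (ℕ.+-monoʳ-≤ e i<m) e+m≤) ▸ λ { (refl , refl) →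
       compute! (+ ((e + suc i) * binom (e + i) i)) (mul-pos (e + suc i) (binom (e + i) i)) (small i i<m) ▸ λ { (refl , refl) →
       compute! (+ binom (e + suc i) (suc i)) (quotient-exact _ (suc i) (binom (e + suc i) (suc i)) next) (ℕ.≤-trans (ℕ.m≤m*n _ (suc i)) (ℕ.≤-trans (ℕ.≤-reflexive next) (small i i<m))) ▸ λ { (refl , refl) →
       finish (refl , refl) } } } })
      λ { (refl , refl) → loop j (suc i) _ (trans (ℕ.+-suc j i) j+i≡) })
      where
      i<m : i < m
      i<m = subst (i <_) j+i≡ (s≤s (ℕ.m≤n+m i j))

      next : binom (e + suc i) (suc i) * suc i ≡ (e + suc i) * binom (e + i) i
      next rewrite ℕ.+-suc e i = trans (ℕ.*-comm _ (suc i)) (binom-absorb (e + i) i)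

  precision-correct : ∀ k {a₀ a₁ a₂ a₃ rest ω} → k ≤ B → 4 ^ k ≤ 2 ^ B → (∀ i → i ≤ k → Small (ε̂ i)) →
    (∀ i → i < k → compare lt (ε̂ i) (+ 5) ≡ true) → compare lt (ε̂ k) (+ 5) ≡ false →
    Term precision (a₀ ∷ a₁ ∷ a₂ ∷ a₃ ∷ rest) ω (5 * k + 4) (λ μ ω′ → ∃ λ a₀′ → Four a₀′ (+ (4 ^ k)) (+ k) rest ω μ ω′)
  precision-correct k {a₃ = a₃} {rest} {ω} k≤B 4^k≤ small before after =
    weaken (ℕ.≤-reflexive (duration k)) (
    compute! 0ℤ refl z≤n ▸ λ { (refl , refl) →
    compute! 1ℤ refl (small-<64 1ℤ _) ▸ λ { (refl , refl) →
    approxε! 0 refl z≤n (small 0 z≤n) ▸ λ { (refl , refl) → loop k 0 (ℕ.+-identityʳ k) } } })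
    where
    duration : ∀ k → 1 + (1 + (1 + (5 * k + 1))) ≡ 5 * k + 4
    duration = ℕRing.solve-∀

    step-duration : ∀ j → 4 + 1 + (5 * j + 1) ≡ 5 * suc j + 1
    step-duration = ℕRing.solve-∀

    loop : ∀ j i → j + i ≡ k → Term precisionLoop (ε̂ i ∷ + (4 ^ i) ∷ + i ∷ a₃ ∷ rest) ω (5 * j + 1) (λ μ ω′ → ∃ λ a₀′ → Four a₀′ (+ (4 ^ k)) (+ k) rest ω μ ω′)
    loop zero    i refl = while-done after (_ , _ , refl , refl)
    loop (suc j) i j+i≡ = weaken (ℕ.≤-reflexive (step-duration j)) (while-step {Mid = λ μ ω′ → μ ≡ ε̂ (suc i) ∷ + (4 ^ suc i) ∷ + suc i ∷ a₃ ∷ rest × ω′ ≡ ω}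
      (before i i<k)
      (compute! (+ suc i) refl (ℕ.≤-trans i<k (ℕ.≤-trans k≤B (ℕ.<⇒≤ (n<2^n B)))) ▸ λ { (refl , refl) →
       compute! (+ (4 ^ suc i)) (mul-pos 4 (4 ^ i)) (ℕ.≤-trans (ℕ.^-monoʳ-≤ 4 i<k) 4^k≤) ▸ λ { (refl , refl) →
       approxε! (suc i) refl (ℕ.≤-trans i<k k≤B) (small (suc i) i<k) ▸ λ { (refl , refl) → finish (refl , refl) } } })
      λ { (refl , refl) → loop j (suc i) (trans (ℕ.+-suc j i) j+i≡) })
      where
      i<k : i < k
      i<k = subst (i <_) j+i≡ (s≤s (ℕ.m≤n+m i j))

  module _ (M m K D n′ b R u R₀ W U J w₀ k N : ℕ) .{{_ : NonZero K}} .{{_ : NonZero J}}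
           (M≡ : suc (d / 20) ≡ M) (m≡ : 10 * M ≡ m) (K≡ : 31 * M ≡ K) (e₀ : ℕ) (e≡ : 11 * M ≡ suc (suc e₀)) (D≡ : suc (2 * m) ≡ D)
           (d≤D : d ≤ D) (n′≡ : D ∸ d + n ≡ n′) (b≡ : n′ + K ≡ b) (R≡ : 2 ^ b ≡ R) (u≡ : R / K ≡ u) (R₀≡ : R ^ n′ ≡ R₀)
           (W≡ : K ^ D ≡ W) (U≡ : (K * u) ^ n′ ≡ U) (J≡ : falling K D ≡ J) (w₀≡ : binom (suc e₀ + m) m ≡ w₀) (N≡ : suc (W / J) * 4 ^ k ≡ N)
           (D≤K : D ≤ K) (1≤R : 1 ≤ R) (1≤Ku : 1 ≤ K * u)
           (K≤ : K ≤ 2 ^ B) (b*n′≤ : n′ * b ≤ 2 ^ B) (b≤ : b ≤ 2 ^ B) (R≤ : R ≤ 2 ^ B) (R₀≤ : R₀ ≤ 2 ^ B) (4^m≤ : 4 ^ m ≤ 2 ^ B) (W≤ : W ≤ 2 ^ B)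
           (Ku≤ : K * u ≤ 2 ^ B) (U≤ : U ≤ 2 ^ B) (N≤ : N ≤ 2 ^ B)
           (w-small : ∀ i → i < m → (suc e₀ + suc i) * binom (suc e₀ + i) i ≤ 2 ^ B) (w₀≤ : w₀ ≤ 2 ^ B)
           (k≤B : k ≤ B) (4^k≤ : 4 ^ k ≤ 2 ^ B) (ε-small : ∀ i → i ≤ k → Small (ε̂ i))
           (before : ∀ i → i < k → compare lt (ε̂ i) (+ 5) ≡ true) (after : compare lt (ε̂ k) (+ 5) ≡ false) where

    prologueTime : ℕ
    prologueTime = 62 + 4 * (b + n′ + m + D + n′) + 5 * D + 6 * m + 5 * k

    Ready : List Bool → Memory → List Bool → Set
    Ready ω μ ω′ = ∃ λ a₀ → ∃ λ a₁ → ∃ λ a₂ → ∃ λ a₃ → μ ≡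
      a₀ ∷ a₁ ∷ a₂ ∷ a₃ ∷ 0ℤ ∷ 0ℤ ∷ 0ℤ ∷ 0ℤ ∷ 0ℤ ∷ 0ℤ ∷ 0ℤ ∷ 0ℤ ∷ 0ℤ ∷ 0ℤ ∷ 0ℤ ∷ 0ℤ ∷ 0ℤ ∷ 0ℤ ∷ 0ℤ ∷ 0ℤ ∷ 0ℤ ∷ 0ℤ ∷ 1ℤ ∷
      + K ∷ + m ∷ + n′ ∷ + R ∷ + u ∷ + suc e₀ ∷ + (n′ * b) ∷ + w₀ ∷ + N ∷
      + M ∷ + D ∷ + b ∷ + R₀ ∷ + (4 ^ m) ∷ + W ∷ + U ∷ + J ∷ [] × ω′ ≡ ω

    prologue-correct : ∀ {ω} → Term prologue [] ω prologueTime (Ready ω)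
    prologue-correct =
      weaken (ℕ.≤-reflexive (duration b n′ m D k)) (
      compute! 0ℤ refl z≤n ▸ λ { (refl , refl) →
      compute! (+ (d / 20)) (quotient-pos d 20) (ℕ.≤-trans (ℕ.m/n≤m d 20) d≤2^B) ▸ λ { (refl , refl) →
      compute! (+ M) (cong +_ M≡) M≤ ▸ λ { (refl , refl) →
      compute! (+ m) (trans (mul-pos 10 M) (cong +_ m≡)) m≤ ▸ λ { (refl , refl) →
      compute! (+ K) (trans (mul-pos 31 M) (cong +_ K≡)) K≤ ▸ λ { (refl , refl) →
      compute! (+ suc (suc e₀)) (trans (mul-pos 11 M) (cong +_ e≡)) (ℕ.≤-trans e≤K K≤) ▸ λ { (refl , refl) →
      compute! (+ suc e₀) refl (ℕ.≤-trans (ℕ.n≤1+n _) (ℕ.≤-trans e≤K K≤)) ▸ λ { (refl , refl) →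
      compute! (+ (2 * m)) (mul-pos 2 m) (ℕ.≤-trans (ℕ.≤-trans (ℕ.n≤1+n _) (ℕ.≤-reflexive D≡)) D≤) ▸ λ { (refl , refl) →
      compute! (+ D) (cong +_ D≡) D≤ ▸ λ { (refl , refl) →
      compute! (+ (D ∸ d)) (sub-pos d≤D) (ℕ.≤-trans (ℕ.m∸n≤m D d) D≤) ▸ λ { (refl , refl) →
      compute! (+ n′) (cong +_ n′≡) n′≤ ▸ λ { (refl , refl) →
      compute! (+ b) (cong +_ b≡) b≤ ▸ λ { (refl , refl) →
      compute! (+ (n′ * b)) (mul-pos n′ b) b*n′≤ ▸ λ { (refl , refl) →
      compute! (+ 2) refl (small-<64 (+ 2) _) ▸ λ { (refl , refl) →
      compute! (+ b) refl b≤ ▸ λ { (refl , refl) →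
      power-correct 2 b (s≤s z≤n) (ℕ.≤-trans (ℕ.≤-reflexive R≡) R≤) b≤ ▸ λ { (_ , refl , refl) →
      compute! (+ R) (cong +_ R≡) R≤ ▸ λ { (refl , refl) →
      compute! (+ u) (trans (quotient-pos R K) (cong +_ u≡)) (ℕ.≤-trans (ℕ.≤-reflexive (sym u≡)) (ℕ.≤-trans (ℕ.m/n≤m R K) R≤)) ▸ λ { (refl , refl) →
      compute! (+ R) refl R≤ ▸ λ { (refl , refl) →
      compute! (+ n′) refl n′≤ ▸ λ { (refl , refl) →
      power-correct R n′ 1≤R (ℕ.≤-trans (ℕ.≤-reflexive R₀≡) R₀≤) n′≤ ▸ λ { (_ , refl , refl) →
      compute! (+ R₀) (cong +_ R₀≡) R₀≤ ▸ λ { (refl , refl) →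
      compute! (+ 4) refl (small-<64 (+ 4) _) ▸ λ { (refl , refl) →
      compute! (+ m) refl m≤ ▸ λ { (refl , refl) →
      power-correct 4 m (s≤s z≤n) 4^m≤ m≤ ▸ λ { (_ , refl , refl) →
      compute! (+ (4 ^ m)) refl 4^m≤ ▸ λ { (refl , refl) →
      compute! (+ K) refl K≤ ▸ λ { (refl , refl) →
      compute! (+ D) refl D≤ ▸ λ { (refl , refl) →
      power-correct K D (ℕ.>-nonZero⁻¹ K) (ℕ.≤-trans (ℕ.≤-reflexive W≡) W≤) D≤ ▸ λ { (_ , refl , refl) →
      compute! (+ W) (cong +_ W≡) W≤ ▸ λ { (refl , refl) →
      compute! (+ (K * u)) (mul-pos K u) Ku≤ ▸ λ { (refl , refl) →
      compute! (+ n′) refl n′≤ ▸ λ { (refl , refl) →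
      power-correct (K * u) n′ 1≤Ku (ℕ.≤-trans (ℕ.≤-reflexive U≡) U≤) n′≤ ▸ λ { (_ , refl , refl) →
      compute! (+ U) (cong +_ U≡) U≤ ▸ λ { (refl , refl) →
      fallingProduct-correct K D D≤K refl refl K≤ (ℕ.≤-trans (ℕ.≤-reflexive W≡) W≤) ▸ λ { (_ , _ , refl , refl) →
      compute! (+ J) (cong +_ J≡) (ℕ.≤-trans (ℕ.≤-reflexive (sym J≡)) (ℕ.≤-trans (falling-≤ K D) (ℕ.≤-trans (ℕ.≤-reflexive W≡) W≤))) ▸ λ { (refl , refl) →
      initialWeight-correct (suc e₀) m refl refl e+m≤ w-small ▸ λ { (_ , _ , refl , refl) →
      compute! (+ w₀) (cong +_ w₀≡) w₀≤ ▸ λ { (refl , refl) →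
      precision-correct k k≤B 4^k≤ ε-small before after ▸ λ { (_ , _ , refl , refl) →
      compute! (+ (W / J)) (quotient-pos W J) (ℕ.≤-trans (ℕ.m/n≤m W J) W≤) ▸ λ { (refl , refl) →
      compute! (+ suc (W / J)) refl (ℕ.≤-trans (ℕ.m≤m*n (suc (W / J)) (4 ^ k) {{ℕ.m^n≢0 4 k}}) (ℕ.≤-trans (ℕ.≤-reflexive N≡) N≤)) ▸ λ { (refl , refl) →
      compute! (+ N) (trans (mul-pos (suc (W / J)) (4 ^ k)) (cong +_ N≡)) N≤ ▸ λ { (refl , refl) →
      compute! 1ℤ refl (small-<64 1ℤ _) ▸ λ { (refl , refl) →
      finish (_ , _ , _ , _ , refl , refl) } } } } } } } } } } } } } } } } } } } } } } } } } } } } } } } } } } } } } } } } } } })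
      where
      duration : ∀ b n′ m D k → 15 + (4 * b + 3 + (4 + (4 * n′ + 3 + (3 + (4 * m + 3 + (3 + (4 * D + 3 + (3 + (4 * n′ + 3 + (1 + (5 * D + 4 + (1 + (6 * m + 3 + (1 + (5 * k + 4 + 5))))))))))))))) ≡
        62 + 4 * (b + n′ + m + D + n′) + 5 * D + 6 * m + 5 * k
      duration = ℕRing.solve-∀

      D≤ : D ≤ 2 ^ B
      D≤ = ℕ.≤-trans D≤K K≤

      m≤ : m ≤ 2 ^ B
      m≤ = ℕ.≤-trans (ℕ.m≤n*m m 2) (ℕ.≤-trans (ℕ.≤-trans (ℕ.n≤1+n (2 * m)) (ℕ.≤-reflexive D≡)) D≤)

      M≤ : M ≤ 2 ^ B
      M≤ = ℕ.≤-trans (ℕ.m≤n*m M 31) (ℕ.≤-trans (ℕ.≤-reflexive K≡) K≤)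

      n′≤ : n′ ≤ 2 ^ B
      n′≤ = ℕ.≤-trans (ℕ.≤-trans (ℕ.m≤m+n n′ K) (ℕ.≤-reflexive b≡)) b≤

      e≤K : suc (suc e₀) ≤ K
      e≤K = subst₂ _≤_ e≡ K≡ (ℕ.*-monoˡ-≤ M (ℕ.m≤m+n 11 20))

      e+m≤ : suc e₀ + m ≤ 2 ^ B
      e+m≤ = ℕ.≤-trans (ℕ.≤-trans (ℕ.+-monoˡ-≤ m (ℕ.n≤1+n (suc e₀))) (ℕ.≤-trans (ℕ.≤-reflexive (cong₂ _+_ (sym e≡) (sym m≡)))
              (ℕ.≤-trans (ℕ.≤-reflexive (sym (ℕ.*-distribʳ-+ M 11 10))) (ℕ.≤-trans (ℕ.*-monoˡ-≤ M (ℕ.m≤m+n 21 10)) (ℕ.≤-reflexive K≡))))) K≤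

∑-cong : ∀ n {f g} → (∀ i → i < n → f i ≡ g i) → ∑ n f ≡ ∑ n g
∑-cong zero    f≡g = refl
∑-cong (suc n) f≡g = cong₂ ℤ._+_ (∑-cong n (λ i i<n → f≡g i (ℕ.m≤n⇒m≤1+n i<n))) (f≡g n ℕ.≤-refl)

∏-cong : ∀ n {f g} → (∀ i → i < n → f i ≡ g i) → ∏ n f ≡ ∏ n g
∏-cong zero    f≡g = refl
∏-cong (suc n) f≡g = cong₂ ℤ._*_ (∏-cong n (λ i i<n → f≡g i (ℕ.m≤n⇒m≤1+n i<n))) (f≡g n ℕ.≤-refl)

∑-+ : ∀ a b f → ∑ (a + b) f ≡ ∑ a f ℤ.+ ∑ b (λ i → f (a + i))
∑-+ a zero    f = trans (cong (λ k → ∑ k f) (ℕ.+-identityʳ a)) (sym (ℤ.+-identityʳ (∑ a f)))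
∑-+ a (suc b) f = trans (cong (λ k → ∑ k f) (ℕ.+-suc a b))
  (trans (cong (ℤ._+ f (a + b)) (∑-+ a b f)) (ℤ.+-assoc (∑ a f) (∑ b (λ i → f (a + i))) (f (a + b))))

∑-*ˡ : ∀ n x f → ∑ n (λ i → x ℤ.* f i) ≡ x ℤ.* ∑ n f
∑-*ˡ zero    x f = sym (ℤ.*-zeroʳ x)
∑-*ˡ (suc n) x f = trans (cong (ℤ._+ x ℤ.* f n) (∑-*ˡ n x f)) (sym (ℤ.*-distribˡ-+ x (∑ n f) (f n)))

∑-*ʳ : ∀ n x f → ∑ n (λ i → f i ℤ.* x) ≡ ∑ n f ℤ.* x
∑-*ʳ n x f = trans (∑-cong n (λ i _ → ℤ.*-comm (f i) x)) (trans (∑-*ˡ n x f) (ℤ.*-comm x (∑ n f)))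

∑-distrib : ∀ n f g → ∑ n (λ i → f i ℤ.+ g i) ≡ ∑ n f ℤ.+ ∑ n g
∑-distrib zero    f g = refl
∑-distrib (suc n) f g = trans (cong (ℤ._+ (f n ℤ.+ g n)) (∑-distrib n f g)) (swap (∑ n f) (∑ n g) (f n) (g n))
  where
  swap : ∀ a b c e → (a ℤ.+ b) ℤ.+ (c ℤ.+ e) ≡ (a ℤ.+ c) ℤ.+ (b ℤ.+ e)
  swap = ℤRing.solve-∀

∑-const : ∀ n x → ∑ n (λ _ → x) ≡ + n ℤ.* x
∑-const zero    x = refl
∑-const (suc n) x = trans (cong (ℤ._+ x) (∑-const n x)) (step (+ n) x)
  where
  step : ∀ n x → n ℤ.* x ℤ.+ x ≡ (1ℤ ℤ.+ n) ℤ.* x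
  step = ℤRing.solve-∀

∑-zero : ∀ n f → (∀ i → i < n → f i ≡ 0ℤ) → ∑ n f ≡ 0ℤ
∑-zero n f f≡0 = trans (∑-cong n f≡0) (trans (∑-const n 0ℤ) (ℤ.*-zeroʳ (+ n)))

∏-front : ∀ n f → ∏ (suc n) f ≡ f 0 ℤ.* ∏ n (f ∘ suc)
∏-front zero    f = ℤ.*-comm 1ℤ (f 0)
∏-front (suc n) f = trans (cong (ℤ._* f (suc n)) (∏-front n f)) (ℤ.*-assoc (f 0) (∏ n (f ∘ suc)) (f (suc n)))

∏-distrib : ∀ n f g → ∏ n (λ i → f i ℤ.* g i) ≡ ∏ n f ℤ.* ∏ n g
∏-distrib zero    f g = refl
∏-distrib (suc n) f g = trans (cong (ℤ._* (f n ℤ.* g n)) (∏-distrib n f g)) (swap (∏ n f) (∏ n g) (f n) (g n))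
  where
  swap : ∀ a b c e → (a ℤ.* b) ℤ.* (c ℤ.* e) ≡ (a ℤ.* c) ℤ.* (b ℤ.* e)
  swap = ℤRing.solve-∀

∏-ones : ∀ n f → (∀ i → i < n → f i ≡ 1ℤ) → ∏ n f ≡ 1ℤ
∏-ones zero    f f≡1 = refl
∏-ones (suc n) f f≡1 = cong₂ ℤ._*_ (∏-ones n f (λ i i<n → f≡1 i (ℕ.m≤n⇒m≤1+n i<n))) (f≡1 n ℕ.≤-refl)

∏-zero : ∀ n f c → c < n → f c ≡ 0ℤ → ∏ n f ≡ 0ℤ
∏-zero (suc n) f c c<sn fc≡0 with c ℕ.≟ n
... | yes refl = trans (cong (∏ n f ℤ.*_) fc≡0) (ℤ.*-zeroʳ (∏ n f))
... | no  c≢n  = cong (ℤ._* f n) (∏-zero n f c (ℕ.≤∧≢⇒< (ℕ.≤-pred c<sn) c≢n) fc≡0)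

value±-* : ∀ s t → value± (s Sign.* t) ≡ value± s ℤ.* value± t
value±-* Sign.+ Sign.+ = refl
value±-* Sign.+ Sign.- = refl
value±-* Sign.- Sign.+ = refl
value±-* Sign.- Sign.- = refl

1^n≡1 : ∀ e → 1ℤ ℤ.^ e ≡ 1ℤ
1^n≡1 = ℤ.^-zeroˡ

value±-alternate : ∀ e → -1ℤ ℤ.^ e ≡ value± (alternate e)
value±-alternate zero    = refl
value±-alternate (suc e) = trans (cong (-1ℤ ℤ.*_) (value±-alternate e)) (sym (value±-* Sign.- (alternate e)))

signMonomial : ℕ → (ℕ → Sign) → (ℕ → ℕ) → ℤ
signMonomial K s β = ∏ K (λ c → value± (s c) ℤ.^ β c)

-- ∑ of (-1)^(β restricted to I) over the j-element subsets I of {0, …, c - 1}.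
subsetSum : (ℕ → ℕ) → ℕ → ℕ → ℤ
subsetSum β zero    zero    = 1ℤ
subsetSum β zero    (suc j) = 0ℤ
subsetSum β (suc c) zero    = subsetSum β c zero
subsetSum β (suc c) (suc j) = subsetSum β c (suc j) ℤ.+ value± (alternate (β c)) ℤ.* subsetSum β c j

signAt-outside : ∀ c j idx {c₀} → c ≤ c₀ → signAt c j idx c₀ ≡ Sign.+
signAt-outside zero    j idx _ = refl
signAt-outside (suc c) j idx {c₀} c<c₀ with idx <ᵇ binom c j
... | true  = signAt-outside c j idx (ℕ.<⇒≤ c<c₀)
... | false with c ≡ᵇ c₀ in e
...   | true  = contradiction (ℕ.≡ᵇ⇒≡ c c₀ (≡→T e)) (ℕ.<⇒≢ c<c₀)
...   | false = signAt-outside c (j ∸ 1) (idx ∸ binom c j) (ℕ.<⇒≤ c<c₀)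

signAt-avoid : ∀ c j idx c₀ → idx < binom c j → signAt (suc c) j idx c₀ ≡ signAt c j idx c₀
signAt-avoid c j idx c₀ idx< = cong (λ b → if b then signAt c j idx c₀ else (if c ≡ᵇ c₀ then Sign.- else Sign.+) Sign.* signAt c (j ∸ 1) (idx ∸ binom c j) c₀) (T→≡ (ℕ.<⇒<ᵇ idx<))

signAt-take : ∀ c j i c₀ → signAt (suc c) (suc j) (binom c (suc j) + i) c₀ ≡
              (if c ≡ᵇ c₀ then Sign.- else Sign.+) Sign.* signAt c j i c₀
signAt-take c j i c₀ = trans
  (cong (λ b → if b then signAt c (suc j) (binom c (suc j) + i) c₀ else rest) (<ᵇ-false (ℕ.m≤m+n (binom c (suc j)) i)))
  (cong (λ k → (if c ≡ᵇ c₀ then Sign.- else Sign.+) Sign.* signAt c j k c₀) (ℕ.m+n∸m≡n (binom c (suc j)) i))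
  where rest = (if c ≡ᵇ c₀ then Sign.- else Sign.+) Sign.* signAt c j (binom c (suc j) + i ∸ binom c (suc j)) c₀

≡ᵇ-refl : ∀ c → (c ≡ᵇ c) ≡ true
≡ᵇ-refl c = T→≡ (ℕ.≡⇒≡ᵇ c c refl)

≡ᵇ-false : ∀ {a b} → a ≢ b → (a ≡ᵇ b) ≡ false
≡ᵇ-false {a} {b} a≢b with a ≡ᵇ b in e
... | true  = contradiction (ℕ.≡ᵇ⇒≡ a b (≡→T e)) a≢b
... | false = refl

signMonomial-avoid : ∀ c j idx β → idx < binom c j →
  signMonomial (suc c) (signAt (suc c) j idx) β ≡ signMonomial c (signAt c j idx) β
signMonomial-avoid c j idx β idx< = trans
  (cong₂ ℤ._*_ (∏-cong c (λ c₀ _ → cong (λ s → value± s ℤ.^ β c₀) (signAt-avoid c j idx c₀ idx<)))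
    (trans (cong (λ s → value± s ℤ.^ β c) (trans (signAt-avoid c j idx c idx<) (signAt-outside c j idx ℕ.≤-refl))) (1^n≡1 (β c))))
  (ℤ.*-identityʳ _)

signMonomial-take : ∀ c j i β →
  signMonomial (suc c) (signAt (suc c) (suc j) (binom c (suc j) + i)) β ≡ value± (alternate (β c)) ℤ.* signMonomial c (signAt c j i) β
signMonomial-take c j i β = trans
  (cong₂ ℤ._*_ (∏-cong c (λ c₀ c₀<c → cong (λ s → value± s ℤ.^ β c₀) (trans (signAt-take c j i c₀)
      (cong (λ b → (if b then Sign.- else Sign.+) Sign.* signAt c j i c₀) (≡ᵇ-false (ℕ.<⇒≢ c₀<c ∘ sym))))))
    (trans (cong (λ s → value± s ℤ.^ β c) (trans (signAt-take c j i c)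
      (cong₂ (λ b s → (if b then Sign.- else Sign.+) Sign.* s) (≡ᵇ-refl c) (signAt-outside c j i ℕ.≤-refl)))) (value±-alternate (β c))))
  (ℤ.*-comm _ (value± (alternate (β c))))

∑-signMonomial : ∀ c j β → ∑ (binom c j) (λ idx → signMonomial c (signAt c j idx) β) ≡ subsetSum β c j
∑-signMonomial zero    zero    β = refl
∑-signMonomial zero    (suc j) β = refl
∑-signMonomial (suc c) zero    β = trans (cong (ℤ._+_ 0ℤ) (signMonomial-avoid c 0 0 β (s≤s z≤n))) (∑-signMonomial c zero β)
∑-signMonomial (suc c) (suc j) β = begin
  ∑ (binom c j + binom c (suc j)) f                        ≡⟨ cong (λ k → ∑ k f) (ℕ.+-comm (binom c j) (binom c (suc j))) ⟩
  ∑ (binom c (suc j) + binom c j) f                        ≡⟨ ∑-+ (binom c (suc j)) (binom c j) f ⟩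
  ∑ (binom c (suc j)) f ℤ.+ ∑ (binom c j) (λ i → f (binom c (suc j) + i))
    ≡⟨ cong₂ ℤ._+_ (trans (∑-cong (binom c (suc j)) (λ i i< → signMonomial-avoid c (suc j) i β i<)) (∑-signMonomial c (suc j) β))
         (trans (∑-cong (binom c j) (λ i _ → signMonomial-take c j i β))
           (trans (∑-*ˡ (binom c j) (value± (alternate (β c))) _) (cong (value± (alternate (β c)) ℤ.*_) (∑-signMonomial c j β)))) ⟩
  subsetSum β (suc c) (suc j) ∎
  where
  open ≡-Reasoning
  f = λ idx → signMonomial (suc c) (signAt (suc c) (suc j) idx) β

delay : (ℕ → ℤ) → ℕ → ℤ
delay h zero    = 0ℤ
delay h (suc i) = h i

-- Multiplication of the generating function of h by 1 - s t.
twist : Sign → (ℕ → ℤ) → ℕ → ℤ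
twist s h i = h i ℤ.- value± s ℤ.* delay h i

twist-cong : ∀ s {g h} → g ≗ h → twist s g ≗ twist s h
twist-cong s g≗h zero    = cong (λ z → z ℤ.- value± s ℤ.* 0ℤ) (g≗h 0)
twist-cong s g≗h (suc i) = cong₂ (λ y z → y ℤ.- value± s ℤ.* z) (g≗h (suc i)) (g≗h i)

twist-comm : ∀ s t h → twist s (twist t h) ≗ twist t (twist s h)
twist-comm s t h zero          = lemma (value± s) (value± t) (h 0)
  where
  lemma : ∀ s t x → (x ℤ.- t ℤ.* 0ℤ) ℤ.- s ℤ.* 0ℤ ≡ (x ℤ.- s ℤ.* 0ℤ) ℤ.- t ℤ.* 0ℤ
  lemma = ℤRing.solve-∀
twist-comm s t h (suc zero)    = lemma (value± s) (value± t) (h 1) (h 0)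
  where
  lemma : ∀ s t x y → (x ℤ.- t ℤ.* y) ℤ.- s ℤ.* (y ℤ.- t ℤ.* 0ℤ) ≡ (x ℤ.- s ℤ.* y) ℤ.- t ℤ.* (y ℤ.- s ℤ.* 0ℤ)
  lemma = ℤRing.solve-∀
twist-comm s t h (suc (suc i)) = lemma (value± s) (value± t) (h (suc (suc i))) (h (suc i)) (h i)
  where
  lemma : ∀ s t x y z → (x ℤ.- t ℤ.* y) ℤ.- s ℤ.* (y ℤ.- t ℤ.* z) ≡ (x ℤ.- s ℤ.* y) ℤ.- t ℤ.* (y ℤ.- s ℤ.* z)
  lemma = ℤRing.solve-∀

twists : Sign → ℕ → (ℕ → ℤ) → ℕ → ℤ
twists s zero    h = h
twists s (suc k) h = twist s (twists s k h)

twists-cong : ∀ s k {g h} → g ≗ h → twists s k g ≗ twists s k h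
twists-cong s zero    g≗h = g≗h
twists-cong s (suc k) g≗h = twist-cong s (twists-cong s k g≗h)

twists-twist : ∀ s k t h → twists s k (twist t h) ≗ twist t (twists s k h)
twists-twist s zero    t h i = refl
twists-twist s (suc k) t h i = trans (twist-cong s (twists-twist s k t h) i) (twist-comm s t (twists s k h) i)

twistAll : ℕ → (ℕ → ℕ) → (ℕ → ℤ) → ℕ → ℤ
twistAll zero    β h = h
twistAll (suc c) β h = twistAll c β (twist (alternate (β c)) h)

weightedSum : ℕ → ℕ → (ℕ → ℤ) → (ℕ → ℕ) → ℤ
weightedSum c m h β = ∑ (suc m) (λ j → value± (alternate j) ℤ.* h (m ∸ j) ℤ.* subsetSum β c j)

value±-neg : ∀ s → value± (Sign.- Sign.* s) ≡ ℤ.- value± s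
value±-neg Sign.+ = refl
value±-neg Sign.- = refl

weightedSum-suc : ∀ c m h β → weightedSum (suc c) m h β ≡ weightedSum c m (twist (alternate (β c)) h) β
weightedSum-suc c m h β = trans (partial m ℕ.≤-refl) (trans (cong (λ z → after m ℤ.+ value± (alternate m) ℤ.* σ ℤ.* delay h z ℤ.* subsetSum β c m) (ℕ.n∸n≡0 m))
    (trans (cong (ℤ._+_ (after m)) (cong (ℤ._* subsetSum β c m) (ℤ.*-zeroʳ (value± (alternate m) ℤ.* σ)))) (ℤ.+-identityʳ (after m))))
  where
  σ = value± (alternate (β c))
  before after : ℕ → ℤ
  before J = ∑ (suc J) (λ j → value± (alternate j) ℤ.* h (m ∸ j) ℤ.* subsetSum β (suc c) j)
  after J = ∑ (suc J) (λ j → value± (alternate j) ℤ.* twist (alternate (β c)) h (m ∸ j) ℤ.* subsetSum β c j)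

  partial : ∀ J → J ≤ m → before J ≡ after J ℤ.+ value± (alternate J) ℤ.* σ ℤ.* delay h (m ∸ J) ℤ.* subsetSum β c J
  partial zero    _   = lemma σ (h m) (delay h m) (subsetSum β c 0)
    where
    lemma : ∀ σ x y a → 0ℤ ℤ.+ 1ℤ ℤ.* x ℤ.* a ≡ 0ℤ ℤ.+ 1ℤ ℤ.* (x ℤ.- σ ℤ.* y) ℤ.* a ℤ.+ 1ℤ ℤ.* σ ℤ.* y ℤ.* a
    lemma = ℤRing.solve-∀
  partial (suc J) J<m = trans (cong (ℤ._+ value± (alternate (suc J)) ℤ.* h (m ∸ suc J) ℤ.* subsetSum β (suc c) (suc J)) (partial J (ℕ.<⇒≤ J<m)))
    (trans (cong₂ (λ z k → after J ℤ.+ value± (alternate J) ℤ.* σ ℤ.* delay h k ℤ.* subsetSum β c J ℤ.+ z ℤ.* h (m ∸ suc J) ℤ.* subsetSum β (suc c) (suc J)) (value±-neg (alternate J)) (ℕ.+-∸-assoc 1 J<m))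
      (trans (lemma (after J) (value± (alternate J)) σ (h (m ∸ suc J)) (delay h (m ∸ suc J)) (subsetSum β c J) (subsetSum β c (suc J)))
        (cong (λ z → after J ℤ.+ z ℤ.* (h (m ∸ suc J) ℤ.- σ ℤ.* delay h (m ∸ suc J)) ℤ.* subsetSum β c (suc J) ℤ.+ z ℤ.* σ ℤ.* delay h (m ∸ suc J) ℤ.* subsetSum β c (suc J)) (sym (value±-neg (alternate J))))))
    where
    lemma : ∀ S v σ x y a b → S ℤ.+ v ℤ.* σ ℤ.* x ℤ.* a ℤ.+ (ℤ.- v) ℤ.* x ℤ.* (b ℤ.+ σ ℤ.* a) ≡
      S ℤ.+ (ℤ.- v) ℤ.* (x ℤ.- σ ℤ.* y) ℤ.* b ℤ.+ (ℤ.- v) ℤ.* σ ℤ.* y ℤ.* b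
    lemma = ℤRing.solve-∀

weightedSum-twistAll : ∀ c m h β → weightedSum c m h β ≡ twistAll c β h m
weightedSum-twistAll zero    m h β = trans (only m) (cong (ℤ._* 1ℤ) (ℤ.*-identityˡ (h m)) ⟨ trans ⟩ ℤ.*-identityʳ (h m))
  where
  open import Function.Base using (_⟨_⟩_)
  only : ∀ J → ∑ (suc J) (λ j → value± (alternate j) ℤ.* h (m ∸ j) ℤ.* subsetSum β 0 j) ≡ 1ℤ ℤ.* h m ℤ.* 1ℤ
  only zero    = ℤ.+-identityˡ _
  only (suc J) = trans (cong₂ ℤ._+_ (only J) (ℤ.*-zeroʳ (value± (alternate (suc J)) ℤ.* h (m ∸ suc J)))) (ℤ.+-identityʳ _)
weightedSum-twistAll (suc c) m h β = trans (weightedSum-suc c m h β) (weightedSum-twistAll c m (twist (alternate (β c)) h) β)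

plus minus : Sign → ℕ
plus  Sign.+ = 1
plus  Sign.- = 0
minus Sign.+ = 0
minus Sign.- = 1

evens odds halves : ℕ → (ℕ → ℕ) → ℕ
evens zero    β = 0
evens (suc c) β = plus (alternate (β c)) + evens c β
odds zero    β = 0
odds (suc c) β = minus (alternate (β c)) + odds c β
halves zero    β = 0
halves (suc c) β = ℕ.⌊ β c /2⌋ + halves c β

sumℕ : ℕ → (ℕ → ℕ) → ℕ
sumℕ zero    f = 0
sumℕ (suc n) f = sumℕ n f + f n

twistAll-count : ∀ c β h → twistAll c β h ≗ twists Sign.- (odds c β) (twists Sign.+ (evens c β) h)
twistAll-count zero    β h i = refl
twistAll-count (suc c) β h i with alternate (β c)
... | Sign.+ = trans (twistAll-count c β (twist Sign.+ h) i)
                 (twists-cong Sign.- (odds c β) (twists-twist Sign.+ (evens c β) Sign.+ h) i)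
... | Sign.- = trans (twistAll-count c β (twist Sign.- h) i)
                 (trans (twists-cong Sign.- (odds c β) (twists-twist Sign.+ (evens c β) Sign.- h) i)
                        (twists-twist Sign.- (odds c β) Sign.- (twists Sign.+ (evens c β) h) i))

odds+evens : ∀ c β → odds c β + evens c β ≡ c
odds+evens zero    β = refl
odds+evens (suc c) β with alternate (β c)
... | Sign.+ = trans (ℕ.+-suc (odds c β) (evens c β)) (cong suc (odds+evens c β))
... | Sign.- = cong suc (odds+evens c β)

alternate-2+ : ∀ e → alternate (suc (suc e)) ≡ alternate e
alternate-2+ e with alternate e
... | Sign.+ = refl
... | Sign.- = refl

parity-half : ∀ e → minus (alternate e) + 2 * ℕ.⌊ e /2⌋ ≡ e
parity-half zero          = refl
parity-half (suc zero)    = refl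
parity-half (suc (suc e)) = trans (cong (λ s → minus s + 2 * suc ℕ.⌊ e /2⌋) (alternate-2+ e))
  (trans (shuffle (minus (alternate e)) ℕ.⌊ e /2⌋) (cong (λ x → suc (suc x)) (parity-half e)))
  where
  shuffle : ∀ x y → x + 2 * suc y ≡ suc (suc (x + 2 * y))
  shuffle = ℕRing.solve-∀

sum-parity : ∀ c β → odds c β + 2 * halves c β ≡ sumℕ c β
sum-parity zero    β = refl
sum-parity (suc c) β = trans (shuffle (minus (alternate (β c))) (odds c β) ℕ.⌊ β c /2⌋ (halves c β))
  (cong₂ _+_ (sum-parity c β) (parity-half (β c)))
  where
  shuffle : ∀ x y a b → x + y + 2 * (a + b) ≡ y + 2 * b + (x + 2 * a)
  shuffle = ℕRing.solve-∀

atMostOne : ℕ → ℤ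
atMostOne zero          = 1ℤ
atMostOne (suc zero)    = 1ℤ
atMostOne (suc (suc _)) = 0ℤ

atMostOne-half : ∀ e → ℕ.⌊ e /2⌋ ≡ 0 → atMostOne e ≡ 1ℤ
atMostOne-half zero       _ = refl
atMostOne-half (suc zero) _ = refl

atMostOne-half-suc : ∀ e {x} → ℕ.⌊ e /2⌋ ≡ suc x → atMostOne e ≡ 0ℤ
atMostOne-half-suc (suc (suc e)) _ = refl

squarefree : ℕ → (ℕ → ℕ) → ℤ
squarefree c β = ∏ c (atMostOne ∘ β)

squarefree-yes : ∀ c β → halves c β ≡ 0 → squarefree c β ≡ 1ℤ
squarefree-yes zero    β _  = refl
squarefree-yes (suc c) β eq0 = cong₂ ℤ._*_ (squarefree-yes c β (ℕ.m+n≡0⇒n≡0 ℕ.⌊ β c /2⌋ eq0)) (atMostOne-half (β c) (ℕ.m+n≡0⇒m≡0 ℕ.⌊ β c /2⌋ eq0))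

squarefree-no : ∀ c β {x} → halves c β ≡ suc x → squarefree c β ≡ 0ℤ
squarefree-no (suc c) β eqs with ℕ.⌊ β c /2⌋ in half
... | suc y = trans (cong (squarefree c β ℤ.*_) (atMostOne-half-suc (β c) half)) (ℤ.*-zeroʳ (squarefree c β))
... | zero  = cong (ℤ._* atMostOne (β c)) (squarefree-no c β eqs)

-- The coefficients of (1 - t)⁻ʳ.
series : ℕ → ℕ → ℤ
series zero    zero    = 1ℤ
series zero    (suc i) = 0ℤ
series (suc r) i       = + binom (r + i) i

binom-diag : ∀ i → binom i i ≡ 1
binom-diag zero    = refl
binom-diag (suc i) = trans (cong₂ _+_ (binom-diag i) (binom-zero i (suc i) ℕ.≤-refl)) refl

twist-series : ∀ r → twist Sign.+ (series (suc r)) ≗ series r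
twist-series zero    zero    = refl
twist-series (suc r) zero    = refl
twist-series r       (suc i) rewrite ℕ.+-suc r i = trans (cancel (+ binom (r + i) i) (+ binom (r + i) (suc i))) (last r)
  where
  cancel : ∀ x y → (x ℤ.+ y) ℤ.- 1ℤ ℤ.* x ≡ y
  cancel = ℤRing.solve-∀
  last : ∀ r → + binom (r + i) (suc i) ≡ series r (suc i)
  last zero    = cong +_ (binom-zero i (suc i) ℕ.≤-refl)
  last (suc r) = cong (λ k → + binom k (suc i)) (sym (ℕ.+-suc r i))

twists-series : ∀ k r → twists Sign.+ k (series (k + r)) ≗ series r
twists-series zero    r i = refl
twists-series (suc k) r i = trans (sym (twists-twist Sign.+ k Sign.+ (series (suc (k + r))) i))
  (trans (twists-cong Sign.+ k (twist-series (k + r)) i) (twists-series k r i))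

Complementary : ℕ → ℤ → (ℕ → ℤ) → Set
Complementary N C p = (∀ i j → suc (i + j) ≡ N → p i ℤ.+ p j ≡ C) × (∀ i → N ≤ i → p i ≡ C)

complementary-twist : ∀ {N C p} → Complementary N C p → Complementary (suc N) (+ 2 ℤ.* C) (twist Sign.- p)
complementary-twist {N} {C} {p} (pair , tail) = pair′ , tail′
  where
  sum-pair : ∀ a b x y → a ℤ.+ y ≡ C → x ℤ.+ b ≡ C → (a ℤ.- -1ℤ ℤ.* b) ℤ.+ (x ℤ.- -1ℤ ℤ.* y) ≡ + 2 ℤ.* C
  sum-pair a b x y e₁ e₂ = trans (regroup a b x y) (trans (cong₂ ℤ._+_ e₁ e₂) (double C))
    where
    regroup : ∀ a b x y → (a ℤ.- -1ℤ ℤ.* b) ℤ.+ (x ℤ.- -1ℤ ℤ.* y) ≡ (a ℤ.+ y) ℤ.+ (x ℤ.+ b)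
    regroup = ℤRing.solve-∀
    double : ∀ c → c ℤ.+ c ≡ + 2 ℤ.* c
    double = ℤRing.solve-∀
  pair′ : ∀ i j → suc (i + j) ≡ suc N → twist Sign.- p i ℤ.+ twist Sign.- p j ≡ + 2 ℤ.* C
  pair′ zero    zero    refl = sum-pair (p 0) 0ℤ (p 0) 0ℤ (trans (ℤ.+-identityʳ (p 0)) (tail 0 z≤n)) (trans (ℤ.+-identityʳ (p 0)) (tail 0 z≤n))
  pair′ zero    (suc j) refl = sum-pair (p 0) 0ℤ (p (suc j)) (p j) (pair 0 j refl) (trans (ℤ.+-identityʳ (p (suc j))) (tail (suc j) ℕ.≤-refl))
  pair′ (suc i) zero    e = sum-pair (p (suc i)) (p i) (p 0) 0ℤ (trans (ℤ.+-identityʳ (p (suc i))) (tail (suc i) (ℕ.≤-reflexive (trans (sym (ℕ.suc-injective e)) (cong suc (ℕ.+-identityʳ i))))))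
      (trans (ℤ.+-comm (p 0) (p i)) (pair i 0 (ℕ.suc-injective e)))
  pair′ (suc i) (suc j) e = sum-pair (p (suc i)) (p i) (p (suc j)) (p j) (pair (suc i) j (trans (cong suc (sym (ℕ.+-suc i j))) (ℕ.suc-injective e)))
      (trans (ℤ.+-comm (p (suc j)) (p i)) (pair i (suc j) (ℕ.suc-injective e)))
  tail′ : ∀ i → suc N ≤ i → twist Sign.- p i ≡ + 2 ℤ.* C
  tail′ (suc i) (s≤s N≤i) = trans (cong₂ (λ x y → x ℤ.- -1ℤ ℤ.* y) (tail (suc i) (ℕ.m≤n⇒m≤1+n N≤i)) (tail i N≤i)) (double C)
    where
    double : ∀ c → c ℤ.- -1ℤ ℤ.* c ≡ + 2 ℤ.* c
    double = ℤRing.solve-∀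

complementary-twists : ∀ k → Complementary k ((+ 2) ℤ.^ k) (twists Sign.- k (series 1))
complementary-twists zero    = (λ i j ()) , λ i _ → cong +_ (binom-diag i)
complementary-twists (suc k) = complementary-twist (complementary-twists k)

Palindromic : ℕ → Sign → (ℕ → ℤ) → Set
Palindromic N s a = (∀ i j → i + j ≡ N → a i ≡ value± s ℤ.* a j) × (∀ i → N < i → a i ≡ 0ℤ)

palindromic-twist : ∀ t {N s a} → Palindromic N s a → Palindromic (suc N) (Sign.- Sign.* t Sign.* s) (twist t a)
palindromic-twist t {N} {s} {a} (pair , tail) = pair′ , tail′
  where
  combine : ∀ x y z w → x ≡ value± s ℤ.* w → y ≡ value± s ℤ.* z → x ℤ.- value± t ℤ.* y ≡ value± (Sign.- Sign.* t Sign.* s) ℤ.* (z ℤ.- value± t ℤ.* w)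
  combine x y z w refl refl = trans (expand t z w) (cong (ℤ._* (z ℤ.- value± t ℤ.* w)) (sym (trans (value±-* (Sign.- Sign.* t) s) (cong (ℤ._* value± s) (value±-neg t)))))
    where
    expand : ∀ t z w → value± s ℤ.* w ℤ.- value± t ℤ.* (value± s ℤ.* z) ≡ (ℤ.- value± t) ℤ.* value± s ℤ.* (z ℤ.- value± t ℤ.* w)
    expand Sign.+ z w = lemma (value± s) z w
      where
      lemma : ∀ s z w → s ℤ.* w ℤ.- 1ℤ ℤ.* (s ℤ.* z) ≡ (ℤ.- 1ℤ) ℤ.* s ℤ.* (z ℤ.- 1ℤ ℤ.* w)
      lemma = ℤRing.solve-∀
    expand Sign.- z w = lemma (value± s) z w
      where
      lemma : ∀ s z w → s ℤ.* w ℤ.- -1ℤ ℤ.* (s ℤ.* z) ≡ (ℤ.- -1ℤ) ℤ.* s ℤ.* (z ℤ.- -1ℤ ℤ.* w)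
      lemma = ℤRing.solve-∀
  vanish : ∀ i → N < i → 0ℤ ≡ value± s ℤ.* a i
  vanish i N<i = sym (trans (cong (value± s ℤ.*_) (tail i N<i)) (ℤ.*-zeroʳ (value± s)))
  pair′ : ∀ i j → i + j ≡ suc N → twist t a i ≡ value± (Sign.- Sign.* t Sign.* s) ℤ.* twist t a j
  pair′ zero    (suc j) refl = combine (a 0) 0ℤ (a (suc j)) (a j) (pair 0 j refl) (vanish (suc j) ℕ.≤-refl)
  pair′ (suc i) zero    e = combine (a (suc i)) (a i) (a 0) 0ℤ (trans (tail (suc i) (ℕ.≤-reflexive (trans (sym e) (ℕ.+-identityʳ (suc i))))) (sym (ℤ.*-zeroʳ (value± s)))) (pair i 0 (ℕ.suc-injective e))
  pair′ (suc i) (suc j) e = combine (a (suc i)) (a i) (a (suc j)) (a j) (pair (suc i) j (trans (sym (ℕ.+-suc i j)) (ℕ.suc-injective e))) (pair i (suc j) (ℕ.suc-injective e))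
  tail′ : ∀ i → suc N < i → twist t a i ≡ 0ℤ
  tail′ (suc i) (s≤s N<i) = trans (cong₂ (λ x y → x ℤ.- value± t ℤ.* y) (tail (suc i) (ℕ.m≤n⇒m≤1+n N<i)) (tail i N<i)) (cong (λ z → 0ℤ ℤ.- z) (ℤ.*-zeroʳ (value± t)))

palindromic-series : Palindromic 0 Sign.+ (series 0)
palindromic-series = (λ { zero zero _ → refl }) , λ { (suc i) _ → refl }

palindromic-+ : ∀ k → Palindromic k (alternate k) (twists Sign.+ k (series 0))
palindromic-+ zero    = palindromic-series
palindromic-+ (suc k) = palindromic-twist Sign.+ {k} {alternate k} (palindromic-+ k)

palindromic-- : ∀ k {N s a} → Palindromic N s a → Palindromic (k + N) s (twists Sign.- k a)
palindromic-- zero    p = p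
palindromic-- (suc k) {N} {s} p = palindromic-twist Sign.- {k + N} {s} (palindromic-- k {N} {s} p)

alternate-double : ∀ x → alternate (2 * x) ≡ Sign.+
alternate-double zero    = refl
alternate-double (suc x) = trans (cong alternate (ℕ.+-suc (suc x) (x + 0))) (trans (alternate-2+ (x + (x + 0))) (alternate-double x))

-- Lee's Waring decomposition of the elementary symmetric polynomial of degree
-- 2m + 1, read as a statement about sums over the sign vectors with at most m
-- negative entries.
lee : ∀ e m β → sumℕ (suc (2 * m) + e) β ≡ suc (2 * m) →
  weightedSum (suc (2 * m) + e) m (series (suc e)) β ≡ + (4 ^ m) ℤ.* squarefree (suc (2 * m) + e) β
lee e m β Σβ≡ = trans (weightedSum-twistAll K m (series (suc e)) β) (trans (twistAll-count K β (series (suc e)) m) (by-halves (halves K β) refl))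
  where
  K = suc (2 * m) + e
  odd-part = odds K β
  even-part = evens K β

  by-halves : ∀ x → halves K β ≡ x → twists Sign.- odd-part (twists Sign.+ even-part (series (suc e))) m ≡ + (4 ^ m) ℤ.* squarefree K β
  by-halves zero halves≡ = trans (twists-cong Sign.- odd-part (λ i → trans (cong (λ k → twists Sign.+ k (series (suc e)) i) evens≡) (trans (cong (λ r → twists Sign.+ e (series r) i) (sym (ℕ.+-comm e 1))) (twists-series e 1 i))) m)
    (trans (cong (λ k → twists Sign.- k (series 1) m) odds≡) (trans middle (sym (trans (cong (+ (4 ^ m) ℤ.*_) (squarefree-yes K β halves≡)) (ℤ.*-identityʳ _)))))
    where
    odds≡ : odd-part ≡ suc (2 * m)
    odds≡ = trans (sym (trans (cong (λ x → odd-part + 2 * x) halves≡) (ℕ.+-identityʳ odd-part))) (trans (sum-parity K β) Σβ≡)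
    evens≡ : even-part ≡ e
    evens≡ = ℕ.+-cancelˡ-≡ (suc (2 * m)) _ _ (trans (cong (_+ even-part) (sym odds≡)) (odds+evens K β))
    p = twists Sign.- (suc (2 * m)) (series 1)
    pow : (+ 2) ℤ.^ suc (2 * m) ≡ + 2 ℤ.* + (4 ^ m)
    pow = cong (+ 2 ℤ.*_) (trans (sym (ℤ.^-*-assoc (+ 2) 2 m)) (pos-^ m))
      where
      pos-^ : ∀ m → (+ 4) ℤ.^ m ≡ + (4 ^ m)
      pos-^ zero    = refl
      pos-^ (suc m) = trans (cong (+ 4 ℤ.*_) (pos-^ m)) (mul-pos 4 (4 ^ m))
    middle : p m ≡ + (4 ^ m)
    middle = ℤ.*-cancelˡ-≡ (+ 2) (p m) (+ (4 ^ m)) (trans (double (p m)) (trans (proj₁ (complementary-twists (suc (2 * m))) m m (cong (λ x → suc (m + x)) (sym (ℕ.+-identityʳ m)))) pow))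
      where
      double : ∀ c → + 2 ℤ.* c ≡ c ℤ.+ c
      double = ℤRing.solve-∀
  by-halves (suc x) halves≡ = trans (twists-cong Sign.- odd-part (λ i → trans (cong (λ k → twists Sign.+ k (series (suc e)) i) evens≡)
      (trans (split-twists (suc (2 * x)) (suc e) (series (suc e)) i) (twists-cong Sign.+ (suc (2 * x)) collapse i))) m)
    (trans (self-negative _ (proj₁ (palindromic-- odd-part {suc (2 * x)} {alternate (suc (2 * x))} (palindromic-+ (suc (2 * x)))) m m degree))
      (sym (trans (cong (+ (4 ^ m) ℤ.*_) (squarefree-no K β halves≡)) (ℤ.*-zeroʳ (+ (4 ^ m))))))
    where
    collapse : twists Sign.+ (suc e) (series (suc e)) ≗ series 0
    collapse i = trans (cong (λ r → twists Sign.+ (suc e) (series r) i) (sym (ℕ.+-identityʳ (suc e)))) (twists-series (suc e) 0 i)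
    split-twists : ∀ a b h → twists Sign.+ (a + b) h ≗ twists Sign.+ a (twists Sign.+ b h)
    split-twists zero    b h i = refl
    split-twists (suc a) b h i = twist-cong Sign.+ (split-twists a b h) i
    total≡ : odd-part + 2 * suc x ≡ suc (2 * m)
    total≡ = trans (cong (λ y → odd-part + 2 * y) (sym halves≡)) (trans (sum-parity K β) Σβ≡)
    degree′ : odd-part + suc (2 * x) ≡ 2 * m
    degree′ = ℕ.suc-injective (trans (shuffle odd-part x) total≡)
      where
      shuffle : ∀ o x → suc (o + suc (2 * x)) ≡ o + 2 * suc x
      shuffle = ℕRing.solve-∀
    degree : m + m ≡ odd-part + suc (2 * x)
    degree = trans (cong (_+_ m) (sym (ℕ.+-identityʳ m))) (sym degree′)
    evens≡ : even-part ≡ suc (2 * x) + suc e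
    evens≡ = ℕ.+-cancelˡ-≡ odd-part _ _ (trans (odds+evens K β) (trans (cong (λ y → suc y + e) (sym degree′)) (shuffle odd-part x e)))
      where
      shuffle : ∀ o x e → suc (o + suc (2 * x)) + e ≡ o + (suc (2 * x) + suc e)
      shuffle = ℕRing.solve-∀
    self-negative : ∀ z → z ≡ value± (alternate (suc (2 * x))) ℤ.* z → z ≡ 0ℤ
    self-negative z z≡ = ℤ.*-cancelˡ-≡ (+ 2) z 0ℤ (trans (double z) (trans (cong (ℤ._+ z) (trans z≡ (cong (λ s → value± (Sign.- Sign.* s) ℤ.* z) (alternate-double x)))) (cancel z)))
      where
      double : ∀ c → + 2 ℤ.* c ≡ c ℤ.+ c
      double = ℤRing.solve-∀
      cancel : ∀ z → -1ℤ ℤ.* z ℤ.+ z ≡ + 2 ℤ.* 0ℤ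
      cancel = ℤRing.solve-∀

∏-update : ∀ K {f g} c x → c < K → (∀ i → c ≢ i → g i ≡ f i) → g c ≡ x ℤ.* f c → ∏ K g ≡ x ℤ.* ∏ K f
∏-update (suc K) {f} {g} c x c<sK others at-c with c ℕ.≟ K
... | yes refl = trans (cong₂ ℤ._*_ (∏-cong K (λ i i<K → others i (ℕ.<⇒≢ i<K ∘ sym))) at-c) (shuffle (∏ K f) x (f K))
  where
  shuffle : ∀ a x b → a ℤ.* (x ℤ.* b) ≡ x ℤ.* (a ℤ.* b)
  shuffle = ℤRing.solve-∀
... | no  c≢K  = trans (cong₂ ℤ._*_ (∏-update K c x (ℕ.≤∧≢⇒< (ℕ.≤-pred c<sK) c≢K) others at-c) (others K c≢K)) (ℤ.*-assoc x (∏ K f) (f K))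

sumℕ-cong : ∀ K {f g} → (∀ i → i < K → f i ≡ g i) → sumℕ K f ≡ sumℕ K g
sumℕ-cong zero    f≡g = refl
sumℕ-cong (suc K) f≡g = cong₂ _+_ (sumℕ-cong K (λ i i<K → f≡g i (ℕ.m≤n⇒m≤1+n i<K))) (f≡g K ℕ.≤-refl)

sumℕ-update : ∀ K {f g} c → c < K → (∀ i → c ≢ i → g i ≡ f i) → sumℕ K g + f c ≡ sumℕ K f + g c
sumℕ-update (suc K) {f} {g} c c<sK others with c ℕ.≟ K
... | yes refl = trans (cong (λ z → z + g K + f K) (sumℕ-cong K (λ i i<K → others i (ℕ.<⇒≢ i<K ∘ sym)))) (shuffle (sumℕ K f) (g K) (f K))
  where
  shuffle : ∀ a x b → a + x + b ≡ a + b + x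
  shuffle = ℕRing.solve-∀
... | no  c≢K  = trans (shuffle (sumℕ K g) (g K) (f c)) (trans (cong₂ _+_ (sumℕ-update K c (ℕ.≤∧≢⇒< (ℕ.≤-pred c<sK) c≢K) others) (others K c≢K)) (shuffle (sumℕ K f) (g c) (f K)))
  where
  shuffle : ∀ a x b → a + x + b ≡ a + b + x
  shuffle = ℕRing.solve-∀

sumℕ-zero : ∀ K → sumℕ K (λ _ → 0) ≡ 0
sumℕ-zero zero    = refl
sumℕ-zero (suc K) = trans (ℕ.+-identityʳ _) (sumℕ-zero K)

sumℕ-front : ∀ n f → sumℕ (suc n) f ≡ f 0 + sumℕ n (f ∘ suc)
sumℕ-front zero    f = sym (ℕ.+-identityʳ (f 0))
sumℕ-front (suc n) f = trans (cong (_+ f (suc n)) (sumℕ-front n f)) (ℕ.+-assoc (f 0) (sumℕ n (f ∘ suc)) (f (suc n)))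

bump : (ℕ → ℕ) → ℕ → ℕ → ℕ → ℕ
bump β c e i = if c ≡ᵇ i then e + β i else β i

bump-at : ∀ β c e → bump β c e c ≡ e + β c
bump-at β c e = cong (λ b → if b then e + β c else β c) (≡ᵇ-refl c)

bump-other : ∀ β c e i → c ≢ i → bump β c e i ≡ β i
bump-other β c e i c≢i = cong (λ b → if b then e + β i else β i) (≡ᵇ-false c≢i)

bump-cong : ∀ {β γ} c e → β ≗ γ → bump β c e ≗ bump γ c e
bump-cong c e β≗γ i with c ≡ᵇ i
... | true  = cong (_+_ e) (β≗γ i)
... | false = β≗γ i

-- The exponents of the colours after replacing xᵢ by the variable of colour χ i.
tally : (ℕ → ℕ) → (ℕ → ℕ) → (ℕ → ℕ) → ℕ → ℕ → ℕ
tally β χ α zero    = β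
tally β χ α (suc l) = bump (tally β χ α l) (χ l) (α l)

tally-cong : ∀ {β γ χ ξ} α l → β ≗ γ → χ ≗ ξ → tally β χ α l ≗ tally γ ξ α l
tally-cong α zero    β≗γ χ≗ξ = β≗γ
tally-cong {γ = γ} {χ} {ξ} α (suc l) β≗γ χ≗ξ i = trans (bump-cong (χ l) (α l) (tally-cong α l β≗γ χ≗ξ) i)
  (cong (λ c → bump (tally γ ξ α l) c (α l) i) (χ≗ξ l))

tally-front : ∀ β χ α l → tally β χ α (suc l) ≗ tally (bump β (χ 0) (α 0)) (χ ∘ suc) (α ∘ suc) l
tally-front β χ α zero    i = refl
tally-front β χ α (suc l) i = bump-cong (χ (suc l)) (α (suc l)) (tally-front β χ α l) i

none : ℕ → ℕ
none _ = 0

signMonomial-none : ∀ K s → signMonomial K s none ≡ 1ℤ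
signMonomial-none K s = ∏-ones K _ λ i _ → refl

signMonomial-tally : ∀ K s χ α l → (∀ i → i < l → χ i < K) →
  ∏ l (λ i → value± (s (χ i)) ℤ.^ α i) ≡ signMonomial K s (tally none χ α l)
signMonomial-tally K s χ α zero    χ<K = sym (signMonomial-none K s)
signMonomial-tally K s χ α (suc l) χ<K = trans (cong (ℤ._* value± (s (χ l)) ℤ.^ α l) (signMonomial-tally K s χ α l (λ i i<l → χ<K i (ℕ.m≤n⇒m≤1+n i<l))))
  (trans (ℤ.*-comm _ (value± (s (χ l)) ℤ.^ α l))
    (sym (∏-update K (χ l) (value± (s (χ l)) ℤ.^ α l) (χ<K l ℕ.≤-refl)
      (λ i χl≢i → cong (value± (s i) ℤ.^_) (bump-other (tally none χ α l) (χ l) (α l) i χl≢i))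
      (trans (cong (value± (s (χ l)) ℤ.^_) (bump-at (tally none χ α l) (χ l) (α l))) (ℤ.^-distribˡ-+-* (value± (s (χ l))) (α l) (tally none χ α l (χ l)))))))

sum-tally : ∀ K χ α l → (∀ i → i < l → χ i < K) → sumℕ K (tally none χ α l) ≡ sumℕ l α
sum-tally K χ α zero    χ<K = sumℕ-zero K
sum-tally K χ α (suc l) χ<K = ℕ.+-cancelʳ-≡ (β (χ l)) _ _
  (trans (sumℕ-update K {β} {bump β (χ l) (α l)} (χ l) (χ<K l ℕ.≤-refl) (bump-other β (χ l) (α l)))
    (trans (cong₂ _+_ (sum-tally K χ α l (λ i i<l → χ<K i (ℕ.m≤n⇒m≤1+n i<l))) (bump-at β (χ l) (α l)))
      (sym (ℕ.+-assoc (sumℕ l α) (α l) (β (χ l))))))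
  where β = tally none χ α l

indicator : Bool → ℤ
indicator b = if b then 1ℤ else 0ℤ

accepts : ℕ → (ℕ → ℕ) → ℕ → ℤ
accepts K χ l = ∏ l (λ i → indicator (χ i <ᵇ K))

coloured-lee : ∀ e m χ α l → let K = suc (2 * m) + e in sumℕ l α ≡ suc (2 * m) →
  ∑ (suc m) (λ j → value± (alternate j) ℤ.* series (suc e) (m ∸ j) ℤ.* ∑ (binom K j) (λ idx →
    ∏ l (λ i → indicator (χ i <ᵇ K) ℤ.* value± (signAt K j idx (χ i)) ℤ.^ α i)))
  ≡ + (4 ^ m) ℤ.* (accepts K χ l ℤ.* squarefree K (tally none χ α l))
coloured-lee e m χ α l Σα≡ with ℕ.anyUpTo? (λ i → suc (2 * m) + e ℕ.≤? χ i) l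
... | yes (i , i<l , K≤χi) = trans
  (∑-zero (suc m) _ λ j _ → trans (cong (value± (alternate j) ℤ.* series (suc e) (m ∸ j) ℤ.*_) (∑-zero (binom K j) _ λ idx _ →
     ∏-zero l _ i i<l (cong (λ b → indicator b ℤ.* value± (signAt K j idx (χ i)) ℤ.^ α i) (<ᵇ-false K≤χi)))) (ℤ.*-zeroʳ (value± (alternate j) ℤ.* series (suc e) (m ∸ j))))
  (sym (trans (cong (λ z → + (4 ^ m) ℤ.* (z ℤ.* squarefree K (tally none χ α l))) (∏-zero l _ i i<l (cong indicator (<ᵇ-false K≤χi)))) (ℤ.*-zeroʳ (+ (4 ^ m)))))
  where K = suc (2 * m) + e
... | no ¬reject = begin
  ∑ (suc m) (λ j → coeff′ j ℤ.* ∑ (binom K j) (λ idx → ∏ l (λ i → indicator (χ i <ᵇ K) ℤ.* value± (signAt K j idx (χ i)) ℤ.^ α i)))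
    ≡⟨ ∑-cong (suc m) (λ j _ → cong (coeff′ j ℤ.*_) (trans (∑-cong (binom K j) (λ idx _ → trans
         (∏-cong l (λ i i<l → trans (cong (λ b → indicator b ℤ.* value± (signAt K j idx (χ i)) ℤ.^ α i) (inside i i<l)) (ℤ.*-identityˡ _)))
         (signMonomial-tally K (signAt K j idx) χ α l χ<K))) (∑-signMonomial K j (tally none χ α l)))) ⟩
  weightedSum K m (series (suc e)) (tally none χ α l)
    ≡⟨ lee e m (tally none χ α l) (trans (sum-tally K χ α l χ<K) Σα≡) ⟩
  + (4 ^ m) ℤ.* squarefree K (tally none χ α l)
    ≡⟨ cong (+ (4 ^ m) ℤ.*_) (sym (trans (cong (ℤ._* squarefree K (tally none χ α l)) (∏-ones l _ (λ i i<l → cong indicator (inside i i<l)))) (ℤ.*-identityˡ _))) ⟩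
  + (4 ^ m) ℤ.* (accepts K χ l ℤ.* squarefree K (tally none χ α l)) ∎
  where
  open ≡-Reasoning
  K = suc (2 * m) + e
  coeff′ : ℕ → ℤ
  coeff′ j = value± (alternate j) ℤ.* series (suc e) (m ∸ j)
  χ<K : ∀ i → i < l → χ i < K
  χ<K i i<l = ℕ.≰⇒> λ K≤χi → ¬reject (i , i<l , K≤χi)
  inside : ∀ i → i < l → (χ i <ᵇ K) ≡ true
  inside i i<l = T→≡ (ℕ.<⇒<ᵇ (χ<K i i<l))

vacant : ℕ → ℕ
vacant zero    = 1
vacant (suc _) = 0

free : ℕ → (ℕ → ℕ) → ℕ
free K β = sumℕ K (vacant ∘ β)

squarefree-cong : ∀ K {β γ} → β ≗ γ → squarefree K β ≡ squarefree K γ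
squarefree-cong K β≗γ = ∏-cong K λ i _ → cong atMostOne (β≗γ i)

squarefree-bump₁ : ∀ K β c → c < K → squarefree K (bump β c 1) ≡ + vacant (β c) ℤ.* squarefree K β
squarefree-bump₁ K β c c<K = ∏-update K c (+ vacant (β c)) c<K (λ i c≢i → cong atMostOne (bump-other β c 1 i c≢i))
  (trans (cong atMostOne (bump-at β c 1)) (step (β c)))
  where
  step : ∀ b → atMostOne (suc b) ≡ + vacant b ℤ.* atMostOne b
  step zero    = refl
  step (suc b) = refl

squarefree-bump₂ : ∀ K β c e → c < K → squarefree K (bump β c (suc (suc e))) ≡ 0ℤ
squarefree-bump₂ K β c e c<K = ∏-zero K _ c c<K (cong atMostOne (bump-at β c (suc (suc e))))

free-bump : ∀ K β c → c < K → β c ≡ 0 → free K (bump β c 1) ≡ free K β ∸ 1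
free-bump K β c c<K βc≡0 = cong (_∸ 1) (trans (trans (ℕ.+-comm 1 _) (cong (λ b → free K (bump β c 1) + vacant b) (sym βc≡0)))
  (trans (sumℕ-update K {vacant ∘ β} {vacant ∘ bump β c 1} c c<K (λ i c≢i → cong vacant (bump-other β c 1 i c≢i)))
    (trans (cong (λ z → free K β + vacant z) (bump-at β c 1)) (ℕ.+-identityʳ _))))

∑-pos : ∀ n f → ∑ n (λ i → + f i) ≡ + sumℕ n f
∑-pos zero    f = refl
∑-pos (suc n) f = cong (ℤ._+ + f n) (∑-pos n f)

-- The number of maps χ from positions to K colours, ζ of them free, such that
-- the positions i with α i = 1 get distinct free colours.
slots : ℕ → ℕ → (ℕ → ℕ) → ℕ → ℕ
slots K zero    α ζ = 1
slots K (suc l) α ζ with α 0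
... | zero        = K * slots K l (α ∘ suc) ζ
... | suc zero    = ζ * slots K l (α ∘ suc) (ζ ∸ 1)
... | suc (suc _) = 0

∑-swap : ∀ a b (f : ℕ → ℕ → ℤ) → ∑ a (λ i → ∑ b (f i)) ≡ ∑ b (λ j → ∑ a (λ i → f i j))
∑-swap zero    b f = sym (∑-zero b _ λ _ _ → refl)
∑-swap (suc a) b f = trans (cong (ℤ._+ ∑ b (f a)) (∑-swap a b f)) (sym (∑-distrib b (λ j → ∑ a (λ i → f i j)) (f a)))

∑-divMod : ∀ R .{{_ : NonZero R}} B (G : ℕ → ℕ → ℤ) → ∑ (B * R) (λ X → G (X % R) (X / R)) ≡ ∑ B (λ y → ∑ R (λ x → G x y))
∑-divMod R zero    G = refl
∑-divMod R (suc B) G = trans (cong (λ k → ∑ k (λ X → G (X % R) (X / R))) (ℕ.+-comm R (B * R)))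
  (trans (∑-+ (B * R) R _) (cong₂ ℤ._+_ (∑-divMod R B G) (∑-cong R λ x x<R → cong₂ G
    (trans (cong (_% R) (ℕ.+-comm (B * R) x)) (trans (ℕ.[m+kn]%n≡m%n x B R) (ℕ.m<n⇒m%n≡m x<R)))
    (trans (ℕ.+-distrib-/-∣ˡ x (divides-refl B)) (trans (cong₂ _+_ (ℕ.m*n/n≡m B R) (ℕ.m<n⇒m/n≡0 x<R)) (ℕ.+-identityʳ B))))))
  where open import Data.Nat.Divisibility.Core using (divides-refl)

∑-quotient : ∀ u .{{_ : NonZero u}} K (G : ℕ → ℤ) → ∑ (K * u) (λ x → G (x / u)) ≡ + u ℤ.* ∑ K G
∑-quotient u K G = trans (∑-divMod u K (λ _ y → G y)) (trans (∑-cong K (λ y _ → ∑-const u (G y))) (∑-*ˡ K (+ u) G))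

∑-quotient-indicator : ∀ R u .{{_ : NonZero u}} K (G : ℕ → ℤ) → K * u ≤ R →
  ∑ R (λ x → indicator (x / u <ᵇ K) ℤ.* G (x / u)) ≡ + u ℤ.* ∑ K G
∑-quotient-indicator R u K G Ku≤R = trans (cong (λ k → ∑ k H) (sym (ℕ.m+[n∸m]≡n Ku≤R)))
  (trans (∑-+ (K * u) (R ∸ K * u) H) (trans (cong₂ ℤ._+_
     (trans (∑-cong (K * u) (λ x x< → trans (cong (λ b → indicator b ℤ.* G (x / u)) (T→≡ (ℕ.<⇒<ᵇ {x / u} {K} (ℕ.m<n*o⇒m/o<n {x} {K} {u} x<)))) (ℤ.*-identityˡ _))) (∑-quotient u K G))
     (∑-zero (R ∸ K * u) _ (λ x _ → cong (λ b → indicator b ℤ.* G ((K * u + x) / u)) (<ᵇ-false (above x)))))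
   (ℤ.+-identityʳ _)))
  where
  H = λ x → indicator (x / u <ᵇ K) ℤ.* G (x / u)
  above : ∀ x → K ≤ (K * u + x) / u
  above x = ℕ.≤-trans (ℕ.≤-reflexive (sym (ℕ.m*n/n≡m K u))) (ℕ./-monoˡ-≤ u (ℕ.m≤m+n (K * u) x))

module Colourings (R : ℕ) .{{_ : NonZero R}} (u : ℕ) .{{_ : NonZero u}} (K : ℕ) (Ku≤R : K * u ≤ R) where

  shift-suc : ∀ X i → shift R X (suc i) ≡ shift R (X / R) i
  shift-suc X zero    = refl
  shift-suc X (suc i) = cong (_/ R) (shift-suc X i)

  colour-suc : ∀ X i → colour R u X (suc i) ≡ colour R u (X / R) i
  colour-suc X i = cong (λ Y → (Y % R) / u) (shift-suc X i)

  tallied : (ℕ → ℕ) → (ℕ → ℕ) → ℕ → ℕ → ℤ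
  tallied β α l X = accepts K (colour R u X) l ℤ.* squarefree K (tally β (colour R u X) α l)

  tallied-front : ∀ β α l X → tallied β α (suc l) X ≡ indicator ((X % R) / u <ᵇ K) ℤ.* tallied (bump β ((X % R) / u) (α 0)) (α ∘ suc) l (X / R)
  tallied-front β α l X = trans (cong₂ ℤ._*_
      (trans (∏-front l _) (cong (indicator ((X % R) / u <ᵇ K) ℤ.*_) (∏-cong l λ i _ → cong (λ c → indicator (c <ᵇ K)) (colour-suc X i))))
      (squarefree-cong K λ i → trans (tally-front β (colour R u X) α l i) (tally-cong (α ∘ suc) l (λ _ → refl) (colour-suc X) i)))
    (ℤ.*-assoc (indicator ((X % R) / u <ᵇ K)) (accepts K (colour R u (X / R)) l) _)

  slots-value : (ℕ → ℕ) → (ℕ → ℕ) → ℕ → ℤ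
  slots-value β α l = + (u ^ l) ℤ.* (squarefree K β ℤ.* + slots K l α (free K β))

  slots-value-cong : ∀ {β γ} α l → β ≗ γ → slots-value β α l ≡ slots-value γ α l
  slots-value-cong α l β≗γ = cong (+ (u ^ l) ℤ.*_) (cong₂ (λ x k → x ℤ.* + slots K l α k) (squarefree-cong K β≗γ) (sumℕ-cong K λ i _ → cong vacant (β≗γ i)))

  ∑-bump : ∀ β α l → + u ℤ.* ∑ K (λ c → slots-value (bump β c (α 0)) (α ∘ suc) l) ≡ slots-value β α (suc l)
  ∑-bump β α l with α 0
  ... | zero = trans (cong (+ u ℤ.*_) (trans (∑-cong K (λ c _ → slots-value-cong (α ∘ suc) l (bump-zero c))) (∑-const K _)))
    (trans (shuffle (+ u) (+ K) (+ (u ^ l)) (squarefree K β) (+ slots K l (α ∘ suc) (free K β)))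
      (cong₂ (λ x y → x ℤ.* (squarefree K β ℤ.* y)) (mul-pos u (u ^ l)) (mul-pos K _)))
    where
    bump-zero : ∀ c → bump β c 0 ≗ β
    bump-zero c i with c ≡ᵇ i
    ... | true  = refl
    ... | false = refl
    shuffle : ∀ u k p s q → u ℤ.* (k ℤ.* (p ℤ.* (s ℤ.* q))) ≡ (u ℤ.* p) ℤ.* (s ℤ.* (k ℤ.* q))
    shuffle = ℤRing.solve-∀
  ... | suc zero = trans (cong (+ u ℤ.*_) (trans (∑-cong K each) (trans (∑-*ʳ K rest (λ c → + vacant (β c))) (cong (ℤ._* rest) (∑-pos K (vacant ∘ β))))))
    (trans (shuffle (+ u) (+ free K β) (+ (u ^ l)) (squarefree K β) (+ slots K l (α ∘ suc) (free K β ∸ 1)))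
      (cong₂ (λ x y → x ℤ.* (squarefree K β ℤ.* y)) (mul-pos u (u ^ l)) (mul-pos (free K β) _)))
    where
    rest = + (u ^ l) ℤ.* (squarefree K β ℤ.* + slots K l (α ∘ suc) (free K β ∸ 1))
    each : ∀ c → c < K → slots-value (bump β c 1) (α ∘ suc) l ≡ + vacant (β c) ℤ.* rest
    each c c<K with β c in βc
    ... | zero  = trans (cong₂ (λ x k → + (u ^ l) ℤ.* (x ℤ.* + slots K l (α ∘ suc) k))
                   (trans (squarefree-bump₁ K β c c<K) (trans (cong (λ b → + vacant b ℤ.* squarefree K β) βc) (ℤ.*-identityˡ _))) (free-bump K β c c<K βc))
                  (sym (ℤ.*-identityˡ rest))
    ... | suc b = trans (cong (λ x → + (u ^ l) ℤ.* (x ℤ.* + slots K l (α ∘ suc) (free K (bump β c 1))))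
                   (trans (squarefree-bump₁ K β c c<K) (cong (λ b → + vacant b ℤ.* squarefree K β) βc))) (ℤ.*-zeroʳ (+ (u ^ l)))
    shuffle : ∀ u k p s q → u ℤ.* (k ℤ.* (p ℤ.* (s ℤ.* q))) ≡ (u ℤ.* p) ℤ.* (s ℤ.* (k ℤ.* q))
    shuffle = ℤRing.solve-∀
  ... | suc (suc e) = trans (cong (+ u ℤ.*_) (∑-zero K _ λ c c<K → trans (cong (λ x → + (u ^ l) ℤ.* (x ℤ.* + slots K l (α ∘ suc) (free K (bump β c (suc (suc e))))))
                       (squarefree-bump₂ K β c e c<K)) (ℤ.*-zeroʳ (+ (u ^ l)))))
    (trans (ℤ.*-zeroʳ (+ u)) (sym (trans (cong (+ (u ^ suc l) ℤ.*_) (ℤ.*-zeroʳ (squarefree K β))) (ℤ.*-zeroʳ (+ (u ^ suc l))))))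

  ∑-tallied : ∀ l β α → ∑ (R ^ l) (tallied β α l) ≡ slots-value β α l
  ∑-tallied zero    β α = lemma (squarefree K β)
    where
    lemma : ∀ s → 0ℤ ℤ.+ 1ℤ ℤ.* s ≡ 1ℤ ℤ.* (s ℤ.* 1ℤ)
    lemma = ℤRing.solve-∀
  ∑-tallied (suc l) β α = begin
    ∑ (R * R ^ l) (tallied β α (suc l))
      ≡⟨ cong (λ k → ∑ k (tallied β α (suc l))) (ℕ.*-comm R (R ^ l)) ⟩
    ∑ (R ^ l * R) (tallied β α (suc l))
      ≡⟨ ∑-cong (R ^ l * R) (λ X _ → tallied-front β α l X) ⟩
    ∑ (R ^ l * R) (λ X → indicator ((X % R) / u <ᵇ K) ℤ.* tallied (bump β ((X % R) / u) (α 0)) (α ∘ suc) l (X / R))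
      ≡⟨ ∑-divMod R (R ^ l) (λ x y → indicator (x / u <ᵇ K) ℤ.* tallied (bump β (x / u) (α 0)) (α ∘ suc) l y) ⟩
    ∑ (R ^ l) (λ y → ∑ R (λ x → indicator (x / u <ᵇ K) ℤ.* tallied (bump β (x / u) (α 0)) (α ∘ suc) l y))
      ≡⟨ ∑-swap (R ^ l) R _ ⟩
    ∑ R (λ x → ∑ (R ^ l) (λ y → indicator (x / u <ᵇ K) ℤ.* tallied (bump β (x / u) (α 0)) (α ∘ suc) l y))
      ≡⟨ ∑-cong R (λ x _ → trans (∑-*ˡ (R ^ l) (indicator (x / u <ᵇ K)) _) (cong (indicator (x / u <ᵇ K) ℤ.*_) (∑-tallied l (bump β (x / u) (α 0)) (α ∘ suc)))) ⟩
    ∑ R (λ x → indicator (x / u <ᵇ K) ℤ.* slots-value (bump β (x / u) (α 0)) (α ∘ suc) l)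
      ≡⟨ ∑-quotient-indicator R u K (λ c → slots-value (bump β c (α 0)) (α ∘ suc) l) Ku≤R ⟩
    + u ℤ.* ∑ K (λ c → slots-value (bump β c (α 0)) (α ∘ suc) l)
      ≡⟨ ∑-bump β α l ⟩
    slots-value β α (suc l) ∎
    where open ≡-Reasoning

falling-front : ∀ ζ o → ζ * falling (ζ ∸ 1) o ≡ falling ζ (suc o)
falling-front ζ zero    = trans (ℕ.*-identityʳ ζ) (sym (ℕ.+-identityʳ ζ))
falling-front ζ (suc o) = trans (sym (ℕ.*-assoc ζ (falling (ζ ∸ 1) o) (ζ ∸ 1 ∸ o))) (cong₂ _*_ (falling-front ζ o) (ℕ.∸-+-assoc ζ 1 o))

slots-falling : ∀ K l α ζ → + (slots K l α ζ * K ^ sumℕ l α) ≡ + (K ^ l * falling ζ (sumℕ l α)) ℤ.* squarefree l α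
slots-falling K zero    α ζ = refl
slots-falling K (suc l) α ζ rewrite sumℕ-front l α | ∏-front l (atMostOne ∘ α) with α 0
... | zero = trans (cong +_ (ℕ.*-assoc K s (K ^ o))) (trans (ℤ.pos-* K (s * K ^ o)) (trans (cong (+ K ℤ.*_) (slots-falling K l (α ∘ suc) ζ))
    (trans (shuffle (+ K) (+ (K ^ l * f)) q) (cong (ℤ._* (1ℤ ℤ.* q)) (trans (mul-pos K (K ^ l * f)) (cong +_ (sym (ℕ.*-assoc K (K ^ l) f))))))))
  where
  o = sumℕ l (α ∘ suc); s = slots K l (α ∘ suc) ζ; f = falling ζ o; q = squarefree l (α ∘ suc)
  shuffle : ∀ k x y → k ℤ.* (x ℤ.* y) ≡ (k ℤ.* x) ℤ.* (1ℤ ℤ.* y)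
  shuffle = ℤRing.solve-∀
... | suc zero = trans (cong +_ (regroup ζ s K (K ^ o))) (trans (ℤ.pos-* (ζ * K) (s * K ^ o)) (trans (cong (+ (ζ * K) ℤ.*_) (slots-falling K l (α ∘ suc) (ζ ∸ 1)))
    (trans (shuffle (+ (ζ * K)) (+ (K ^ l * f)) q) (cong (ℤ._* (1ℤ ℤ.* q)) (trans (mul-pos (ζ * K) (K ^ l * f))
      (cong +_ (trans (regroup′ ζ K (K ^ l) f) (cong (K * K ^ l *_) (falling-front ζ o)))))))))
  where
  o = sumℕ l (α ∘ suc); s = slots K l (α ∘ suc) (ζ ∸ 1); f = falling (ζ ∸ 1) o; q = squarefree l (α ∘ suc)
  regroup : ∀ z s k p → z * s * (k * p) ≡ z * k * (s * p)
  regroup = ℕRing.solve-∀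
  regroup′ : ∀ z k p f → z * k * (p * f) ≡ k * p * (z * f)
  regroup′ = ℕRing.solve-∀
  shuffle : ∀ k x y → k ℤ.* (x ℤ.* y) ≡ (k ℤ.* x) ℤ.* (1ℤ ℤ.* y)
  shuffle = ℤRing.solve-∀
... | suc (suc e) = sym (ℤ.*-zeroʳ (+ (K * K ^ l * falling ζ (suc (suc e) + sumℕ l (α ∘ suc)))))

^-distribʳ-* : ∀ k x y → (x * y) ^ k ≡ x ^ k * y ^ k
^-distribʳ-* zero    x y = refl
^-distribʳ-* (suc k) x y = trans (cong (x * y *_) (^-distribʳ-* k x y)) (swap x y (x ^ k) (y ^ k))
  where
  swap : ∀ x y a b → x * y * (a * b) ≡ x * a * (y * b)
  swap = ℕRing.solve-∀

-- 600 M⁶ times the Taylor polynomial of degree 5 of eˣ at x = i / M, with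
-- x⁶ / 600 in place of the remainder.
taylor : ℕ → ℕ → ℕ
taylor M i = 600 * M ^ 6 + 600 * i * M ^ 5 + 300 * i ^ 2 * M ^ 4 + 100 * i ^ 3 * M ^ 3 + 25 * i ^ 4 * M ^ 2 + 5 * i ^ 5 * M + i ^ 6

taylor-step : ∀ M i → i ≤ M → suc M * taylor M i ≤ M * taylor M (suc i)
taylor-step M i i≤M = ℕ.+-cancelʳ-≤ (i ^ 6) _ _ (ℕ.≤-trans
  (ℕ.+-mono-≤ (ℕ.m≤m+n (suc M * taylor M i) rest) (ℕ.*-monoˡ-≤ (i ^ 5) i≤M))
  (ℕ.≤-reflexive (sym (expand M i))))
  where
  rest = 300 * M ^ 5 + (300 * i + 100) * M ^ 4 + 25 * (6 * i ^ 2 + 4 * i + 1) * M ^ 3 + 5 * (10 * i ^ 3 + 10 * i ^ 2 + 5 * i + 1) * M ^ 2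
         + (15 * i ^ 4 + 20 * i ^ 3 + 15 * i ^ 2 + 6 * i + 1) * M
  expand : ∀ M i →
    M * (600 * (M * (M * (M * (M * (M * (M * 1)))))) + 600 * (suc i) * (M * (M * (M * (M * (M * 1))))) + 300 * (suc i * (suc i * 1)) * (M * (M * (M * (M * 1)))) + 100 * (suc i * (suc i * (suc i * 1))) * (M * (M * (M * 1))) + 25 * (suc i * (suc i * (suc i * (suc i * 1)))) * (M * (M * 1)) + 5 * (suc i * (suc i * (suc i * (suc i * (suc i * 1))))) * M + (suc i * (suc i * (suc i * (suc i * (suc i * (suc i * 1))))))) + (i * (i * (i * (i * (i * (i * 1)))))) ≡
    suc M * (600 * (M * (M * (M * (M * (M * (M * 1)))))) + 600 * i * (M * (M * (M * (M * (M * 1))))) + 300 * (i * (i * 1)) * (M * (M * (M * (M * 1)))) + 100 * (i * (i * (i * 1))) * (M * (M * (M * 1))) + 25 * (i * (i * (i * (i * 1)))) * (M * (M * 1)) + 5 * (i * (i * (i * (i * (i * 1))))) * M + (i * (i * (i * (i * (i * (i * 1)))))))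
    + (300 * (M * (M * (M * (M * (M * 1))))) + (300 * i + 100) * (M * (M * (M * (M * 1)))) + 25 * (6 * (i * (i * 1)) + 4 * i + 1) * (M * (M * (M * 1))) + 5 * (10 * (i * (i * (i * 1))) + 10 * (i * (i * 1)) + 5 * i + 1) * (M * (M * 1))
       + (15 * (i * (i * (i * (i * 1)))) + 20 * (i * (i * (i * 1))) + 15 * (i * (i * 1)) + 6 * i + 1) * M) + M * (i * (i * (i * (i * (i * 1)))))
  expand = ℕRing.solve-∀

taylor-bound : ∀ M i → i ≤ M → 600 * M ^ 6 * suc M ^ i ≤ M ^ i * taylor M i
taylor-bound M zero    _   = ℕ.≤-reflexive (start M)
  where
  start : ∀ M → 600 * (M * (M * (M * (M * (M * (M * 1)))))) * 1 ≡ 1 * (600 * (M * (M * (M * (M * (M * (M * 1)))))) + 600 * 0 * (M * (M * (M * (M * (M * 1))))) + 300 * (0 * (0 * 1)) * (M * (M * (M * (M * 1)))) + 100 * (0 * (0 * (0 * 1))) * (M * (M * (M * 1))) + 25 * (0 * (0 * (0 * (0 * 1)))) * (M * (M * 1)) + 5 * (0 * (0 * (0 * (0 * (0 * 1))))) * M + (0 * (0 * (0 * (0 * (0 * (0 * 1)))))))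
  start = ℕRing.solve-∀
taylor-bound M (suc i) i<M = begin
  600 * M ^ 6 * (suc M * suc M ^ i)      ≡⟨ shuffle (600 * M ^ 6) (suc M) (suc M ^ i) ⟩
  suc M * (600 * M ^ 6 * suc M ^ i)      ≤⟨ ℕ.*-monoʳ-≤ (suc M) (taylor-bound M i (ℕ.<⇒≤ i<M)) ⟩
  suc M * (M ^ i * taylor M i)           ≡⟨ swap (suc M) (M ^ i) (taylor M i) ⟩
  M ^ i * (suc M * taylor M i)           ≤⟨ ℕ.*-monoʳ-≤ (M ^ i) (taylor-step M i (ℕ.<⇒≤ i<M)) ⟩
  M ^ i * (M * taylor M (suc i))         ≡⟨ assoc (M ^ i) M (taylor M (suc i)) ⟩
  M * M ^ i * taylor M (suc i)           ∎
  where
  open ℕ.≤-Reasoning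
  shuffle : ∀ a s p → a * (s * p) ≡ s * (a * p)
  shuffle = ℕRing.solve-∀
  swap : ∀ s p t → s * (p * t) ≡ p * (s * t)
  swap = ℕRing.solve-∀
  assoc : ∀ p m t → p * (m * t) ≡ m * p * t
  assoc = ℕRing.solve-∀

-- (1 + 1/M)ᴹ ≤ 1631/600, slightly more than e.
euler-bound : ∀ M .{{_ : NonZero M}} → 600 * suc M ^ M ≤ 1631 * M ^ M
euler-bound M = ℕ.*-cancelˡ-≤ (M ^ 6) {{ℕ.m^n≢0 M 6}} (subst₂ _≤_ (shuffle (M ^ 6) (suc M ^ M)) (total M (M ^ M)) (taylor-bound M M ℕ.≤-refl))
  where
  shuffle : ∀ a b → 600 * a * b ≡ a * (600 * b)
  shuffle = ℕRing.solve-∀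
  total : ∀ M p → p * (600 * (M * (M * (M * (M * (M * (M * 1)))))) + 600 * M * (M * (M * (M * (M * (M * 1))))) + 300 * (M * (M * 1)) * (M * (M * (M * (M * 1)))) + 100 * (M * (M * (M * 1))) * (M * (M * (M * 1))) + 25 * (M * (M * (M * (M * 1)))) * (M * (M * 1)) + 5 * (M * (M * (M * (M * (M * 1))))) * M + (M * (M * (M * (M * (M * (M * 1))))))) ≡ (M * (M * (M * (M * (M * (M * 1)))))) * (1631 * p)
  total = ℕRing.solve-∀

falling-+ : ∀ K a b → falling K (a + b) ≡ falling K a * falling (K ∸ a) b
falling-+ K a zero    = trans (cong (falling K) (ℕ.+-identityʳ a)) (sym (ℕ.*-identityʳ _))
falling-+ K a (suc b) = trans (cong (falling K) (ℕ.+-suc a b))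
  (trans (cong₂ _*_ (falling-+ K a b) (sym (ℕ.∸-+-assoc K a b))) (ℕ.*-assoc (falling K a) (falling (K ∸ a) b) (K ∸ a ∸ b)))

falling-≥ : ∀ x K o → x + o ≤ K → x ^ o ≤ falling K o
falling-≥ x K zero    _ = ℕ.≤-refl
falling-≥ x K (suc o) x+o≤K = ℕ.≤-trans (ℕ.≤-reflexive (ℕ.*-comm x (x ^ o)))
  (ℕ.*-mono-≤ (falling-≥ x K o (ℕ.≤-trans (ℕ.+-monoʳ-≤ x (ℕ.n≤1+n o)) x+o≤K))
    (ℕ.≤-trans (ℕ.≤-reflexive (sym (ℕ.m+n∸n≡m x o))) (ℕ.∸-monoˡ-≤ o (ℕ.≤-trans (ℕ.+-monoʳ-≤ x (ℕ.n≤1+n o)) x+o≤K))))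

falling-pos : ∀ K o → o ≤ K → 1 ≤ falling K o
falling-pos K zero    _   = ℕ.≤-refl
falling-pos K (suc o) o<K = ℕ.*-mono-≤ (falling-pos K o (ℕ.<⇒≤ o<K)) (ℕ.m<n⇒0<n∸m o<K)

falling-block : ∀ M → falling (31 * suc M) (20 * suc M) * falling (11 * suc M) 11 ≡ falling (31 * suc M) 31 * falling (31 * M) (20 * M)
falling-block M = trans (cong (λ k → falling (31 * suc M) (20 * suc M) * falling k 11) (sym rest₁))
  (trans (sym (falling-+ (31 * suc M) (20 * suc M) 11))
    (trans (cong (falling (31 * suc M)) (shuffle M)) (trans (falling-+ (31 * suc M) 31 (20 * M)) (cong (λ k → falling (31 * suc M) 31 * falling k (20 * M)) rest₂))))
  where
  shuffle : ∀ M → 20 * suc M + 11 ≡ 31 + 20 * M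
  shuffle = ℕRing.solve-∀
  rest₁ : 31 * suc M ∸ 20 * suc M ≡ 11 * suc M
  rest₁ = sym (ℕ.*-distribʳ-∸ (suc M) 31 20)
  rest₂ : 31 * suc M ∸ 31 ≡ 31 * M
  rest₂ = trans (cong (_∸ 31) (ℕ.*-suc 31 M)) (ℕ.m+n∸m≡n 31 (31 * M))

growth-step : ∀ c₂₀ c₁₁ c₃₁ e g f y₂₀ y₁₁ y₃₁ u v w P P′ C A B .{{_ : NonZero (f * y₁₁)}} →
  c₂₀ * c₁₁ ≡ c₃₁ → y₂₀ * y₁₁ ≡ y₃₁ → e * u ≤ g * v → C * v * A ≤ w * B * P → c₃₁ * w * P ≤ P′ * (f * y₁₁) →
  (c₂₀ * C) * (y₂₀ * u) * ((c₁₁ * e) * A) ≤ y₃₁ * ((f * g) * B) * P′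
growth-step c₂₀ c₁₁ c₃₁ e g f y₂₀ y₁₁ y₃₁ u v w P P′ C A B c≡ y≡ euler prev block = ℕ.*-cancelʳ-≤ _ _ (f * y₁₁) (begin
  (c₂₀ * C) * (y₂₀ * u) * ((c₁₁ * e) * A) * (f * y₁₁)      ≡⟨ s₁ c₂₀ c₁₁ e f y₂₀ y₁₁ u C A ⟩
  (c₂₀ * c₁₁) * (y₂₀ * y₁₁) * f * (C * A) * (e * u)        ≤⟨ ℕ.*-monoʳ-≤ ((c₂₀ * c₁₁) * (y₂₀ * y₁₁) * f * (C * A)) euler ⟩
  (c₂₀ * c₁₁) * (y₂₀ * y₁₁) * f * (C * A) * (g * v)        ≡⟨ cong₂ (λ c y → c * y * f * (C * A) * (g * v)) c≡ y≡ ⟩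
  c₃₁ * y₃₁ * f * (C * A) * (g * v)                        ≡⟨ s₂ c₃₁ y₃₁ f g C A v ⟩
  c₃₁ * y₃₁ * (f * g) * (C * v * A)                        ≤⟨ ℕ.*-monoʳ-≤ (c₃₁ * y₃₁ * (f * g)) prev ⟩
  c₃₁ * y₃₁ * (f * g) * (w * B * P)                        ≡⟨ s₃ c₃₁ y₃₁ f g w B P ⟩
  y₃₁ * ((f * g) * B) * (c₃₁ * w * P)                      ≤⟨ ℕ.*-monoʳ-≤ (y₃₁ * ((f * g) * B)) block ⟩
  y₃₁ * ((f * g) * B) * (P′ * (f * y₁₁))                   ≡⟨ ℕ.*-assoc (y₃₁ * ((f * g) * B)) P′ (f * y₁₁) ⟨
  y₃₁ * ((f * g) * B) * P′ * (f * y₁₁)                     ∎)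
  where
  open ℕ.≤-Reasoning
  s₁ : ∀ c c′ e f y y′ u C A → (c * C) * (y * u) * ((c′ * e) * A) * (f * y′) ≡ (c * c′) * (y * y′) * f * (C * A) * (e * u)
  s₁ = ℕRing.solve-∀
  s₂ : ∀ c y f g C A v → c * y * f * (C * A) * (g * v) ≡ c * y * (f * g) * (C * v * A)
  s₂ = ℕRing.solve-∀
  s₃ : ∀ c y f g w B P → c * y * (f * g) * (w * B * P) ≡ y * ((f * g) * B) * (c * w * P)
  s₃ = ℕRing.solve-∀

-- From M to M + 1 the quotient of the two sides of falling-growth shrinks by
-- (1 + 1/M)²⁰ᴹ ≤ e²⁰ and by a factor that the power M³¹ compensates. The large
-- constants are variables, so that they are never unfolded.
module FallingGrowth (c₂₀ c₁₁ c₃₁ e g f : ℕ) .{{_ : NonZero f}} (c≡ : c₂₀ * c₁₁ ≡ c₃₁) (c₃₁≡ : c₃₁ ≡ 31 ^ 31) (e≡ : e ≡ 600 ^ 20) (g≡ : g ≡ 1631 ^ 20) (f≡ : f ≡ 11 ^ 11)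
                     (base : c₂₀ * (c₁₁ * e) ≤ (f * g) * falling 31 20) where

  Bound : ℕ → Set
  Bound M = c₂₀ ^ M * (M ^ M) ^ 20 * (c₁₁ * e) ^ M ≤ M ^ 31 * (f * g) ^ M * falling (31 * M) (20 * M)

  advance : ∀ M M′ .{{_ : NonZero M}} → M′ ≡ suc M → Bound M → Bound M′
  advance M M′ M′≡ prev = subst₂ _≤_ (cong₂ _*_ (cong₂ _*_ (next c₂₀) next-20) (next (c₁₁ * e))) (cong (λ z → M′ ^ 31 * z * P′) (next (f * g)))
    (growth-step c₂₀ c₁₁ c₃₁ e g f (M′ ^ 20) (M′ ^ 11) (M′ ^ 31) ((M′ ^ M) ^ 20) ((M ^ M) ^ 20) (M ^ 31) P P′ (c₂₀ ^ M) ((c₁₁ * e) ^ M) ((f * g) ^ M)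
      {{ℕ.m*n≢0 f (M′ ^ 11) {{it}} {{ℕ.m^n≢0 M′ 11 {{ℕ.>-nonZero (ℕ.≤-trans (s≤s z≤n) (ℕ.≤-reflexive (sym M′≡)))}}}}}} c≡ (sym (ℕ.^-distribˡ-+-* M′ 20 11)) euler^20 prev block)
    where
    open import Function.Base using (it)
    P = falling (31 * M) (20 * M)
    P′ = falling (31 * M′) (20 * M′)
    next : ∀ x → x * x ^ M ≡ x ^ M′
    next x = cong (x ^_) (sym M′≡)
    next-20 : M′ ^ 20 * (M′ ^ M) ^ 20 ≡ (M′ ^ M′) ^ 20
    next-20 = trans (sym (^-distribʳ-* 20 M′ (M′ ^ M))) (cong (_^ 20) (next M′))
    euler^20 : e * (M′ ^ M) ^ 20 ≤ g * (M ^ M) ^ 20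
    euler^20 = subst₂ _≤_ (trans (^-distribʳ-* 20 600 (M′ ^ M)) (cong (_* (M′ ^ M) ^ 20) (sym e≡))) (trans (^-distribʳ-* 20 1631 (M ^ M)) (cong (_* (M ^ M) ^ 20) (sym g≡)))
      (ℕ.^-monoˡ-≤ 20 (subst (λ x → 600 * x ^ M ≤ 1631 * M ^ M) (sym M′≡) (euler-bound M)))
    room : 31 * M + 31 ≡ 31 * M′
    room = trans (ℕ.+-comm (31 * M) 31) (trans (sym (ℕ.*-suc 31 M)) (cong (31 *_) (sym M′≡)))
    split : falling (31 * M′) 31 * P ≡ P′ * falling (11 * M′) 11
    split = subst (λ x → falling (31 * x) 31 * P ≡ falling (31 * x) (20 * x) * falling (11 * x) 11) (sym M′≡) (sym (falling-block M))
    block : c₃₁ * M ^ 31 * P ≤ P′ * (f * M′ ^ 11)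
    block = subst₂ _≤_ (cong (_* P) (trans (^-distribʳ-* 31 31 M) (cong (_* M ^ 31) (sym c₃₁≡)))) (cong (P′ *_) (trans (^-distribʳ-* 11 11 M′) (cong (_* M′ ^ 11) (sym f≡))))
      (ℕ.≤-trans (ℕ.*-monoˡ-≤ P (falling-≥ (31 * M) (31 * M′) 31 (ℕ.≤-reflexive room)))
         (ℕ.≤-trans (ℕ.≤-reflexive split) (ℕ.*-monoʳ-≤ P′ (falling-≤ (11 * M′) 11))))

  falling-growth : ∀ M .{{_ : NonZero M}} → Bound M
  falling-growth (suc zero) = subst₂ _≤_ (left c₂₀ (c₁₁ * e)) (right (f * g) (falling 31 20)) base
    where
    left : ∀ x y → x * y ≡ x * 1 * 1 * (y * 1)
    left = ℕRing.solve-∀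
    right : ∀ x y → x * y ≡ 1 * (x * 1) * y
    right = ℕRing.solve-∀
  falling-growth (suc (suc q)) = advance (suc q) (suc (suc q)) refl (falling-growth (suc q))

pow-20 : ∀ c M → (c * M) ^ (20 * M) ≡ (c ^ 20) ^ M * (M ^ M) ^ 20
pow-20 c M = trans (^-distribʳ-* (20 * M) c M) (cong₂ _*_ (sym (ℕ.^-*-assoc c 20 M)) (trans (cong (M ^_) (ℕ.*-comm 20 M)) (sym (ℕ.^-*-assoc M M 20))))

subsetsUpTo : ℕ → ℕ → ℕ
subsetsUpTo K m = sumℕ (suc m) (binom K)

subsetsUpTo-suc : ∀ K m → subsetsUpTo (suc K) (suc m) ≡ subsetsUpTo K m + subsetsUpTo K (suc m)
subsetsUpTo-suc K zero    = refl
subsetsUpTo-suc K (suc m) = trans (cong (_+ (binom K (suc m) + binom K (suc (suc m)))) (subsetsUpTo-suc K m))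
  (shuffle (subsetsUpTo K m) (subsetsUpTo K (suc m)) (binom K (suc m)) (binom K (suc (suc m))))
  where
  shuffle : ∀ a b x y → a + b + (x + y) ≡ a + x + (b + y)
  shuffle = ℕRing.solve-∀

subsetsUpTo-≤ : ∀ K m → subsetsUpTo K m * (10 ^ m * 21 ^ K) ≤ 31 ^ K * 21 ^ m
subsetsUpTo-≤ zero    m       = ℕ.≤-trans (ℕ.≤-reflexive (trans (cong₂ _*_ (only m) (ℕ.*-identityʳ (10 ^ m))) (ℕ.*-identityˡ (10 ^ m))))
    (ℕ.≤-trans (ℕ.^-monoˡ-≤ m (ℕ.m≤m+n 10 11)) (ℕ.≤-reflexive (sym (ℕ.*-identityˡ (21 ^ m)))))
  where
  only : ∀ m → subsetsUpTo 0 m ≡ 1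
  only zero    = refl
  only (suc m) = trans (ℕ.+-identityʳ _) (only m)
subsetsUpTo-≤ (suc K) zero    = ℕ.≤-trans (ℕ.≤-reflexive (simplify (21 ^ suc K))) (ℕ.≤-trans (ℕ.^-monoˡ-≤ (suc K) (ℕ.m≤m+n 21 10)) (ℕ.≤-reflexive (sym (ℕ.*-identityʳ (31 ^ suc K)))))
  where
  simplify : ∀ x → 1 * (1 * x) ≡ x
  simplify = ℕRing.solve-∀
subsetsUpTo-≤ (suc K) (suc m) = begin
  subsetsUpTo (suc K) (suc m) * (10 * 10 ^ m * (21 * 21 ^ K))
    ≡⟨ cong (_* (10 * 10 ^ m * (21 * 21 ^ K))) (subsetsUpTo-suc K m) ⟩
  (subsetsUpTo K m + subsetsUpTo K (suc m)) * (10 * 10 ^ m * (21 * 21 ^ K))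
    ≡⟨ expand (subsetsUpTo K m) (subsetsUpTo K (suc m)) (10 ^ m) (21 ^ K) ⟩
  210 * (subsetsUpTo K m * (10 ^ m * 21 ^ K)) + 21 * (subsetsUpTo K (suc m) * (10 * 10 ^ m * 21 ^ K))
    ≤⟨ ℕ.+-mono-≤ (ℕ.*-monoʳ-≤ 210 (subsetsUpTo-≤ K m)) (ℕ.*-monoʳ-≤ 21 (subsetsUpTo-≤ K (suc m))) ⟩
  210 * (31 ^ K * 21 ^ m) + 21 * (31 ^ K * (21 * 21 ^ m))
    ≡⟨ collect (31 ^ K) (21 ^ m) ⟩
  31 * 31 ^ K * (21 * 21 ^ m) ∎
  where
  open ℕ.≤-Reasoning
  expand : ∀ a b x y → (a + b) * (10 * x * (21 * y)) ≡ 210 * (a * (x * y)) + 21 * (b * (10 * x * y))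
  expand = ℕRing.solve-∀
  collect : ∀ x y → 210 * (x * y) + 21 * (x * (21 * y)) ≡ 31 * x * (21 * y)
  collect = ℕRing.solve-∀

module SampleCount (M : ℕ) .{{_ : NonZero M}} (m K D : ℕ) (m≡ : 10 * M ≡ m) (K≡ : 31 * M ≡ K) (D≡ : suc (2 * m) ≡ D) where

  W J : ℕ
  W = K ^ D
  J = falling K D

  20M≡ : 2 * m ≡ 20 * M
  20M≡ = trans (cong (2 *_) (sym m≡)) (sym (ℕ.*-assoc 2 10 M))

  D≤K : D ≤ K
  D≤K = subst₂ _≤_ (trans (cong suc (sym 20M≡)) D≡) K≡ (ℕ.≤-trans (ℕ.+-monoˡ-≤ (20 * M) (ℕ.>-nonZero⁻¹ M))
    (ℕ.≤-trans (ℕ.*-monoˡ-≤ M (ℕ.m≤m+n 21 10)) ℕ.≤-refl))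

  instance
    J-nonZero : NonZero J
    J-nonZero = ℕ.>-nonZero (falling-pos K D D≤K)

  draws : ℕ
  draws = suc (W / J)

  private
    P X : ℕ
    P = falling (31 * M) (20 * M)
    X = (31 * M) ^ (20 * M)

    instance
      P-nonZero : NonZero P
      P-nonZero = ℕ.>-nonZero (falling-pos (31 * M) (20 * M) (ℕ.*-monoˡ-≤ M (ℕ.m≤m+n 20 11)))

    J≡ : J ≡ P * (11 * M)
    J≡ = trans (cong₂ falling (sym K≡) (trans (sym D≡) (cong suc 20M≡)))
           (cong (P *_) (sym (ℕ.*-distribʳ-∸ M 31 20)))

    W≡ : W ≡ 31 * M * X
    W≡ = cong₂ _^_ (sym K≡) (trans (sym D≡) (cong suc 20M≡))

    draws*J≤2W : draws * J ≤ 2 * W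
    draws*J≤2W = ℕ.+-mono-≤ (falling-≤ K D) (ℕ.≤-trans (ℕ.m/n*n≤m W J) (ℕ.≤-reflexive (sym (ℕ.+-identityʳ W))))

    draws*P≤ : draws * 11 * P ≤ 62 * X
    draws*P≤ = ℕ.*-cancelʳ-≤ _ _ M (subst₂ _≤_ (trans (cong (draws *_) J≡) (left draws P M)) (trans (cong (2 *_) W≡) (right M X)) draws*J≤2W)
      where
      left : ∀ q p m → q * (p * (11 * m)) ≡ q * 11 * p * m
      left = ℕRing.solve-∀
      right : ∀ m x → 2 * (31 * m * x) ≡ 62 * x * m
      right = ℕRing.solve-∀

  module _ (c₂₀ c₁₁ c₃₁ e g f t₁₀ t₂₁ t₂₁₋₁₀ p₄₀ p₁₆₃ : ℕ) .{{_ : NonZero f}} .{{_ : NonZero (c₁₁ * e * (t₁₀ * t₂₁))}} .{{_ : NonZero t₂₁₋₁₀}}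
           (c≡ : c₂₀ * c₁₁ ≡ c₃₁) (c₂₀≡ : c₂₀ ≡ 31 ^ 20) (c₃₁≡ : c₃₁ ≡ 31 ^ 31) (e≡ : e ≡ 600 ^ 20) (g≡ : g ≡ 1631 ^ 20) (f≡ : f ≡ 11 ^ 11)
           (t₁₀≡ : t₁₀ ≡ 10 ^ 10) (t₂₁≡ : t₂₁ ≡ 21 ^ 21) (t₂₁₋₁₀≡ : t₂₁₋₁₀ ≡ 21 ^ 10) (p₄₀≡ : p₄₀ ≡ 40 ^ 20) (p₁₆₃≡ : p₁₆₃ ≡ 163 ^ 20)
           (base : c₂₀ * (c₁₁ * e) ≤ (f * g) * falling 31 20)
           (margin : f * g * c₃₁ * p₄₀ ≤ c₁₁ * e * (t₁₀ * t₂₁) * p₁₆₃) where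

    open FallingGrowth c₂₀ c₁₁ c₃₁ e g f c≡ c₃₁≡ e≡ g≡ f≡ base

    private
      a = c₁₁ * e
      b′ = f * g
      c = t₁₀ * t₂₁
      NI = subsetsUpTo K m

      growth : X * a ^ M ≤ M ^ 31 * b′ ^ M * P
      growth = subst (λ x → x * a ^ M ≤ M ^ 31 * b′ ^ M * P) (sym (trans (pow-20 31 M) (cong (λ x → x ^ M * (M ^ M) ^ 20) (sym c₂₀≡)))) (falling-growth M)

      draws≤ : draws * 11 * a ^ M ≤ 62 * (M ^ 31 * b′ ^ M)
      draws≤ = ℕ.*-cancelʳ-≤ _ _ P (begin
        draws * 11 * a ^ M * P      ≡⟨ swap (draws * 11) (a ^ M) P ⟩
        draws * 11 * P * a ^ M      ≤⟨ ℕ.*-monoˡ-≤ (a ^ M) draws*P≤ ⟩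
        62 * X * a ^ M              ≡⟨ ℕ.*-assoc 62 X (a ^ M) ⟩
        62 * (X * a ^ M)            ≤⟨ ℕ.*-monoʳ-≤ 62 growth ⟩
        62 * (M ^ 31 * b′ ^ M * P)  ≡⟨ ℕ.*-assoc 62 (M ^ 31 * b′ ^ M) P ⟨
        62 * (M ^ 31 * b′ ^ M) * P  ∎)
        where
        open ℕ.≤-Reasoning
        swap : ∀ x y z → x * y * z ≡ x * z * y
        swap = ℕRing.solve-∀

      subsets≤ : NI * c ^ M ≤ c₃₁ ^ M
      subsets≤ = ℕ.*-cancelʳ-≤ _ _ (t₂₁₋₁₀ ^ M) {{ℕ.m^n≢0 t₂₁₋₁₀ M}} (subst₂ _≤_
          (trans (cong (NI *_) (trans (cong₂ _*_ tens twenty-ones) (trans (sym (ℕ.*-assoc (t₁₀ ^ M) (t₂₁ ^ M) (t₂₁₋₁₀ ^ M)))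
             (cong (_* t₂₁₋₁₀ ^ M) (sym (^-distribʳ-* M t₁₀ t₂₁)))))) (sym (ℕ.*-assoc NI (c ^ M) (t₂₁₋₁₀ ^ M))))
          (cong₂ _*_ (trans (cong (31 ^_) (sym K≡)) (trans (sym (ℕ.^-*-assoc 31 31 M)) (cong (_^ M) (sym c₃₁≡)))) (trans (cong (21 ^_) (sym m≡)) (trans (sym (ℕ.^-*-assoc 21 10 M)) (cong (_^ M) (sym t₂₁₋₁₀≡)))))
          (subsetsUpTo-≤ K m))
        where
        tens : 10 ^ m ≡ t₁₀ ^ M
        tens = trans (cong (10 ^_) (sym m≡)) (trans (sym (ℕ.^-*-assoc 10 10 M)) (cong (_^ M) (sym t₁₀≡)))
        twenty-ones : 21 ^ K ≡ t₂₁ ^ M * t₂₁₋₁₀ ^ M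
        twenty-ones = trans (cong (21 ^_) (sym K≡)) (trans (cong (21 ^_) (ℕ.*-distribʳ-+ M 21 10)) (trans (ℕ.^-distribˡ-+-* 21 (21 * M) (10 * M))
          (cong₂ _*_ (trans (sym (ℕ.^-*-assoc 21 21 M)) (cong (_^ M) (sym t₂₁≡))) (trans (sym (ℕ.^-*-assoc 21 10 M)) (cong (_^ M) (sym t₂₁₋₁₀≡))))))

      combined : draws * NI * 11 * p₄₀ ^ M ≤ 62 * M ^ 31 * p₁₆₃ ^ M
      combined = ℕ.*-cancelʳ-≤ _ _ ((a * c) ^ M) {{ℕ.m^n≢0 (a * c) M}} (begin
        draws * NI * 11 * p₄₀ ^ M * (a * c) ^ M              ≡⟨ cong (draws * NI * 11 * p₄₀ ^ M *_) (^-distribʳ-* M a c) ⟩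
        draws * NI * 11 * p₄₀ ^ M * (a ^ M * c ^ M)          ≡⟨ shuffle draws NI 11 (p₄₀ ^ M) (a ^ M) (c ^ M) ⟩
        (draws * 11 * a ^ M) * (NI * c ^ M) * p₄₀ ^ M        ≤⟨ ℕ.*-monoˡ-≤ (p₄₀ ^ M) (ℕ.*-mono-≤ draws≤ subsets≤) ⟩
        62 * (M ^ 31 * b′ ^ M) * c₃₁ ^ M * p₄₀ ^ M           ≡⟨ regroup 62 (M ^ 31) (b′ ^ M) (c₃₁ ^ M) (p₄₀ ^ M) ⟩
        62 * M ^ 31 * (b′ ^ M * c₃₁ ^ M * p₄₀ ^ M)           ≡⟨ cong (62 * M ^ 31 *_) (trans (cong (_* p₄₀ ^ M) (sym (^-distribʳ-* M b′ c₃₁))) (sym (^-distribʳ-* M (b′ * c₃₁) p₄₀))) ⟩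
        62 * M ^ 31 * (b′ * c₃₁ * p₄₀) ^ M                   ≤⟨ ℕ.*-monoʳ-≤ (62 * M ^ 31) (ℕ.^-monoˡ-≤ M margin) ⟩
        62 * M ^ 31 * (a * c * p₁₆₃) ^ M                     ≡⟨ cong (62 * M ^ 31 *_) (trans (^-distribʳ-* M (a * c) p₁₆₃) (ℕ.*-comm ((a * c) ^ M) (p₁₆₃ ^ M))) ⟩
        62 * M ^ 31 * (p₁₆₃ ^ M * (a * c) ^ M)               ≡⟨ ℕ.*-assoc (62 * M ^ 31) (p₁₆₃ ^ M) ((a * c) ^ M) ⟨
        62 * M ^ 31 * p₁₆₃ ^ M * (a * c) ^ M                 ∎)
        where
        open ℕ.≤-Reasoning
        shuffle : ∀ q s e f a c → q * s * e * f * (a * c) ≡ (q * e * a) * (s * c) * f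
        shuffle = ℕRing.solve-∀
        regroup : ∀ e p b t f → e * (p * b) * t * f ≡ e * p * (b * t * f)
        regroup = ℕRing.solve-∀

    evaluations-bound : ∀ d r → d + r ≡ 20 * M → r ≤ 20 → ∀ x → x ≡ 5 ^ 20 → draws * NI * 40 ^ d ≤ M ^ 31 * 163 ^ d * (x * 6)
    evaluations-bound d r d+r≡ r≤20 x x≡ = ℕ.*-cancelʳ-≤ _ _ 11 (ℕ.*-cancelʳ-≤ _ _ (40 ^ r) {{ℕ.m^n≢0 40 r}} (begin
      draws * NI * 40 ^ d * 11 * 40 ^ r          ≡⟨ shuffle (draws * NI) (40 ^ d) 11 (40 ^ r) ⟩
      draws * NI * 11 * (40 ^ d * 40 ^ r)        ≡⟨ cong (draws * NI * 11 *_) (trans (split 40) (cong (_^ M) (sym p₄₀≡))) ⟩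
      draws * NI * 11 * p₄₀ ^ M                  ≤⟨ combined ⟩
      62 * M ^ 31 * p₁₆₃ ^ M                     ≡⟨ cong (62 * M ^ 31 *_) (trans (cong (_^ M) p₁₆₃≡) (sym (split 163))) ⟩
      62 * M ^ 31 * (163 ^ d * 163 ^ r)          ≤⟨ ℕ.*-monoʳ-≤ (62 * M ^ 31) (ℕ.*-monoʳ-≤ (163 ^ d) 163^r≤) ⟩
      62 * M ^ 31 * (163 ^ d * (x * 40 ^ r))     ≤⟨ ℕ.*-monoˡ-≤ (163 ^ d * (x * 40 ^ r)) (ℕ.*-monoˡ-≤ (M ^ 31) (ℕ.m≤m+n 62 4)) ⟩
      66 * M ^ 31 * (163 ^ d * (x * 40 ^ r))     ≡⟨ regroup (M ^ 31) (163 ^ d) x (40 ^ r) ⟩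
      M ^ 31 * 163 ^ d * (x * 6) * 11 * 40 ^ r   ∎))
      where
      open ℕ.≤-Reasoning
      split : ∀ x → x ^ d * x ^ r ≡ (x ^ 20) ^ M
      split x = trans (sym (ℕ.^-distribˡ-+-* x d r)) (trans (cong (x ^_) d+r≡) (sym (ℕ.^-*-assoc x 20 M)))
      163^r≤ : 163 ^ r ≤ x * 40 ^ r
      163^r≤ = ℕ.≤-trans (ℕ.^-monoˡ-≤ r (ℕ.m≤m+n 163 37)) (ℕ.≤-trans (ℕ.≤-reflexive (^-distribʳ-* r 5 40)) (ℕ.*-monoˡ-≤ (40 ^ r) (ℕ.≤-trans (ℕ.^-monoʳ-≤ 5 r≤20) (ℕ.≤-reflexive (sym x≡)))))
      shuffle : ∀ q x e y → q * x * e * y ≡ q * e * (x * y)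
      shuffle = ℕRing.solve-∀
      regroup : ∀ p x f y → 66 * p * (x * (f * y)) ≡ p * x * (f * 6) * 11 * y
      regroup = ℕRing.solve-∀

  evaluations : ∀ d r → d + r ≡ 20 * M → r ≤ 20 → ∀ x → x ≡ 5 ^ 20 → draws * subsetsUpTo K m * 40 ^ d ≤ M ^ 31 * 163 ^ d * (x * 6)
  evaluations = evaluations-bound (31 ^ 20) (31 ^ 11) (31 ^ 31) (600 ^ 20) (1631 ^ 20) (11 ^ 11) (10 ^ 10) (21 ^ 21) (21 ^ 10) (40 ^ 20) (163 ^ 20)
    refl refl refl refl refl refl refl refl refl refl refl (ℕ.≤ᵇ⇒≤ _ _ _) (ℕ.≤ᵇ⇒≤ _ _ _)

2*-≤-2^ : ∀ x → 2 * suc x ≤ 2 ^ suc x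
2*-≤-2^ x = ℕ.*-monoʳ-≤ 2 (n<2^n x)

-- Bernoulli's inequality, in the form (1 + K/y)ⁿ ≤ 2 for 2nK ≤ y.
bernoulli-≤2 : ∀ n .{{_ : NonZero n}} K y → 2 * n * K ≤ y → (y + K) ^ n ≤ 2 * y ^ n
bernoulli-≤2 n K y 2nK≤y = ℕ.*-cancelʳ-≤ _ _ n (ℕ.≤-trans (claim n n refl) (ℕ.≤-reflexive (shuffle n (y ^ n))))
  where
  shuffle : ∀ n p → (n + n) * p ≡ 2 * p * n
  shuffle = ℕRing.solve-∀
  claim : ∀ i j → i + j ≡ n + n → (y + K) ^ i * j ≤ (n + n) * y ^ i
  claim zero    j j≡ = ℕ.≤-reflexive (trans (ℕ.*-identityˡ j) (trans j≡ (sym (ℕ.*-identityʳ (n + n)))))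
  claim (suc i) j i+j≡ = ℕ.≤-trans (ℕ.≤-reflexive (assoc (y + K) ((y + K) ^ i) j)) (ℕ.≤-trans (ℕ.*-monoʳ-≤ ((y + K) ^ i) grow)
      (ℕ.≤-trans (ℕ.≤-reflexive (swap ((y + K) ^ i) y (suc j))) (ℕ.≤-trans (ℕ.*-monoʳ-≤ y (claim i (suc j) (trans (ℕ.+-suc i j) i+j≡))) (ℕ.≤-reflexive (back y (n + n) (y ^ i))))))
    where
    assoc : ∀ s p j → s * p * j ≡ p * (s * j)
    assoc = ℕRing.solve-∀
    swap : ∀ p y j → p * (y * j) ≡ y * (p * j)
    swap = ℕRing.solve-∀
    back : ∀ y t p → y * (t * p) ≡ t * (y * p)
    back = ℕRing.solve-∀
    expand : ∀ y k j → (y + k) * j ≡ j * k + y * j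
    expand = ℕRing.solve-∀
    two : ∀ n → n + n ≡ 2 * n
    two = ℕRing.solve-∀
    grow : (y + K) * j ≤ y * suc j
    grow = ℕ.≤-trans (ℕ.≤-reflexive (expand y K j)) (ℕ.≤-trans
      (ℕ.+-monoˡ-≤ (y * j) (ℕ.≤-trans (ℕ.*-monoˡ-≤ K (ℕ.≤-trans (ℕ.m≤n+m j (suc i)) (ℕ.≤-reflexive (trans i+j≡ (two n))))) 2nK≤y))
      (ℕ.≤-reflexive (sym (ℕ.*-suc y j))))

module Sizes (n d M m K e₀ a : ℕ) (d≤n : d ≤ n) (M≡ : suc (d / 20) ≡ M) (m≡ : 10 * M ≡ m) (K≡ : 31 * M ≡ K)
             (e≡ : 11 * M ≡ suc (suc e₀)) (a≡ : suc (2 * m) ∸ d ≡ a) where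

  D n′ b rb R : ℕ
  D = suc (2 * m)
  n′ = a + n
  b = n′ + K
  rb = n′ * b
  R = 2 ^ b

  1≤M : 1 ≤ M
  1≤M = ℕ.≤-trans (s≤s z≤n) (ℕ.≤-reflexive M≡)

  D≡ : D ≡ suc (20 * M)
  D≡ = cong suc (trans (cong (2 *_) (sym m≡)) (sym (ℕ.*-assoc 2 10 M)))

  d-split : ∃ λ g → d + g ≡ 20 * M × g ≤ 20
  d-split = 20 ∸ d % 20 , trans (cong (_+ (20 ∸ d % 20)) (ℕ.m≡m%n+[m/n]*n d 20)) (trans (regroup (d % 20) (d / 20 * 20) (20 ∸ d % 20))
      (trans (cong (_+ d / 20 * 20) (ℕ.m+[n∸m]≡n (ℕ.<⇒≤ (ℕ.m%n<n d 20)))) (trans (ℕ.*-comm (suc (d / 20)) 20) (cong (20 *_) M≡)))) , ℕ.m∸n≤m 20 (d % 20)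
    where
    regroup : ∀ x y z → x + y + z ≡ x + z + y
    regroup = ℕRing.solve-∀

  d≤D : d ≤ D
  d≤D = ℕ.≤-trans (ℕ.m≤m+n d (proj₁ d-split)) (ℕ.≤-trans (ℕ.≤-reflexive (proj₁ (proj₂ d-split))) (ℕ.≤-trans (ℕ.n≤1+n (20 * M)) (ℕ.≤-reflexive (sym D≡))))

  d+a≡D : d + a ≡ D
  d+a≡D = trans (cong (_+_ d) (sym a≡)) (ℕ.m+[n∸m]≡n d≤D)

  K≡D+e : K ≡ suc (2 * m) + suc e₀
  K≡D+e = trans (sym K≡) (trans (ℕ.*-distribʳ-+ M 20 11) (trans (cong₂ _+_ (ℕ.suc-injective (sym D≡)) e≡) (ℕ.+-suc (2 * m) (suc e₀))))

  D≤K : D ≤ K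
  D≤K = ℕ.≤-trans (ℕ.m≤m+n D (suc e₀)) (ℕ.≤-reflexive (sym K≡D+e))

  m<K : m < K
  m<K = ℕ.≤-trans (s≤s (ℕ.m≤n*m m 2)) D≤K

  1≤n′ : 1 ≤ n′
  1≤n′ = ℕ.≤-trans (s≤s z≤n) (ℕ.≤-trans (ℕ.≤-reflexive (trans (sym d+a≡D) (ℕ.+-comm d a))) (ℕ.+-monoʳ-≤ a d≤n))

  e₀+m<K : suc e₀ + m < K
  e₀+m<K = ℕ.≤-trans (ℕ.≤-reflexive (cong suc (ℕ.+-comm (suc e₀) m))) (ℕ.≤-trans (ℕ.≤-reflexive refl) (ℕ.≤-trans (s≤s (ℕ.+-monoˡ-≤ (suc e₀) (ℕ.m≤n*m m 2))) (ℕ.≤-reflexive (sym K≡D+e))))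

  instance
    K-nonZero : NonZero K
    K-nonZero = ℕ.>-nonZero (ℕ.≤-<-trans z≤n m<K)

    n′-nonZero : NonZero n′
    n′-nonZero = ℕ.>-nonZero 1≤n′

    R-nonZero : NonZero R
    R-nonZero = ℕ.m^n≢0 2 b

  room : suc (2 * n′) * K ≤ R
  room = ℕ.≤-trans (room′ n′ K 1≤n′ (ℕ.≤-<-trans z≤n m<K)) (ℕ.≤-reflexive (sym (ℕ.^-distribˡ-+-* 2 n′ K)))
    where
    room′ : ∀ x y → 1 ≤ x → 1 ≤ y → suc (2 * x) * y ≤ 2 ^ x * 2 ^ y
    room′ x (suc y) _ _ = ℕ.≤-trans (ℕ.*-monoˡ-≤ (suc y) (ℕ.≤-trans (ℕ.n≤1+n (suc (2 * x))) (ℕ.≤-trans (ℕ.≤-reflexive (double x)) (ℕ.*-monoʳ-≤ 2 (n<2^n x)))))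
      (ℕ.≤-trans (ℕ.≤-reflexive (swap (2 ^ x) (suc y))) (ℕ.*-monoʳ-≤ (2 ^ x) (2*-≤-2^ y)))
      where
      double : ∀ x → suc (suc (2 * x)) ≡ 2 * suc x
      double = ℕRing.solve-∀
      swap : ∀ p y → 2 * p * y ≡ p * (2 * y)
      swap = ℕRing.solve-∀

  u : ℕ
  u = R / K

  K≤R : K ≤ R
  K≤R = ℕ.≤-trans (ℕ.m≤n*m K (suc (2 * n′))) room

  instance
    u-nonZero : NonZero u
    u-nonZero = ℕ.>-nonZero (ℕ.m≥n⇒m/n>0 K≤R)

  Ku≤R : K * u ≤ R
  Ku≤R = ℕ.≤-trans (ℕ.≤-reflexive (ℕ.*-comm K u)) (ℕ.m/n*n≤m R K)

  1≤Ku : 1 ≤ K * u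
  1≤Ku = ℕ.>-nonZero⁻¹ (K * u) {{ℕ.m*n≢0 K u}}

  R^n′≤ : R ^ n′ ≤ 2 * (K * u) ^ n′
  R^n′≤ = ℕ.≤-trans (ℕ.^-monoˡ-≤ n′ R≤) (bernoulli-≤2 n′ K (K * u) (ℕ.+-cancelʳ-≤ K _ _ (ℕ.≤-trans (ℕ.≤-reflexive (ℕ.+-comm (2 * n′ * K) K)) (ℕ.≤-trans room R≤))))
    where
    R≤ : R ≤ K * u + K
    R≤ = ℕ.≤-trans (ℕ.≤-reflexive (ℕ.m≡m%n+[m/n]*n R K)) (ℕ.≤-trans (ℕ.+-mono-≤ (ℕ.<⇒≤ (ℕ.m%n<n R K)) (ℕ.≤-reflexive (ℕ.*-comm u K))) (ℕ.≤-reflexive (ℕ.+-comm K (K * u))))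

  R^n′≡ : R ^ n′ ≡ 2 ^ rb
  R^n′≡ = trans (ℕ.^-*-assoc 2 b n′) (cong (2 ^_) (ℕ.*-comm b n′))

  open SampleCount M {{ℕ.>-nonZero 1≤M}} m K D m≡ K≡ refl public using (W; J; J-nonZero; draws; evaluations)

  W≤ : W ≤ 2 ^ (K * D)
  W≤ = ℕ.≤-trans (ℕ.^-monoˡ-≤ D (ℕ.<⇒≤ (n<2^n K))) (ℕ.≤-reflexive (ℕ.^-*-assoc 2 K D))

  draws≤ : draws ≤ 2 ^ suc (K * D)
  draws≤ = ℕ.≤-trans (ℕ.+-mono-≤ (ℕ.m^n>0 2 (K * D)) (ℕ.≤-trans (ℕ.m/n≤m W J) W≤)) (ℕ.≤-reflexive (cong (_+_ (2 ^ (K * D))) (sym (ℕ.+-identityʳ _))))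

  W≤draws*J : W ≤ draws * J
  W≤draws*J = ℕ.≤-trans (ℕ.≤-reflexive (ℕ.m≡m%n+[m/n]*n W J)) (ℕ.+-monoˡ-≤ (W / J * J) (ℕ.<⇒≤ (ℕ.m%n<n W J)))

  D≤n′ : D ≤ n′
  D≤n′ = ℕ.≤-trans (ℕ.≤-reflexive (trans (sym d+a≡D) (ℕ.+-comm d a))) (ℕ.+-monoʳ-≤ a d≤n)

  Λ : ℕ
  Λ = 4 ^ m * (u ^ n′ * (K ^ (n′ ∸ D) * J))

  W*Λ≡ : W * Λ ≡ 4 ^ m * J * (K * u) ^ n′
  W*Λ≡ = trans (shuffle W (4 ^ m) (u ^ n′) (K ^ (n′ ∸ D)) J) (cong (4 ^ m * J *_)
      (trans (cong (_* u ^ n′) (trans (sym (ℕ.^-distribˡ-+-* K (n′ ∸ D) D)) (cong (K ^_) (ℕ.m∸n+n≡m D≤n′)))) (sym (^-distribʳ-* n′ K u))))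
    where
    shuffle : ∀ w f u k j → w * (f * (u * (k * j))) ≡ f * j * (k * w * u)
    shuffle = ℕRing.solve-∀

  enough-draws : R ^ n′ * 4 ^ m ≤ 3 * (Λ * draws)
  enough-draws = begin
    R ^ n′ * 4 ^ m                       ≤⟨ ℕ.*-monoˡ-≤ (4 ^ m) R^n′≤ ⟩
    2 * (K * u) ^ n′ * 4 ^ m             ≤⟨ ℕ.*-monoˡ-≤ (4 ^ m) (ℕ.*-monoˡ-≤ ((K * u) ^ n′) (ℕ.n≤1+n 2)) ⟩
    3 * (K * u) ^ n′ * 4 ^ m             ≡⟨ cong (λ x → 3 * x * 4 ^ m) (trans (^-distribʳ-* n′ K u) (cong (_* u ^ n′) (trans (cong (K ^_) (sym (ℕ.m∸n+n≡m D≤n′))) (ℕ.^-distribˡ-+-* K (n′ ∸ D) D)))) ⟩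
    3 * (K ^ (n′ ∸ D) * W * u ^ n′) * 4 ^ m   ≤⟨ ℕ.*-monoˡ-≤ (4 ^ m) (ℕ.*-monoʳ-≤ 3 (ℕ.*-monoˡ-≤ (u ^ n′) (ℕ.*-monoʳ-≤ (K ^ (n′ ∸ D)) W≤draws*J))) ⟩
    3 * (K ^ (n′ ∸ D) * (draws * J) * u ^ n′) * 4 ^ m ≡⟨ shuffle (K ^ (n′ ∸ D)) draws J (u ^ n′) (4 ^ m) ⟩
    3 * (Λ * draws)                      ∎
    where
    open ℕ.≤-Reasoning
    shuffle : ∀ k q j u f → 3 * (k * (q * j) * u) * f ≡ 3 * (f * (u * (k * j)) * q)
    shuffle = ℕRing.solve-∀

-- A record, so that the type checker never compares these numerals by unfolding them.
record TimeEstimate (T₀ d ℓ p : ℕ) : Set where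
  constructor estimate
  field
    estimated : 144 * T₀ * 40 ^ d ≤ 163 ^ d * ℓ * p

sumℕ-affine : ∀ N c x f → sumℕ N (λ j → c + f j * x) ≡ N * c + sumℕ N f * x
sumℕ-affine zero    c x f = refl
sumℕ-affine (suc N) c x f = trans (cong (_+ (c + f N * x)) (sumℕ-affine N c x f)) (shuffle N c x (sumℕ N f) (f N))
  where
  shuffle : ∀ n c x s y → n * c + s * x + (c + y * x) ≡ suc n * c + (s + y) * x
  shuffle = ℕRing.solve-∀

≤-sum : ∀ {a b x y} q → x ≤ q * a → y ≤ q * b → x + y ≤ q * (a + b)
≤-sum {a} {b} q x≤ y≤ = ℕ.≤-trans (ℕ.+-mono-≤ x≤ y≤) (ℕ.≤-reflexive (sym (ℕ.*-distribˡ-+ q a b)))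

≤-scale : ∀ {a x} c q → x ≤ q * a → c * x ≤ q * (c * a)
≤-scale {a} c q x≤ = ℕ.≤-trans (ℕ.*-monoʳ-≤ c x≤) (ℕ.≤-reflexive (swap c q a))
  where
  swap : ∀ c q a → c * (q * a) ≡ q * (c * a)
  swap = ℕRing.solve-∀

≤-product : ∀ {a b x y} H → x ≤ H * a → y ≤ H * b → x * y ≤ H * H * (a * b)
≤-product {a} {b} H x≤ y≤ = ℕ.≤-trans (ℕ.*-mono-≤ x≤ y≤) (ℕ.≤-reflexive (shuffle a b H))
  where
  shuffle : ∀ a b h → (h * a) * (h * b) ≡ h * h * (a * b)
  shuffle = ℕRing.solve-∀

opaque
  degree : ℕ
  degree = 120

  120≤degree : 120 ≤ degree
  120≤degree = ℕ.≤-refl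

absorb-constant : ∀ {H} e p c → 2 ≤ H → c ≤ 2 ^ e → e + p ≤ 120 → H ^ p * c ≤ H ^ degree
absorb-constant {H} e p c 2≤H c≤ e+p≤ = begin
  H ^ p * c        ≤⟨ ℕ.*-monoʳ-≤ (H ^ p) (ℕ.≤-trans c≤ (ℕ.^-monoˡ-≤ e 2≤H)) ⟩
  H ^ p * H ^ e    ≡⟨ ℕ.*-comm (H ^ p) (H ^ e) ⟩
  H ^ e * H ^ p    ≡⟨ ℕ.^-distribˡ-+-* H e p ⟨
  H ^ (e + p)      ≤⟨ ℕ.^-monoʳ-≤ H {{ℕ.>-nonZero (ℕ.≤-trans (s≤s z≤n) 2≤H)}} (ℕ.≤-trans e+p≤ 120≤degree) ⟩
  H ^ degree       ∎
  where open ℕ.≤-Reasoning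

time-arithmetic : ∀ draws NI V B e M³¹ p H ℓ x v c → draws * NI * e ≤ M³¹ * p * (x * 6) → V ≤ H * H * v → B ≤ H * H * ℓ * c →
  M³¹ ≤ H ^ 31 → x * 6 * (864 * (v * c)) ≤ 2 ^ 85 → 2 ≤ H → 144 * (draws * NI * V * (6 * B)) * e ≤ p * ℓ * H ^ degree
time-arithmetic draws NI V B e M³¹ p H ℓ x v c evals V≤ B≤ M≤ const≤ 2≤H = begin
  144 * (draws * NI * V * (6 * B)) * e
    ≡⟨ split draws NI V B e ⟩
  (draws * NI * e) * (864 * V * B)
    ≤⟨ ℕ.*-mono-≤ evals (ℕ.*-mono-≤ (ℕ.*-monoʳ-≤ 864 V≤) B≤) ⟩
  (M³¹ * p * (x * 6)) * (864 * (H * H * v) * (H * H * ℓ * c))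
    ≡⟨ collect x v c M³¹ p H ℓ ⟩
  p * ℓ * (M³¹ * (H * (H * (H * (H * 1)))) * (x * 6 * (864 * (v * c))))
    ≤⟨ ℕ.*-monoʳ-≤ (p * ℓ) (ℕ.*-monoˡ-≤ (x * 6 * (864 * (v * c))) (ℕ.≤-trans (ℕ.*-monoˡ-≤ (H ^ 4) M≤) (ℕ.≤-reflexive (sym (ℕ.^-distribˡ-+-* H 31 4))))) ⟩
  p * ℓ * (H ^ 35 * (x * 6 * (864 * (v * c))))
    ≤⟨ ℕ.*-monoʳ-≤ (p * ℓ) (absorb-constant 85 35 (x * 6 * (864 * (v * c))) 2≤H const≤ ℕ.≤-refl) ⟩
  p * ℓ * H ^ degree ∎
  where
  open ℕ.≤-Reasoning
  split : ∀ q i v b e → 144 * (q * i * v * (6 * b)) * e ≡ (q * i * e) * (864 * v * b)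
  split = ℕRing.solve-∀
  collect : ∀ x v c m p h l → (m * p * (x * 6)) * (864 * (h * h * v) * (h * h * l * c)) ≡ p * l * (m * (h * (h * (h * (h * 1)))) * (x * 6 * (864 * (v * c))))
  collect = ℕRing.solve-∀

space-arithmetic : ∀ G B H → G ≤ H * 70 → B ≤ H * H * 2646 → 2 ≤ H → G * B ≤ H ^ degree
space-arithmetic G B H G≤ B≤ 2≤H = begin
  G * B                         ≤⟨ ℕ.*-mono-≤ G≤ B≤ ⟩
  (H * 70) * (H * H * 2646)     ≡⟨ shuffle 70 2646 H ⟩
  H ^ 3 * (70 * 2646)           ≤⟨ absorb-constant 18 3 (70 * 2646) 2≤H (ℕ.≤ᵇ⇒≤ _ _ _) (ℕ.≤ᵇ⇒≤ _ _ _) ⟩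
  H ^ degree                    ∎
  where
  open ℕ.≤-Reasoning
  shuffle : ∀ c c₁ h → (h * c) * (h * h * c₁) ≡ h * (h * (h * 1)) * (c * c₁)
  shuffle = ℕRing.solve-∀

module Cost (n d M m K e₀ a : ℕ) (d≤n : d ≤ n) (M≡ : suc (d / 20) ≡ M) (m≡ : 10 * M ≡ m) (K≡ : 31 * M ≡ K)
            (e≡ : 11 * M ≡ suc (suc e₀)) (a≡ : suc (2 * m) ∸ d ≡ a) (s k H : ℕ) (H≡ : 2 + n + s ≡ H) where
  open Sizes n d M m K e₀ a d≤n M≡ m≡ K≡ e≡ a≡

  N NI : ℕ
  N = draws * 4 ^ k
  NI = subsetsUpTo K m

  B₃ B₄ B G unitCost : ℕ
  B₃ = 2 + K * D + 2 * k + 3 * K + 2 * s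
  B₄ = B₃ + (K * D + rb)
  B = B₄ + (6 + (K + K))
  G = 48 + n′
  unitCost = 6 * suc B

  evaluation prologueSteps sampleSteps steps V : ℕ
  evaluation = suc (3 + (n′ * (K * 12 + 22) + 1 + 11) + 2)
  prologueSteps = 62 + 4 * (b + n′ + m + D + n′) + 5 * D + 6 * m + 5 * k
  sampleSteps = 2 + (rb * 6 + 1 + (4 + (suc (suc m * 13 + NI * evaluation) + 2)))
  steps = suc (prologueSteps + (N * suc sampleSteps + 1 + 7))
  V = (71 + 4 * (b + n′ + m + D + n′) + 5 * D + 6 * m + 5) + (11 + rb * 6 + suc m * 13 + evaluation)

  1≤NI : 1 ≤ NI
  1≤NI = go m
    where
    go : ∀ m → 1 ≤ subsetsUpTo K m
    go zero    = ℕ.≤-refl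
    go (suc m) = ℕ.≤-trans (go m) (ℕ.m≤m+n _ _)

  k≤N : k ≤ N
  k≤N = ℕ.≤-trans (ℕ.<⇒≤ (n<2^n k)) (ℕ.≤-trans (ℕ.^-monoˡ-≤ k (ℕ.m≤m+n 2 2)) (ℕ.m≤n*m (4 ^ k) draws))

  1≤N : 1 ≤ N
  1≤N = ℕ.≤-trans (ℕ.m^n>0 4 k) (ℕ.m≤n*m (4 ^ k) draws)

  steps≤ : steps ≤ N * NI * V
  steps≤ = begin
    steps
      ≡⟨ expand (4 * (b + n′ + m + D + n′)) (5 * D) (6 * m) k N rb m (NI * evaluation) ⟩
    c₀ * 1 * 1 + 5 * (k * 1) + N * (c₁ * 1 + NI * evaluation)
      ≤⟨ ℕ.+-mono-≤ (ℕ.+-mono-≤ (ℕ.*-mono-≤ (ℕ.*-monoʳ-≤ c₀ 1≤N) 1≤NI) (ℕ.*-monoʳ-≤ 5 (ℕ.*-mono-≤ k≤N 1≤NI))) (ℕ.*-monoʳ-≤ N (ℕ.+-monoˡ-≤ (NI * evaluation) (ℕ.*-monoʳ-≤ c₁ 1≤NI))) ⟩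
    c₀ * N * NI + 5 * (N * NI) + N * (c₁ * NI + NI * evaluation)
      ≡⟨ collect c₀ c₁ N NI evaluation ⟩
    N * NI * (c₀ + 5 + (c₁ + evaluation)) ∎
    where
    open ℕ.≤-Reasoning
    c₀ = 71 + 4 * (b + n′ + m + D + n′) + 5 * D + 6 * m
    c₁ = 11 + rb * 6 + suc m * 13
    expand : ∀ x y z k N r m e → suc (62 + x + y + z + 5 * k + (N * suc (2 + (r * 6 + 1 + (4 + (suc (suc m * 13 + e) + 2)))) + 1 + 7)) ≡
      (71 + x + y + z) * 1 * 1 + 5 * (k * 1) + N * ((11 + r * 6 + suc m * 13) * 1 + e)
    expand = ℕRing.solve-∀
    collect : ∀ c c′ N I e → c * N * I + 5 * (N * I) + N * (c′ * I + I * e) ≡ N * I * (c + 5 + (c′ + e))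
    collect = ℕRing.solve-∀

  -- Kept folded: comparing these products as unary numerals would not terminate in practice.
  opaque
    Tₘ T₀ Sₘ : ℕ
    Tₘ = steps * unitCost
    T₀ = draws * NI * V * unitCost
    Sₘ = G * suc B

    Tₘ≡ : Tₘ ≡ steps * unitCost
    Tₘ≡ = refl

    T₀≡ : T₀ ≡ draws * NI * V * unitCost
    T₀≡ = refl

    Sₘ≡ : Sₘ ≡ G * suc B
    Sₘ≡ = refl

  Tₘ≤ : Tₘ ≤ 4 ^ k * T₀
  Tₘ≤ = ℕ.≤-trans (ℕ.≤-reflexive Tₘ≡) (ℕ.≤-trans (ℕ.*-monoˡ-≤ unitCost steps≤)
      (ℕ.≤-reflexive (trans (shuffle draws (4 ^ k) NI V unitCost) (cong (4 ^ k *_) (sym T₀≡)))))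
    where
    shuffle : ∀ q e i v u → q * e * i * v * u ≡ e * (q * i * v * u)
    shuffle = ℕRing.solve-∀

  q : ℕ
  q = H * H

  2≤H : 2 ≤ H
  2≤H = ℕ.≤-trans (s≤s (s≤s z≤n)) (ℕ.≤-reflexive H≡)

  1≤H : 1 ≤ H
  1≤H = ℕ.≤-trans (s≤s z≤n) 2≤H

  1+n≤H : suc n ≤ H
  1+n≤H = ℕ.≤-trans (ℕ.≤-trans (ℕ.n≤1+n (suc n)) (ℕ.m≤m+n (2 + n) s)) (ℕ.≤-reflexive H≡)

  s≤H : s ≤ H
  s≤H = ℕ.≤-trans (ℕ.m≤n+m s (2 + n)) (ℕ.≤-reflexive H≡)

  instance
    H-nonZero : NonZero H
    H-nonZero = ℕ.>-nonZero 1≤H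

    q-nonZero : NonZero q
    q-nonZero = ℕ.m*n≢0 H H

  const≤ : ∀ c → c ≤ q * c
  const≤ c = ℕ.m≤n*m c q

  linear : ∀ {x} c → x ≤ H * c → x ≤ q * c
  linear c x≤ = ℕ.≤-trans x≤ (ℕ.*-monoˡ-≤ c (ℕ.m≤m*n H H))

  M≤H : M ≤ H
  M≤H = ℕ.≤-trans (ℕ.≤-reflexive (sym M≡)) (ℕ.≤-trans (s≤s (ℕ.≤-trans (ℕ.m/n≤m d 20) d≤n)) 1+n≤H)

  M≤ : M ≤ H * 1
  M≤ = ℕ.≤-trans M≤H (ℕ.≤-reflexive (sym (ℕ.*-identityʳ H)))

  m≤ : m ≤ H * 10
  m≤ = ℕ.≤-trans (ℕ.≤-reflexive (sym m≡)) (≤-scale {1} 10 H M≤)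

  K≤ : K ≤ H * 31
  K≤ = ℕ.≤-trans (ℕ.≤-reflexive (sym K≡)) (≤-scale {1} 31 H M≤)

  D≤ : D ≤ H * 21
  D≤ = ≤-sum {1} {20} H (ℕ.≤-trans 1≤H (ℕ.≤-reflexive (sym (ℕ.*-identityʳ H)))) (≤-scale {10} 2 H m≤)

  n′≤ : n′ ≤ H * 22
  n′≤ = ≤-sum {21} {1} H (ℕ.≤-trans (ℕ.≤-trans (ℕ.≤-reflexive (sym a≡)) (ℕ.m∸n≤m (suc (2 * m)) d)) D≤)
    (ℕ.≤-trans (ℕ.≤-trans (ℕ.n≤1+n n) 1+n≤H) (ℕ.≤-reflexive (sym (ℕ.*-identityʳ H))))

  b≤ : b ≤ H * 53
  b≤ = ≤-sum {22} {31} H n′≤ K≤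

  rb≤ : rb ≤ q * 1166
  rb≤ = ≤-product {22} {53} H n′≤ b≤

  KD≤ : K * D ≤ q * 651
  KD≤ = ≤-product {31} {21} H K≤ D≤

  evaluation≤ : evaluation ≤ q * 8686
  evaluation≤ = ℕ.≤-trans (ℕ.≤-reflexive (shape (n′ * (K * 12 + 22)))) (≤-sum {18} {8668} q (const≤ 18)
      (≤-product {22} {394} H n′≤ (≤-sum {372} {22} H (ℕ.≤-trans (ℕ.≤-reflexive (ℕ.*-comm K 12)) (≤-scale {31} 12 H K≤)) (ℕ.m≤n*m 22 H))))
    where
    shape : ∀ x → suc (3 + (x + 1 + 11) + 2) ≡ 18 + x
    shape = ℕRing.solve-∀

  prologue≤ : 71 + 4 * (b + n′ + m + D + n′) + 5 * D + 6 * m + 5 ≤ q * 753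
  prologue≤ = ≤-sum {748} {5} q (≤-sum {688} {60} q (≤-sum {583} {105} q (≤-sum {71} {512} q (const≤ 71) (≤-scale {128} 4 q (linear 128 sum≤))) (≤-scale {21} 5 q (linear 21 D≤))) (≤-scale {10} 6 q (linear 10 m≤))) (const≤ 5)
    where
    sum≤ : b + n′ + m + D + n′ ≤ H * 128
    sum≤ = ≤-sum {106} {22} H (≤-sum {85} {21} H (≤-sum {75} {10} H (≤-sum {53} {22} H b≤ n′≤) m≤) D≤) n′≤

  V≤ : V ≤ q * 16589
  V≤ = ≤-sum {753} {15836} q prologue≤ (≤-sum {7150} {8686} q (≤-sum {7007} {143} q (≤-sum {11} {6996} q (const≤ 11) (ℕ.≤-trans (ℕ.≤-reflexive (ℕ.*-comm rb 6)) (≤-scale {1166} 6 q rb≤)))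
      (ℕ.≤-trans (ℕ.≤-reflexive (ℕ.*-comm (suc m) 13)) (≤-scale {11} 13 q (≤-sum {1} {10} q (const≤ 1) (linear 10 m≤))))) evaluation≤)

  suc-B≤ : suc B ≤ q * 2634 + 2 * k
  suc-B≤ = ℕ.≤-trans (ℕ.≤-reflexive (shape (K * D) k K s rb)) (ℕ.+-monoˡ-≤ (2 * k)
      (≤-sum {2632} {2} q (≤-sum {2477} {155} q (≤-sum {1311} {1166} q (≤-sum {9} {1302} q (const≤ 9) (≤-scale {651} 2 q KD≤)) rb≤) (≤-scale {31} 5 q (linear 31 K≤))) (≤-scale {1} 2 q (linear 1 s≤))))
    where
    shape : ∀ x k K s r → suc (2 + x + 2 * k + 3 * K + 2 * s + (x + r) + (6 + (K + K))) ≡ 9 + 2 * x + r + 5 * K + 2 * s + 2 * k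
    shape = ℕRing.solve-∀
    s≤ : s ≤ H * 1
    s≤ = ℕ.≤-trans s≤H (ℕ.≤-reflexive (sym (ℕ.*-identityʳ H)))

  2k≤ : ∀ ℓ → k ≤ ℓ + 5 → 1 ≤ ℓ → 2 * k ≤ ℓ * 12
  2k≤ ℓ k≤ 1≤ℓ = ℕ.≤-trans (ℕ.*-monoʳ-≤ 2 (ℕ.≤-trans k≤ (ℕ.+-monoʳ-≤ ℓ (ℕ.m≤n*m 5 ℓ {{ℕ.>-nonZero 1≤ℓ}})))) (ℕ.≤-reflexive (six ℓ))
    where
    six : ∀ l → 2 * (l + l * 5) ≡ l * 12
    six = ℕRing.solve-∀

  time-bound : ∀ ℓ → 1 ≤ ℓ → k ≤ ℓ + 5 → TimeEstimate T₀ d ℓ (H ^ degree)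
  time-bound ℓ 1≤ℓ k≤ = subst (λ t → TimeEstimate t d ℓ (H ^ degree)) (sym T₀≡) $ estimate
    (time-arithmetic draws NI V (suc B) (40 ^ d) (M ^ 31) (163 ^ d) H ℓ (5 ^ 20) 16589 2646
      (evaluations d (proj₁ d-split) (proj₁ (proj₂ d-split)) (proj₂ (proj₂ d-split)) (5 ^ 20) refl) V≤ sucB≤ (ℕ.^-monoˡ-≤ 31 M≤H) (ℕ.≤ᵇ⇒≤ _ _ _) 2≤H)
    where
    sucB≤ : suc B ≤ q * ℓ * 2646
    sucB≤ = ℕ.≤-trans suc-B≤ (≤-sum {2634} {12} (q * ℓ) (ℕ.*-monoˡ-≤ 2634 (ℕ.m≤m*n q ℓ {{ℕ.>-nonZero 1≤ℓ}})) (ℕ.≤-trans (2k≤ ℓ k≤ 1≤ℓ) (ℕ.*-monoˡ-≤ 12 (ℕ.m≤n*m ℓ q))))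

  space-bound : ∀ ℓ H′ → H + ℓ ≡ H′ → k ≤ ℓ + 5 → 1 ≤ ℓ → Sₘ ≤ H′ ^ degree
  space-bound ℓ H′ H′≡ k≤ 1≤ℓ = ℕ.≤-trans (ℕ.≤-reflexive Sₘ≡) (space-arithmetic G (suc B) H′ G≤ sucB≤ (ℕ.≤-trans 2≤H H≤))
    where
    H≤ : H ≤ H′
    H≤ = ℕ.≤-trans (ℕ.m≤m+n H ℓ) (ℕ.≤-reflexive H′≡)
    ℓ≤ : ℓ ≤ H′ * H′
    ℓ≤ = ℕ.≤-trans (ℕ.≤-trans (ℕ.m≤n+m ℓ H) (ℕ.≤-reflexive H′≡)) (ℕ.m≤m*n H′ H′ {{ℕ.>-nonZero (ℕ.≤-trans 1≤H H≤)}})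
    G≤ : G ≤ H′ * 70
    G≤ = ℕ.≤-trans (≤-sum {48} {22} H (ℕ.m≤n*m 48 H) n′≤) (ℕ.*-monoˡ-≤ 70 H≤)
    sucB≤ : suc B ≤ H′ * H′ * 2646
    sucB≤ = ℕ.≤-trans suc-B≤ (≤-sum {2634} {12} (H′ * H′) (ℕ.*-monoˡ-≤ 2634 (ℕ.*-mono-≤ H≤ H≤)) (ℕ.≤-trans (2k≤ ℓ k≤ 1≤ℓ) (ℕ.*-monoˡ-≤ 12 ℓ≤)))

∑bits : ∀ r → (Vec Bool r → ℤ) → ℤ
∑bits zero    f = f []
∑bits (suc r) f = ∑bits r (f ∘ (true ∷_)) ℤ.+ ∑bits r (f ∘ (false ∷_))

sumBits : ∀ r → (Vec Bool r → ℕ) → ℕ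
sumBits zero    f = f []
sumBits (suc r) f = sumBits r (f ∘ (true ∷_)) + sumBits r (f ∘ (false ∷_))

∑bits-pos : ∀ r f → ∑bits r (λ v → + f v) ≡ + sumBits r f
∑bits-pos zero    f = refl
∑bits-pos (suc r) f = cong₂ ℤ._+_ (∑bits-pos r _) (∑bits-pos r _)

∑bits-cong : ∀ r {f g : Vec Bool r → ℤ} → f ≗ g → ∑bits r f ≡ ∑bits r g
∑bits-cong zero    f≗g = f≗g []
∑bits-cong (suc r) f≗g = cong₂ ℤ._+_ (∑bits-cong r (f≗g ∘ (true ∷_))) (∑bits-cong r (f≗g ∘ (false ∷_)))

∑bits-*ˡ : ∀ r x f → ∑bits r (λ v → x ℤ.* f v) ≡ x ℤ.* ∑bits r f
∑bits-*ˡ zero    x f = refl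
∑bits-*ˡ (suc r) x f = trans (cong₂ ℤ._+_ (∑bits-*ˡ r x _) (∑bits-*ˡ r x _)) (sym (ℤ.*-distribˡ-+ x _ _))

sumBits-*ˡ : ∀ r x f → sumBits r (λ v → x * f v) ≡ x * sumBits r f
sumBits-*ˡ zero    x f = refl
sumBits-*ˡ (suc r) x f = trans (cong₂ _+_ (sumBits-*ˡ r x _) (sumBits-*ˡ r x _)) (sym (ℕ.*-distribˡ-+ x _ _))

sumBits-mono : ∀ r {f g : Vec Bool r → ℕ} → (∀ v → f v ≤ g v) → sumBits r f ≤ sumBits r g
sumBits-mono zero    f≤g = f≤g []
sumBits-mono (suc r) f≤g = ℕ.+-mono-≤ (sumBits-mono r (f≤g ∘ (true ∷_))) (sumBits-mono r (f≤g ∘ (false ∷_)))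

∑bits-++ : ∀ a b (f : Vec Bool (a + b) → ℤ) → ∑bits (a + b) f ≡ ∑bits a (λ u → ∑bits b (λ w → f (u Vec.++ w)))
∑bits-++ zero    b f = refl
∑bits-++ (suc a) b f = cong₂ ℤ._+_ (∑bits-++ a b _) (∑bits-++ a b _)

∑bits-fromBits : ∀ r x (G : ℕ → ℤ) → ∑bits r (λ v → G (fromBits x (toList v))) ≡ ∑ (2 ^ r) (λ y → G (x * 2 ^ r + y))
∑bits-fromBits zero    x G = trans (cong G (sym (trans (ℕ.+-identityʳ (x * 1)) (ℕ.*-identityʳ x)))) (sym (ℤ.+-identityˡ _))
∑bits-fromBits (suc r) x G = begin
  ∑bits r (λ v → G (fromBits (x + x + 1) (toList v))) ℤ.+ ∑bits r (λ v → G (fromBits (x + x + 0) (toList v)))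
    ≡⟨ cong₂ ℤ._+_ (∑bits-fromBits r (x + x + 1) G) (∑bits-fromBits r (x + x + 0) G) ⟩
  ∑ h (λ y → G ((x + x + 1) * h + y)) ℤ.+ ∑ h (λ y → G ((x + x + 0) * h + y))
    ≡⟨ ℤ.+-comm (∑ h (λ y → G ((x + x + 1) * h + y))) (∑ h (λ y → G ((x + x + 0) * h + y))) ⟩
  ∑ h (λ y → G ((x + x + 0) * h + y)) ℤ.+ ∑ h (λ y → G ((x + x + 1) * h + y))
    ≡⟨ cong₂ ℤ._+_ (∑-cong h (λ y _ → cong G (low x h y))) (∑-cong h (λ y _ → cong G (high x h y))) ⟩
  ∑ h (λ y → G (x * (2 * h) + y)) ℤ.+ ∑ h (λ y → G (x * (2 * h) + (h + y)))
    ≡⟨ ∑-+ h h (λ y → G (x * (2 * h) + y)) ⟨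
  ∑ (h + h) (λ y → G (x * (2 * h) + y))
    ≡⟨ cong (λ k → ∑ (h + k) (λ y → G (x * (2 * h) + y))) (sym (ℕ.+-identityʳ h)) ⟩
  ∑ (2 * h) (λ y → G (x * (2 * h) + y)) ∎
  where
  open ≡-Reasoning
  h = 2 ^ r
  low : ∀ x h y → (x + x + 0) * h + y ≡ x * (2 * h) + y
  low = ℕRing.solve-∀
  high : ∀ x h y → (x + x + 1) * h + y ≡ x * (2 * h) + (h + y)
  high = ℕRing.solve-∀

chunks : ∀ r N → Vec Bool (N * r) → List (List Bool)
chunks r zero    v = []
chunks r (suc N) v = toList (Vec.take r v) ∷ chunks r N (Vec.drop r v)

chunks-++ : ∀ r N (u : Vec Bool r) w → chunks r (suc N) (u Vec.++ w) ≡ toList u ∷ chunks r N w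
chunks-++ r N u w = cong₂ (λ x y → toList x ∷ chunks r N y) (proj₁ (split u)) (proj₂ (split u))
  where
  split : ∀ {r} (u : Vec Bool r) → Vec.take r (u Vec.++ w) ≡ u × Vec.drop r (u Vec.++ w) ≡ w
  split []      = refl , refl
  split (b ∷ u) = cong (b ∷_) (proj₁ (split u)) , proj₂ (split u)

chunks-concat : ∀ r N v → List.concat (chunks r N v) ≡ toList v
chunks-concat r zero    [] = refl
chunks-concat r (suc N) v = trans (cong (toList (Vec.take r v) ++_) (chunks-concat r N (Vec.drop r v)))
  (trans (sym (Vec.toList-++ (Vec.take r v) (Vec.drop r v))) (cong toList (Vec.take++drop≡id r v)))

chunks-length : ∀ r N v → length (chunks r N v) ≡ N
chunks-length r zero    v = refl
chunks-length r (suc N) v = cong suc (chunks-length r N (Vec.drop r v))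

chunks-lengths : ∀ r N v → All (λ bs → length bs ≡ r) (chunks r N v)
chunks-lengths r zero    v = []
chunks-lengths r (suc N) v = Vec.length-toList (Vec.take r v) ∷ chunks-lengths r N (Vec.drop r v)

module Chebyshev (r : ℕ) (z : ℕ → ℕ) (Λ F : ℕ) .{{_ : NonZero Λ}} where

  R₀ A : ℕ
  R₀ = 2 ^ r
  A = sumℕ R₀ z

  total-of : List (List Bool) → ℕ
  total-of []         = 0
  total-of (bs ∷ bss) = z (fromBits 0 bs) + total-of bss

  deviation : ℕ → ℤ
  deviation X = + R₀ ℤ.* + z X ℤ.- + A

  deviations : ℤ → List (List Bool) → ℤ
  deviations y []         = y
  deviations y (bs ∷ bss) = deviations (y ℤ.+ deviation (fromBits 0 bs)) bss

  deviations-total : ∀ y bss → deviations y bss ≡ y ℤ.+ (+ R₀ ℤ.* + total-of bss ℤ.- + length bss ℤ.* + A)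
  deviations-total y []         = lemma y (+ R₀) (+ A)
    where
    lemma : ∀ y r a → y ≡ y ℤ.+ (r ℤ.* 0ℤ ℤ.- 0ℤ ℤ.* a)
    lemma = ℤRing.solve-∀
  deviations-total y (bs ∷ bss) = trans (deviations-total (y ℤ.+ deviation (fromBits 0 bs)) bss)
      (lemma y (+ R₀) (+ z (fromBits 0 bs)) (+ A) (+ total-of bss) (+ length bss))
    where
    lemma : ∀ y r z a t l → y ℤ.+ (r ℤ.* z ℤ.- a) ℤ.+ (r ℤ.* t ℤ.- l ℤ.* a) ≡ y ℤ.+ (r ℤ.* (z ℤ.+ t) ℤ.- (1ℤ ℤ.+ l) ℤ.* a)
    lemma = ℤRing.solve-∀

  variance : ℤ
  variance = ∑ R₀ (λ X → deviation X ℤ.* deviation X)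

  ∑-deviation : ∑ R₀ deviation ≡ 0ℤ
  ∑-deviation = trans (∑-distrib R₀ (λ X → + R₀ ℤ.* + z X) (λ _ → ℤ.- + A))
    (trans (cong₂ ℤ._+_ (trans (∑-*ˡ R₀ (+ R₀) (λ X → + z X)) (cong (+ R₀ ℤ.*_) (∑-pos R₀ z))) (∑-const R₀ (ℤ.- + A))) (lemma (+ R₀) (+ A)))
    where
    lemma : ∀ r a → r ℤ.* a ℤ.+ r ℤ.* (ℤ.- a) ≡ 0ℤ
    lemma = ℤRing.solve-∀

  ∑-shifted-square : ∀ y → ∑ R₀ (λ X → (y ℤ.+ deviation X) ℤ.* (y ℤ.+ deviation X)) ≡ + R₀ ℤ.* (y ℤ.* y) ℤ.+ variance
  ∑-shifted-square y = trans (∑-cong R₀ (λ X _ → expand y (deviation X)))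
    (trans (∑-distrib R₀ (λ X → y ℤ.* y ℤ.+ (y ℤ.+ y) ℤ.* deviation X) (λ X → deviation X ℤ.* deviation X))
      (cong (ℤ._+ variance) (trans (∑-distrib R₀ (λ _ → y ℤ.* y) (λ X → (y ℤ.+ y) ℤ.* deviation X))
        (trans (cong₂ ℤ._+_ (∑-const R₀ (y ℤ.* y)) (trans (∑-*ˡ R₀ (y ℤ.+ y) deviation) (trans (cong ((y ℤ.+ y) ℤ.*_) ∑-deviation) (ℤ.*-zeroʳ (y ℤ.+ y))))) (ℤ.+-identityʳ (+ R₀ ℤ.* (y ℤ.* y)))))))
    where
    expand : ∀ y x → (y ℤ.+ x) ℤ.* (y ℤ.+ x) ≡ y ℤ.* y ℤ.+ (y ℤ.+ y) ℤ.* x ℤ.+ x ℤ.* x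
    expand = ℤRing.solve-∀

  second-moment : ∀ N y → + R₀ ℤ.* ∑bits (N * r) (λ v → let x = deviations y (chunks r N v) in x ℤ.* x) ≡
                  + (R₀ ^ N) ℤ.* (+ R₀ ℤ.* (y ℤ.* y) ℤ.+ + N ℤ.* variance)
  second-moment zero    y = lemma (+ R₀) y variance
    where
    lemma : ∀ r y v → r ℤ.* (y ℤ.* y) ≡ 1ℤ ℤ.* (r ℤ.* (y ℤ.* y) ℤ.+ 0ℤ ℤ.* v)
    lemma = ℤRing.solve-∀
  second-moment (suc N) y = begin
    + R₀ ℤ.* ∑bits (r + N * r) (λ v → sq (deviations y (chunks r (suc N) v)))
      ≡⟨ cong (+ R₀ ℤ.*_) (trans (∑bits-++ r (N * r) _) (∑bits-cong r λ u → ∑bits-cong (N * r) λ w → cong (sq ∘ deviations y) (chunks-++ r N u w))) ⟩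
    + R₀ ℤ.* ∑bits r (λ u → ∑bits (N * r) (λ w → sq (deviations (y ℤ.+ deviation (fromBits 0 (toList u))) (chunks r N w))))
      ≡⟨ sym (∑bits-*ˡ r (+ R₀) _) ⟩
    ∑bits r (λ u → + R₀ ℤ.* ∑bits (N * r) (λ w → sq (deviations (y ℤ.+ deviation (fromBits 0 (toList u))) (chunks r N w))))
      ≡⟨ ∑bits-cong r (λ u → second-moment N (y ℤ.+ deviation (fromBits 0 (toList u)))) ⟩
    ∑bits r (λ u → next (fromBits 0 (toList u)))
      ≡⟨ ∑bits-fromBits r 0 next ⟩
    ∑ R₀ next
      ≡⟨ ∑-*ˡ R₀ (+ (R₀ ^ N)) _ ⟩
    + (R₀ ^ N) ℤ.* ∑ R₀ (λ X → + R₀ ℤ.* sq (y ℤ.+ deviation X) ℤ.+ + N ℤ.* variance)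
      ≡⟨ cong (+ (R₀ ^ N) ℤ.*_) (trans (∑-distrib R₀ _ _) (cong₂ ℤ._+_ (trans (∑-*ˡ R₀ (+ R₀) _) (cong (+ R₀ ℤ.*_) (∑-shifted-square y))) (∑-const R₀ _))) ⟩
    + (R₀ ^ N) ℤ.* (+ R₀ ℤ.* (+ R₀ ℤ.* (y ℤ.* y) ℤ.+ variance) ℤ.+ + R₀ ℤ.* (+ N ℤ.* variance))
      ≡⟨ collect (+ (R₀ ^ N)) (+ R₀) (y ℤ.* y) variance (+ N) ⟩
    (+ R₀ ℤ.* + (R₀ ^ N)) ℤ.* (+ R₀ ℤ.* (y ℤ.* y) ℤ.+ (1ℤ ℤ.+ + N) ℤ.* variance)
      ≡⟨ cong (ℤ._* (+ R₀ ℤ.* (y ℤ.* y) ℤ.+ + suc N ℤ.* variance)) (mul-pos R₀ (R₀ ^ N)) ⟩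
    + (R₀ ^ suc N) ℤ.* (+ R₀ ℤ.* (y ℤ.* y) ℤ.+ + suc N ℤ.* variance) ∎
    where
    open ≡-Reasoning
    sq : ℤ → ℤ
    sq x = x ℤ.* x
    next : ℕ → ℤ
    next X = + (R₀ ^ N) ℤ.* (+ R₀ ℤ.* sq (y ℤ.+ deviation X) ℤ.+ + N ℤ.* variance)
    collect : ∀ p r y v n → p ℤ.* (r ℤ.* (r ℤ.* y ℤ.+ v) ℤ.+ r ℤ.* (n ℤ.* v)) ≡ (r ℤ.* p) ℤ.* (r ℤ.* y ℤ.+ (1ℤ ℤ.+ n) ℤ.* v)
    collect = ℤRing.solve-∀

  squares : ℕ
  squares = sumℕ R₀ (λ X → z X * z X)

  square-abs : ∀ x → x ℤ.* x ≡ + (ℤ.∣ x ∣ * ℤ.∣ x ∣)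
  square-abs (+ n)      = mul-pos n n
  square-abs (-[1+ n ]) = refl

  variance-≤ : ∃ λ V → variance ≡ + V × V ≤ R₀ * R₀ * squares
  variance-≤ = V , V≡ , ℤ.drop‿+≤+ (ℤ.≤-trans (ℤ.i≤i+j (+ V) (+ (R₀ * (A * A)))) (ℤ.≤-reflexive (trans (cong (ℤ._+ + (R₀ * (A * A))) (sym V≡)) (sym moment))))
    where
    V = sumℕ R₀ (λ X → ℤ.∣ deviation X ∣ * ℤ.∣ deviation X ∣)
    V≡ : variance ≡ + V
    V≡ = trans (∑-cong R₀ (λ X _ → square-abs (deviation X))) (∑-pos R₀ _)
    moment : + (R₀ * R₀ * squares) ≡ variance ℤ.+ + (R₀ * (A * A))
    moment = begin
      + (R₀ * R₀ * squares)
        ≡⟨ trans (ℤ.pos-* (R₀ * R₀) squares) (cong₂ ℤ._*_ (ℤ.pos-* R₀ R₀) (sym (∑-pos R₀ _))) ⟩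
      + R₀ ℤ.* + R₀ ℤ.* ∑ R₀ (λ X → + (z X * z X))
        ≡⟨ sym (∑-*ˡ R₀ (+ R₀ ℤ.* + R₀) _) ⟩
      ∑ R₀ (λ X → + R₀ ℤ.* + R₀ ℤ.* + (z X * z X))
        ≡⟨ ∑-cong R₀ (λ X _ → trans (cong (+ R₀ ℤ.* + R₀ ℤ.*_) (ℤ.pos-* (z X) (z X))) (expand (+ R₀) (+ z X) (+ A))) ⟩
      ∑ R₀ (λ X → (+ A ℤ.+ deviation X) ℤ.* (+ A ℤ.+ deviation X))
        ≡⟨ ∑-shifted-square (+ A) ⟩
      + R₀ ℤ.* (+ A ℤ.* + A) ℤ.+ variance
        ≡⟨ trans (ℤ.+-comm _ variance) (cong (ℤ._+_ variance) (trans (cong (+ R₀ ℤ.*_) (mul-pos A A)) (mul-pos R₀ (A * A)))) ⟩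
      variance ℤ.+ + (R₀ * (A * A)) ∎
      where
      open ≡-Reasoning
      expand : ∀ r z a → r ℤ.* r ℤ.* (z ℤ.* z) ≡ (a ℤ.+ (r ℤ.* z ℤ.- a)) ℤ.* (a ℤ.+ (r ℤ.* z ℤ.- a))
      expand = ℤRing.solve-∀

  module _ (z≤ : ∀ X → Λ * z X ≤ F * A) where

    squares-≤ : Λ * squares ≤ F * A * A
    squares-≤ = go R₀
      where
      go : ∀ k → Λ * sumℕ k (λ X → z X * z X) ≤ F * A * sumℕ k z
      go zero    = ℕ.≤-reflexive (trans (ℕ.*-zeroʳ Λ) (sym (ℕ.*-zeroʳ (F * A))))
      go (suc k) = ℕ.≤-trans (ℕ.≤-reflexive (ℕ.*-distribˡ-+ Λ _ (z k * z k)))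
        (ℕ.≤-trans (ℕ.+-mono-≤ (go k) (ℕ.≤-trans (ℕ.≤-reflexive (sym (ℕ.*-assoc Λ (z k) (z k)))) (ℕ.*-monoˡ-≤ (z k) (z≤ k))))
          (ℕ.≤-reflexive (sym (ℕ.*-distribˡ-+ (F * A) (sumℕ k z) (z k)))))

    module _ (draws k : ℕ) .{{_ : NonZero draws}} (R₀F≤ : R₀ * F ≤ 3 * (Λ * draws)) where

      N : ℕ
      N = draws * 4 ^ k

      error : Vec Bool (N * r) → ℕ
      error v = ℤ.∣ + R₀ ℤ.* + total-of (chunks r N v) ℤ.- + N ℤ.* + A ∣

      accurate : Vec Bool (N * r) → Bool
      accurate v = 2 ^ k * error v <ᵇ suc (3 * (N * A))

      failure : Vec Bool (N * r) → ℕ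
      failure v = if accurate v then 0 else 1

      error≡ : ∀ v → error v ≡ ℤ.∣ deviations 0ℤ (chunks r N v) ∣
      error≡ v = cong ℤ.∣_∣ (sym (trans (deviations-total 0ℤ (chunks r N v))
        (trans (ℤ.+-identityˡ _) (cong (λ l → + R₀ ℤ.* + total-of (chunks r N v) ℤ.- + l ℤ.* + A) (chunks-length r N v)))))

      sum-square : R₀ * sumBits (N * r) (λ v → error v * error v) ≤ R₀ ^ N * (N * (R₀ * R₀ * squares))
      sum-square with variance-≤
      ... | V , V≡ , V≤ = ℕ.≤-trans (ℕ.≤-reflexive (ℤ.+-injective (begin
          + (R₀ * sumBits (N * r) (λ v → error v * error v))
            ≡⟨ trans (ℤ.pos-* R₀ _) (cong (+ R₀ ℤ.*_) (sym (∑bits-pos (N * r) _))) ⟩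
          + R₀ ℤ.* ∑bits (N * r) (λ v → + (error v * error v))
            ≡⟨ cong (+ R₀ ℤ.*_) (∑bits-cong (N * r) λ v → trans (cong (λ x → + (x * x)) (error≡ v)) (sym (square-abs (deviations 0ℤ (chunks r N v))))) ⟩
          + R₀ ℤ.* ∑bits (N * r) (λ v → deviations 0ℤ (chunks r N v) ℤ.* deviations 0ℤ (chunks r N v))
            ≡⟨ second-moment N 0ℤ ⟩
          + (R₀ ^ N) ℤ.* (+ R₀ ℤ.* 0ℤ ℤ.+ + N ℤ.* variance)
            ≡⟨ cong (+ (R₀ ^ N) ℤ.*_) (trans (cong₂ (λ x y → x ℤ.+ + N ℤ.* y) (ℤ.*-zeroʳ (+ R₀)) V≡) (trans (ℤ.+-identityˡ _) (mul-pos N V))) ⟩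
          + (R₀ ^ N) ℤ.* + (N * V)
            ≡⟨ mul-pos (R₀ ^ N) (N * V) ⟩
          + (R₀ ^ N * (N * V)) ∎)))
          (ℕ.*-monoʳ-≤ (R₀ ^ N) (ℕ.*-monoʳ-≤ N V≤))
        where open ≡-Reasoning

      failures : ℕ
      failures = sumBits (N * r) failure

      markov : failures * (3 * (N * A) * (3 * (N * A))) ≤ 4 ^ k * sumBits (N * r) (λ v → error v * error v)
      markov = subst₂ _≤_ (trans (sumBits-*ˡ (N * r) (threshold * threshold) failure) (ℕ.*-comm (threshold * threshold) failures)) (sumBits-*ˡ (N * r) (4 ^ k) _) (sumBits-mono (N * r) each)
        where
        threshold = 3 * (N * A)
        4^k≡ : 4 ^ k ≡ 2 ^ k * 2 ^ k
        4^k≡ = trans (ℕ.^-*-assoc 2 2 k) (trans (cong (λ x → 2 ^ (k + x)) (ℕ.+-identityʳ k)) (ℕ.^-distribˡ-+-* 2 k k))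
        each : ∀ v → threshold * threshold * failure v ≤ 4 ^ k * (error v * error v)
        each v with accurate v in acc
        ... | true  = ℕ.≤-trans (ℕ.≤-reflexive (ℕ.*-zeroʳ (threshold * threshold))) z≤n
        ... | false = ℕ.≤-trans (ℕ.≤-reflexive (ℕ.*-identityʳ (threshold * threshold)))
            (ℕ.≤-trans (ℕ.*-mono-≤ threshold≤ threshold≤) (ℕ.≤-reflexive (trans (shuffle (2 ^ k) (error v)) (cong (_* (error v * error v)) (sym 4^k≡)))))
          where
          threshold≤ : threshold ≤ 2 ^ k * error v
          threshold≤ = ℕ.<⇒≤ (<ᵇ-false⁻¹ {2 ^ k * error v} acc)
          shuffle : ∀ p e → p * e * (p * e) ≡ p * p * (e * e)
          shuffle = ℕRing.solve-∀

      few-failures : 3 * failures ≤ R₀ ^ N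
      few-failures with A ℕ.≟ 0
      ... | yes A≡0 = ℕ.≤-trans (ℕ.≤-reflexive (trans (cong (3 *_) (all-zero (N * r) (λ v → cong (λ b → if b then 0 else 1) (always v)))) (ℕ.*-zeroʳ 3))) z≤n
        where
        all-zero : ∀ r {f : Vec Bool r → ℕ} → (∀ v → f v ≡ 0) → sumBits r f ≡ 0
        all-zero zero    f≡0 = f≡0 []
        all-zero (suc r) f≡0 = cong₂ _+_ (all-zero r (f≡0 ∘ (true ∷_))) (all-zero r (f≡0 ∘ (false ∷_)))
        z≡0 : ∀ X → z X ≡ 0
        z≡0 X = ℕ.n≤0⇒n≡0 (ℕ.*-cancelˡ-≤ Λ (ℕ.≤-trans (z≤ X) (ℕ.≤-reflexive (trans (cong (F *_) A≡0) (trans (ℕ.*-zeroʳ F) (sym (ℕ.*-zeroʳ Λ)))))))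
        total≡0 : ∀ bss → total-of bss ≡ 0
        total≡0 []         = refl
        total≡0 (bs ∷ bss) = cong₂ _+_ (z≡0 (fromBits 0 bs)) (total≡0 bss)
        error≡0 : ∀ v → error v ≡ 0
        error≡0 v = cong ℤ.∣_∣ (cong₂ ℤ._-_ (trans (cong (λ t → + R₀ ℤ.* + t) (total≡0 (chunks r N v))) (ℤ.*-zeroʳ (+ R₀))) (trans (cong (λ a → + N ℤ.* + a) A≡0) (ℤ.*-zeroʳ (+ N))))
        always : ∀ v → accurate v ≡ true
        always v = T→≡ (ℕ.<⇒<ᵇ (ℕ.≤-<-trans (ℕ.≤-reflexive (trans (cong (2 ^ k *_) (error≡0 v)) (ℕ.*-zeroʳ (2 ^ k)))) z<s))
      ... | no A≢0 = ℕ.*-cancelˡ-≤ common {{nonZero}} (begin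
        common * (3 * failures)
          ≡⟨ s₁ Λ R₀ draws N A failures (4 ^ k) ⟩
        Λ * R₀ * (failures * (3 * (draws * 4 ^ k * A) * (3 * (N * A))))
          ≤⟨ ℕ.*-monoʳ-≤ (Λ * R₀) markov ⟩
        Λ * R₀ * (4 ^ k * SS)
          ≡⟨ s₂ Λ R₀ (4 ^ k) SS ⟩
        Λ * 4 ^ k * (R₀ * SS)
          ≤⟨ ℕ.*-monoʳ-≤ (Λ * 4 ^ k) sum-square ⟩
        Λ * 4 ^ k * (R₀ ^ N * (N * (R₀ * R₀ * squares)))
          ≡⟨ s₃ Λ (4 ^ k) (R₀ ^ N) N R₀ squares ⟩
        4 ^ k * R₀ ^ N * N * R₀ * R₀ * (Λ * squares)
          ≤⟨ ℕ.*-monoʳ-≤ (4 ^ k * R₀ ^ N * N * R₀ * R₀) squares-≤ ⟩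
        4 ^ k * R₀ ^ N * N * R₀ * R₀ * (F * A * A)
          ≡⟨ s₄ (4 ^ k) (R₀ ^ N) N R₀ F A ⟩
        4 ^ k * N * R₀ * A * A * R₀ ^ N * (R₀ * F)
          ≤⟨ ℕ.*-monoʳ-≤ (4 ^ k * N * R₀ * A * A * R₀ ^ N) R₀F≤ ⟩
        4 ^ k * N * R₀ * A * A * R₀ ^ N * (3 * (Λ * draws))
          ≡⟨ s₅ (4 ^ k) N R₀ A (R₀ ^ N) Λ draws ⟩
        common * R₀ ^ N ∎)
        where
        open ℕ.≤-Reasoning
        SS = sumBits (N * r) (λ v → error v * error v)
        common = 3 * (Λ * R₀ * draws * N * A * A * 4 ^ k)
        nonZero : NonZero common
        nonZero = ℕ.m*n≢0 3 (Λ * R₀ * draws * N * A * A * 4 ^ k)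
          where
          instance
            R₀-nonZero : NonZero R₀
            R₀-nonZero = ℕ.m^n≢0 2 r
            4^k-nonZero : NonZero (4 ^ k)
            4^k-nonZero = ℕ.m^n≢0 4 k
            A-nonZero : NonZero A
            A-nonZero = ℕ.≢-nonZero A≢0
            N-nonZero : NonZero N
            N-nonZero = ℕ.m*n≢0 draws (4 ^ k)
            p₁ : NonZero (Λ * R₀)
            p₁ = ℕ.m*n≢0 Λ R₀
            p₂ : NonZero (Λ * R₀ * draws)
            p₂ = ℕ.m*n≢0 (Λ * R₀) draws
            p₃ : NonZero (Λ * R₀ * draws * N)
            p₃ = ℕ.m*n≢0 (Λ * R₀ * draws) N
            p₄ : NonZero (Λ * R₀ * draws * N * A)
            p₄ = ℕ.m*n≢0 (Λ * R₀ * draws * N) A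
            p₅ : NonZero (Λ * R₀ * draws * N * A * A)
            p₅ = ℕ.m*n≢0 (Λ * R₀ * draws * N * A) A
            p₆ : NonZero (Λ * R₀ * draws * N * A * A * 4 ^ k)
            p₆ = ℕ.m*n≢0 (Λ * R₀ * draws * N * A * A) (4 ^ k)
        s₁ : ∀ Λ r q n a f e → 3 * (Λ * r * q * n * a * a * e) * (3 * f) ≡ Λ * r * (f * (3 * (q * e * a) * (3 * (n * a))))
        s₁ = ℕRing.solve-∀
        s₂ : ∀ Λ r e s → Λ * r * (e * s) ≡ Λ * e * (r * s)
        s₂ = ℕRing.solve-∀
        s₃ : ∀ Λ e p n r s → Λ * e * (p * (n * (r * r * s))) ≡ e * p * n * r * r * (Λ * s)
        s₃ = ℕRing.solve-∀
        s₄ : ∀ e p n r f a → e * p * n * r * r * (f * a * a) ≡ e * n * r * a * a * p * (r * f)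
        s₄ = ℕRing.solve-∀
        s₅ : ∀ e n r a p Λ q → e * n * r * a * a * p * (3 * (Λ * q)) ≡ 3 * (Λ * r * q * n * a * a * e) * p
        s₅ = ℕRing.solve-∀

      count-complement : ∀ r (p : Vec Bool r → Bool) → count p + sumBits r (λ v → if p v then 0 else 1) ≡ 2 ^ r
      count-complement zero    p with p []
      ... | true  = refl
      ... | false = refl
      count-complement (suc r) p = trans (shuffle (count (p ∘ (true ∷_))) _ _ _)
          (trans (cong₂ _+_ (count-complement r (p ∘ (true ∷_))) (count-complement r (p ∘ (false ∷_)))) (cong (_+_ (2 ^ r)) (sym (ℕ.+-identityʳ (2 ^ r)))))
        where
        shuffle : ∀ a b c e → a + b + (c + e) ≡ (a + c) + (b + e)
        shuffle = ℕRing.solve-∀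

      likely-accurate : 2 * 2 ^ (N * r) ≤ 3 * count accurate
      likely-accurate = ℕ.+-cancelʳ-≤ (3 * failures) _ _ (begin
        2 * 2 ^ (N * r) + 3 * failures           ≤⟨ ℕ.+-monoʳ-≤ (2 * 2 ^ (N * r)) few-failures ⟩
        2 * 2 ^ (N * r) + R₀ ^ N                 ≡⟨ cong (_+_ (2 * 2 ^ (N * r))) (trans (ℕ.^-*-assoc 2 r N) (cong (2 ^_) (ℕ.*-comm r N))) ⟩
        2 * 2 ^ (N * r) + 2 ^ (N * r)            ≡⟨ three (2 ^ (N * r)) ⟩
        3 * 2 ^ (N * r)                          ≡⟨ cong (3 *_) (sym (count-complement (N * r) accurate)) ⟩
        3 * (count accurate + failures)          ≡⟨ ℕ.*-distribˡ-+ 3 (count accurate) failures ⟩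
        3 * count accurate + 3 * failures        ∎)
        where
        open ℕ.≤-Reasoning
        three : ∀ x → 2 * x + x ≡ 3 * x
        three = ℕRing.solve-∀

opaque
  int : ℤ → ℚ
  int z = z ℚ./ 1

  int≡ : ∀ z → int z ≡ z ℚ./ 1
  int≡ z = refl

  int-0 : int 0ℤ ≡ 0ℚ
  int-0 = refl

  int-1 : int 1ℤ ≡ 1ℚ
  int-1 = refl

  toℚᵘ-int : ∀ z → ℚ.toℚᵘ (int z) ℚᵘ.≃ ℚᵘ.mkℚᵘ z 0
  toℚᵘ-int z = ℚ.toℚᵘ-fromℚᵘ (ℚᵘ.mkℚᵘ z 0)

  int-+ : ∀ a b → int (a ℤ.+ b) ≡ int a ℚ.+ int b
  int-+ a b = ℚ.toℚᵘ-injective (ℚᵘ.≃-trans (toℚᵘ-int (a ℤ.+ b)) (ℚᵘ.≃-trans (ℚᵘ.*≡* (lemma a b))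
    (ℚᵘ.≃-sym (ℚᵘ.≃-trans (ℚ.toℚᵘ-homo-+ (int a) (int b)) (ℚᵘ.+-cong (toℚᵘ-int a) (toℚᵘ-int b))))))
    where
    lemma : ∀ a b → (a ℤ.+ b) ℤ.* 1ℤ ≡ (a ℤ.* 1ℤ ℤ.+ b ℤ.* 1ℤ) ℤ.* 1ℤ
    lemma = ℤRing.solve-∀

  int-* : ∀ a b → int (a ℤ.* b) ≡ int a ℚ.* int b
  int-* a b = ℚ.toℚᵘ-injective (ℚᵘ.≃-trans (toℚᵘ-int (a ℤ.* b)) (ℚᵘ.≃-trans (ℚᵘ.*≡* refl)
    (ℚᵘ.≃-sym (ℚᵘ.≃-trans (ℚ.toℚᵘ-homo-* (int a) (int b)) (ℚᵘ.*-cong (toℚᵘ-int a) (toℚᵘ-int b))))))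

  int-pos-* : ∀ a b → int (+ (a * b)) ≡ int (+ a) ℚ.* int (+ b)
  int-pos-* a b = trans (cong int (ℤ.pos-* a b)) (int-* (+ a) (+ b))

  int-mono : ∀ {a b} → a ℤ.≤ b → int a ℚ.≤ int b
  int-mono {a} {b} a≤b = ℚ.toℚᵘ-cancel-≤ (ℚᵘ.≤-respˡ-≃ (ℚᵘ.≃-sym (toℚᵘ-int a)) (ℚᵘ.≤-respʳ-≃ (ℚᵘ.≃-sym (toℚᵘ-int b))
    (ℚᵘ.*≤* (ℤ.*-monoʳ-≤-nonNeg 1ℤ a≤b))))

  int-cancel : ∀ {a b} → int a ℚ.≤ int b → a ℤ.≤ b
  int-cancel {a} {b} p = ℤ.*-cancelʳ-≤-pos a b 1ℤ (ℚᵘ.drop-*≤* (ℚᵘ.≤-respˡ-≃ (toℚᵘ-int a) (ℚᵘ.≤-respʳ-≃ (toℚᵘ-int b) (ℚ.toℚᵘ-mono-≤ p))))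

  int-neg : ∀ a → int (ℤ.- a) ≡ ℚ.- int a
  int-neg a = trans (lemma (int (ℤ.- a)) (int a)) (trans (cong (ℚ._- int a) (trans (sym (int-+ (ℤ.- a) a)) (cong int (ℤ.+-inverseˡ a)))) (ℚ.+-identityˡ _))
    where
    lemma : ∀ x y → x ≡ x ℚ.+ y ℚ.- y
    lemma = ℚ-solve 2 (λ x y → x := x :+ y :- y) refl

  int-positive : ∀ n .{{_ : NonZero n}} → 0ℚ ℚ.< int (+ n)
  int-positive n = ℚ.≰⇒> λ n≤0 → ℕ.≢-nonZero⁻¹ n (ℕ.n≤0⇒n≡0 (ℤ.drop‿+≤+ (int-cancel {+ n} {0ℤ} n≤0)))

  quotient-* : ∀ a b .{{_ : NonZero b}} → (a ℚ./ b) ℚ.* int (+ b) ≡ int a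
  quotient-* a (suc b) = ℚ.toℚᵘ-injective (ℚᵘ.≃-trans (ℚ.toℚᵘ-homo-* (a ℚ./ suc b) (int (+ suc b)))
    (ℚᵘ.≃-trans (ℚᵘ.*-cong (ℚ.toℚᵘ-fromℚᵘ (ℚᵘ.mkℚᵘ a b)) (toℚᵘ-int (+ suc b)))
      (ℚᵘ.≃-trans (ℚᵘ.*≡* (trans (ℤ.*-identityʳ (a ℤ.* + suc b)) (cong (λ k → a ℤ.* + suc k) (sym (ℕ.*-identityʳ b))))) (ℚᵘ.≃-sym (toℚᵘ-int a)))))

-- The order of Cauchy reals, on the level of the approximating sequences.
infix 4 _≲_ _≋_
record _≲_ (u v : ℕ → ℚ) : Set where
  constructor mk≲
  field within : ∀ δ → 0ℚ ℚ.< δ → Eventually λ n → u n ℚ.≤ v n ℚ.+ δ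

open _≲_ public

_≋_ : (ℕ → ℚ) → (ℕ → ℚ) → Set
u ≋ v = u ≲ v × v ≲ u

eventually-× : ∀ {P Q : ℕ → Set} → Eventually P → Eventually Q → Eventually λ n → P n × Q n
eventually-× (M , p) (N , q) = M ⊔ N , λ n M⊔N≤n → p n (ℕ.m⊔n≤o⇒m≤o M N M⊔N≤n) , q n (ℕ.m⊔n≤o⇒n≤o M N M⊔N≤n)

eventually-map : ∀ {P Q : ℕ → Set} → (∀ n → P n → Q n) → Eventually P → Eventually Q
eventually-map f (N , p) = N , λ n N≤n → f n (p n N≤n)

half-positive : ∀ {δ} → 0ℚ ℚ.< δ → 0ℚ ℚ.< ½ ℚ.* δ
half-positive {δ} 0<δ = ℚ.positive⁻¹ (½ ℚ.* δ) {{ℚ.pos*pos⇒pos ½ δ {{ℚ.positive 0<δ}}}}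

halves-sum : ∀ δ → ½ ℚ.* δ ℚ.+ ½ ℚ.* δ ≡ δ
halves-sum δ = trans (sym (ℚ.*-distribʳ-+ δ ½ ½)) (ℚ.*-identityˡ δ)

≗⇒≲ : ∀ {u v} → u ≗ v → u ≲ v
≗⇒≲ {u} {v} u≗v = mk≲ λ δ 0<δ → 0 , λ n _ → ℚ.≤-trans (ℚ.≤-reflexive (u≗v n)) (ℚ.≤-trans (ℚ.≤-reflexive (sym (ℚ.+-identityʳ (v n)))) (ℚ.+-monoʳ-≤ (v n) (ℚ.<⇒≤ 0<δ)))

≗⇒≋ : ∀ {u v} → u ≗ v → u ≋ v
≗⇒≋ u≗v = ≗⇒≲ u≗v , ≗⇒≲ (sym ∘ u≗v)

≲-trans : ∀ {u v w} → u ≲ v → v ≲ w → u ≲ w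
≲-trans {u} {v} {w} u≲v v≲w = mk≲ λ δ 0<δ → eventually-map
  (λ n (p , q) → ℚ.≤-trans p (ℚ.≤-trans (ℚ.+-monoˡ-≤ (½ ℚ.* δ) q) (ℚ.≤-reflexive (trans (ℚ.+-assoc (w n) (½ ℚ.* δ) (½ ℚ.* δ)) (cong (ℚ._+_ (w n)) (halves-sum δ))))))
  (eventually-× (within u≲v (½ ℚ.* δ) (half-positive 0<δ)) (within v≲w (½ ℚ.* δ) (half-positive 0<δ)))

≋-trans : ∀ {u v w} → u ≋ v → v ≋ w → u ≋ w
≋-trans (p , q) (p′ , q′) = ≲-trans p p′ , ≲-trans q′ q

≋-sym : ∀ {u v} → u ≋ v → v ≋ u
≋-sym (p , q) = q , p

≲-+ : ∀ {u v u′ v′} → u ≲ v → u′ ≲ v′ → (λ n → u n ℚ.+ u′ n) ≲ (λ n → v n ℚ.+ v′ n)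
≲-+ {u} {v} {u′} {v′} p q = mk≲ λ δ 0<δ → eventually-map
  (λ n (p , q) → ℚ.≤-trans (ℚ.+-mono-≤ p q) (ℚ.≤-reflexive (trans (shuffle (v n) (½ ℚ.* δ) (v′ n)) (cong (ℚ._+_ (v n ℚ.+ v′ n)) (halves-sum δ)))))
  (eventually-× (within p (½ ℚ.* δ) (half-positive 0<δ)) (within q (½ ℚ.* δ) (half-positive 0<δ)))
  where
  shuffle : ∀ a b c → (a ℚ.+ b) ℚ.+ (c ℚ.+ b) ≡ (a ℚ.+ c) ℚ.+ (b ℚ.+ b)
  shuffle = ℚ-solve 3 (λ a b c → (a :+ b) :+ (c :+ b) := (a :+ c) :+ (b :+ b)) refl

≋-+ : ∀ {u v u′ v′} → u ≋ v → u′ ≋ v′ → (λ n → u n ℚ.+ u′ n) ≋ (λ n → v n ℚ.+ v′ n)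
≋-+ {u} {v} {u′} {v′} (p , q) (p′ , q′) = ≲-+ {u} {v} {u′} {v′} p p′ , ≲-+ {v} {u} {v′} {u′} q q′

≲-neg : ∀ {u v} → u ≲ v → (λ n → ℚ.- v n) ≲ (λ n → ℚ.- u n)
≲-neg {u} {v} p = mk≲ λ δ 0<δ → eventually-map (λ n u≤ → flip-≤ δ (u n) (v n) u≤) (within p δ 0<δ)
  where
  flip-≤ : ∀ δ a b → a ℚ.≤ b ℚ.+ δ → ℚ.- b ℚ.≤ ℚ.- a ℚ.+ δ
  flip-≤ δ a b a≤ = subst₂ ℚ._≤_ (left a b) (right a b δ) (ℚ.+-monoˡ-≤ (ℚ.- a ℚ.- b) a≤)
    where
    left : ∀ a b → a ℚ.+ (ℚ.- a ℚ.- b) ≡ ℚ.- b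
    left = ℚ-solve 2 (λ a b → a :+ (:- a :- b) := :- b) refl
    right : ∀ a b δ → (b ℚ.+ δ) ℚ.+ (ℚ.- a ℚ.- b) ≡ ℚ.- a ℚ.+ δ
    right = ℚ-solve 3 (λ a b δ → (b :+ δ) :+ (:- a :- b) := :- a :+ δ) refl

≲-scale : ∀ k {u v} → u ≲ v → (λ n → int (+ k) ℚ.* u n) ≲ (λ n → int (+ k) ℚ.* v n)
≲-scale zero    {u} {v} p = ≗⇒≲ λ n → trans (vanish (u n)) (sym (vanish (v n)))
  where
  vanish : ∀ x → int 0ℤ ℚ.* x ≡ 0ℚ
  vanish x = trans (cong (ℚ._* x) int-0) (ℚ.*-zeroˡ x)
≲-scale (suc k) {u} {v} p = ≲-trans (≗⇒≲ λ n → step (u n))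
  (≲-trans (≲-+ {u} {v} {λ n → int (+ k) ℚ.* u n} {λ n → int (+ k) ℚ.* v n} p (≲-scale k p)) (≗⇒≲ λ n → sym (step (v n))))
  where
  step : ∀ x → int (+ suc k) ℚ.* x ≡ x ℚ.+ int (+ k) ℚ.* x
  step x = trans (cong (ℚ._* x) (int-+ 1ℤ (+ k))) (trans (ℚ.*-distribʳ-+ x (int 1ℤ) (int (+ k))) (cong (ℚ._+ int (+ k) ℚ.* x) (trans (cong (ℚ._* x) int-1) (ℚ.*-identityˡ x))))

≋-scale : ∀ z {u v} → u ≋ v → (λ n → int z ℚ.* u n) ≋ (λ n → int z ℚ.* v n)
≋-scale (+ k)     {u} {v} (p , q) = ≲-scale k p , ≲-scale k q
≋-scale (-[1+ k ]) {u} {v} (p , q) = ≲-trans (≗⇒≲ (negate u)) (≲-trans (≲-neg (≲-scale (suc k) q)) (≗⇒≲ (sym ∘ negate v)))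
                             , ≲-trans (≗⇒≲ (negate v)) (≲-trans (≲-neg (≲-scale (suc k) p)) (≗⇒≲ (sym ∘ negate u)))
  where
  negate : ∀ (w : ℕ → ℚ) n → int -[1+ k ] ℚ.* w n ≡ ℚ.- (int (+ suc k) ℚ.* w n)
  negate w n = trans (cong (ℚ._* w n) (int-neg (+ suc k))) (sym (ℚ.neg-distribˡ-* (int (+ suc k)) (w n)))

≲-const : ∀ {p q} → (λ _ → p) ≲ (λ _ → q) → p ℚ.≤ q
≲-const {p} {q} p≲q with p ℚ.≤? q
... | yes p≤q = p≤q
... | no  p≰q = contradiction (ℚ.≤-<-trans (proj₂ bound (proj₁ bound) ℕ.≤-refl) below) (ℚ.<-irrefl refl)
  where
  gap₀ : ℚ
  gap₀ = p ℚ.- q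
  0<gap : 0ℚ ℚ.< gap₀
  0<gap = subst (ℚ._< gap₀) (ℚ.+-inverseʳ q) (ℚ.+-monoˡ-< (ℚ.- q) (ℚ.≰⇒> p≰q))
  bound = within p≲q (½ ℚ.* gap₀) (half-positive 0<gap)
  below : q ℚ.+ ½ ℚ.* gap₀ ℚ.< p
  below = subst (q ℚ.+ ½ ℚ.* gap₀ ℚ.<_) (trans (cong (ℚ._+_ q) (halves-sum gap₀)) (cancel p q))
    (ℚ.+-monoʳ-< q (subst (ℚ._< ½ ℚ.* gap₀ ℚ.+ ½ ℚ.* gap₀) (ℚ.+-identityˡ (½ ℚ.* gap₀)) (ℚ.+-monoˡ-< (½ ℚ.* gap₀) (half-positive 0<gap))))
    where
    cancel : ∀ p q → q ℚ.+ (p ℚ.- q) ≡ p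
    cancel = ℚ-solve 2 (λ p q → q :+ (p :- q) := p) refl

∑ℚ : ℕ → (ℕ → ℚ) → ℚ
∑ℚ zero    f = 0ℚ
∑ℚ (suc n) f = ∑ℚ n f ℚ.+ f n

∑ℚ-cong : ∀ n {f g} → (∀ i → f i ≡ g i) → ∑ℚ n f ≡ ∑ℚ n g
∑ℚ-cong zero    f≡g = refl
∑ℚ-cong (suc n) f≡g = cong₂ ℚ._+_ (∑ℚ-cong n f≡g) (f≡g n)

int-∑ : ∀ n f → int (∑ n f) ≡ ∑ℚ n (int ∘ f)
int-∑ zero    f = int-0
int-∑ (suc n) f = trans (int-+ (∑ n f) (f n)) (cong (ℚ._+ int (f n)) (int-∑ n f))

≋-∑ : ∀ n {u v : ℕ → ℕ → ℚ} → (∀ i → u i ≋ v i) → (λ k → ∑ℚ n (λ i → u i k)) ≋ (λ k → ∑ℚ n (λ i → v i k))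
≋-∑ zero    u≋v = ≗⇒≋ λ _ → refl
≋-∑ (suc n) {u} {v} u≋v = ≋-+ {λ k → ∑ℚ n (λ i → u i k)} {λ k → ∑ℚ n (λ i → v i k)} {u n} {v n} (≋-∑ n u≋v) (u≋v n)

listSum : ∀ {A : Set} → List A → (A → ℚ) → ℚ
listSum xs f = foldr (λ x → ℚ._+_ (f x)) 0ℚ xs

listSum-cong : ∀ {A : Set} {xs : List A} {f g} → All (λ x → f x ≡ g x) xs → listSum xs f ≡ listSum xs g
listSum-cong []          = refl
listSum-cong (eq0 ∷ eqs) = cong₂ ℚ._+_ eq0 (listSum-cong eqs)

listSum-zero : ∀ {A : Set} (xs : List A) → listSum xs (λ _ → 0ℚ) ≡ 0ℚ
listSum-zero []       = refl
listSum-zero (x ∷ xs) = trans (ℚ.+-identityˡ _) (listSum-zero xs)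

listSum-+ : ∀ {A : Set} (xs : List A) f g → listSum xs (λ x → f x ℚ.+ g x) ≡ listSum xs f ℚ.+ listSum xs g
listSum-+ []       f g = refl
listSum-+ (x ∷ xs) f g = trans (cong (ℚ._+_ (f x ℚ.+ g x)) (listSum-+ xs f g)) (swap (f x) (g x) (listSum xs f) (listSum xs g))
  where
  swap : ∀ a b c e → (a ℚ.+ b) ℚ.+ (c ℚ.+ e) ≡ (a ℚ.+ c) ℚ.+ (b ℚ.+ e)
  swap = ℚ-solve 4 (λ a b c e → (a :+ b) :+ (c :+ e) := (a :+ c) :+ (b :+ e)) refl

listSum-*ˡ : ∀ {A : Set} c (xs : List A) f → listSum xs (λ x → c ℚ.* f x) ≡ c ℚ.* listSum xs f
listSum-*ˡ c []       f = sym (ℚ.*-zeroʳ c)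
listSum-*ˡ c (x ∷ xs) f = trans (cong (ℚ._+_ (c ℚ.* f x)) (listSum-*ˡ c xs f)) (sym (ℚ.*-distribˡ-+ c (f x) (listSum xs f)))

listSum-++ : ∀ {A : Set} (xs ys : List A) f → listSum (xs ++ ys) f ≡ listSum xs f ℚ.+ listSum ys f
listSum-++ []       ys f = sym (ℚ.+-identityˡ _)
listSum-++ (x ∷ xs) ys f = trans (cong (ℚ._+_ (f x)) (listSum-++ xs ys f)) (sym (ℚ.+-assoc (f x) _ _))

listSum-map : ∀ {A B : Set} (h : A → B) xs f → listSum (List.map h xs) f ≡ listSum xs (f ∘ h)
listSum-map h []       f = refl
listSum-map h (x ∷ xs) f = cong (ℚ._+_ (f (h x))) (listSum-map h xs f)

∑ℚ-listSum : ∀ {A : Set} n (xs : List A) (f : ℕ → A → ℚ) → ∑ℚ n (λ i → listSum xs (f i)) ≡ listSum xs (λ x → ∑ℚ n (λ i → f i x))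
∑ℚ-listSum zero    xs f = sym (listSum-zero xs)
∑ℚ-listSum (suc n) xs f = trans (cong (ℚ._+ listSum xs (f n)) (∑ℚ-listSum n xs f)) (sym (listSum-+ xs (λ x → ∑ℚ n (λ i → f i x)) (f n)))

≲-listSum : ∀ {A : Set} (xs : List A) {u v : A → ℕ → ℚ} → (∀ x → u x ≲ v x) → (λ k → listSum xs (λ x → u x k)) ≲ (λ k → listSum xs (λ x → v x k))
≲-listSum []       u≲v = ≗⇒≲ λ _ → refl
≲-listSum (x ∷ xs) {u} {v} u≲v = ≲-+ {u x} {v x} {λ k → listSum xs (λ y → u y k)} {λ k → listSum xs (λ y → v y k)} (u≲v x) (≲-listSum xs u≲v)

seq-sumᵣ : ∀ {A : Set} (h : A → ℝ) xs N → seq (sumᵣ (List.map h xs)) N ≡ listSum xs (λ x → seq (h x) N)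
seq-sumᵣ h []       N = refl
seq-sumᵣ h (x ∷ xs) N = cong (ℚ._+_ (seq (h x) N)) (seq-sumᵣ h xs N)

multilinear : ∀ {n} → Vec ℕ n → ℤ
multilinear []      = 1ℤ
multilinear (a ∷ α) = atMostOne a ℤ.* multilinear α

multilinearSum : ∀ n d → (Vec ℕ n → ℚ) → ℚ
multilinearSum n d g = listSum (exponents n d) (λ α → g α ℚ.* int (multilinear α))

listSum-concatMap : ∀ {A B : Set} (h : A → List B) xs f → listSum (concatMap h xs) f ≡ listSum xs (λ x → listSum (h x) f)
listSum-concatMap h []       f = refl
listSum-concatMap h (x ∷ xs) f = trans (listSum-++ (h x) (concatMap h xs) f) (cong (ℚ._+_ (listSum (h x) f)) (listSum-concatMap h xs f))

listSum-applyUpTo-zero : ∀ (h : ℕ → ℚ) (f : ℕ → ℕ) k → (∀ i → h (f i) ≡ 0ℚ) → listSum (List.applyUpTo f k) h ≡ 0ℚ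
listSum-applyUpTo-zero h f zero    z = refl
listSum-applyUpTo-zero h f (suc k) z = trans (cong₂ ℚ._+_ (z 0) (listSum-applyUpTo-zero h (f ∘ suc) k (z ∘ suc))) refl

multilinearSum-head : ∀ n d a (g : Vec ℕ (suc n) → ℚ) → atMostOne a ≡ 1ℤ →
  listSum (List.map (a ∷_) (exponents n d)) (λ α → g α ℚ.* int (multilinear α)) ≡ multilinearSum n d (λ α → g (a ∷ α))
multilinearSum-head n d a g a≤1 = trans (listSum-map (a ∷_) (exponents n d) (λ α → g α ℚ.* int (multilinear α)))
  (listSum-cong (All.universal (λ α → cong (λ z → g (a ∷ α) ℚ.* int z) (trans (cong (ℤ._* multilinear α) a≤1) (ℤ.*-identityˡ (multilinear α)))) (exponents n d)))

multilinearSum-zero : ∀ n d a (g : Vec ℕ (suc n) → ℚ) → atMostOne a ≡ 0ℤ →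
  listSum (List.map (a ∷_) (exponents n d)) (λ α → g α ℚ.* int (multilinear α)) ≡ 0ℚ
multilinearSum-zero n d a g a>1 = trans (listSum-map (a ∷_) (exponents n d) (λ α → g α ℚ.* int (multilinear α)))
  (trans (listSum-cong (All.universal (λ α → trans (cong (λ z → g (a ∷ α) ℚ.* int (z ℤ.* multilinear α)) a>1) (trans (cong (g (a ∷ α) ℚ.*_) int-0) (ℚ.*-zeroʳ (g (a ∷ α))))) (exponents n d))) (listSum-zero (exponents n d)))

multilinearSum-suc-zero : ∀ n g → multilinearSum (suc n) 0 g ≡ multilinearSum n 0 (λ α → g (0 ∷ α))
multilinearSum-suc-zero n g = trans (listSum-concatMap (λ a → List.map (a ∷_) (exponents n (0 ∸ a))) (upTo 1) (λ α → g α ℚ.* int (multilinear α)))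
  (trans (ℚ.+-identityʳ _) (multilinearSum-head n 0 0 g refl))

multilinearSum-suc-suc : ∀ n d g → multilinearSum (suc n) (suc d) g ≡ multilinearSum n d (λ α → g (1 ∷ α)) ℚ.+ multilinearSum n (suc d) (λ α → g (0 ∷ α))
multilinearSum-suc-suc n d g = trans (listSum-concatMap (λ a → List.map (a ∷_) (exponents n (suc d ∸ a))) (upTo (suc (suc d))) (λ α → g α ℚ.* int (multilinear α)))
  (trans (cong₂ ℚ._+_ (multilinearSum-head n (suc d) 0 g refl) (cong₂ ℚ._+_ (multilinearSum-head n d 1 g refl)
     (listSum-applyUpTo-zero (λ a → listSum (List.map (a ∷_) (exponents n (suc d ∸ a))) (λ α → g α ℚ.* int (multilinear α))) (λ i → suc (suc i)) d
        (λ i → multilinearSum-zero n (d ∸ suc i) (suc (suc i)) g refl))))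
   (lemma (multilinearSum n (suc d) (λ α → g (0 ∷ α))) (multilinearSum n d (λ α → g (1 ∷ α)))))
  where
  lemma : ∀ x y → x ℚ.+ (y ℚ.+ 0ℚ) ≡ y ℚ.+ x
  lemma = ℚ-solve 2 (λ x y → x :+ (y :+ (con 0ℚ)) := y :+ x) refl

∂ℚ : ∀ {n} → Fin n → (Vec ℕ n → ℚ) → Vec ℕ n → ℚ
∂ℚ i g α = int (+ suc (Vec.lookup α i)) ℚ.* g (α Vec.[ i ]%= suc)

seq-∂ : ∀ {n} (g : Coefficients n) I α N → seq (foldr ∂ g I α) N ≡ foldr ∂ℚ (λ β → seq (g β) N) I α
seq-∂ g []      α N = refl
seq-∂ g (i ∷ I) α N = cong₂ ℚ._*_ (sym (int≡ (+ suc (Vec.lookup α i)))) (seq-∂ g I (α Vec.[ i ]%= suc) N)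

∂ℚ-suc : ∀ {n} (g : Vec ℕ (suc n) → ℚ) J a α → foldr ∂ℚ g (List.map suc J) (a ∷ α) ≡ foldr ∂ℚ (λ β → g (a ∷ β)) J α
∂ℚ-suc g []      a α = refl
∂ℚ-suc g (j ∷ J) a α = cong (int (+ suc (Vec.lookup α j)) ℚ.*_) (∂ℚ-suc g J a (α Vec.[ j ]%= suc))

sublists-map : ∀ {A B : Set} (h : A → B) k xs → sublists k (List.map h xs) ≡ List.map (List.map h) (sublists k xs)
sublists-map h zero    xs       = refl
sublists-map h (suc k) []       = refl
sublists-map h (suc k) (x ∷ xs) = trans (cong₂ _++_
    (trans (cong (List.map (h x ∷_)) (sublists-map h k xs)) (trans (sym (List.map-∘ (sublists k xs))) (List.map-∘ (sublists k xs))))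
    (sublists-map h (suc k) xs))
  (sym (List.map-++ (List.map h) (List.map (x ∷_) (sublists k xs)) (sublists (suc k) xs)))

sublists-short : ∀ {A : Set} k (xs : List A) → length xs < k → sublists k xs ≡ []
sublists-short (suc k) []       _         = refl
sublists-short (suc k) (x ∷ xs) (s≤s xs<k) = cong₂ (λ y z → List.map (x ∷_) y ++ z) (sublists-short k xs xs<k) (sublists-short (suc k) xs (ℕ.m≤n⇒m≤1+n xs<k))

allFin-suc : ∀ n → allFin (suc n) ≡ zero ∷ List.map suc (allFin n)
allFin-suc n = cong (zero ∷_) (sym (List.map-tabulate (λ i → i) suc))

elementary-multilinear : ∀ n d (g : Vec ℕ n → ℚ) →
  listSum (sublists d (allFin n)) (λ I → foldr ∂ℚ g I (Vec.replicate n 0)) ≡ multilinearSum n d g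
elementary-multilinear zero    zero    g = cong (ℚ._+ 0ℚ) (sym (trans (cong (g [] ℚ.*_) int-1) (ℚ.*-identityʳ (g []))))
elementary-multilinear zero    (suc d) g = refl
elementary-multilinear (suc n) zero    g = trans (elementary-multilinear n zero (λ α → g (0 ∷ α))) (sym (multilinearSum-suc-zero n g))
elementary-multilinear (suc n) (suc d) g = begin
  listSum (sublists (suc d) (allFin (suc n))) E
    ≡⟨ cong (λ xs → listSum (sublists (suc d) xs) E) (allFin-suc n) ⟩
  listSum (List.map (zero ∷_) (sublists d ys) ++ sublists (suc d) ys) E
    ≡⟨ listSum-++ (List.map (zero ∷_) (sublists d ys)) (sublists (suc d) ys) E ⟩
  listSum (List.map (zero ∷_) (sublists d ys)) E ℚ.+ listSum (sublists (suc d) ys) E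
    ≡⟨ cong₂ ℚ._+_ (trans (listSum-map (zero ∷_) (sublists d ys) E) (shifted d (E ∘ (zero ∷_)) (λ α → g (1 ∷ α)) with-zero)) (shifted (suc d) E (λ α → g (0 ∷ α)) (λ J → ∂ℚ-suc g J 0 (Vec.replicate n 0))) ⟩
  multilinearSum n d (λ α → g (1 ∷ α)) ℚ.+ multilinearSum n (suc d) (λ α → g (0 ∷ α))
    ≡⟨ multilinearSum-suc-suc n d g ⟨
  multilinearSum (suc n) (suc d) g ∎
  where
  open ≡-Reasoning
  ys = List.map suc (allFin n)
  E : List (Fin (suc n)) → ℚ
  E I = foldr ∂ℚ g I (Vec.replicate (suc n) 0)
  with-zero : ∀ J → E (zero ∷ List.map suc J) ≡ foldr ∂ℚ (λ α → g (1 ∷ α)) J (Vec.replicate n 0)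
  with-zero J = trans (trans (cong (ℚ._* foldr ∂ℚ g (List.map suc J) (1 ∷ Vec.replicate n 0)) int-1) (ℚ.*-identityˡ _)) (∂ℚ-suc g J 1 (Vec.replicate n 0))
  shifted : ∀ k (H : List (Fin (suc n)) → ℚ) h → (∀ J → H (List.map suc J) ≡ foldr ∂ℚ h J (Vec.replicate n 0)) → listSum (sublists k ys) H ≡ multilinearSum n k h
  shifted k H h same = trans (cong (λ zs → listSum zs H) (sublists-map suc k (allFin n))) (trans (listSum-map (List.map suc) (sublists k (allFin n)) H)
    (trans (listSum-cong (All.universal same (sublists k (allFin n)))) (elementary-multilinear n k h)))

seq-e∂ : ∀ {n d} (f : NonNegForm n d) N → seq (e∂ f) N ≡ multilinearSum n d (λ α → seq (coeff f α) N)
seq-e∂ {n} {d} f N = trans (seq-sumᵣ (λ I → foldr ∂ (coeff f) I (Vec.replicate n 0)) (sublists d (allFin n)) N)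
  (trans (listSum-cong (All.universal (λ I → seq-∂ (coeff f) I (Vec.replicate n 0) N) (sublists d (allFin n)))) (elementary-multilinear n d (λ α → seq (coeff f α) N)))

seq-eval : ∀ {n d} (f : NonNegForm n d) v N → seq (eval f v) N ≡ listSum (exponents n d) (λ α → seq (coeff f α) N ℚ.* int (monomial α v))
seq-eval {n} {d} f v N = trans (seq-sumᵣ (λ α → coeff f α *ᵣ fromℤ (monomial α v)) (exponents n d) N)
  (listSum-cong (All.universal (λ α → cong (seq (coeff f α) N ℚ.*_) (sym (int≡ (monomial α v)))) (exponents n d)))

exponents-sum : ∀ n d → All (λ α → Vec.sum α ≡ d) (exponents n d)
exponents-sum zero    zero    = refl ∷ []
exponents-sum zero    (suc d) = []
exponents-sum (suc n) d       = All.concat⁺ (All.map⁺ (All.applyUpTo⁺₁ (λ a → a) (suc d) (λ {a} a≤d →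
  All.map⁺ (All.map (λ {α} Σα≡ → trans (cong (_+_ a) Σα≡) (ℕ.m+[n∸m]≡n (ℕ.≤-pred a≤d))) (exponents-sum n (d ∸ a))))))

-- Exponents of the padded form f · x_{n+1} ⋯ x_{n′}.
padded : ∀ {n} → Vec ℕ n → ℕ → ℕ
padded []      i       = 1
padded (a ∷ α) zero    = a
padded (a ∷ α) (suc i) = padded α i

sum-padded : ∀ {n} (α : Vec ℕ n) a → sumℕ (a + n) (padded α) ≡ Vec.sum α + a
sum-padded []      a = trans (cong (λ k → sumℕ k (λ _ → 1)) (ℕ.+-identityʳ a)) (ones a)
  where
  ones : ∀ a → sumℕ a (λ _ → 1) ≡ a
  ones zero    = refl
  ones (suc a) = trans (cong (_+ 1) (ones a)) (ℕ.+-comm a 1)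
sum-padded {suc n} (x ∷ α) a = trans (cong (λ k → sumℕ k (padded (x ∷ α))) (ℕ.+-suc a n))
  (trans (sumℕ-front (a + n) (padded (x ∷ α))) (trans (cong (_+_ x) (sum-padded α a)) (sym (ℕ.+-assoc x (Vec.sum α) a))))

squarefree-padded : ∀ {n} (α : Vec ℕ n) a → squarefree (a + n) (padded α) ≡ multilinear α
squarefree-padded []      a = ∏-ones (a + 0) _ (λ _ _ → refl)
squarefree-padded {suc n} (x ∷ α) a = trans (cong (λ k → squarefree k (padded (x ∷ α))) (ℕ.+-suc a n))
  (trans (∏-front (a + n) (atMostOne ∘ padded (x ∷ α))) (cong (atMostOne x ℤ.*_) (squarefree-padded α a)))

monomial-padded : ∀ n a (s : ℕ → Sign) (α : Vec ℕ n) →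
  ∏ (a + n) (λ i → if i <ᵇ n then 1ℤ else value± (s i)) ℤ.* monomial α (cubePoint (Vec.tabulate (s ∘ toℕ))) ≡ ∏ (a + n) (λ i → value± (s i) ℤ.^ padded α i)
monomial-padded zero    a s []      = trans (ℤ.*-identityʳ _) (∏-cong (a + 0) λ i _ → sym (ℤ.^-identityʳ (value± (s i))))
monomial-padded (suc n) a s (x ∷ α) = begin
  ∏ (a + suc n) f ℤ.* (value± (s 0) ℤ.^ x ℤ.* mono)        ≡⟨ cong (λ k → ∏ k f ℤ.* (value± (s 0) ℤ.^ x ℤ.* mono)) (ℕ.+-suc a n) ⟩
  ∏ (suc (a + n)) f ℤ.* (value± (s 0) ℤ.^ x ℤ.* mono)      ≡⟨ cong (ℤ._* (value± (s 0) ℤ.^ x ℤ.* mono)) (trans (∏-front (a + n) f) (ℤ.*-identityˡ _)) ⟩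
  ∏ (a + n) (f ∘ suc) ℤ.* (value± (s 0) ℤ.^ x ℤ.* mono)    ≡⟨ shuffle (∏ (a + n) (f ∘ suc)) (value± (s 0) ℤ.^ x) mono ⟩
  value± (s 0) ℤ.^ x ℤ.* (∏ (a + n) (f ∘ suc) ℤ.* mono)    ≡⟨ cong (value± (s 0) ℤ.^ x ℤ.*_) (monomial-padded n a (s ∘ suc) α) ⟩
  value± (s 0) ℤ.^ x ℤ.* ∏ (a + n) (λ i → value± (s (suc i)) ℤ.^ padded α i) ≡⟨ sym (∏-front (a + n) (λ i → value± (s i) ℤ.^ padded (x ∷ α) i)) ⟩
  ∏ (suc (a + n)) (λ i → value± (s i) ℤ.^ padded (x ∷ α) i) ≡⟨ cong (λ k → ∏ k (λ i → value± (s i) ℤ.^ padded (x ∷ α) i)) (sym (ℕ.+-suc a n)) ⟩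
  ∏ (a + suc n) (λ i → value± (s i) ℤ.^ padded (x ∷ α) i) ∎
  where
  open ≡-Reasoning
  f : ℕ → ℤ
  f i = if i <ᵇ suc n then 1ℤ else value± (s i)
  mono = monomial α (cubePoint (Vec.tabulate (s ∘ suc ∘ toℕ)))
  shuffle : ∀ p y m → p ℤ.* (y ℤ.* m) ≡ y ℤ.* (p ℤ.* m)
  shuffle = ℤRing.solve-∀

0-or-1 : ℤ → Set
0-or-1 z = z ≡ 0ℤ ⊎ z ≡ 1ℤ

tallied-0-or-1 : ∀ K χ α l → let t = accepts K χ l ℤ.* squarefree K (tally none χ α l) in
  (t ≡ 0ℤ × 0-or-1 (squarefree l α)) ⊎ (t ≡ 1ℤ × squarefree l α ≡ 1ℤ)
tallied-0-or-1 K χ α zero    = inj₂ (trans (ℤ.*-identityˡ _) (∏-ones K _ (λ _ _ → refl)) , refl)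
tallied-0-or-1 K χ α (suc l) with tallied-0-or-1 K χ α l | χ l ℕ.<? K
... | prev | no χl≮K = inj₁ (trans (cong (λ b → (accepts K χ l ℤ.* indicator b) ℤ.* squarefree K (bump (tally none χ α l) (χ l) (α l))) (<ᵇ-false (ℕ.≮⇒≥ χl≮K)))
      (cong (ℤ._* squarefree K (bump (tally none χ α l) (χ l) (α l))) (ℤ.*-zeroʳ (accepts K χ l))) , extend prev (α l))
  where
  extend : ∀ {t} → (t ≡ 0ℤ × 0-or-1 (squarefree l α)) ⊎ (t ≡ 1ℤ × squarefree l α ≡ 1ℤ) → ∀ e → 0-or-1 (squarefree l α ℤ.* atMostOne e)
  extend (inj₁ (_ , inj₁ eq0)) e             = inj₁ (cong (ℤ._* atMostOne e) eq0)
  extend (inj₁ (_ , inj₂ eq1)) zero          = inj₂ (cong (ℤ._* 1ℤ) eq1)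
  extend (inj₁ (_ , inj₂ eq1)) (suc zero)    = inj₂ (cong (ℤ._* 1ℤ) eq1)
  extend (inj₁ (_ , inj₂ eq1)) (suc (suc e)) = inj₁ (cong (ℤ._* 0ℤ) eq1)
  extend (inj₂ (_ , eq1))      zero          = inj₂ (cong (ℤ._* 1ℤ) eq1)
  extend (inj₂ (_ , eq1))      (suc zero)    = inj₂ (cong (ℤ._* 1ℤ) eq1)
  extend (inj₂ (_ , eq1))      (suc (suc e)) = inj₁ (cong (ℤ._* 0ℤ) eq1)
... | prev | yes χl<K = subst (λ t → (t ≡ 0ℤ × 0-or-1 (squarefree l α ℤ.* atMostOne e)) ⊎ (t ≡ 1ℤ × squarefree l α ℤ.* atMostOne e ≡ 1ℤ)) (sym current) (step e prev)
  where
  e = α l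
  β = tally none χ α l
  t₀ = accepts K χ l ℤ.* squarefree K β

  factor′ : ℕ → ℤ
  factor′ zero          = 1ℤ
  factor′ (suc zero)    = + vacant (β (χ l))
  factor′ (suc (suc _)) = 0ℤ

  bumped : ∀ e → squarefree K (bump β (χ l) e) ≡ factor′ e ℤ.* squarefree K β
  bumped zero          = trans (squarefree-cong K bump-zero) (sym (ℤ.*-identityˡ _))
    where
    bump-zero : bump β (χ l) 0 ≗ β
    bump-zero i with χ l ≡ᵇ i
    ... | true  = refl
    ... | false = refl
  bumped (suc zero)    = squarefree-bump₁ K β (χ l) χl<K
  bumped (suc (suc e)) = squarefree-bump₂ K β (χ l) e χl<K

  current : (accepts K χ l ℤ.* indicator (χ l <ᵇ K)) ℤ.* squarefree K (bump β (χ l) e) ≡ factor′ e ℤ.* t₀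
  current = trans (cong₂ (λ b x → (accepts K χ l ℤ.* indicator b) ℤ.* x) (T→≡ (ℕ.<⇒<ᵇ χl<K)) (bumped e)) (shuffle (accepts K χ l) (factor′ e) (squarefree K β))
    where
    shuffle : ∀ a f s → (a ℤ.* 1ℤ) ℤ.* (f ℤ.* s) ≡ f ℤ.* (a ℤ.* s)
    shuffle = ℤRing.solve-∀

  weaken-0-or-1 : ∀ {z} e → 0-or-1 z → 0-or-1 (z ℤ.* atMostOne e)
  weaken-0-or-1 e             (inj₁ refl) = inj₁ refl
  weaken-0-or-1 zero          (inj₂ refl) = inj₂ refl
  weaken-0-or-1 (suc zero)    (inj₂ refl) = inj₂ refl
  weaken-0-or-1 (suc (suc e)) (inj₂ refl) = inj₁ refl

  step : ∀ e → (t₀ ≡ 0ℤ × 0-or-1 (squarefree l α)) ⊎ (t₀ ≡ 1ℤ × squarefree l α ≡ 1ℤ) →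
    (factor′ e ℤ.* t₀ ≡ 0ℤ × 0-or-1 (squarefree l α ℤ.* atMostOne e)) ⊎ (factor′ e ℤ.* t₀ ≡ 1ℤ × squarefree l α ℤ.* atMostOne e ≡ 1ℤ)
  step e             (inj₁ (t≡0 , s)) = inj₁ (trans (cong (factor′ e ℤ.*_) t≡0) (ℤ.*-zeroʳ (factor′ e)) , weaken-0-or-1 e s)
  step zero          (inj₂ (t≡1 , s)) = inj₂ (cong (1ℤ ℤ.*_) t≡1 , cong (ℤ._* 1ℤ) s)
  step (suc (suc e)) (inj₂ (t≡1 , s)) = inj₁ (cong (0ℤ ℤ.*_) t≡1 , inj₁ (cong (ℤ._* 0ℤ) s))
  step (suc zero)    (inj₂ (t≡1 , s)) with β (χ l)
  ... | zero  = inj₂ (cong (1ℤ ℤ.*_) t≡1 , cong (ℤ._* 1ℤ) s)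
  ... | suc _ = inj₁ (cong (0ℤ ℤ.*_) t≡1 , inj₂ (cong (ℤ._* 1ℤ) s))

∑ℚ-*ˡ : ∀ n x f → ∑ℚ n (λ i → x ℚ.* f i) ≡ x ℚ.* ∑ℚ n f
∑ℚ-*ˡ zero    x f = sym (ℚ.*-zeroʳ x)
∑ℚ-*ˡ (suc n) x f = trans (cong (ℚ._+ x ℚ.* f n) (∑ℚ-*ˡ n x f)) (sym (ℚ.*-distribˡ-+ x (∑ℚ n f) (f n)))

coloured-lee-at : ∀ K e m χ α l → K ≡ suc (2 * m) + e → sumℕ l α ≡ suc (2 * m) →
  ∑ (suc m) (λ j → value± (alternate j) ℤ.* series (suc e) (m ∸ j) ℤ.* ∑ (binom K j) (λ idx →
    ∏ l (λ i → indicator (χ i <ᵇ K) ℤ.* value± (signAt K j idx (χ i)) ℤ.^ α i)))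
  ≡ + (4 ^ m) ℤ.* (accepts K χ l ℤ.* squarefree K (tally none χ α l))
coloured-lee-at K e m χ α l refl = coloured-lee e m χ α l

sizeWeight-binom : ∀ m e₀ j → j ≤ m → sizeWeight m e₀ (binom (suc e₀ + m) m) j ≡ binom (suc e₀ + (m ∸ j)) (m ∸ j)
sizeWeight-binom m e₀ zero    _   = refl
sizeWeight-binom m e₀ (suc j) j<m = trans
    (trans (cong (λ w → w * (m ∸ j) / (suc e₀ + (m ∸ j))) (sizeWeight-binom m e₀ j (ℕ.<⇒≤ j<m))) (cong (λ x → binom (suc e₀ + x) x * x / (suc e₀ + x)) (ℕ.+-∸-assoc 1 j<m)))
    (divide (m ∸ suc j))
  where
  divide : ∀ x → binom (suc e₀ + suc x) (suc x) * suc x / (suc e₀ + suc x) ≡ binom (suc e₀ + x) x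
  divide x rewrite ℕ.+-suc e₀ x = trans (cong (_/ suc (suc e₀ + x)) (trans (ℕ.*-comm (binom (suc (suc e₀ + x)) (suc x)) (suc x)) (trans (binom-absorb (suc e₀ + x) x) (ℕ.*-comm (suc (suc e₀ + x)) (binom (suc e₀ + x) x)))))
    (ℕ.m*n/n≡m (binom (suc e₀ + x) x) (suc (suc e₀ + x)))

squarefree-none : ∀ K → squarefree K none ≡ 1ℤ
squarefree-none K = ∏-ones K _ λ _ _ → refl

free-none : ∀ K → free K none ≡ K
free-none zero    = refl
free-none (suc K) = trans (cong (_+ 1) (free-none K)) (ℕ.+-comm K 1)

module Estimate {n d : ℕ} (f : NonNegForm n d) (val : Vec Sign n → ℚ) (val-eval : ∀ σ → fromℚ (val σ) ≈ᵣ eval f (cubePoint σ))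
  (s : ℕ) (fz : Vec Sign n → ℤ) (fz≡ : ∀ σ → int (fz σ) ≡ int (+ 2 ^ s) ℚ.* val σ)
  (K m e₀ a R u : ℕ) .{{_ : NonZero K}} .{{_ : NonZero R}} .{{_ : NonZero u}} (K≡ : K ≡ suc (2 * m) + suc e₀) (d+a≡ : d + a ≡ suc (2 * m)) (d≤n : d ≤ n) (Ku≤R : K * u ≤ R) where

  D n′ : ℕ
  D = suc (2 * m)
  n′ = a + n

  open Estimator n K m n′ R u e₀ (binom (suc e₀ + m) m) fz
  open Colourings R u K Ku≤R

  exps : List (Vec ℕ n)
  exps = exponents n d

  c : Vec ℕ n → ℕ → ℚ
  c α N = seq (coeff f α) N

  Lin : (Vec ℕ n → ℤ) → ℕ → ℚ
  Lin h N = listSum exps (λ α → c α N ℚ.* int (h α))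

  Lin-cong : ∀ {h h′} → (∀ α → Vec.sum α ≡ d → h α ≡ h′ α) → Lin h ≗ Lin h′
  Lin-cong h≡h′ N = listSum-cong (All.map (λ {α} Σα≡ → cong (λ z → c α N ℚ.* int z) (h≡h′ α Σα≡)) (exponents-sum n d))

  Lin-+ : ∀ h h′ → Lin (λ α → h α ℤ.+ h′ α) ≗ (λ N → Lin h N ℚ.+ Lin h′ N)
  Lin-+ h h′ N = trans (listSum-cong (All.universal (λ α → trans (cong (c α N ℚ.*_) (int-+ (h α) (h′ α))) (ℚ.*-distribˡ-+ (c α N) (int (h α)) (int (h′ α)))) exps))
    (listSum-+ exps (λ α → c α N ℚ.* int (h α)) (λ α → c α N ℚ.* int (h′ α)))

  Lin-* : ∀ z h → Lin (λ α → z ℤ.* h α) ≗ (λ N → int z ℚ.* Lin h N)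
  Lin-* z h N = trans (listSum-cong (All.universal (λ α → trans (cong (c α N ℚ.*_) (int-* z (h α))) (swap (c α N) (int z) (int (h α)))) exps))
    (listSum-*ˡ (int z) exps (λ α → c α N ℚ.* int (h α)))
    where
    swap : ∀ x y z → x ℚ.* (y ℚ.* z) ≡ y ℚ.* (x ℚ.* z)
    swap = ℚ-solve 3 (λ x y z → x :* (y :* z) := y :* (x :* z)) refl

  Lin-∑ : ∀ k (h : ℕ → Vec ℕ n → ℤ) N → ∑ℚ k (λ i → Lin (h i) N) ≡ Lin (λ α → ∑ k (λ i → h i α)) N
  Lin-∑ k h N = trans (∑ℚ-listSum k exps (λ i α → c α N ℚ.* int (h i α)))
    (listSum-cong (All.universal (λ α → trans (∑ℚ-*ˡ k (c α N) (λ i → int (h i α))) (cong (c α N ℚ.*_) (sym (int-∑ k (λ i → h i α))))) exps))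

  Lin-nonNegative : ∀ h → (∀ α → Vec.sum α ≡ d → ∃ λ k → h α ≡ + k) → (λ _ → 0ℚ) ≲ Lin h
  Lin-nonNegative h h≥0 = ≲-trans {v = λ _ → listSum exps (λ _ → 0ℚ)} (≗⇒≲ λ _ → sym (listSum-zero exps))
      (≲-trans {v = λ N → listSum exps (λ α → int (+ absolute α) ℚ.* c α N)} (≲-listSum exps {λ _ _ → 0ℚ} {λ α N → int (+ absolute α) ℚ.* c α N} each)
        (≗⇒≲ (λ N → listSum-cong {f = λ α → int (+ absolute α) ℚ.* c α N} {g = λ α → c α N ℚ.* int (h α)} (All.map (λ {α} Σα≡ → same α (h≥0 α Σα≡) N) (exponents-sum n d)))))
    where
    absolute : Vec ℕ n → ℕ
    absolute α = ℤ.∣ h α ∣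
    each : ∀ α → (λ _ → 0ℚ) ≲ (λ N → int (+ absolute α) ℚ.* c α N)
    each α = ≲-trans {v = λ _ → int (+ absolute α) ℚ.* 0ℚ} (≗⇒≲ λ _ → sym (ℚ.*-zeroʳ (int (+ absolute α))))
      (≲-scale (absolute α) {λ _ → 0ℚ} {c α} (mk≲ (_≤ᵣ_.eventually-≤ (nonNegative f α))))
    same : ∀ α → (∃ λ k → h α ≡ + k) → ∀ N → int (+ absolute α) ℚ.* c α N ≡ c α N ℚ.* int (h α)
    same α (k , hα≡) N = trans (ℚ.*-comm (int (+ absolute α)) (c α N)) (cong (λ z → c α N ℚ.* int z) (trans (cong (λ z → + ℤ.∣ z ∣) hα≡) (sym hα≡)))

  t : ℕ → Vec ℕ n → ℤ
  t X α = accepts K (colour R u X) n′ ℤ.* squarefree K (tally none (colour R u X) (padded α) n′)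

  weighted-monomial : ∀ X α → Vec.sum α ≡ d →
    ∑ (suc m) (λ j → ∑ (binom K j) (λ idx → wt X j idx ℤ.* monomial α (cubePoint (point± X j idx)))) ≡ + (4 ^ m) ℤ.* t X α
  weighted-monomial X α Σα≡ = trans
    (∑-cong (suc m) λ j j≤m → trans (∑-cong (binom K j) λ idx _ → regroup j idx (ℕ.≤-pred j≤m)) (∑-*ˡ (binom K j) (value± (alternate j) ℤ.* series (suc (suc e₀)) (m ∸ j)) (λ idx → ∏ n′ (λ i → indicator (χ i <ᵇ K) ℤ.* value± (signAt K j idx (χ i)) ℤ.^ padded α i))))
    (coloured-lee-at K (suc e₀) m χ (padded α) n′ K≡ (trans (sum-padded α a) (trans (cong (_+ a) Σα≡) d+a≡)))
    where
    χ = colour R u X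
    regroup : ∀ j idx → j ≤ m → wt X j idx ℤ.* monomial α (cubePoint (point± X j idx)) ≡
      value± (alternate j) ℤ.* series (suc (suc e₀)) (m ∸ j) ℤ.* ∏ n′ (λ i → indicator (χ i <ᵇ K) ℤ.* value± (signAt K j idx (χ i)) ℤ.^ padded α i)
    regroup j idx j≤m = begin
      (+ sizeWeight m e₀ (binom (suc e₀ + m) m) j ℤ.* value± (alternate j)) ℤ.* ∏ n′ (Weights.factor n K R u X j idx w′ (alternate j)) ℤ.* mono
        ≡⟨ cong₂ (λ x y → (+ x ℤ.* value± (alternate j)) ℤ.* y ℤ.* mono) (sizeWeight-binom m e₀ j j≤m) (∏-distrib n′ (λ i → indicator (χ i <ᵇ K)) (λ i → if i <ᵇ n then 1ℤ else value± (signAt K j idx (χ i)))) ⟩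
      (h ℤ.* value± (alternate j)) ℤ.* (accepts K χ n′ ℤ.* dummies) ℤ.* mono
        ≡⟨ shuffle h (value± (alternate j)) (accepts K χ n′) dummies mono ⟩
      value± (alternate j) ℤ.* h ℤ.* (accepts K χ n′ ℤ.* (dummies ℤ.* mono))
        ≡⟨ cong (λ x → value± (alternate j) ℤ.* h ℤ.* (accepts K χ n′ ℤ.* x)) (monomial-padded n a (λ i → signAt K j idx (χ i)) α) ⟩
      value± (alternate j) ℤ.* h ℤ.* (accepts K χ n′ ℤ.* ∏ n′ (λ i → value± (signAt K j idx (χ i)) ℤ.^ padded α i))
        ≡⟨ cong (value± (alternate j) ℤ.* h ℤ.*_) (sym (∏-distrib n′ (λ i → indicator (χ i <ᵇ K)) (λ i → value± (signAt K j idx (χ i)) ℤ.^ padded α i))) ⟩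
      value± (alternate j) ℤ.* h ℤ.* ∏ n′ (λ i → indicator (χ i <ᵇ K) ℤ.* value± (signAt K j idx (χ i)) ℤ.^ padded α i) ∎
      where
      open ≡-Reasoning
      w′ = sizeWeight m e₀ (binom (suc e₀ + m) m) j
      h = series (suc (suc e₀)) (m ∸ j)
      dummies = ∏ n′ (λ i → if i <ᵇ n then 1ℤ else value± (signAt K j idx (χ i)))
      mono = monomial α (cubePoint (point± X j idx))
      shuffle : ∀ h v a e m → (h ℤ.* v) ℤ.* (a ℤ.* e) ℤ.* m ≡ v ℤ.* h ℤ.* (a ℤ.* (e ℤ.* m))
      shuffle = ℤRing.solve-∀

  scale : ℤ
  scale = + 2 ^ s

  sampleValue-Lin : ∀ X → (λ _ → int (sampleValue X)) ≋ Lin (λ α → scale ℤ.* (+ (4 ^ m) ℤ.* t X α))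
  sampleValue-Lin X = ≋-trans {v = λ _ → onCube λ σ → val σ} (≗⇒≋ λ _ → exact)
      (≋-trans {v = λ N → onCube λ σ → seq (eval f (cubePoint σ)) N}
        (≋-∑ (suc m) {λ j _ → layerOnCube (λ σ → val σ) j} {λ j N → layerOnCube (λ σ → seq (eval f (cubePoint σ)) N) j}
          λ j → ≋-∑ (binom K j) {λ idx _ → int (wt X j idx ℤ.* scale) ℚ.* val (point± X j idx)} {λ idx N → int (wt X j idx ℤ.* scale) ℚ.* seq (eval f (cubePoint (point± X j idx))) N}
            λ idx → ≋-scale (wt X j idx ℤ.* scale) {λ _ → val (point± X j idx)} {seq (eval f (cubePoint (point± X j idx)))} (converges (point± X j idx)))
        (≗⇒≋ expand))
    where
    layerOnCube : (Vec Sign n → ℚ) → ℕ → ℚ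
    layerOnCube v j = ∑ℚ (binom K j) (λ idx → int (wt X j idx ℤ.* scale) ℚ.* v (point± X j idx))
    onCube : (Vec Sign n → ℚ) → ℚ
    onCube v = ∑ℚ (suc m) (layerOnCube v)
    exact : int (sampleValue X) ≡ onCube (λ σ → val σ)
    exact = trans (int-∑ (suc m) (layer X)) (∑ℚ-cong (suc m) λ j → trans (int-∑ (binom K j) (term X j)) (∑ℚ-cong (binom K j) λ idx →
      trans (int-* (wt X j idx) (fz (point± X j idx))) (trans (cong (int (wt X j idx) ℚ.*_) (fz≡ (point± X j idx)))
        (trans (sym (ℚ.*-assoc (int (wt X j idx)) (int scale) (val (point± X j idx)))) (cong (ℚ._* val (point± X j idx)) (sym (int-* (wt X j idx) scale)))))))
    converges : ∀ σ → (λ _ → val σ) ≋ seq (eval f (cubePoint σ))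
    converges σ = mk≲ (_≤ᵣ_.eventually-≤ (proj₁ (val-eval σ))) , mk≲ (_≤ᵣ_.eventually-≤ (proj₂ (val-eval σ)))
    mono : Vec ℕ n → ℕ → ℕ → ℤ
    mono α j idx = monomial α (cubePoint (point± X j idx))
    expand : ∀ N → onCube (λ σ → seq (eval f (cubePoint σ)) N) ≡ Lin (λ α → scale ℤ.* (+ (4 ^ m) ℤ.* t X α)) N
    expand N = trans (∑ℚ-cong (suc m) λ j → trans (∑ℚ-cong (binom K j) λ idx →
          trans (cong (int (wt X j idx ℤ.* scale) ℚ.*_) (seq-eval f (cubePoint (point± X j idx)) N)) (sym (Lin-* (wt X j idx ℤ.* scale) (λ α → mono α j idx) N)))
          (Lin-∑ (binom K j) (λ idx α → wt X j idx ℤ.* scale ℤ.* mono α j idx) N))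
      (trans (Lin-∑ (suc m) (λ j α → ∑ (binom K j) (λ idx → wt X j idx ℤ.* scale ℤ.* mono α j idx)) N)
        (Lin-cong {λ α → ∑ (suc m) (λ j → ∑ (binom K j) (λ idx → wt X j idx ℤ.* scale ℤ.* mono α j idx))} {λ α → scale ℤ.* (+ (4 ^ m) ℤ.* t X α)}
          (λ α Σα≡ → trans (∑-cong (suc m) λ j _ → trans (∑-cong (binom K j) λ idx _ → swap (wt X j idx) scale (mono α j idx)) (∑-*ˡ (binom K j) scale (λ idx → wt X j idx ℤ.* mono α j idx)))
          (trans (∑-*ˡ (suc m) scale (λ j → ∑ (binom K j) (λ idx → wt X j idx ℤ.* mono α j idx))) (cong (scale ℤ.*_) (weighted-monomial X α Σα≡)))) N))
      where
      swap : ∀ w s x → w ℤ.* s ℤ.* x ≡ s ℤ.* (w ℤ.* x)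
      swap = ℤRing.solve-∀

  t-cases : ∀ X α → (t X α ≡ 0ℤ × 0-or-1 (multilinear α)) ⊎ (t X α ≡ 1ℤ × multilinear α ≡ 1ℤ)
  t-cases X α = subst (λ z → (t X α ≡ 0ℤ × 0-or-1 z) ⊎ (t X α ≡ 1ℤ × z ≡ 1ℤ)) (squarefree-padded α a) (tallied-0-or-1 K (colour R u X) (padded α) n′)

  sampleValue-nonNegative : ∀ X → 0ℤ ℤ.≤ sampleValue X
  sampleValue-nonNegative X = int-cancel (ℚ.≤-trans (ℚ.≤-reflexive int-0) (≲-const (≲-trans {v = Lin (λ α → scale ℤ.* (+ (4 ^ m) ℤ.* t X α))} (Lin-nonNegative (λ α → scale ℤ.* (+ (4 ^ m) ℤ.* t X α)) (λ α _ → natural (t-cases X α))) (proj₂ (sampleValue-Lin X)))))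
    where
    natural : ∀ {t z} → (t ≡ 0ℤ × 0-or-1 z) ⊎ (t ≡ 1ℤ × z ≡ 1ℤ) → ∃ λ k → scale ℤ.* (+ (4 ^ m) ℤ.* t) ≡ + k
    natural (inj₁ (refl , _)) = 0 , trans (cong (scale ℤ.*_) (ℤ.*-zeroʳ (+ (4 ^ m)))) (ℤ.*-zeroʳ scale)
    natural (inj₂ (refl , _)) = 2 ^ s * 4 ^ m , trans (cong (scale ℤ.*_) (ℤ.*-identityʳ (+ (4 ^ m)))) (mul-pos (2 ^ s) (4 ^ m))

  J Λ : ℕ
  J = falling K D
  Λ = 4 ^ m * (u ^ n′ * (K ^ (n′ ∸ D) * J))

  ∑-t : ∀ α → Vec.sum α ≡ d → ∑ (R ^ n′) (λ X → + (4 ^ m) ℤ.* t X α) ≡ + Λ ℤ.* multilinear α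
  ∑-t α Σα≡ = begin
    ∑ (R ^ n′) (λ X → + (4 ^ m) ℤ.* t X α)          ≡⟨ ∑-*ˡ (R ^ n′) (+ (4 ^ m)) (λ X → t X α) ⟩
    + (4 ^ m) ℤ.* ∑ (R ^ n′) (λ X → t X α)          ≡⟨ cong (+ (4 ^ m) ℤ.*_) (∑-tallied n′ none (padded α)) ⟩
    + (4 ^ m) ℤ.* (+ (u ^ n′) ℤ.* (squarefree K none ℤ.* + slots K n′ (padded α) (free K none)))
      ≡⟨ cong (λ x → + (4 ^ m) ℤ.* (+ (u ^ n′) ℤ.* x)) (trans (cong₂ (λ x k → x ℤ.* + slots K n′ (padded α) k) (squarefree-none K) (free-none K)) (trans (ℤ.*-identityˡ _) slots≡)) ⟩
    + (4 ^ m) ℤ.* (+ (u ^ n′) ℤ.* (+ (K ^ (n′ ∸ D) * J) ℤ.* multilinear α))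
      ≡⟨ assoc (+ (4 ^ m)) (+ (u ^ n′)) (+ (K ^ (n′ ∸ D) * J)) (multilinear α) ⟩
    + (4 ^ m) ℤ.* (+ (u ^ n′) ℤ.* + (K ^ (n′ ∸ D) * J)) ℤ.* multilinear α
      ≡⟨ cong (ℤ._* multilinear α) (trans (cong (+ (4 ^ m) ℤ.*_) (mul-pos (u ^ n′) _)) (mul-pos (4 ^ m) _)) ⟩
    + Λ ℤ.* multilinear α ∎
    where
    open ≡-Reasoning
    assoc : ∀ x y z w → x ℤ.* (y ℤ.* (z ℤ.* w)) ≡ x ℤ.* (y ℤ.* z) ℤ.* w
    assoc = ℤRing.solve-∀
    Σ≡D : sumℕ n′ (padded α) ≡ D
    Σ≡D = trans (sum-padded α a) (trans (cong (_+ a) Σα≡) d+a≡)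
    D≤n′ : D ≤ n′
    D≤n′ = ℕ.≤-trans (ℕ.≤-reflexive (trans (sym d+a≡) (ℕ.+-comm d a))) (ℕ.+-monoʳ-≤ a d≤n)
    slots≡ : + slots K n′ (padded α) K ≡ + (K ^ (n′ ∸ D) * J) ℤ.* multilinear α
    slots≡ = ℤ.*-cancelʳ-≡ _ _ (+ (K ^ D)) {{ℕ.m^n≢0 K D}} (begin
      + slots K n′ (padded α) K ℤ.* + (K ^ D)            ≡⟨ mul-pos (slots K n′ (padded α) K) (K ^ D) ⟩
      + (slots K n′ (padded α) K * K ^ D)                ≡⟨ cong (λ k → + (slots K n′ (padded α) K * K ^ k)) (sym Σ≡D) ⟩
      + (slots K n′ (padded α) K * K ^ sumℕ n′ (padded α)) ≡⟨ slots-falling K n′ (padded α) K ⟩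
      + (K ^ n′ * falling K (sumℕ n′ (padded α))) ℤ.* squarefree n′ (padded α)
        ≡⟨ cong₂ (λ k x → + (K ^ n′ * falling K k) ℤ.* x) Σ≡D (squarefree-padded α a) ⟩
      + (K ^ n′ * J) ℤ.* multilinear α
        ≡⟨ cong (λ x → + (x * J) ℤ.* multilinear α) (trans (cong (K ^_) (sym (ℕ.m∸n+n≡m D≤n′))) (ℕ.^-distribˡ-+-* K (n′ ∸ D) D)) ⟩
      + (K ^ (n′ ∸ D) * K ^ D * J) ℤ.* multilinear α
        ≡⟨ cong (ℤ._* multilinear α) (trans (cong +_ (swap (K ^ (n′ ∸ D)) (K ^ D) J)) (ℤ.pos-* (K ^ (n′ ∸ D) * J) (K ^ D))) ⟩
      + (K ^ (n′ ∸ D) * J) ℤ.* + (K ^ D) ℤ.* multilinear α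
        ≡⟨ swap′ (+ (K ^ (n′ ∸ D) * J)) (+ (K ^ D)) (multilinear α) ⟩
      + (K ^ (n′ ∸ D) * J) ℤ.* multilinear α ℤ.* + (K ^ D) ∎)
      where
      swap : ∀ x y z → x * y * z ≡ x * z * y
      swap = ℕRing.solve-∀
      swap′ : ∀ x y z → x ℤ.* y ℤ.* z ≡ x ℤ.* z ℤ.* y
      swap′ = ℤRing.solve-∀

  totalValue : ℤ
  totalValue = ∑ (R ^ n′) sampleValue

  totalValue-Lin : (λ _ → int totalValue) ≋ Lin (λ α → scale ℤ.* (+ Λ ℤ.* multilinear α))
  totalValue-Lin = ≋-trans {v = λ _ → ∑ℚ (R ^ n′) (λ X → int (sampleValue X))} (≗⇒≋ λ _ → int-∑ (R ^ n′) sampleValue)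
    (≋-trans {v = λ N → ∑ℚ (R ^ n′) (λ X → Lin (λ α → scale ℤ.* (+ (4 ^ m) ℤ.* t X α)) N)}
      (≋-∑ (R ^ n′) {λ X _ → int (sampleValue X)} {λ X → Lin (λ α → scale ℤ.* (+ (4 ^ m) ℤ.* t X α))} sampleValue-Lin)
      (≗⇒≋ λ N → trans (Lin-∑ (R ^ n′) (λ X α → scale ℤ.* (+ (4 ^ m) ℤ.* t X α)) N)
        (Lin-cong {λ α → ∑ (R ^ n′) (λ X → scale ℤ.* (+ (4 ^ m) ℤ.* t X α))} {λ α → scale ℤ.* (+ Λ ℤ.* multilinear α)}
          (λ α Σα≡ → trans (∑-*ˡ (R ^ n′) scale (λ X → + (4 ^ m) ℤ.* t X α)) (cong (scale ℤ.*_) (∑-t α Σα≡))) N)))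

  totalValue-e∂ : (λ _ → int totalValue) ≋ (λ N → int (scale ℤ.* + Λ) ℚ.* seq (e∂ f) N)
  totalValue-e∂ = ≋-trans {v = Lin (λ α → scale ℤ.* (+ Λ ℤ.* multilinear α))} totalValue-Lin (≗⇒≋ λ N →
    trans (Lin-cong {λ α → scale ℤ.* (+ Λ ℤ.* multilinear α)} {λ α → scale ℤ.* + Λ ℤ.* multilinear α} (λ α _ → sym (ℤ.*-assoc scale (+ Λ) (multilinear α))) N)
    (trans (Lin-* (scale ℤ.* + Λ) multilinear N) (cong (int (scale ℤ.* + Λ) ℚ.*_) (sym (seq-e∂ f N)))))

  sampleValue-≤ : ∀ X → + Λ ℤ.* sampleValue X ℤ.≤ + (4 ^ m) ℤ.* totalValue
  sampleValue-≤ X = ℤ.0≤i-j⇒j≤i (int-cancel (ℚ.≤-trans (ℚ.≤-reflexive int-0) (≲-const (≲-trans {v = Lin excess} (Lin-nonNegative excess (λ α _ → natural (t-cases X α))) (proj₂ difference)))))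
    where
    F = + (4 ^ m)
    excess : Vec ℕ n → ℤ
    excess α = F ℤ.* (scale ℤ.* (+ Λ ℤ.* multilinear α)) ℤ.+ ℤ.- + Λ ℤ.* (scale ℤ.* (F ℤ.* t X α))
    natural : ∀ {t z} → (t ≡ 0ℤ × 0-or-1 z) ⊎ (t ≡ 1ℤ × z ≡ 1ℤ) → ∃ λ k → F ℤ.* (scale ℤ.* (+ Λ ℤ.* z)) ℤ.+ ℤ.- + Λ ℤ.* (scale ℤ.* (F ℤ.* t)) ≡ + k
    natural (inj₁ (refl , inj₁ refl)) = 0 , lemma F scale (+ Λ)
      where
      lemma : ∀ f s l → f ℤ.* (s ℤ.* (l ℤ.* 0ℤ)) ℤ.+ ℤ.- l ℤ.* (s ℤ.* (f ℤ.* 0ℤ)) ≡ 0ℤ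
      lemma = ℤRing.solve-∀
    natural (inj₁ (refl , inj₂ refl)) = 4 ^ m * (2 ^ s * Λ) , trans (lemma F scale (+ Λ)) (trans (cong (F ℤ.*_) (mul-pos (2 ^ s) Λ)) (mul-pos (4 ^ m) (2 ^ s * Λ)))
      where
      lemma : ∀ f s l → f ℤ.* (s ℤ.* (l ℤ.* 1ℤ)) ℤ.+ ℤ.- l ℤ.* (s ℤ.* (f ℤ.* 0ℤ)) ≡ f ℤ.* (s ℤ.* l)
      lemma = ℤRing.solve-∀
    natural (inj₂ (refl , refl)) = 0 , lemma F scale (+ Λ)
      where
      lemma : ∀ f s l → f ℤ.* (s ℤ.* (l ℤ.* 1ℤ)) ℤ.+ ℤ.- l ℤ.* (s ℤ.* (f ℤ.* 1ℤ)) ≡ 0ℤ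
      lemma = ℤRing.solve-∀
    difference : (λ _ → int (F ℤ.* totalValue ℤ.- + Λ ℤ.* sampleValue X)) ≋ Lin excess
    difference = ≋-trans {v = λ _ → int F ℚ.* int totalValue ℚ.+ int (ℤ.- + Λ) ℚ.* int (sampleValue X)}
      (≗⇒≋ λ _ → trans (int-+ (F ℤ.* totalValue) (ℤ.- (+ Λ ℤ.* sampleValue X))) (cong₂ ℚ._+_ (int-* F totalValue)
          (trans (cong int (ℤ.neg-distribˡ-* (+ Λ) (sampleValue X))) (int-* (ℤ.- + Λ) (sampleValue X)))))
      (≋-trans {v = λ N → int F ℚ.* Lin total-form N ℚ.+ int (ℤ.- + Λ) ℚ.* Lin sample-form N}
        (≋-+ (≋-scale F {λ _ → int totalValue} {Lin total-form} totalValue-Lin) (≋-scale (ℤ.- + Λ) {λ _ → int (sampleValue X)} {Lin sample-form} (sampleValue-Lin X)))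
        (≗⇒≋ λ N → sym (trans (Lin-+ (λ α → F ℤ.* total-form α) (λ α → ℤ.- + Λ ℤ.* sample-form α) N) (cong₂ ℚ._+_ (Lin-* F total-form N) (Lin-* (ℤ.- + Λ) sample-form N)))))
      where
      total-form sample-form : Vec ℕ n → ℤ
      total-form α = scale ℤ.* (+ Λ ℤ.* multilinear α)
      sample-form α = scale ℤ.* (F ℤ.* t X α)

int-nonNegative : ∀ k → 0ℚ ℚ.≤ int (+ k)
int-nonNegative k = ℚ.≤-trans (ℚ.≤-reflexive (sym int-0)) (int-mono (ℤ.+≤+ z≤n))

int-2 : int (+ 2) ≡ 1ℚ ℚ.+ 1ℚ
int-2 = trans (int-+ 1ℤ 1ℤ) (cong₂ ℚ._+_ int-1 int-1)

int-*-mono : ∀ k {p q} → p ℚ.≤ q → int (+ k) ℚ.* p ℚ.≤ int (+ k) ℚ.* q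
int-*-mono k p≤q = ℚ.*-monoˡ-≤-nonNeg (int (+ k)) {{ℚ.nonNegative (int-nonNegative k)}} p≤q

int-*-cancel : ∀ k .{{_ : NonZero k}} {p q} → int (+ k) ℚ.* p ℚ.≤ int (+ k) ℚ.* q → p ℚ.≤ q
int-*-cancel k kp≤kq = ℚ.*-cancelˡ-≤-pos (int (+ k)) {{ℚ.positive (int-positive k)}} kp≤kq

≲-unscale : ∀ k .{{_ : NonZero k}} {u v} → (λ n → int (+ k) ℚ.* u n) ≲ (λ n → int (+ k) ℚ.* v n) → u ≲ v
≲-unscale k {u} {v} p = mk≲ λ δ 0<δ → eventually-map
  (λ n ku≤ → int-*-cancel k (ℚ.≤-trans ku≤ (ℚ.≤-reflexive (sym (ℚ.*-distribˡ-+ (int (+ k)) (v n) δ)))))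
  (within p (int (+ k) ℚ.* δ) (ℚ.positive⁻¹ (int (+ k) ℚ.* δ) {{ℚ.pos*pos⇒pos (int (+ k)) {{ℚ.positive (int-positive k)}} δ {{ℚ.positive 0<δ}}}}))

-- If θ = 3 / 2ᵏ ≤ ε eventually, a rational within the relative error θ of
-- the limit of x is within the relative error ε of x.
relative-error : ∀ (x ε : ℝ) (E z : ℚ) k → 0ℚ ℚ.≤ E → (λ _ → E) ≋ seq x →
  Eventually (λ N → int (+ 3) ℚ.≤ int (+ 2 ^ k) ℚ.* seq ε N × seq ε N ℚ.≤ 1ℚ) →
  int (+ 2 ^ k) ℚ.* (E ℚ.- z) ℚ.≤ int (+ 3) ℚ.* E → int (+ 2 ^ k) ℚ.* (z ℚ.- E) ℚ.≤ int (+ 3) ℚ.* E →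
  ((1ᵣ -ᵣ ε) *ᵣ x ≤ᵣ fromℚ z) × (fromℚ z ≤ᵣ (1ᵣ +ᵣ ε) *ᵣ x)
relative-error x ε E z k 0≤E (E≲x , x≲E) precise low high =
    mk≤ (λ δ 0<δ → eventually-map (λ N (x≤ , 3≤ , ε≤1) → lower δ 0<δ (seq ε N) (seq x N) 3≤ ε≤1 x≤) (eventually-× (within x≲E δ 0<δ) precise))
  , mk≤ (λ δ 0<δ → eventually-map (λ N (E≤ , 3≤ , ε≤1) → upper δ 0<δ (seq ε N) (seq x N) 3≤ ε≤1 E≤) (eventually-× (within E≲x (½ ℚ.* δ) (half-positive 0<δ)) precise))
  where
  instance
    2^k-nonZero : NonZero (2 ^ k)
    2^k-nonZero = ℕ.m^n≢0 2 k

  absorb : ∀ e y → int (+ 3) ℚ.≤ int (+ 2 ^ k) ℚ.* e → int (+ 2 ^ k) ℚ.* y ℚ.≤ int (+ 3) ℚ.* E → y ℚ.≤ e ℚ.* E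
  absorb e y 3≤ y≤ = int-*-cancel (2 ^ k) (ℚ.≤-trans y≤ (ℚ.≤-trans (ℚ.*-monoʳ-≤-nonNeg E {{ℚ.nonNegative 0≤E}} 3≤) (ℚ.≤-reflexive (ℚ.*-assoc (int (+ 2 ^ k)) e E))))

  0≤ε : ∀ e → int (+ 3) ℚ.≤ int (+ 2 ^ k) ℚ.* e → 0ℚ ℚ.≤ e
  0≤ε e 3≤ = int-*-cancel (2 ^ k) (ℚ.≤-trans (ℚ.≤-reflexive (ℚ.*-zeroʳ (int (+ 2 ^ k)))) (ℚ.≤-trans (int-nonNegative 3) 3≤))

  lower : ∀ δ → 0ℚ ℚ.< δ → ∀ e y → int (+ 3) ℚ.≤ int (+ 2 ^ k) ℚ.* e → e ℚ.≤ 1ℚ → y ℚ.≤ E ℚ.+ δ → (1ℚ ℚ.+ ℚ.- e) ℚ.* y ℚ.≤ z ℚ.+ δ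
  lower δ 0<δ e y 3≤ e≤1 y≤ = begin
    (1ℚ ℚ.+ ℚ.- e) ℚ.* y             ≤⟨ ℚ.*-monoˡ-≤-nonNeg (1ℚ ℚ.+ ℚ.- e) {{ℚ.nonNegative (ℚ.≤-trans (ℚ.≤-reflexive (sym (ℚ.+-inverseʳ e))) (ℚ.+-monoˡ-≤ (ℚ.- e) e≤1))}} y≤ ⟩
    (1ℚ ℚ.+ ℚ.- e) ℚ.* (E ℚ.+ δ)     ≡⟨ expand e E δ z ⟩
    (E ℚ.- z) ℚ.+ ((z ℚ.+ δ) ℚ.+ ℚ.- (e ℚ.* E ℚ.+ e ℚ.* δ)) ≤⟨ ℚ.+-monoˡ-≤ ((z ℚ.+ δ) ℚ.+ ℚ.- (e ℚ.* E ℚ.+ e ℚ.* δ)) (absorb e (E ℚ.- z) 3≤ low) ⟩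
    e ℚ.* E ℚ.+ ((z ℚ.+ δ) ℚ.+ ℚ.- (e ℚ.* E ℚ.+ e ℚ.* δ))   ≡⟨ collect e E δ z ⟩
    (z ℚ.+ δ) ℚ.+ ℚ.- (e ℚ.* δ)      ≤⟨ ℚ.+-monoʳ-≤ (z ℚ.+ δ) (ℚ.neg-antimono-≤ (ℚ.≤-trans (ℚ.≤-reflexive (sym (ℚ.*-zeroʳ e))) (ℚ.*-monoˡ-≤-nonNeg e {{ℚ.nonNegative (0≤ε e 3≤)}} (ℚ.<⇒≤ 0<δ)))) ⟩
    (z ℚ.+ δ) ℚ.+ 0ℚ                 ≡⟨ ℚ.+-identityʳ (z ℚ.+ δ) ⟩
    z ℚ.+ δ                          ∎
    where
    open ℚ.≤-Reasoning
    expand : ∀ e E δ z → (1ℚ ℚ.+ ℚ.- e) ℚ.* (E ℚ.+ δ) ≡ (E ℚ.- z) ℚ.+ ((z ℚ.+ δ) ℚ.+ ℚ.- (e ℚ.* E ℚ.+ e ℚ.* δ))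
    expand = ℚ-solve 4 (λ e E δ z → ((con 1ℚ) :+ :- e) :* (E :+ δ) := (E :- z) :+ ((z :+ δ) :+ :- (e :* E :+ e :* δ))) refl
    collect : ∀ e E δ z → e ℚ.* E ℚ.+ ((z ℚ.+ δ) ℚ.+ ℚ.- (e ℚ.* E ℚ.+ e ℚ.* δ)) ≡ (z ℚ.+ δ) ℚ.+ ℚ.- (e ℚ.* δ)
    collect = ℚ-solve 4 (λ e E δ z → e :* E :+ ((z :+ δ) :+ :- (e :* E :+ e :* δ)) := (z :+ δ) :+ :- (e :* δ)) refl

  upper : ∀ δ → 0ℚ ℚ.< δ → ∀ e y → int (+ 3) ℚ.≤ int (+ 2 ^ k) ℚ.* e → e ℚ.≤ 1ℚ → E ℚ.≤ y ℚ.+ ½ ℚ.* δ → z ℚ.≤ (1ℚ ℚ.+ e) ℚ.* y ℚ.+ δ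
  upper δ 0<δ e y 3≤ e≤1 E≤ = begin
    z                                                       ≡⟨ rearrange z E ⟩
    (z ℚ.- E) ℚ.+ E                                         ≤⟨ ℚ.+-monoˡ-≤ E (absorb e (z ℚ.- E) 3≤ high) ⟩
    e ℚ.* E ℚ.+ E                                           ≡⟨ factorise e E ⟩
    (1ℚ ℚ.+ e) ℚ.* E                                        ≤⟨ ℚ.*-monoˡ-≤-nonNeg (1ℚ ℚ.+ e) {{ℚ.nonNegative (ℚ.+-mono-≤ (ℚ.<⇒≤ (ℚ.positive⁻¹ 1ℚ)) (0≤ε e 3≤))}} E≤ ⟩
    (1ℚ ℚ.+ e) ℚ.* (y ℚ.+ ½ ℚ.* δ)                          ≡⟨ expand e y (½ ℚ.* δ) ⟩
    (1ℚ ℚ.+ e) ℚ.* y ℚ.+ (½ ℚ.* δ ℚ.+ e ℚ.* (½ ℚ.* δ))      ≤⟨ ℚ.+-monoʳ-≤ ((1ℚ ℚ.+ e) ℚ.* y) (ℚ.+-monoʳ-≤ (½ ℚ.* δ) (ℚ.≤-trans (ℚ.*-monoʳ-≤-nonNeg (½ ℚ.* δ) {{ℚ.nonNegative (ℚ.<⇒≤ (half-positive 0<δ))}} e≤1) (ℚ.≤-reflexive (ℚ.*-identityˡ (½ ℚ.* δ))))) ⟩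
    (1ℚ ℚ.+ e) ℚ.* y ℚ.+ (½ ℚ.* δ ℚ.+ ½ ℚ.* δ)              ≡⟨ cong (ℚ._+_ ((1ℚ ℚ.+ e) ℚ.* y)) (halves-sum δ) ⟩
    (1ℚ ℚ.+ e) ℚ.* y ℚ.+ δ                                  ∎
    where
    open ℚ.≤-Reasoning
    rearrange : ∀ z E → z ≡ (z ℚ.- E) ℚ.+ E
    rearrange = ℚ-solve 2 (λ z E → z := (z :- E) :+ E) refl
    factorise : ∀ e E → e ℚ.* E ℚ.+ E ≡ (1ℚ ℚ.+ e) ℚ.* E
    factorise = ℚ-solve 2 (λ e E → e :* E :+ E := ((con 1ℚ) :+ e) :* E) refl
    expand : ∀ e y h → (1ℚ ℚ.+ e) ℚ.* (y ℚ.+ h) ≡ (1ℚ ℚ.+ e) ℚ.* y ℚ.+ (h ℚ.+ e ℚ.* h)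
    expand = ℚ-solve 3 (λ e y h → ((con 1ℚ) :+ e) :* (y :+ h) := ((con 1ℚ) :+ e) :* y :+ (h :+ e :* h)) refl

witness : ∀ {P : Set} → Eventually (λ _ → P) → P
witness (N , p) = p N ℕ.≤-refl

least : ∀ {P : ℕ → Set} → (∀ i → Dec (P i)) → ∀ k → P k → ∃ λ i → P i × (∀ j → j < i → ¬ P j)
least P? zero    p = 0 , p , λ _ ()
least {P} P? (suc k) p with P? 0
... | yes p₀ = 0 , p₀ , λ _ ()
... | no ¬p₀ with least (P? ∘ suc) k p
...   | i , pi , below = suc i , pi , λ { zero _ → ¬p₀ ; (suc j) (s≤s j<i) → below j j<i }

compare-<-true : ∀ {a b} → a ℤ.< b → compare lt a b ≡ true
compare-<-true {a} {b} a<b with a ℤ.<? b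
... | yes _   = refl
... | no  a≮b = contradiction a<b a≮b

compare-<-false : ∀ {a b} → b ℤ.≤ a → compare lt a b ≡ false
compare-<-false {a} {b} b≤a with a ℤ.<? b
... | yes a<b = contradiction b≤a (ℤ.<⇒≱ a<b)
... | no  _   = refl

module Precision (ε : ℝ) (0<ε : 0ᵣ <ᵣ ε) (ε<1 : ε <ᵣ 1ᵣ) (ε̂ : ℕ → ℤ) (approx : ε̂ Approximates ε) where

  e : ℕ → ℚ
  e = seq ε

  ε≤1 : Eventually λ N → e N ℚ.≤ 1ℚ
  ε≤1 = eventually-map (λ N p → ℚ.≤-trans (ℚ.≤-reflexive (sym (ℚ.+-identityʳ (e N)))) (ℚ.≤-trans (ℚ.+-monoʳ-≤ (e N) (ℚ.<⇒≤ (gap-positive ε<1))) p)) (eventually-< ε<1)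
    where open _<ᵣ_

  g : ℚ
  g = _<ᵣ_.gap 0<ε

  0<g : 0ℚ ℚ.< g
  0<g = _<ᵣ_.gap-positive 0<ε

  g≤ε : Eventually λ N → g ℚ.≤ e N
  g≤ε = eventually-map (λ N p → ℚ.≤-trans (ℚ.≤-reflexive (sym (ℚ.+-identityˡ g))) p) (_<ᵣ_.eventually-< 0<ε)

  0≤ε : Eventually λ N → 0ℚ ℚ.≤ e N
  0≤ε = eventually-map (λ N → ℚ.≤-trans (ℚ.<⇒≤ 0<g)) g≤ε

  approx-≤ : ∀ k → Eventually λ N → int (ε̂ k) ℚ.≤ int (+ 2 ^ k) ℚ.* e N ℚ.+ int (+ 2)
  approx-≤ k = eventually-map
    (λ N q → subst₂ (λ x y → int (ε̂ k) ℚ.≤ x ℚ.* e N ℚ.+ y) (sym (int≡ (+ 2 ^ k))) (sym int-2)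
       (ℚ.≤-trans (ℚ.≤-reflexive (rearrange (int (ε̂ k)))) (ℚ.≤-trans (ℚ.+-monoˡ-≤ 1ℚ (subst (λ x → x ℚ.+ ℚ.- 1ℚ ℚ.≤ _) (sym (int≡ (ε̂ k))) q))
         (ℚ.≤-reflexive (ℚ.+-assoc ((+ 2 ^ k) ℚ./ 1 ℚ.* e N) 1ℚ 1ℚ)))))
    (_≤ᵣ_.eventually-≤ (proj₁ (approx k)) 1ℚ (ℚ.positive⁻¹ 1ℚ))
    where
    rearrange : ∀ x → x ≡ (x ℚ.+ ℚ.- 1ℚ) ℚ.+ 1ℚ
    rearrange = ℚ-solve 1 (λ x → x := (x :+ :- (con 1ℚ)) :+ (con 1ℚ)) refl

  approx-≥ : ∀ k → Eventually λ N → int (+ 2 ^ k) ℚ.* e N ℚ.≤ int (ε̂ k) ℚ.+ int (+ 2)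
  approx-≥ k = eventually-map
    (λ N q → subst₂ (λ x y → x ℚ.* e N ℚ.≤ int (ε̂ k) ℚ.+ y) (sym (int≡ (+ 2 ^ k))) (sym int-2)
       (ℚ.≤-trans q (ℚ.≤-trans (ℚ.≤-reflexive (ℚ.+-assoc (ε̂ k ℚ./ 1) 1ℚ 1ℚ)) (ℚ.≤-reflexive (cong (ℚ._+ (1ℚ ℚ.+ 1ℚ)) (sym (int≡ (ε̂ k))))))))
    (_≤ᵣ_.eventually-≤ (proj₂ (approx k)) 1ℚ (ℚ.positive⁻¹ 1ℚ))

  coarse : ∀ k → ¬ (+ 5 ℤ.≤ ε̂ k) → Eventually λ N → int (+ 2 ^ k) ℚ.* e N ℚ.≤ int (+ 6)
  coarse k ¬5≤ = eventually-map (λ N p → ℚ.≤-trans p (ℚ.≤-trans (ℚ.+-monoˡ-≤ (int (+ 2)) (int-mono ε̂≤4)) (ℚ.≤-reflexive (sym (int-+ (+ 4) (+ 2)))))) (approx-≥ k)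
    where
    ε̂≤4 : ε̂ k ℤ.≤ + 4
    ε̂≤4 = ℤ.≮⇒≥ λ 4< → ¬5≤ (ℤ.i<j⇒suc[i]≤j 4<)

  eventually-fine : ∃ λ k → + 5 ℤ.≤ ε̂ k
  eventually-fine = k₀ , fine (+ 5 ℤ.≤? ε̂ k₀)
    where
    k₀ = 6 * ℚ.↧ₙ g
    1≤↥ : int 1ℤ ℚ.≤ int (+ ℚ.↧ₙ g) ℚ.* g
    1≤↥ = ℚ.≤-trans (int-mono {1ℤ} {ℚ.↥ g} (ℤ.i<j⇒suc[i]≤j (ℤ.≰⇒> λ ↥≤0 → ℚ.<-irrefl refl $ ℚ.<-≤-trans 0<g
             (int-*-cancel (ℚ.↧ₙ g) (ℚ.≤-trans (ℚ.≤-reflexive clear) (ℚ.≤-trans (int-mono ↥≤0) (ℚ.≤-reflexive (trans int-0 (sym (ℚ.*-zeroʳ (int (+ ℚ.↧ₙ g)))))))))))) (ℚ.≤-reflexive (sym clear))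
      where
      clear : int (+ ℚ.↧ₙ g) ℚ.* g ≡ int (ℚ.↥ g)
      clear = trans (ℚ.*-comm (int (+ ℚ.↧ₙ g)) g) (trans (cong (ℚ._* int (+ ℚ.↧ₙ g)) (sym (ℚ.↥p/↧p≡p g))) (quotient-* (ℚ.↥ g) (ℚ.↧ₙ g)))
    6<2^k₀g : int (+ 6) ℚ.< int (+ 2 ^ k₀) ℚ.* g
    6<2^k₀g = ℚ.<-≤-trans (subst (ℚ._< int (+ 6) ℚ.+ g) (ℚ.+-identityʳ (int (+ 6))) (ℚ.+-monoʳ-< (int (+ 6)) 0<g))
      (ℚ.≤-trans (ℚ.+-monoˡ-≤ g (ℚ.≤-trans (ℚ.≤-reflexive (int-pos-* 6 1)) (int-*-mono 6 1≤↥))) (ℚ.≤-trans (ℚ.≤-reflexive (sym expand))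
        (ℚ.*-monoʳ-≤-nonNeg g {{ℚ.nonNegative (ℚ.<⇒≤ 0<g)}} (int-mono (ℤ.+≤+ (n<2^n k₀))))))
      where
      expand : int (+ suc k₀) ℚ.* g ≡ int (+ 6) ℚ.* (int (+ ℚ.↧ₙ g) ℚ.* g) ℚ.+ g
      expand = trans (cong (ℚ._* g) (trans (int-+ 1ℤ (+ k₀)) (cong₂ ℚ._+_ int-1 (int-pos-* 6 (ℚ.↧ₙ g))))) (lemma (int (+ 6)) (int (+ ℚ.↧ₙ g)) g)
        where
        lemma : ∀ x y g → (1ℚ ℚ.+ x ℚ.* y) ℚ.* g ≡ x ℚ.* (y ℚ.* g) ℚ.+ g
        lemma = ℚ-solve 3 (λ x y g → ((con 1ℚ) :+ x :* y) :* g := x :* (y :* g) :+ g) refl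
    fine : Dec (+ 5 ℤ.≤ ε̂ k₀) → + 5 ℤ.≤ ε̂ k₀
    fine (yes p)  = p
    fine (no ¬p) = contradiction (witness (eventually-map (λ N (g≤ , ≤6) → ℚ.<-≤-trans 6<2^k₀g (ℚ.≤-trans (int-*-mono (2 ^ k₀) g≤) ≤6)) (eventually-× g≤ε (coarse k₀ ¬p)))) (ℚ.<-irrefl refl)

  abstract
    found : ∃ λ i → + 5 ℤ.≤ ε̂ i × (∀ j → j < i → ¬ (+ 5 ℤ.≤ ε̂ j))
    found = least (λ i → + 5 ℤ.≤? ε̂ i) (proj₁ eventually-fine) (proj₂ eventually-fine)

  opaque
    k : ℕ
    k = proj₁ found

    before : ∀ i → i < k → compare lt (ε̂ i) (+ 5) ≡ true
    before i i<k = compare-<-true (ℤ.≰⇒> (proj₂ (proj₂ found) i i<k))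

    after : compare lt (ε̂ k) (+ 5) ≡ false
    after = compare-<-false (proj₁ (proj₂ found))

    precise : Eventually λ N → int (+ 3) ℚ.≤ int (+ 2 ^ k) ℚ.* e N × e N ℚ.≤ 1ℚ
    precise = eventually-× (eventually-map (λ N p → subst₂ ℚ._≤_ (trans (sym (int-+ (+ 5) (ℤ.- + 2))) refl) (lemma (int (+ 2 ^ k) ℚ.* e N)) (ℚ.+-monoˡ-≤ (int (ℤ.- + 2)) (ℚ.≤-trans (int-mono (proj₁ (proj₂ found))) p))) (approx-≤ k)) ε≤1
      where
      lemma : ∀ x → x ℚ.+ int (+ 2) ℚ.+ int (ℤ.- + 2) ≡ x
      lemma x = trans (ℚ.+-assoc x (int (+ 2)) (int (ℤ.- + 2))) (trans (cong (ℚ._+_ x) (sym (int-+ (+ 2) (ℤ.- + 2)))) (trans (cong (ℚ._+_ x) int-0) (ℚ.+-identityʳ x)))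

    not-too-precise : Eventually λ N → int (+ 2 ^ k) ℚ.* e N ℚ.≤ int (+ 12)
    not-too-precise = by-cases k refl
      where
      by-cases : ∀ i → i ≡ k → Eventually λ N → int (+ 2 ^ i) ℚ.* e N ℚ.≤ int (+ 12)
      by-cases zero    _ = eventually-map (λ N p → ℚ.≤-trans (ℚ.≤-reflexive (trans (cong (ℚ._* e N) int-1) (ℚ.*-identityˡ (e N)))) (ℚ.≤-trans p (ℚ.≤-trans (ℚ.≤-reflexive (sym int-1)) (int-mono (ℤ.+≤+ (s≤s (z≤n {11}))))))) ε≤1
      by-cases (suc i) i≡k = eventually-map (λ N p → ℚ.≤-trans (ℚ.≤-reflexive (trans (cong (ℚ._* e N) (int-pos-* 2 (2 ^ i))) (ℚ.*-assoc (int (+ 2)) (int (+ 2 ^ i)) (e N)))) (ℚ.≤-trans (int-*-mono 2 p) (ℚ.≤-reflexive (sym (int-pos-* 2 6)))))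
        (coarse i (proj₂ (proj₂ found) i (subst (i <_) i≡k ℕ.≤-refl)))

  ε̂-small : ∀ i → i ≤ k → ℤ.∣ ε̂ i ∣ ≤ 2 ^ (k + 2)
  ε̂-small i i≤k = ℕ.≤-trans (bounded-abs (ε̂ i) upper′ lower′) (ℕ.≤-trans (ℕ.+-monoˡ-≤ 2 (ℕ.^-monoʳ-≤ 2 i≤k)) large)
    where
    upper′ : ε̂ i ℤ.≤ + (2 ^ i + 2)
    upper′ = int-cancel (ℚ.≤-trans (witness (eventually-map (λ N (p , q) → ℚ.≤-trans p (ℚ.+-monoˡ-≤ (int (+ 2)) (ℚ.≤-trans (int-*-mono (2 ^ i) q) (ℚ.≤-reflexive (ℚ.*-identityʳ (int (+ 2 ^ i))))))) (eventually-× (approx-≤ i) ε≤1)))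
      (ℚ.≤-reflexive (sym (int-+ (+ 2 ^ i) (+ 2)))))
    lower′ : 0ℤ ℤ.≤ ε̂ i ℤ.+ + 2
    lower′ = int-cancel (ℚ.≤-trans (ℚ.≤-trans (ℚ.≤-reflexive int-0) (witness (eventually-map (λ N (p , q) → ℚ.≤-trans (ℚ.≤-reflexive (sym (ℚ.*-zeroʳ (int (+ 2 ^ i))))) (ℚ.≤-trans (int-*-mono (2 ^ i) q) p)) (eventually-× (approx-≥ i) 0≤ε))))
      (ℚ.≤-reflexive (sym (int-+ (ε̂ i) (+ 2)))))
    bounded-abs : ∀ {b} z → z ℤ.≤ + (b + 2) → 0ℤ ℤ.≤ z ℤ.+ + 2 → ℤ.∣ z ∣ ≤ b + 2
    bounded-abs (+ n)           z≤ _ = ℤ.drop‿+≤+ z≤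
    bounded-abs -[1+ zero ]     _  _ = ℕ.≤-trans (s≤s z≤n) (ℕ.m≤n+m 2 _)
    bounded-abs -[1+ suc zero ] _  _ = ℕ.m≤n+m 2 _
    bounded-abs -[1+ suc (suc n) ] _ ()
    large : 2 ^ k + 2 ≤ 2 ^ (k + 2)
    large = ℕ.≤-trans (ℕ.+-monoʳ-≤ (2 ^ k) (ℕ.*-monoʳ-≤ 2 (ℕ.m^n>0 2 k))) (ℕ.≤-trans (ℕ.≤-reflexive (three (2 ^ k))) (ℕ.≤-trans (ℕ.*-monoˡ-≤ (2 ^ k) (ℕ.n≤1+n 3)) (ℕ.≤-reflexive (trans (ℕ.*-comm 4 (2 ^ k)) (sym (ℕ.^-distribˡ-+-* 2 k 2))))))
      where
      three : ∀ x → x + 2 * x ≡ 3 * x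
      three = ℕRing.solve-∀

  k-≤ : ∀ ℓ → ℓ ≥log1/ ε → k ≤ ℓ + 5
  k-≤ ℓ (_ , mk≤ p) = ^-cancel-≤ (ℕ.≤-trans (ℤ.drop‿+≤+ (int-cancel (witness (eventually-map combine (eventually-× (eventually-map (λ N → subst (λ x → 1ℚ ℚ.≤ x ℚ.* e N ℚ.+ ½) (sym (int≡ (+ 2 ^ ℓ)))) (p ½ (ℚ.positive⁻¹ ½))) not-too-precise)))))
      (ℕ.≤-trans (ℕ.*-monoˡ-≤ (2 ^ ℓ) (ℕ.m≤m+n 24 8)) (ℕ.≤-reflexive (trans (ℕ.*-comm 32 (2 ^ ℓ)) (sym (ℕ.^-distribˡ-+-* 2 ℓ 5))))))
    where
    combine : ∀ N → (1ℚ ℚ.≤ int (+ 2 ^ ℓ) ℚ.* e N ℚ.+ ½) × (int (+ 2 ^ k) ℚ.* e N ℚ.≤ int (+ 12)) → int (+ 2 ^ k) ℚ.≤ int (+ (24 * 2 ^ ℓ))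
    combine N (1≤ , ≤12) = begin
      int (+ 2 ^ k)                                            ≡⟨ ℚ.*-identityʳ (int (+ 2 ^ k)) ⟨
      int (+ 2 ^ k) ℚ.* 1ℚ                                     ≤⟨ int-*-mono (2 ^ k) 1≤2x ⟩
      int (+ 2 ^ k) ℚ.* (int (+ 2) ℚ.* (int (+ 2 ^ ℓ) ℚ.* e N)) ≡⟨ shuffle (int (+ 2 ^ k)) (int (+ 2)) (int (+ 2 ^ ℓ)) (e N) ⟩
      int (+ 2) ℚ.* (int (+ 2 ^ ℓ) ℚ.* (int (+ 2 ^ k) ℚ.* e N)) ≤⟨ int-*-mono 2 (int-*-mono (2 ^ ℓ) ≤12) ⟩
      int (+ 2) ℚ.* (int (+ 2 ^ ℓ) ℚ.* int (+ 12))             ≡⟨ cong (int (+ 2) ℚ.*_) (int-pos-* (2 ^ ℓ) 12) ⟨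
      int (+ 2) ℚ.* int (+ (2 ^ ℓ * 12))                       ≡⟨ int-pos-* 2 (2 ^ ℓ * 12) ⟨
      int (+ (2 * (2 ^ ℓ * 12)))                               ≡⟨ cong (λ x → int (+ x)) (collect (2 ^ ℓ)) ⟩
      int (+ (24 * 2 ^ ℓ))                                     ∎
      where
      open ℚ.≤-Reasoning
      shuffle : ∀ a b c e → a ℚ.* (b ℚ.* (c ℚ.* e)) ≡ b ℚ.* (c ℚ.* (a ℚ.* e))
      shuffle = ℚ-solve 4 (λ a b c e → a :* (b :* (c :* e)) := b :* (c :* (a :* e))) refl
      collect : ∀ x → 2 * (x * 12) ≡ 24 * x
      collect = ℕRing.solve-∀
      x = int (+ 2 ^ ℓ) ℚ.* e N
      1≤2x : 1ℚ ℚ.≤ int (+ 2) ℚ.* x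
      1≤2x = subst₂ ℚ._≤_ (cong (λ y → y ℚ.* 1ℚ ℚ.+ ℚ.- 1ℚ) int-2) (lemma x) (ℚ.+-monoˡ-≤ (ℚ.- 1ℚ) (int-*-mono 2 1≤))
        where
        lemma : ∀ x → int (+ 2) ℚ.* (x ℚ.+ ½) ℚ.+ ℚ.- 1ℚ ≡ int (+ 2) ℚ.* x
        lemma x = trans (cong (ℚ._+ ℚ.- 1ℚ) (trans (ℚ.*-distribˡ-+ (int (+ 2)) x ½) (cong (λ y → int (+ 2) ℚ.* x ℚ.+ y ℚ.* ½) int-2))) (trans (ℚ.+-assoc (int (+ 2) ℚ.* x) 1ℚ (ℚ.- 1ℚ)) (ℚ.+-identityʳ (int (+ 2) ℚ.* x)))

  timeBound : ∀ T₀ T d ℓ p → T ≤ 4 ^ k * T₀ → TimeEstimate T₀ d ℓ p → TimeBound T d ε ℓ p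
  timeBound T₀ T d ℓ p T≤ (estimate bound) = mk≤ λ δ 0<δ → eventually-map (λ N (≤12 , 0≤e) → relax δ 0<δ (converted N ≤12 0≤e)) (eventually-× not-too-precise 0≤ε)
    where
    q : ℚ
    q = + 163 ℚ./ 40
    geometric : ∀ d N → int (+ 40 ^ d) ℚ.* seq (fromℚ q ^ᵣ d) N ≡ int (+ 163 ^ d)
    geometric zero    N = ℚ.*-identityʳ (int (+ 1))
    geometric (suc d) N = trans (cong (ℚ._* (q ℚ.* seq (fromℚ q ^ᵣ d) N)) (int-pos-* 40 (40 ^ d)))
      (trans (swap (int (+ 40)) (int (+ 40 ^ d)) q (seq (fromℚ q ^ᵣ d) N)) (trans (cong₂ ℚ._*_ (quotient-* (+ 163) 40) (geometric d N)) (sym (int-pos-* 163 (163 ^ d)))))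
      where
      swap : ∀ a b q s → (a ℚ.* b) ℚ.* (q ℚ.* s) ≡ (q ℚ.* a) ℚ.* (b ℚ.* s)
      swap = ℚ-solve 4 (λ a b q s → (a :* b) :* (q :* s) := (q :* a) :* (b :* s)) refl
    relax : ∀ δ → 0ℚ ℚ.< δ → ∀ {x y} → x ℚ.≤ y → x ℚ.≤ y ℚ.+ δ
    relax δ 0<δ {x} {y} x≤y = ℚ.≤-trans x≤y (ℚ.≤-trans (ℚ.≤-reflexive (sym (ℚ.+-identityʳ y))) (ℚ.+-monoʳ-≤ y (ℚ.<⇒≤ 0<δ)))
    pointwise : ∀ N → int (+ 2 ^ k) ℚ.* e N ℚ.≤ int (+ 12) → 0ℚ ℚ.≤ e N → int (+ T) ℚ.* (e N ℚ.* (e N ℚ.* 1ℚ)) ℚ.≤ seq (fromℚ q ^ᵣ d) N ℚ.* int (+ ℓ) ℚ.* int (+ p)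
    pointwise N ≤12 0≤e = begin
      int (+ T) ℚ.* (e N ℚ.* (e N ℚ.* 1ℚ))
        ≤⟨ ℚ.*-monoʳ-≤-nonNeg (e N ℚ.* (e N ℚ.* 1ℚ)) {{ℚ.nonNegative sq≥0}} (int-mono (ℤ.+≤+ T≤)) ⟩
      int (+ (4 ^ k * T₀)) ℚ.* (e N ℚ.* (e N ℚ.* 1ℚ))
        ≡⟨ cong (λ x → int (+ (x * T₀)) ℚ.* (e N ℚ.* (e N ℚ.* 1ℚ))) 4^k≡ ⟩
      int (+ (2 ^ k * 2 ^ k * T₀)) ℚ.* (e N ℚ.* (e N ℚ.* 1ℚ))
        ≡⟨ cong (ℚ._* (e N ℚ.* (e N ℚ.* 1ℚ))) (trans (int-pos-* (2 ^ k * 2 ^ k) T₀) (cong (ℚ._* int (+ T₀)) (int-pos-* (2 ^ k) (2 ^ k)))) ⟩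
      int (+ 2 ^ k) ℚ.* int (+ 2 ^ k) ℚ.* int (+ T₀) ℚ.* (e N ℚ.* (e N ℚ.* 1ℚ))
        ≡⟨ shuffle (int (+ 2 ^ k)) (int (+ T₀)) (e N) ⟩
      int (+ T₀) ℚ.* ((int (+ 2 ^ k) ℚ.* e N) ℚ.* (int (+ 2 ^ k) ℚ.* e N))
        ≤⟨ int-*-mono T₀ (ℚ.≤-trans (ℚ.*-monoˡ-≤-nonNeg x {{ℚ.nonNegative x≥0}} ≤12) (ℚ.*-monoʳ-≤-nonNeg (int (+ 12)) {{ℚ.nonNegative (int-nonNegative 12)}} ≤12)) ⟩
      int (+ T₀) ℚ.* (int (+ 12) ℚ.* int (+ 12))
        ≡⟨ trans (cong (int (+ T₀) ℚ.*_) (sym (int-pos-* 12 12))) (trans (sym (int-pos-* T₀ 144)) (cong (λ x → int (+ x)) (ℕ.*-comm T₀ 144))) ⟩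
      int (+ (144 * T₀))
        ≤⟨ int-*-cancel (40 ^ d) {{ℕ.m^n≢0 40 d}} scaled ⟩
      seq (fromℚ q ^ᵣ d) N ℚ.* int (+ ℓ) ℚ.* int (+ p) ∎
      where
      open ℚ.≤-Reasoning
      x = int (+ 2 ^ k) ℚ.* e N
      4^k≡ : 4 ^ k ≡ 2 ^ k * 2 ^ k
      4^k≡ = trans (ℕ.^-*-assoc 2 2 k) (trans (cong (λ x → 2 ^ (k + x)) (ℕ.+-identityʳ k)) (ℕ.^-distribˡ-+-* 2 k k))
      x≥0 : 0ℚ ℚ.≤ x
      x≥0 = ℚ.≤-trans (ℚ.≤-reflexive (sym (ℚ.*-zeroʳ (int (+ 2 ^ k))))) (int-*-mono (2 ^ k) 0≤e)
      sq≥0 : 0ℚ ℚ.≤ e N ℚ.* (e N ℚ.* 1ℚ)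
      sq≥0 = ℚ.≤-trans (ℚ.≤-reflexive (sym (ℚ.*-zeroʳ (e N)))) (ℚ.*-monoˡ-≤-nonNeg (e N) {{ℚ.nonNegative 0≤e}} (ℚ.≤-trans 0≤e (ℚ.≤-reflexive (sym (ℚ.*-identityʳ (e N))))))
      shuffle : ∀ p t e → p ℚ.* p ℚ.* t ℚ.* (e ℚ.* (e ℚ.* 1ℚ)) ≡ t ℚ.* ((p ℚ.* e) ℚ.* (p ℚ.* e))
      shuffle = ℚ-solve 3 (λ p t e → p :* p :* t :* (e :* (e :* (con 1ℚ))) := t :* ((p :* e) :* (p :* e))) refl
      scaled : int (+ 40 ^ d) ℚ.* int (+ (144 * T₀)) ℚ.≤ int (+ 40 ^ d) ℚ.* (seq (fromℚ q ^ᵣ d) N ℚ.* int (+ ℓ) ℚ.* int (+ p))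
      scaled = ℚ.≤-trans (ℚ.≤-reflexive (sym (int-pos-* (40 ^ d) (144 * T₀)))) (ℚ.≤-trans (int-mono (ℤ.+≤+ (ℕ.≤-trans (ℕ.≤-reflexive (ℕ.*-comm (40 ^ d) (144 * T₀))) bound)))
        (ℚ.≤-reflexive (trans (int-pos-* (163 ^ d * ℓ) p) (trans (cong (ℚ._* int (+ p)) (int-pos-* (163 ^ d) ℓ)) (trans (cong (λ y → y ℚ.* int (+ ℓ) ℚ.* int (+ p)) (sym (geometric d N)))
          (assoc (int (+ 40 ^ d)) (seq (fromℚ q ^ᵣ d) N) (int (+ ℓ)) (int (+ p))))))))
        where
        assoc : ∀ a s l p → a ℚ.* s ℚ.* l ℚ.* p ≡ a ℚ.* (s ℚ.* l ℚ.* p)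
        assoc = ℚ-solve 4 (λ a s l p → a :* s :* l :* p := a :* (s :* l :* p)) refl
    converted : ∀ N → int (+ 2 ^ k) ℚ.* e N ℚ.≤ int (+ 12) → 0ℚ ℚ.≤ e N → (+ T ℚ./ 1) ℚ.* (e N ℚ.* (e N ℚ.* 1ℚ)) ℚ.≤ seq (fromℚ q ^ᵣ d) N ℚ.* (+ ℓ ℚ./ 1) ℚ.* (+ p ℚ./ 1)
    converted N ≤12 0≤e = subst₂ ℚ._≤_ (cong (ℚ._* (e N ℚ.* (e N ℚ.* 1ℚ))) (int≡ (+ T))) (cong₂ (λ x y → seq (fromℚ q ^ᵣ d) N ℚ.* x ℚ.* y) (int≡ (+ ℓ)) (int≡ (+ p))) (pointwise N ≤12 0≤e)

maxSigns-≥ : ∀ n (g : Vec Sign n → ℕ) σ → g σ ≤ maxSigns n g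
maxSigns-≥ zero    g []           = ℕ.≤-refl
maxSigns-≥ (suc n) g (Sign.+ ∷ σ) = ℕ.≤-trans (maxSigns-≥ n (λ τ → g (Sign.+ ∷ τ)) σ) (ℕ.m≤m⊔n _ _)
maxSigns-≥ (suc n) g (Sign.- ∷ σ) = ℕ.≤-trans (maxSigns-≥ n (λ τ → g (Sign.- ∷ τ)) σ) (ℕ.m≤n⊔m _ _)

∣z∣≤2^len : ∀ z → ℤ.∣ z ∣ ≤ 2 ^ len z
∣z∣≤2^len z = ℕ.≮⇒≥ λ large → ℕ.<-irrefl refl (ℕ.≤-trans (ℕ.≤-reflexive (sym (⌊log₂[2^n]⌋≡n (len z)))) (⌊log₂⌋-mono-≤ (ℕ.<⇒≤ large)))

denominator-cleared : ∀ p → int (+ ℚ.↧ₙ p) ℚ.* p ≡ int (ℚ.↥ p)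
denominator-cleared p = trans (ℚ.*-comm (int (+ ℚ.↧ₙ p)) p) (trans (cong (ℚ._* int (+ ℚ.↧ₙ p)) (sym (ℚ.↥p/↧p≡p p))) (quotient-* (ℚ.↥ p) (ℚ.↧ₙ p)))

scaled-value : ∀ p s l → l ≤ s → ℚ.↧ₙ p ≡ 2 ^ l → int (ℚ.↥ p ℤ.* + 2 ^ (s ∸ l)) ≡ int (+ 2 ^ s) ℚ.* p
scaled-value p s l l≤s ↧≡ = begin
  int (ℚ.↥ p ℤ.* + 2 ^ (s ∸ l))                       ≡⟨ int-* (ℚ.↥ p) (+ 2 ^ (s ∸ l)) ⟩
  int (ℚ.↥ p) ℚ.* int (+ 2 ^ (s ∸ l))                 ≡⟨ cong (ℚ._* int (+ 2 ^ (s ∸ l))) (sym (denominator-cleared p)) ⟩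
  int (+ ℚ.↧ₙ p) ℚ.* p ℚ.* int (+ 2 ^ (s ∸ l))        ≡⟨ cong (λ x → int (+ x) ℚ.* p ℚ.* int (+ 2 ^ (s ∸ l))) ↧≡ ⟩
  int (+ 2 ^ l) ℚ.* p ℚ.* int (+ 2 ^ (s ∸ l))         ≡⟨ swap (int (+ 2 ^ l)) p (int (+ 2 ^ (s ∸ l))) ⟩
  (int (+ 2 ^ l) ℚ.* int (+ 2 ^ (s ∸ l))) ℚ.* p       ≡⟨ cong (ℚ._* p) (sym (int-pos-* (2 ^ l) (2 ^ (s ∸ l)))) ⟩
  int (+ (2 ^ l * 2 ^ (s ∸ l))) ℚ.* p                 ≡⟨ cong (λ x → int (+ x) ℚ.* p) (trans (sym (ℕ.^-distribˡ-+-* 2 l (s ∸ l))) (cong (2 ^_) (ℕ.m+[n∸m]≡n l≤s))) ⟩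
  int (+ 2 ^ s) ℚ.* p                                 ∎
  where
  open ≡-Reasoning
  swap : ∀ a p b → a ℚ.* p ℚ.* b ≡ (a ℚ.* b) ℚ.* p
  swap = ℚ-solve 3 (λ a p b → a :* p :* b := (a :* b) :* p) refl

result-≡ : ∀ m y → load m 1 ≡ +[1+ y ] → result m ≡ load m 0 ℚ./ suc y
result-≡ m y eq₁ with load m 1 | eq₁
... | .(+[1+ y ]) | refl = refl

result-quotient : ∀ m z y .{{_ : NonZero y}} → load m 0 ≡ z → load m 1 ≡ + y → result m ℚ.* int (+ y) ≡ int z
result-quotient m z (suc y) refl eq₁ = trans (cong (ℚ._* int (+ suc y)) (result-≡ m y eq₁)) (quotient-* (load m 0) (suc y))

int-*-cancelʳ-≡ : ∀ n .{{_ : NonZero n}} {p q} → p ℚ.* int (+ n) ≡ q ℚ.* int (+ n) → p ≡ q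
int-*-cancelʳ-≡ n {p} {q} eq₀ = ℚ.≤-antisym (int-*-cancel n (ℚ.≤-reflexive (trans (ℚ.*-comm _ p) (trans eq₀ (ℚ.*-comm q _)))))
                                 (int-*-cancel n (ℚ.≤-reflexive (trans (ℚ.*-comm _ q) (trans (sym eq₀) (ℚ.*-comm p _)))))

-- Numerator P·W·R₀ and denominator 2ᵃ·N·F·J·U of the output, for P = S / 2ˢ⁻ᵃ.
output-value : ∀ z (P : ℤ) (S : ℕ) s a (N F J U W Λ R₀ : ℕ) .{{_ : NonZero W}} → a ≤ s → P ℤ.* + 2 ^ (s ∸ a) ≡ + S → W * Λ ≡ F * J * U →
  z ℚ.* int (+ (2 ^ a * N * F * J * U)) ≡ int (P ℤ.* + W ℤ.* + R₀) → z ℚ.* int (+ (2 ^ s * Λ * N)) ≡ int (+ (R₀ * S))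
output-value z P S s a N F J U W Λ R₀ a≤s P≡ WΛ≡ z≡ = int-*-cancelʳ-≡ W (begin
  z ℚ.* int (+ (2 ^ s * Λ * N)) ℚ.* int (+ W)
    ≡⟨ trans (ℚ.*-assoc z _ _) (cong (z ℚ.*_) (sym (int-pos-* (2 ^ s * Λ * N) W))) ⟩
  z ℚ.* int (+ (2 ^ s * Λ * N * W))
    ≡⟨ cong (λ x → z ℚ.* int (+ x)) (trans (shuffle (2 ^ s) Λ N W) (trans (cong₂ (λ x y → x * N * y) (sym pow) WΛ≡) (regroup (2 ^ a) (2 ^ (s ∸ a)) N F J U))) ⟩
  z ℚ.* int (+ (2 ^ a * N * F * J * U * 2 ^ (s ∸ a)))
    ≡⟨ trans (cong (z ℚ.*_) (int-pos-* (2 ^ a * N * F * J * U) (2 ^ (s ∸ a)))) (sym (ℚ.*-assoc z _ _)) ⟩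
  z ℚ.* int (+ (2 ^ a * N * F * J * U)) ℚ.* int (+ 2 ^ (s ∸ a))
    ≡⟨ trans (cong (ℚ._* int (+ 2 ^ (s ∸ a))) z≡) (sym (int-* (P ℤ.* + W ℤ.* + R₀) (+ 2 ^ (s ∸ a)))) ⟩
  int (P ℤ.* + W ℤ.* + R₀ ℤ.* + 2 ^ (s ∸ a))
    ≡⟨ cong int (trans (swap P (+ W) (+ R₀) (+ 2 ^ (s ∸ a))) (cong (λ x → + R₀ ℤ.* x ℤ.* + W) P≡)) ⟩
  int (+ R₀ ℤ.* + S ℤ.* + W)
    ≡⟨ trans (int-* (+ R₀ ℤ.* + S) (+ W)) (cong (λ x → int x ℚ.* int (+ W)) (mul-pos R₀ S)) ⟩
  int (+ (R₀ * S)) ℚ.* int (+ W) ∎)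
  where
  open ≡-Reasoning
  pow : 2 ^ a * 2 ^ (s ∸ a) ≡ 2 ^ s
  pow = trans (sym (ℕ.^-distribˡ-+-* 2 a (s ∸ a))) (cong (2 ^_) (ℕ.m+[n∸m]≡n a≤s))
  shuffle : ∀ p l n w → p * l * n * w ≡ p * n * (w * l)
  shuffle = ℕRing.solve-∀
  regroup : ∀ p p′ n f j u → p * p′ * n * (f * j * u) ≡ p * n * f * j * u * p′
  regroup = ℕRing.solve-∀
  swap : ∀ p w r t → p ℤ.* w ℤ.* r ℤ.* t ≡ r ℤ.* (p ℤ.* t) ℤ.* w
  swap = ℤRing.solve-∀

error-bounds : ∀ k N q R₀ A S E z .{{_ : NonZero N}} .{{_ : NonZero q}} → E ℚ.* int (+ q) ≡ int (+ A) → z ℚ.* int (+ (q * N)) ≡ int (+ (R₀ * S)) →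
  2 ^ k * ℤ.∣ + R₀ ℤ.* + S ℤ.- + N ℤ.* + A ∣ ≤ 3 * (N * A) →
  int (+ 2 ^ k) ℚ.* (E ℚ.- z) ℚ.≤ int (+ 3) ℚ.* E × int (+ 2 ^ k) ℚ.* (z ℚ.- E) ℚ.≤ int (+ 3) ℚ.* E
error-bounds k N q R₀ A S E z E≡ z≡ close = bound (E ℚ.- z) (ℤ.- x) (ℕ.≤-trans (ℕ.≤-reflexive (cong (2 ^ k *_) (ℤ.∣-i∣≡∣i∣ x))) close) lower , bound (z ℚ.- E) x close upper
  where
  x = + R₀ ℤ.* + S ℤ.- + N ℤ.* + A
  instance
    qN-nonZero : NonZero (q * N)
    qN-nonZero = ℕ.m*n≢0 q N
  NA : int (+ (q * N)) ℚ.* E ≡ int (+ (N * A))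
  NA = trans (cong (ℚ._* E) (int-pos-* q N)) (trans (swap (int (+ q)) (int (+ N)) E) (trans (cong (int (+ N) ℚ.*_) E≡) (sym (int-pos-* N A))))
    where
    swap : ∀ q n e → (q ℚ.* n) ℚ.* e ≡ n ℚ.* (e ℚ.* q)
    swap = ℚ-solve 3 (λ q n e → (q :* n) :* e := n :* (e :* q)) refl
  RS : int (+ (q * N)) ℚ.* z ≡ int (+ (R₀ * S))
  RS = trans (ℚ.*-comm _ z) z≡
  upper : int (+ (q * N)) ℚ.* (z ℚ.- E) ≡ int x
  upper = trans (distribute (int (+ (q * N))) z E) (trans (cong₂ ℚ._-_ RS NA) (sym (trans (int-+ (+ R₀ ℤ.* + S) (ℤ.- (+ N ℤ.* + A)))
    (cong₂ ℚ._+_ (cong int (mul-pos R₀ S)) (trans (int-neg (+ N ℤ.* + A)) (cong (λ y → ℚ.- int y) (mul-pos N A)))))))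
    where
    distribute : ∀ c z e → c ℚ.* (z ℚ.- e) ≡ c ℚ.* z ℚ.- c ℚ.* e
    distribute = ℚ-solve 3 (λ c z e → c :* (z :- e) := c :* z :- c :* e) refl
  lower : int (+ (q * N)) ℚ.* (E ℚ.- z) ≡ int (ℤ.- x)
  lower = trans (flip-sign (int (+ (q * N))) E z) (trans (cong ℚ.-_ upper) (sym (int-neg x)))
    where
    flip-sign : ∀ c e z → c ℚ.* (e ℚ.- z) ≡ ℚ.- (c ℚ.* (z ℚ.- e))
    flip-sign = ℚ-solve 3 (λ c e z → c :* (e :- z) := :- (c :* (z :- e))) refl
  bound : ∀ y w → 2 ^ k * ℤ.∣ w ∣ ≤ 3 * (N * A) → int (+ (q * N)) ℚ.* y ≡ int w → int (+ 2 ^ k) ℚ.* y ℚ.≤ int (+ 3) ℚ.* E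
  bound y w w≤ y≡ = int-*-cancel (q * N) (begin
    int (+ (q * N)) ℚ.* (int (+ 2 ^ k) ℚ.* y)   ≡⟨ swap (int (+ (q * N))) (int (+ 2 ^ k)) y ⟩
    int (+ 2 ^ k) ℚ.* (int (+ (q * N)) ℚ.* y)   ≡⟨ cong (int (+ 2 ^ k) ℚ.*_) y≡ ⟩
    int (+ 2 ^ k) ℚ.* int w                      ≤⟨ int-*-mono (2 ^ k) (int-mono {w} {+ ℤ.∣ w ∣} (≤-abs w)) ⟩
    int (+ 2 ^ k) ℚ.* int (+ ℤ.∣ w ∣)            ≡⟨ int-pos-* (2 ^ k) ℤ.∣ w ∣ ⟨
    int (+ (2 ^ k * ℤ.∣ w ∣))                    ≤⟨ int-mono (ℤ.+≤+ w≤) ⟩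
    int (+ (3 * (N * A)))                        ≡⟨ int-pos-* 3 (N * A) ⟩
    int (+ 3) ℚ.* int (+ (N * A))                ≡⟨ cong (int (+ 3) ℚ.*_) NA ⟨
    int (+ 3) ℚ.* (int (+ (q * N)) ℚ.* E)        ≡⟨ swap (int (+ 3)) (int (+ (q * N))) E ⟩
    int (+ (q * N)) ℚ.* (int (+ 3) ℚ.* E)        ∎)
    where
    open ℚ.≤-Reasoning
    swap : ∀ a b y → a ℚ.* (b ℚ.* y) ≡ b ℚ.* (a ℚ.* y)
    swap = ℚ-solve 3 (λ a b y → a :* (b :* y) := b :* (a :* y)) refl
    ≤-abs : ∀ w → w ℤ.≤ + ℤ.∣ w ∣
    ≤-abs (+ n)    = ℤ.≤-refl
    ≤-abs -[1+ n ] = ℤ.-≤+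

2^-mono : ∀ {x y} → x ≤ y → 2 ^ x ≤ 2 ^ y
2^-mono = ℕ.^-monoʳ-≤ 2

x≤2^y : ∀ {x y} → x ≤ y → x ≤ 2 ^ y
x≤2^y {x} x≤y = ℕ.≤-trans (ℕ.<⇒≤ (n<2^n x)) (2^-mono x≤y)

2^-product : ∀ {x y} p q → x ≤ 2 ^ p → y ≤ 2 ^ q → x * y ≤ 2 ^ (p + q)
2^-product p q x≤ y≤ = ℕ.≤-trans (ℕ.*-mono-≤ x≤ y≤) (ℕ.≤-reflexive (sym (ℕ.^-distribˡ-+-* 2 p q)))

≤-remainder : ∀ {x y} r → x + r ≡ y → x ≤ y
≤-remainder {x} r refl = ℕ.m≤m+n x r

4^≤ : ∀ m → 4 ^ m ≤ 2 ^ (2 * m)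
4^≤ m = ℕ.≤-reflexive (ℕ.^-*-assoc 2 2 m)

module Bounds (n d M m K e₀ a : ℕ) (d≤n : d ≤ n) (M≡ : suc (d / 20) ≡ M) (m≡ : 10 * M ≡ m) (K≡ : 31 * M ≡ K)
              (e≡ : 11 * M ≡ suc (suc e₀)) (a≡ : suc (2 * m) ∸ d ≡ a) (s k H : ℕ) (H≡ : 2 + n + s ≡ H) where
  open Sizes n d M m K e₀ a d≤n M≡ m≡ K≡ e≡ a≡ public
  open Cost n d M m K e₀ a d≤n M≡ m≡ K≡ e≡ a≡ s k H H≡ public using (B₃; B₄; N; steps; sampleSteps; prologueSteps; evaluation; Tₘ; T₀; Sₘ; Tₘ≡; Sₘ≡; Tₘ≤; time-bound; space-bound) renaming (B to B₅; G to G₅)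

  w₀ : ℕ
  w₀ = binom (suc e₀ + m) m

  private
    B₄≤ : B₄ ≤ B₅
    B₄≤ = ℕ.m≤m+n B₄ (6 + (K + K))

    B₃≤ : B₃ ≤ B₅
    B₃≤ = ℕ.≤-trans (ℕ.m≤m+n B₃ (K * D + rb)) B₄≤

    K+K≤ : K + K ≤ B₅
    K+K≤ = ℕ.≤-trans (ℕ.m≤n+m (K + K) 6) (ℕ.m≤n+m (6 + (K + K)) B₄)

    K≤ : K ≤ B₅
    K≤ = ℕ.≤-trans (ℕ.m≤m+n K K) K+K≤

    rb≤B₄ : rb ≤ B₄
    rb≤B₄ = ℕ.≤-trans (ℕ.m≤n+m rb (K * D)) (ℕ.m≤n+m (K * D + rb) B₃)

    KD≤ : K * D ≤ B₅
    KD≤ = ℕ.≤-trans (ℕ.≤-trans (ℕ.m≤m+n (K * D) rb) (ℕ.m≤n+m (K * D + rb) B₃)) B₄≤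

    rb+6≤ : rb + 6 ≤ B₅
    rb+6≤ = ℕ.+-mono-≤ rb≤B₄ (ℕ.m≤m+n 6 (K + K))

    b≤rb : b ≤ rb
    b≤rb = ℕ.m≤n*m b n′

    n′≤rb : n′ ≤ rb
    n′≤rb = ℕ.≤-trans (ℕ.m≤m+n n′ K) b≤rb

    rb≤ : rb ≤ B₅
    rb≤ = ℕ.≤-trans (ℕ.m≤m+n rb 6) rb+6≤

    sums≤ : 2 * s ≤ B₅
    sums≤ = ℕ.≤-trans (ℕ.m≤n+m (2 * s) (2 + K * D + 2 * k + 3 * K)) B₃≤

    k+2≤B₃ : k + 2 ≤ B₃
    k+2≤B₃ = ≤-remainder (K * D + k + 3 * K + 2 * s) (shape (K * D) k K s)
      where
      shape : ∀ p k K s → k + 2 + (p + k + 3 * K + 2 * s) ≡ 2 + p + 2 * k + 3 * K + 2 * s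
      shape = ℕRing.solve-∀

    4^m≤2^K : 4 ^ m ≤ 2 ^ K
    4^m≤2^K = ℕ.≤-trans (4^≤ m) (2^-mono (ℕ.≤-trans (ℕ.n≤1+n (2 * m)) D≤K))

    U≤R^n′ : (K * u) ^ n′ ≤ 2 ^ rb
    U≤R^n′ = ℕ.≤-trans (ℕ.^-monoˡ-≤ n′ Ku≤R) (ℕ.≤-reflexive R^n′≡)

    J≤ : J ≤ 2 ^ (K * D)
    J≤ = ℕ.≤-trans (falling-≤ K D) W≤

    w₀≤2^K : w₀ ≤ 2 ^ K
    w₀≤2^K = ℕ.≤-trans (binom-≤ (suc e₀ + m) m) (2^-mono (ℕ.<⇒≤ e₀+m<K))

    N≤′ : N ≤ 2 ^ (suc (K * D) + 2 * k)
    N≤′ = 2^-product (suc (K * D)) (2 * k) draws≤ (4^≤ k)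

    e₁ e₂ e₃ e₄ : ℕ
    e₁ = s + (suc (K * D) + 2 * k)
    e₂ = e₁ + K
    e₃ = e₂ + K * D
    e₄ = e₃ + rb

    e₂≤B₃ : e₂ ≤ B₃
    e₂≤B₃ = ≤-remainder (1 + 2 * K + s) (shape (K * D) k K s)
      where
      shape : ∀ p k K s → s + (1 + p + 2 * k) + K + (1 + 2 * K + s) ≡ 2 + p + 2 * k + 3 * K + 2 * s
      shape = ℕRing.solve-∀

    e₄≤B₅ : e₄ ≤ B₅
    e₄≤B₅ = ℕ.≤-trans (ℕ.≤-trans (ℕ.+-monoˡ-≤ rb (ℕ.+-monoˡ-≤ (K * D) e₂≤B₃)) (ℕ.≤-reflexive (ℕ.+-assoc B₃ (K * D) rb))) B₄≤

    e₃≤B₅ : e₃ ≤ B₅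
    e₃≤B₅ = ℕ.≤-trans (ℕ.m≤m+n e₃ rb) e₄≤B₅

    e₂≤B₅ : e₂ ≤ B₅
    e₂≤B₅ = ℕ.≤-trans (ℕ.m≤m+n e₂ (K * D)) e₃≤B₅

    e₁≤B₅ : e₁ ≤ B₅
    e₁≤B₅ = ℕ.≤-trans (ℕ.m≤m+n e₁ K) e₂≤B₅

  cap₃ : suc N * (suc (suc m) * (2 ^ K * (w₀ * (2 ^ s * 2 ^ s)))) ≤ 2 ^ B₃
  cap₃ = ℕ.≤-trans (2^-product (suc (suc (K * D) + 2 * k)) (K + (K + (K + (s + s)))) (ℕ.≤-trans (ℕ.+-mono-≤ (ℕ.m^n>0 2 (suc (K * D) + 2 * k)) N≤′) (ℕ.≤-reflexive (cong (_+_ (2 ^ (suc (K * D) + 2 * k))) (sym (ℕ.+-identityʳ _)))))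
      (2^-product K (K + (K + (s + s))) (ℕ.≤-trans (s≤s m<K) (n<2^n K))
        (2^-product K (K + (s + s)) ℕ.≤-refl (2^-product K (s + s) w₀≤2^K (2^-product s s ℕ.≤-refl ℕ.≤-refl)))))
    (ℕ.≤-reflexive (cong (2 ^_) (shape (K * D) k K s)))
    where
    shape : ∀ p k K s → suc (suc p + 2 * k) + (K + (K + (K + (s + s)))) ≡ 2 + p + 2 * k + 3 * K + 2 * s
    shape = ℕRing.solve-∀

  module Within (B : ℕ) (B≡ : B₅ ≡ B) where

    private
      small : ∀ {x e} → x ≤ 2 ^ e → e ≤ B₅ → x ≤ 2 ^ B
      small x≤ e≤ = ℕ.≤-trans x≤ (2^-mono (ℕ.≤-trans e≤ (ℕ.≤-reflexive B≡)))

    6≤B : 6 ≤ B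
    6≤B = ℕ.≤-trans (ℕ.m≤n+m 6 rb) (ℕ.≤-trans rb+6≤ (ℕ.≤-reflexive B≡))

    rb<B : rb < B
    rb<B = ℕ.≤-trans (ℕ.≤-trans (s≤s (ℕ.m≤m+n rb 5)) (ℕ.≤-reflexive (sym (ℕ.+-suc rb 5)))) (ℕ.≤-trans rb+6≤ (ℕ.≤-reflexive B≡))

    k≤B : k ≤ B
    k≤B = ℕ.≤-trans (ℕ.≤-trans (ℕ.m≤m+n k 2) (ℕ.≤-trans k+2≤B₃ B₃≤)) (ℕ.≤-reflexive B≡)

    rb-small : ∀ {x} → x ≤ rb → x ≤ 2 ^ B
    rb-small x≤ = small (x≤2^y x≤) rb≤

    K-small : ∀ {x} → x ≤ K → x ≤ 2 ^ B
    K-small x≤ = small (x≤2^y x≤) K≤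

    n≤2^B : n ≤ 2 ^ B
    n≤2^B = rb-small (ℕ.≤-trans (ℕ.m≤n+m n a) n′≤rb)

    d≤2^B : d ≤ 2 ^ B
    d≤2^B = K-small (ℕ.≤-trans d≤D D≤K)

    K≤2^B : K ≤ 2 ^ B
    K≤2^B = K-small ℕ.≤-refl

    b≤2^B : b ≤ 2 ^ B
    b≤2^B = rb-small b≤rb

    rb≤2^B : rb ≤ 2 ^ B
    rb≤2^B = rb-small ℕ.≤-refl

    K*2^K≤ : K * 2 ^ K ≤ 2 ^ B
    K*2^K≤ = small (2^-product K K (ℕ.<⇒≤ (n<2^n K)) ℕ.≤-refl) K+K≤

    40+n′≤2^B : 40 + n′ ≤ 2 ^ B
    40+n′≤2^B = small (ℕ.≤-trans (ℕ.+-monoʳ-≤ 40 (ℕ.m≤m*n n′ 40)) (2^-product rb 6 (ℕ.≤-trans (s≤s n′≤rb) (n<2^n rb)) (ℕ.≤ᵇ⇒≤ 40 (2 ^ 6) _))) rb+6≤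

    R≤2^B : R ≤ 2 ^ B
    R≤2^B = small {R} {b} ℕ.≤-refl (ℕ.≤-trans b≤rb rb≤)

    R₀≤2^B : 2 ^ rb ≤ 2 ^ B
    R₀≤2^B = small {2 ^ rb} {rb} ℕ.≤-refl rb≤

    Ku≤2^B : K * u ≤ 2 ^ B
    Ku≤2^B = ℕ.≤-trans Ku≤R R≤2^B

    U≤2^B : (K * u) ^ n′ ≤ 2 ^ B
    U≤2^B = ℕ.≤-trans U≤R^n′ R₀≤2^B

    4^m≤2^B : 4 ^ m ≤ 2 ^ B
    4^m≤2^B = small 4^m≤2^K K≤

    4^k≤2^B : 4 ^ k ≤ 2 ^ B
    4^k≤2^B = small (4^≤ k) (ℕ.≤-trans (≤-remainder (2 + K * D + 3 * K + 2 * s) (shape (K * D) k K s)) B₃≤)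
      where
      shape : ∀ p k K s → 2 * k + (2 + p + 3 * K + 2 * s) ≡ 2 + p + 2 * k + 3 * K + 2 * s
      shape = ℕRing.solve-∀

    W≤2^B : W ≤ 2 ^ B
    W≤2^B = small W≤ KD≤

    w₀≤2^B : w₀ ≤ 2 ^ B
    w₀≤2^B = small w₀≤2^K K≤

    w₀*m≤ : w₀ * suc m ≤ 2 ^ B
    w₀*m≤ = small (2^-product K K w₀≤2^K (x≤2^y m<K)) K+K≤

    w-small : ∀ i → i < m → (suc e₀ + suc i) * binom (suc e₀ + i) i ≤ 2 ^ B
    w-small i i<m = small (2^-product K K (x≤2^y (ℕ.≤-trans (ℕ.+-monoʳ-≤ (suc e₀) i<m) (ℕ.<⇒≤ e₀+m<K)))
      (ℕ.≤-trans (binom-≤ (suc e₀ + i) i) (2^-mono (ℕ.≤-trans (ℕ.+-monoʳ-≤ (suc e₀) (ℕ.<⇒≤ i<m)) (ℕ.<⇒≤ e₀+m<K))))) K+K≤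

    e₀+m≤2^B : suc e₀ + m ≤ 2 ^ B
    e₀+m≤2^B = K-small (ℕ.<⇒≤ e₀+m<K)

    N≤2^B : N ≤ 2 ^ B
    N≤2^B = small N≤′ (ℕ.≤-trans (ℕ.m≤n+m (suc (K * D) + 2 * k) s) e₁≤B₅)

    cap : suc N * (suc (suc m) * (2 ^ K * (w₀ * (2 ^ s * 2 ^ s)))) ≤ 2 ^ B
    cap = small cap₃ B₃≤

    2^s*2^s≤ : 2 ^ s * 2 ^ s ≤ 2 ^ B
    2^s*2^s≤ = small (2^-product s s ℕ.≤-refl ℕ.≤-refl) (ℕ.≤-trans (ℕ.≤-reflexive (cong (_+_ s) (sym (ℕ.+-identityʳ s)))) sums≤)

    2^s≤ : 2 ^ s ≤ 2 ^ B
    2^s≤ = ℕ.≤-trans (ℕ.m≤m*n (2 ^ s) (2 ^ s) {{ℕ.m^n≢0 2 s}}) 2^s*2^s≤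

    ε-bound : ∀ {x} → x ≤ 2 ^ (k + 2) → x ≤ 2 ^ B
    ε-bound x≤ = small x≤ (ℕ.≤-trans k+2≤B₃ B₃≤)

    PW≤ : ∀ {P} → P ≤ 2 ^ B₃ → P * W ≤ 2 ^ B
    PW≤ P≤ = small (2^-product B₃ (K * D) P≤ W≤) (ℕ.≤-trans (ℕ.+-monoʳ-≤ B₃ (ℕ.m≤m+n (K * D) rb)) B₄≤)

    PWR₀≤ : ∀ {P} → P ≤ 2 ^ B₃ → P * W * 2 ^ rb ≤ 2 ^ B
    PWR₀≤ P≤ = small (2^-product (B₃ + K * D) rb (2^-product B₃ (K * D) P≤ W≤) ℕ.≤-refl) (ℕ.≤-trans (ℕ.≤-reflexive (ℕ.+-assoc B₃ (K * D) rb)) B₄≤)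

    module _ {x : ℕ} (x≤ : x ≤ 2 ^ s) where

      private
        QN : x * N ≤ 2 ^ e₁
        QN = 2^-product s (suc (K * D) + 2 * k) x≤ N≤′

        QNF : x * N * 4 ^ m ≤ 2 ^ e₂
        QNF = 2^-product e₁ K QN 4^m≤2^K

        QNFJ : x * N * 4 ^ m * J ≤ 2 ^ e₃
        QNFJ = 2^-product e₂ (K * D) QNF J≤

      QN≤ : x * N ≤ 2 ^ B
      QN≤ = small QN e₁≤B₅

      QNF≤ : x * N * 4 ^ m ≤ 2 ^ B
      QNF≤ = small QNF e₂≤B₅

      QNFJ≤ : x * N * 4 ^ m * J ≤ 2 ^ B
      QNFJ≤ = small QNFJ e₃≤B₅

      QNFJU≤ : x * N * 4 ^ m * J * (K * u) ^ n′ ≤ 2 ^ B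
      QNFJU≤ = small (2^-product e₃ rb QNFJ U≤R^n′) e₄≤B₅

record Output (s N F J U W R₀ : ℕ) (S : ℤ) (μ : Memory) : Set where
  constructor output
  field
    P            : ℤ
    place        : ℕ
    place≤s      : place ≤ s
    P≡           : P ℤ.* + 2 ^ (s ∸ place) ≡ S
    numerator≡   : load μ 0 ≡ P ℤ.* + W ℤ.* + R₀
    denominator≡ : load μ 1 ≡ + (2 ^ place * N * F * J * U)

module Execute (n d : ℕ) (M m K e₀ a : ℕ) (d≤n : d ≤ n) (M≡ : suc (d / 20) ≡ M) (m≡ : 10 * M ≡ m) (K≡ : 31 * M ≡ K)
  (e≡ : 11 * M ≡ suc (suc e₀)) (a≡ : suc (2 * m) ∸ d ≡ a) (s k H : ℕ) (H≡ : 2 + n + s ≡ H) where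
  open Bounds n d M m K e₀ a d≤n M≡ m≡ K≡ e≡ a≡ s k H H≡

  module OnInput (B G : ℕ) (B≡ : B₅ ≡ B) (G≡ : G₅ ≡ G) (F : Vec ℤ n → Maybe ℚ) (ε̂ : ℕ → ℤ)
    (val : Vec Sign n → ℚ) (F-val : ∀ σ → F (cubePoint σ) ≡ just (val σ)) (pl : Vec Sign n → ℕ) (pl≤s : ∀ σ → pl σ ≤ s)
    (den : ∀ σ → ℚ.↧ₙ (val σ) ≡ 2 ^ pl σ) (num : ∀ σ → ℤ.∣ ℚ.↥ (val σ) ∣ ≤ 2 ^ s)
    (ε-small : ∀ i → i ≤ k → ℤ.∣ ε̂ i ∣ ≤ 2 ^ (k + 2))
    (before : ∀ i → i < k → compare lt (ε̂ i) (+ 5) ≡ true) (after : compare lt (ε̂ k) (+ 5) ≡ false) where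
    open Within B B≡

    48≤G : 48 ≤ G
    48≤G = ℕ.≤-trans (ℕ.m≤m+n 48 n′) (ℕ.≤-reflexive G≡)

    40+n′≤G : 40 + n′ ≤ G
    40+n′≤G = ℕ.≤-trans (ℕ.+-monoˡ-≤ n′ (ℕ.m≤m+n 40 8)) (ℕ.≤-reflexive G≡)

    others : Vec ℤ 8
    others = + M ∷ + D ∷ + b ∷ + 2 ^ rb ∷ + (4 ^ m) ∷ + W ∷ + ((K * u) ^ n′) ∷ + J ∷ []

    open SampleRun n d F ε̂ B G 6≤B 48≤G n≤2^B d≤2^B K K*2^K≤ m n′ R u e₀ rb w₀ N others 40+n′≤G 40+n′≤2^B (ℕ.m≤n+m n a)
      val F-val s pl pl≤s den num m<K e₀+m≤2^B w₀*m≤ rb<B N≤2^B cap public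
    open PrologueRun n d F ε̂ B G 6≤B 48≤G n≤2^B d≤2^B using (prologue-correct; Ready)

    sumOf : List (List Bool) → ℤ
    sumOf = samplesSum 2^s≤ 2^s*2^s≤ 0ℤ

    samplesSum-≤ : ∀ bss S → ℤ.∣ samplesSum 2^s≤ 2^s*2^s≤ S bss ∣ ≤ ℤ.∣ S ∣ + length bss * valueBound
    samplesSum-≤ []         S = ℕ.m≤m+n _ 0
    samplesSum-≤ (bs ∷ bss) S = ℕ.≤-trans (samplesSum-≤ bss (S ℤ.+ sampleValue (fromBits 0 bs)))
      (ℕ.≤-trans (ℕ.+-monoˡ-≤ (length bss * valueBound) (ℕ.≤-trans (ℤ.∣i+j∣≤∣i∣+∣j∣ S (sampleValue (fromBits 0 bs))) (ℕ.+-monoʳ-≤ ℤ.∣ S ∣ (∣sampleValue∣-≤ (fromBits 0 bs)))))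
        (ℕ.≤-reflexive (ℕ.+-assoc ℤ.∣ S ∣ valueBound (length bss * valueBound))))

    epilogue-correct : ∀ {idx j C w sg X P Q sc arr S} → Sums S P Q → ℤ.∣ S ∣ ≤ 2 ^ B₃ →
      Term epilogue (mem sc (outer idx j C w sg X (+ N) P Q) arr) [] 7 (λ μ _ → Output s N (4 ^ m) J ((K * u) ^ n′) W (2 ^ rb) S μ)
    epilogue-correct {P = P} (sums l l≤s refl P≡) S≤ =
      compute! (P ℤ.* + W) refl (ℕ.≤-trans (ℕ.≤-reflexive (ℤ.abs-* P (+ W))) (PW≤ ∣P∣≤)) ▸ λ { (refl , refl) →
      compute! (P ℤ.* + W ℤ.* + 2 ^ rb) refl (ℕ.≤-trans (ℕ.≤-reflexive (trans (ℤ.abs-* (P ℤ.* + W) (+ 2 ^ rb)) (cong (_* 2 ^ rb) (ℤ.abs-* P (+ W))))) (PWR₀≤ ∣P∣≤)) ▸ λ { (refl , refl) →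
      compute! (+ (2 ^ l * N)) (mul-pos (2 ^ l) N) (QN≤ 2^l≤) ▸ λ { (refl , refl) →
      compute! (+ (2 ^ l * N * 4 ^ m)) (mul-pos (2 ^ l * N) (4 ^ m)) (QNF≤ 2^l≤) ▸ λ { (refl , refl) →
      compute! (+ (2 ^ l * N * 4 ^ m * J)) (mul-pos (2 ^ l * N * 4 ^ m) J) (QNFJ≤ 2^l≤) ▸ λ { (refl , refl) →
      compute! (+ (2 ^ l * N * 4 ^ m * J * (K * u) ^ n′)) (mul-pos (2 ^ l * N * 4 ^ m * J) ((K * u) ^ n′)) (QNFJU≤ 2^l≤) ▸ λ { (refl , refl) →
      finish (output P l l≤s P≡ refl refl) } } } } } }
      where
      2^l≤ : 2 ^ l ≤ 2 ^ s
      2^l≤ = 2^-mono l≤s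

      ∣P∣≤ : ℤ.∣ P ∣ ≤ 2 ^ B₃
      ∣P∣≤ = ℕ.≤-trans (ℕ.≤-trans (ℕ.m≤m*n ℤ.∣ P ∣ (2 ^ (s ∸ l)) {{ℕ.m^n≢0 2 (s ∸ l)}}) (ℕ.≤-reflexive (trans (sym (ℤ.abs-* P (+ 2 ^ (s ∸ l)))) (cong ℤ.∣_∣ P≡)))) S≤

    total-sum : ∀ N T → total N T ≡ suc (sumℕ N (suc ∘ T))
    total-sum zero    T = refl
    total-sum (suc N) T = trans (cong (_+_ (suc (T 0))) (total-sum N (T ∘ suc))) (trans (ℕ.+-suc (suc (T 0)) _) (cong suc (sym (sumℕ-front N (suc ∘ T)))))

    sampleTime≡ : sampleTime 2^s≤ 2^s*2^s≤ ≡ sampleSteps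
    sampleTime≡ = cong (λ t → 2 + (rb * 6 + 1 + (4 + (t + 2)))) (trans (total-sum (suc m) _) (cong suc
      (trans (sumℕ-cong (suc m) (λ j _ → shape (binom K j) evaluation)) (sumℕ-affine (suc m) 13 evaluation (binom K)))))
      where
      shape : ∀ x e → suc (1 + (x * e + 1 + 10)) ≡ 13 + x * e
      shape = ℕRing.solve-∀

    program-run : ∀ bss → All (λ bs → length bs ≡ rb) bss → length bss ≡ N → Term program [] (List.concat bss ++ []) steps (λ μ _ → Output s N (4 ^ m) J ((K * u) ^ n′) W (2 ^ rb) (sumOf bss) μ)
    program-run bss lengths bss≡ = branch! false (compare-lt-false d≤n) (λ ()) λ _ →
      prologue-correct M m K D n′ b R u (2 ^ rb) W ((K * u) ^ n′) J w₀ k N M≡ m≡ K≡ e₀ e≡ refl d≤D (cong (_+ n) a≡) refl refl refl R^n′≡ refl refl refl refl refl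
        D≤K (ℕ.m^n>0 2 b) 1≤Ku K≤2^B rb≤2^B b≤2^B R≤2^B R₀≤2^B 4^m≤2^B W≤2^B Ku≤2^B U≤2^B N≤2^B w-small w₀≤2^B k≤B 4^k≤2^B (λ i i≤k → ε-bound (ε-small i i≤k)) before after ▸
      λ { (r₀ , r₁ , r₂ , r₃ , refl , refl) →
      weaken (ℕ.≤-reflexive (cong₂ (λ l t → l * suc t + 1) bss≡ sampleTime≡)) (samples-correct 2^s≤ 2^s*2^s≤ bss 0 lengths bss≡ z≤n
        (sampled {sc = scratch r₀ r₁ r₂ r₃ 0ℤ 0ℤ 0ℤ 0ℤ 0ℤ 0ℤ 0ℤ 0ℤ 0ℤ 0ℤ} {arr = []} refl refl (sums 0 z≤n refl (ℤ.*-zeroˡ (+ 2 ^ s))))) ▸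
      λ { (sampled {sc = sc} refl refl S-is) → epilogue-correct {sc = sc} S-is (ℕ.≤-trans (ℕ.≤-trans (samplesSum-≤ bss 0ℤ) (ℕ.≤-trans (ℕ.≤-reflexive (cong (_* valueBound) bss≡)) (ℕ.m≤n+m (N * valueBound) valueBound))) cap₃) } }

    program-on : (ω : Vec Bool (N * rb)) → Term program [] (toList ω) steps (λ μ _ → Output s N (4 ^ m) J ((K * u) ^ n′) W (2 ^ rb) (sumOf (chunks rb N ω)) μ)
    program-on ω = subst (λ l → Term program [] l steps (λ μ _ → Output s N (4 ^ m) J ((K * u) ^ n′) W (2 ^ rb) (sumOf (chunks rb N ω)) μ))
      (trans (List.++-identityʳ (List.concat (chunks rb N ω))) (chunks-concat rb N ω)) (program-run (chunks rb N ω) (chunks-lengths rb N ω) (chunks-length rb N ω))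

    -- Folded, since unfolding an execution would run the program symbolically.
    opaque
      exec : (ω : Vec Bool (N * rb)) → Execution program n d F ε̂ (toList ω)
      exec ω = let μ , ω′ , t , σ , run , _ = halts (program-on ω) ([] , z≤n) in
        record { final = μ ; unused = ω′ ; time = t ; space = σ ; run = run }

      exec-time : ∀ ω → time (exec ω) ≤ Tₘ
      exec-time ω = let _ , _ , _ , _ , _ , t≤ , _ = halts (program-on ω) ([] , z≤n) in
        ℕ.≤-trans t≤ (ℕ.≤-reflexive (trans (cong (λ x → steps * (6 * suc x)) (sym B≡)) (sym Tₘ≡)))

      exec-space : ∀ ω → space (exec ω) ≤ Sₘ
      exec-space ω = let _ , _ , _ , _ , _ , _ , s≤ , _ = halts (program-on ω) ([] , z≤n) in
        ℕ.≤-trans s≤ (ℕ.≤-reflexive (trans (cong₂ (λ x y → x * suc y) (sym G≡) (sym B≡)) (sym Sₘ≡)))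

      exec-output : ∀ ω → Output s N (4 ^ m) J ((K * u) ^ n′) W (2 ^ rb) (sumOf (chunks rb N ω)) (final (exec ω))
      exec-output ω = let _ , _ , _ , _ , _ , _ , _ , _ , out = halts (program-on ω) ([] , z≤n) in out

∑-abs : ∀ n f → (∀ i → 0ℤ ℤ.≤ f i) → ∑ n f ≡ + sumℕ n (λ i → ℤ.∣ f i ∣)
∑-abs zero    f 0≤ = refl
∑-abs (suc n) f 0≤ = cong₂ ℤ._+_ (∑-abs n f 0≤) (sym (ℤ.0≤i⇒+∣i∣≡i (0≤ n)))

module Accurate (n d : ℕ) (M m K e₀ a : ℕ) (d≤n : d ≤ n) (M≡ : suc (d / 20) ≡ M) (m≡ : 10 * M ≡ m) (K≡ : 31 * M ≡ K)
  (e≡ : 11 * M ≡ suc (suc e₀)) (a≡ : suc (2 * m) ∸ d ≡ a) (s k H : ℕ) (H≡ : 2 + n + s ≡ H)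
  (f : NonNegForm n d) (val : Vec Sign n → ℚ) (val-eval : ∀ σ → fromℚ (val σ) ≈ᵣ eval f (cubePoint σ))
  (fz : Vec Sign n → ℤ) (fz≡ : ∀ σ → int (fz σ) ≡ int (+ 2 ^ s) ℚ.* val σ)
  (ε : ℝ) (precise : Eventually λ i → int (+ 3) ℚ.≤ int (+ 2 ^ k) ℚ.* seq ε i × seq ε i ℚ.≤ 1ℚ) where
  open Bounds n d M m K e₀ a d≤n M≡ m≡ K≡ e≡ a≡ s k H H≡
  open Estimator n K m n′ R u e₀ w₀ fz using (sampleValue)
  open Estimate f val val-eval s fz fz≡ K m e₀ a R u K≡D+e d+a≡D d≤n Ku≤R using (sampleValue-nonNegative; sampleValue-≤; totalValue; totalValue-e∂)

  instance
    Λ-nonZero : NonZero Λ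
    Λ-nonZero = ℕ.m*n≢0 (4 ^ m) _ {{ℕ.m^n≢0 4 m}} {{ℕ.m*n≢0 (u ^ n′) _ {{ℕ.m^n≢0 u n′}} {{ℕ.m*n≢0 (K ^ (n′ ∸ D)) J {{ℕ.m^n≢0 K (n′ ∸ D)}}}}}}

    W-nonZero : NonZero W
    W-nonZero = ℕ.m^n≢0 K D

    draws-nonZero : NonZero draws
    draws-nonZero = _

    q-nonZero : NonZero (2 ^ s * Λ)
    q-nonZero = ℕ.m*n≢0 (2 ^ s) Λ {{ℕ.m^n≢0 2 s}}

    N-nonZero : NonZero N
    N-nonZero = ℕ.m*n≢0 draws (4 ^ k) {{draws-nonZero}} {{ℕ.m^n≢0 4 k}}

  sampleSize : ℕ → ℕ
  sampleSize X = ℤ.∣ sampleValue X ∣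

  sampleSize≡ : ∀ X → sampleValue X ≡ + sampleSize X
  sampleSize≡ X = sym (ℤ.0≤i⇒+∣i∣≡i (sampleValue-nonNegative X))

  open Chebyshev rb sampleSize Λ (4 ^ m) using (A; total-of; accurate; likely-accurate) public

  totalValue≡ : totalValue ≡ + A
  totalValue≡ = trans (cong (λ x → ∑ x sampleValue) R^n′≡) (∑-abs (2 ^ rb) sampleValue sampleValue-nonNegative)

  sampleSize-≤ : ∀ X → Λ * sampleSize X ≤ 4 ^ m * A
  sampleSize-≤ X = ℤ.drop‿+≤+ (subst₂ ℤ._≤_ (trans (cong (ℤ._*_ (+ Λ)) (sampleSize≡ X)) (mul-pos Λ (sampleSize X)))
    (trans (cong (ℤ._*_ (+ (4 ^ m))) totalValue≡) (mul-pos (4 ^ m) A)) (sampleValue-≤ X))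

  enough : 2 ^ rb * 4 ^ m ≤ 3 * (Λ * draws)
  enough = subst (λ x → x * 4 ^ m ≤ 3 * (Λ * draws)) R^n′≡ enough-draws

  E : ℚ
  E = + A ℚ./ (2 ^ s * Λ)

  E≡ : E ℚ.* int (+ (2 ^ s * Λ)) ≡ int (+ A)
  E≡ = quotient-* (+ A) (2 ^ s * Λ)

  private
    q*E : int (+ (2 ^ s * Λ)) ℚ.* E ≡ int totalValue
    q*E = trans (ℚ.*-comm _ E) (trans E≡ (cong int (sym totalValue≡)))

    q*e∂ : ∀ i → int (+ 2 ^ s ℤ.* + Λ) ℚ.* seq (e∂ f) i ≡ int (+ (2 ^ s * Λ)) ℚ.* seq (e∂ f) i
    q*e∂ i = cong (λ x → int x ℚ.* seq (e∂ f) i) (mul-pos (2 ^ s) Λ)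

  0≤E : 0ℚ ℚ.≤ E
  0≤E = int-*-cancel (2 ^ s * Λ) (subst₂ ℚ._≤_ (sym (ℚ.*-zeroʳ (int (+ (2 ^ s * Λ))))) (sym (trans q*E (cong int totalValue≡))) (int-nonNegative A))

  E≋ : (λ _ → E) ≋ seq (e∂ f)
  E≋ = ≲-unscale (2 ^ s * Λ) {λ _ → E} {seq (e∂ f)} (≲-trans {v = λ _ → int totalValue} (≗⇒≲ λ _ → q*E) (≲-trans {v = λ i → int (+ 2 ^ s ℤ.* + Λ) ℚ.* seq (e∂ f) i} (proj₁ totalValue-e∂) (≗⇒≲ q*e∂)))
     , ≲-unscale (2 ^ s * Λ) {seq (e∂ f)} {λ _ → E} (≲-trans {v = λ i → int (+ 2 ^ s ℤ.* + Λ) ℚ.* seq (e∂ f) i} (≗⇒≲ (sym ∘ q*e∂)) (≲-trans {v = λ _ → int totalValue} (proj₂ totalValue-e∂) (≗⇒≲ λ _ → sym q*E)))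

  opaque
    good : Vec Bool (N * rb) → Bool
    good = accurate sampleSize-≤ draws k enough

    likely : 2 * 2 ^ (N * rb) ≤ 3 * count good
    likely = likely-accurate sampleSize-≤ draws k enough

    guarantee : ∀ ω {μ} → Output s N (4 ^ m) J ((K * u) ^ n′) W (2 ^ rb) (+ total-of (chunks rb N ω)) μ → good ω ≡ true →
      ((1ᵣ -ᵣ ε) *ᵣ e∂ f ≤ᵣ fromℚ (result μ)) × (fromℚ (result μ) ≤ᵣ (1ᵣ +ᵣ ε) *ᵣ e∂ f)
    guarantee ω {μ} (output P l l≤s P≡ numerator≡ denominator≡) good≡ = relative-error (e∂ f) ε E z k 0≤E E≋ precise (proj₁ bounds) (proj₂ bounds)
      where
      z : ℚ
      z = result μ
      Y S : ℕ
      Y = 2 ^ l * N * 4 ^ m * J * (K * u) ^ n′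
      S = total-of (chunks rb N ω)
      instance
        Y-nonZero : NonZero Y
        Y-nonZero = ℕ.m*n≢0 _ _ {{ℕ.m*n≢0 _ J {{ℕ.m*n≢0 _ _ {{ℕ.m*n≢0 _ N {{ℕ.m^n≢0 2 l}}}} {{ℕ.m^n≢0 4 m}}}}}} {{ℕ.m^n≢0 (K * u) n′ {{ℕ.m*n≢0 K u}}}}
      z≡ : z ℚ.* int (+ (2 ^ s * Λ * N)) ≡ int (+ (2 ^ rb * S))
      z≡ = output-value z P S s l N (4 ^ m) J ((K * u) ^ n′) W Λ (2 ^ rb) l≤s P≡ W*Λ≡ (result-quotient μ (P ℤ.* + W ℤ.* + 2 ^ rb) Y numerator≡ denominator≡)
      bounds : int (+ 2 ^ k) ℚ.* (E ℚ.- z) ℚ.≤ int (+ 3) ℚ.* E × int (+ 2 ^ k) ℚ.* (z ℚ.- E) ℚ.≤ int (+ 3) ℚ.* E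
      bounds = error-bounds k N (2 ^ s * Λ) (2 ^ rb) A S E z E≡ z≡ (ℕ.s≤s⁻¹ (<ᵇ-true⁻¹ good≡))

Achieves : ∀ n d (f : NonNegForm n d) → CubeValues f → (Vec ℤ n → Maybe ℚ) → ℝ → (ℕ → ℤ) → Set
Achieves n d f values F ε ε̂ =
  ∃ λ (T : ℕ) → ∃ λ (S : ℕ) → ∃ λ (R : ℕ) →
  (∀ ℓ → ℓ ≥log1/ ε →
     TimeBound T d ε ℓ ((2 + n + bitComplexity f values) ^ degree)
     × S ≤ (2 + n + bitComplexity f values + ℓ) ^ degree)
  × ∃ λ (exec : (ω : Vec Bool R) → Execution program n d F ε̂ (toList ω)) →
    (∀ ω → time (exec ω) ≤ T × space (exec ω) ≤ S)
    × Probability≥ 2 3 (λ ω →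
        let z = fromℚ (result (final (exec ω))) in
        (1ᵣ -ᵣ ε) *ᵣ e∂ f ≤ᵣ z × z ≤ᵣ (1ᵣ +ᵣ ε) *ᵣ e∂ f)

linear-estimate : ∀ T d ℓ H → T ≤ 3 * 2 ^ d → 2 ≤ H → 1 ≤ ℓ → TimeEstimate T d ℓ (H ^ degree)
linear-estimate T d ℓ H T≤ 2≤H 1≤ℓ = estimate (begin
  144 * T * 40 ^ d               ≤⟨ ℕ.*-monoˡ-≤ (40 ^ d) (ℕ.*-monoʳ-≤ 144 T≤) ⟩
  144 * (3 * 2 ^ d) * 40 ^ d     ≡⟨ shuffle 144 3 (2 ^ d) (40 ^ d) ⟩
  2 ^ d * 40 ^ d * (144 * 3)     ≡⟨ cong (_* 432) (^-distribʳ-* d 2 40) ⟨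
  80 ^ d * 432                   ≤⟨ ℕ.*-monoˡ-≤ 432 (ℕ.^-monoˡ-≤ d (ℕ.m≤m+n 80 83)) ⟩
  163 ^ d * 432                  ≤⟨ ℕ.*-mono-≤ (ℕ.m≤m*n (163 ^ d) ℓ {{ℕ.>-nonZero 1≤ℓ}})
                                     (ℕ.≤-trans (ℕ.m≤n*m 432 1) (absorb-constant 9 0 432 2≤H (ℕ.≤ᵇ⇒≤ 432 (2 ^ 9) _) (ℕ.≤ᵇ⇒≤ 9 120 _))) ⟩
  163 ^ d * ℓ * H ^ degree       ∎)
  where
  open ℕ.≤-Reasoning
  shuffle : ∀ c e x y → c * (e * x) * y ≡ x * y * (c * e)
  shuffle = ℕRing.solve-∀

module _ (n d : ℕ) (f : NonNegForm n d) (values : CubeValues f) (F : Vec ℤ n → Maybe ℚ) (box : IsBlackBox F f)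
  (ε : ℝ) (0<ε : 0ᵣ <ᵣ ε) (ε<1 : ε <ᵣ 1ᵣ) (ε̂ : ℕ → ℤ) (approx : ε̂ Approximates ε) where

  open Precision ε 0<ε ε<1 ε̂ approx using (k; before; after; precise; ε̂-small; k-≤; timeBound)

  private
    answer : Vec Sign n → Binary
    answer σ = proj₁ (values σ)

    val : Vec Sign n → ℚ
    val σ = Binary.value (answer σ)

    pl : Vec Sign n → ℕ
    pl σ = places (answer σ)

    box-answer : ∀ σ → F (cubePoint σ) ≡ just (val σ)
    box-answer σ = Equivalence.from (box (cubePoint σ) (val σ)) (proj₂ (values σ))

    bits≤ : ∀ {s} → bitComplexity f values ≡ s → ∀ σ → len (ℚ.↥ val σ) ⊔ pl σ ≤ s
    bits≤ refl σ = ℕ.≤-trans (ℕ.n≤1+n _) (maxSigns-≥ n (λ τ → bits (answer τ)) σ)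

    pl≤ : ∀ {s} → bitComplexity f values ≡ s → ∀ σ → pl σ ≤ s
    pl≤ s≡ σ = ℕ.≤-trans (ℕ.m≤n⊔m (len (ℚ.↥ val σ)) (pl σ)) (bits≤ s≡ σ)

    num≤ : ∀ {s} → bitComplexity f values ≡ s → ∀ σ → ℤ.∣ ℚ.↥ (val σ) ∣ ≤ 2 ^ s
    num≤ s≡ σ = ℕ.≤-trans (∣z∣≤2^len (ℚ.↥ val σ)) (2^-mono (ℕ.≤-trans (ℕ.m≤m⊔n (len (ℚ.↥ val σ)) (pl σ)) (bits≤ s≡ σ)))

  module Sampling (M m K e₀ a : ℕ) (d≤n : d ≤ n) (M≡ : suc (d / 20) ≡ M) (m≡ : 10 * M ≡ m) (K≡ : 31 * M ≡ K)
    (e≡ : 11 * M ≡ suc (suc e₀)) (a≡ : suc (2 * m) ∸ d ≡ a) (s H : ℕ) (s≡ : bitComplexity f values ≡ s) (H≡ : 2 + n + s ≡ H) where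

    module _ (B G : ℕ) (B≡ : Bounds.B₅ n d M m K e₀ a d≤n M≡ m≡ K≡ e≡ a≡ s k H H≡ ≡ B) (G≡ : Bounds.G₅ n d M m K e₀ a d≤n M≡ m≡ K≡ e≡ a≡ s k H H≡ ≡ G) where
      open Bounds n d M m K e₀ a d≤n M≡ m≡ K≡ e≡ a≡ s k H H≡ using (N; rb; T₀; Tₘ; Sₘ; Tₘ≤; time-bound; space-bound; J; W; u; n′)
      open Bounds.Within n d M m K e₀ a d≤n M≡ m≡ K≡ e≡ a≡ s k H H≡ B B≡ using (2^s≤; 2^s*2^s≤)
      open Execute.OnInput n d M m K e₀ a d≤n M≡ m≡ K≡ e≡ a≡ s k H H≡ B G B≡ G≡ F ε̂ val box-answer pl (pl≤ s≡) (λ σ → isBinary (answer σ)) (num≤ s≡) ε̂-small before after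
        using (fz; sampleValue; samplesSum; sumOf; exec; exec-time; exec-space; exec-output)
      open Accurate n d M m K e₀ a d≤n M≡ m≡ K≡ e≡ a≡ s k H H≡ f val (λ σ → proj₂ (values σ)) fz (λ σ → scaled-value (val σ) s (pl σ) (pl≤ s≡ σ) (isBinary (answer σ))) ε precise
        using (Λ-nonZero; sampleSize; sampleSize≡; total-of; good; likely; guarantee)

      samples-total : ∀ bss x p q → samplesSum p q (+ x) bss ≡ + (x + total-of bss)
      samples-total []         x p q = cong +_ (sym (ℕ.+-identityʳ x))
      samples-total (bs ∷ bss) x p q = trans (cong (λ y → samplesSum p q (+ x ℤ.+ y) bss) (sampleSize≡ (fromBits 0 bs)))
        (trans (samples-total bss (x + sampleSize (fromBits 0 bs)) p q) (cong +_ (ℕ.+-assoc x (sampleSize (fromBits 0 bs)) (total-of bss))))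

      total-output : ∀ ω → Output s N (4 ^ m) J ((K * u) ^ n′) W (2 ^ rb) (+ total-of (chunks rb N ω)) (final (exec ω))
      total-output ω = subst (λ x → Output s N (4 ^ m) J ((K * u) ^ n′) W (2 ^ rb) x (final (exec ω))) (samples-total (chunks rb N ω) 0 2^s≤ 2^s*2^s≤) (exec-output ω)

      correct : ∀ ω → good ω ≡ true →
        ((1ᵣ -ᵣ ε) *ᵣ e∂ f ≤ᵣ fromℚ (result (final (exec ω)))) × (fromℚ (result (final (exec ω))) ≤ᵣ (1ᵣ +ᵣ ε) *ᵣ e∂ f)
      correct ω = guarantee ω {final (exec ω)} (total-output ω)

      bounded-achieves : ∀ T T₀ S → Tₘ ≡ T → T ≤ 4 ^ k * T₀ → (∀ ℓ → 1 ≤ ℓ → k ≤ ℓ + 5 → TimeEstimate T₀ d ℓ (H ^ degree)) →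
        Sₘ ≡ S → (∀ ℓ H′ → H + ℓ ≡ H′ → k ≤ ℓ + 5 → 1 ≤ ℓ → S ≤ H′ ^ degree) → Achieves n d f values F ε ε̂
      bounded-achieves T T₀ S T≡ T≤ estimates S≡ S≤ = T , S , N * rb , (λ ℓ ℓ≥ → timed ℓ ℓ≥ , S≤ ℓ (2 + n + bitComplexity f values + ℓ) (cong (_+ ℓ) (sym H≡′)) (k-≤ ℓ ℓ≥) (proj₁ ℓ≥))
        , exec , (λ ω → ℕ.≤-trans (exec-time ω) (ℕ.≤-reflexive T≡) , ℕ.≤-trans (exec-space ω) (ℕ.≤-reflexive S≡)) , good
        , correct
        , likely
        where
        H≡′ : 2 + n + bitComplexity f values ≡ H
        H≡′ = trans (cong (_+_ (2 + n)) s≡) H≡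
        timed : ∀ ℓ → ℓ ≥log1/ ε → TimeBound T d ε ℓ ((2 + n + bitComplexity f values) ^ degree)
        timed ℓ ℓ≥ = timeBound T₀ T d ℓ ((2 + n + bitComplexity f values) ^ degree) T≤ (subst (λ h → TimeEstimate T₀ d ℓ (h ^ degree)) (sym H≡′) (estimates ℓ (proj₁ ℓ≥) (k-≤ ℓ ℓ≥)))

      sampled-achieves : Achieves n d f values F ε ε̂
      sampled-achieves = bounded-achieves Tₘ T₀ Sₘ refl Tₘ≤ time-bound refl space-bound

  long : d ≤ n → Achieves n d f values F ε ε̂
  long d≤n = Sampling.sampled-achieves _ _ _ (9 + 11 * (d / 20)) _ d≤n refl refl refl (ℕ.*-suc 11 (d / 20)) refl _ _ refl refl _ _ refl refl

  short : n < d → Achieves n d f values F ε ε̂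
  short n<d = achieves T₁ refl T₁≤
    where
    T₁ : ℕ
    T₁ = len (+ n) + len (+ d) + 1

    idle : (ω : Vec Bool 0) → Execution program n d F ε̂ (toList ω)
    idle ω = record { final = [] ; unused = toList ω ; time = T₁ ; space = 0 ; run = Semantics.run-then (compare-lt-true n<d) Semantics.run-skip }

    vanishes : ∀ i → seq (e∂ f) i ≡ 0ℚ
    vanishes i = trans (seq-sumᵣ (λ I → foldr ∂ (coeff f) I (Vec.replicate n 0)) (sublists d (allFin n)) i)
      (cong (λ xs → listSum xs (λ I → seq (foldr ∂ (coeff f) I (Vec.replicate n 0)) i)) (sublists-short d (allFin n) (subst (_< d) (sym (List.length-tabulate {n = n} (λ x → x))) n<d)))

    zero-error : int (+ 2 ^ k) ℚ.* (0ℚ ℚ.- 0ℚ) ℚ.≤ int (+ 3) ℚ.* 0ℚ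
    zero-error = ℚ.≤-reflexive (trans (cong (int (+ 2 ^ k) ℚ.*_) (ℚ.+-inverseʳ 0ℚ)) (trans (ℚ.*-zeroʳ (int (+ 2 ^ k))) (sym (ℚ.*-zeroʳ (int (+ 3))))))

    zero-output : ∀ z → z ≡ 0ℚ → ((1ᵣ -ᵣ ε) *ᵣ e∂ f ≤ᵣ fromℚ z) × (fromℚ z ≤ᵣ (1ᵣ +ᵣ ε) *ᵣ e∂ f)
    zero-output z refl = relative-error (e∂ f) ε 0ℚ 0ℚ k ℚ.≤-refl (≗⇒≋ {λ _ → 0ℚ} {seq (e∂ f)} (λ i → sym (vanishes i))) precise zero-error zero-error

    len≤ : ∀ x → len (+ x) ≤ suc x
    len≤ x = s≤s (ℕ.≤-trans (⌊log₂⌋-mono-≤ (ℕ.<⇒≤ (n<2^n x))) (ℕ.≤-reflexive (⌊log₂[2^n]⌋≡n x)))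

    T₁≤ : T₁ ≤ 3 * 2 ^ d
    T₁≤ = ℕ.≤-trans (ℕ.+-mono-≤ (ℕ.+-mono-≤ (ℕ.≤-trans (len≤ n) (ℕ.≤-trans (s≤s (ℕ.<⇒≤ n<d)) (n<2^n d))) (ℕ.≤-trans (len≤ d) (n<2^n d))) (ℕ.m^n>0 2 d)) (ℕ.≤-reflexive (three (2 ^ d)))
      where
      three : ∀ x → x + x + x ≡ 3 * x
      three = ℕRing.solve-∀

    achieves : ∀ T → T₁ ≡ T → T ≤ 3 * 2 ^ d → Achieves n d f values F ε ε̂
    achieves T T≡ T≤ = T , 0 , 0
      , (λ ℓ ℓ≥ → timeBound T T d ℓ ((2 + n + bitComplexity f values) ^ degree) (ℕ.m≤n*m T (4 ^ k) {{ℕ.m^n≢0 4 k}})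
          (linear-estimate T d ℓ (2 + n + bitComplexity f values) T≤ (s≤s (s≤s z≤n)) (proj₁ ℓ≥)) , z≤n)
      , idle , (λ ω → ℕ.≤-reflexive T≡ , z≤n) , (λ _ → true) , (λ ω _ → zero-output (result (final (idle ω))) refl) , ℕ.n≤1+n 2

theorem7 :
  ∃ λ (A : Program) → ∃ λ (c : ℕ) →
  ∀ (n d : ℕ) (f : NonNegForm n d) (values : CubeValues f)
    (F : Vec ℤ n → Maybe ℚ) → IsBlackBox F f →
  ∀ (ε : ℝ) → 0ᵣ <ᵣ ε → ε <ᵣ 1ᵣ → ∀ (ε̂ : ℕ → ℤ) → ε̂ Approximates ε →
  ∃ λ (T : ℕ) → ∃ λ (S : ℕ) → ∃ λ (R : ℕ) →
  (∀ ℓ → ℓ ≥log1/ ε →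
     TimeBound T d ε ℓ ((2 + n + bitComplexity f values) ^ c)
     × S ≤ (2 + n + bitComplexity f values + ℓ) ^ c)
  × ∃ λ (exec : (ω : Vec Bool R) → Execution A n d F ε̂ (toList ω)) →
    (∀ ω → time (exec ω) ≤ T × space (exec ω) ≤ S)
    × Probability≥ 2 3 (λ ω →
        let z = fromℚ (result (final (exec ω))) in
        (1ᵣ -ᵣ ε) *ᵣ e∂ f ≤ᵣ z × z ≤ᵣ (1ᵣ +ᵣ ε) *ᵣ e∂ f)
theorem7 = program , degree , λ n d f values F box ε 0<ε ε<1 ε̂ approx →
  [ long n d f values F box ε 0<ε ε<1 ε̂ approx , short n d f values F box ε 0<ε ε<1 ε̂ approx ]′ (ℕ.≤-<-connex d n)
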